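{- Let $q$ be even with $q \ge 8$. Then $m'_2(3,q) < q^2 - (\sqrt{5}-1)q + 5$.
   Context: A $k$-cap of the projective space $\mathrm{PG}(n,q)$, $n \ge 3$, is a set of $k$ points no three of which are collinear. A $k$-cap is complete if it is not contained in a $(k+1)$-cap. $m'_2(n,q)$ denotes the second largest value of $k$ for which there exists a complete $k$-cap in $\mathrm{PG}(n,q)$ (i.e. the largest size of a complete cap that is not of maximum size; for $q$ even, $q>2$, the maximum size of a cap in $\mathrm{PG}(3,q)$ is $q^2+1$). -}

module Defs where

open import Level using (0ℓ)
open import Algebra.Bundles using (CommutativeRing)
open import Data.Nat as ℕ using (ℕ; _∸_; _<_)
open import Data.Fin using (Fin)
open import Data.List using (List; length; lookup; _∷_)
open import Data.Product using (Σ; ∃; _×_)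
open import Relation.Nullary using (¬_)
open import Relation.Binary.PropositionalEquality using (_≡_; _≢_)

record IsFiniteFieldOfOrder (F : CommutativeRing 0ℓ 0ℓ) (q : ℕ) : Set where
  open CommutativeRing F
  field
    0≉1      : ¬ (0# ≈ 1#)
    inverse  : ∀ x → ¬ (x ≈ 0#) → ∃ λ y → (x * y) ≈ 1#
    enum     : Fin q → Carrier
    enum-inj : ∀ i j → enum i ≈ enum j → i ≡ j
    enum-sur : ∀ x → ∃ λ i → enum i ≈ x

-- Projective space PG(3,F): points are nonzero vectors of F^4 up to nonzero scalars.
module PG3 (F : CommutativeRing 0ℓ 0ℓ) where
  open CommutativeRing F

  V4 : Set
  V4 = Fin 4 → Carrier

  NonZeroV : V4 → Set
  NonZeroV v = ¬ (∀ i → v i ≈ 0#)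

  SamePoint : V4 → V4 → Set
  SamePoint u v = ∃ λ a → ∀ i → u i ≈ (a * v i)

  Collinear : V4 → V4 → V4 → Set
  Collinear u v w = Σ Carrier λ a → Σ Carrier λ b → Σ Carrier λ c →
    ¬ ((a ≈ 0#) × (b ≈ 0#) × (c ≈ 0#)) ×
    (∀ i → ((a * u i) + (b * v i) + (c * w i)) ≈ 0#)

  -- A cap, given as a list of representatives of pairwise distinct points,
  -- no three of which are collinear. Its size is the length of the list.
  record IsCap (K : List V4) : Set where
    field
      nonzero  : ∀ i → NonZeroV (lookup K i)
      distinct : ∀ i j → i ≢ j → ¬ SamePoint (lookup K i) (lookup K j)
      noThree  : ∀ i j k → i ≢ j → i ≢ k → j ≢ k →
                 ¬ Collinear (lookup K i) (lookup K j) (lookup K k)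

  IsCompleteCap : List V4 → Set
  IsCompleteCap K = IsCap K × (∀ v → NonZeroV v → ¬ IsCap (v ∷ K))

  NotMaximum : List V4 → Set
  NotMaximum K = ∃ λ K' → IsCap K' × (length K < length K')

-- k < q^2 - (√5 - 1) q + 5  ⇔  √5 q < q^2 + q + 5 - k
--                           ⇔  k < q^2 + q + 5  and  5 q^2 < (q^2 + q + 5 - k)^2
BelowBound : ℕ → ℕ → Set
BelowBound q k = (k < q ℕ.* q ℕ.+ q ℕ.+ 5) ×
  (5 ℕ.* (q ℕ.* q) < (q ℕ.* q ℕ.+ q ℕ.+ 5 ∸ k) ℕ.* (q ℕ.* q ℕ.+ q ℕ.+ 5 ∸ k))

{-# OPTIONS --safe #-}
-- Put t = q² + q + 2 − k for a cap of size k; t is the number of tangents at each of its points.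
-- For q even, Lagrange interpolation in a plane (in the spirit of Segre) shows that a point lying
-- on a secant is on at most t tangents; if the cap is complete, this holds for every point off it.
-- If a plane contains n points of the cap and s = q + 2 − n, summing this bound over the plane
-- gives n s q ≤ t (t − 1).  Hence t + 3 ≤ √5 q forces n ≤ 4 or s ≤ 4.  Every tangent lies in a
-- plane with n ≤ 4, and a count at a point P of the cap shows that exactly two such planes pass
-- through P, each with one or two points, so that t = 2q or t = 2q + 1.
-- If t = 2q + 1, the two planes at P have one point each and the lines in which they meet, as P
-- varies, pass through a common point, which has more than t tangents.  If t = 2q and the planes at
-- some P have one and two points, the line in which they meet has too few points with fewer than t
-- tangents.  If t = 2q and all these planes have two points, the lines in which they meet are
-- secants without tangents, and some plane contains too many of them.
-- A complete cap with t ≤ q would have t = 0 and planes with 0 or q + 2 points only, whence q + 2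
-- divides 4; so caps have at most q² + 1 points.
module Submission where

-- The constant 5 has a single source. When n ≥ 5 and s ≥ 5, the relation n + s = q + 2 forces n s ≥
-- 5 (q - 3), so a plane of that kind needs t² of the order of 5q²; the summand 3 in t + 3 makes up
-- for the linear terms. The planar bound replaces the algebraic envelope of the tangents. For a
-- point v on a secant of an n-arc, the claim is that at most s points of the arc have a tangent
-- through v. Interpolation in the pencil of each such point gives a linear relation between
-- reciprocals. After rescaling, the matrix of these reciprocals is symmetric, so in characteristic
-- two the sum of its entries is the sum of its diagonal, and the latter is an interpolation sum
-- that cannot vanish. Passing to space loses nothing, because the values of s in the planes through
-- a secant add up to exactly t. All counts are of vectors and covectors instead of points and
-- planes, which brings in factors p = q - 1, and the identities are arranged so that natural
-- numbers need no subtraction.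

module FiniteSums where
  open import Data.Empty using (⊥-elim)
  open import Data.Fin using (Fin; zero; suc)
  import Data.Fin.Properties as Fin
  open import Data.List using (List; []; _∷_; length; map; filter; allFin; cartesianProductWith; tabulate; _++_)
  open import Data.List.Properties using (map-tabulate)
  open import Data.List.Membership.Propositional using (_∈_; find; lose)
  open import Data.List.Relation.Unary.Any using (here; there; any?)
  open import Data.Nat using (ℕ; zero; suc; _+_; _*_; _^_; _≤_; z≤n; s≤s)
  open import Data.Nat.Properties hiding (_≟_)
  open import Data.Nat.Solver using (module +-*-Solver)
  open +-*-Solver using () renaming (solve to solveℕ; _:+_ to _:+:_; _:=_ to _:=:_)
  open import Data.Product using (∃; _,_)
  open import Data.Vec using (Vec; []; _∷_)
  import Data.Vec.Properties as Vec
  open import Relation.Binary using (DecidableEquality)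
  open import Relation.Binary.PropositionalEquality
  open import Relation.Nullary using (¬_; Dec; yes; no)
  open import Relation.Nullary.Decidable using (map′; _×-dec_; ¬?)

  private variable
    A B : Set
    P Q : Set

  -- Indicators and sums over lists.

  𝟙 : Dec P → ℕ
  𝟙 (yes _) = 1
  𝟙 (no _)  = 0

  𝟙-yes : (d : Dec P) → P → 𝟙 d ≡ 1
  𝟙-yes (yes _) _ = refl
  𝟙-yes (no ¬p) p = ⊥-elim (¬p p)

  𝟙-no : (d : Dec P) → ¬ P → 𝟙 d ≡ 0
  𝟙-no (yes p) ¬p = ⊥-elim (¬p p)
  𝟙-no (no _)  _  = refl

  𝟙-≤1 : (d : Dec P) → 𝟙 d ≤ 1
  𝟙-≤1 (yes _) = ≤-refl
  𝟙-≤1 (no _)  = z≤n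

  𝟙-pos : (d : Dec P) → 1 ≤ 𝟙 d → P
  𝟙-pos (yes p) _ = p

  𝟙-mono : (d : Dec P) (e : Dec Q) → (P → Q) → 𝟙 d ≤ 𝟙 e
  𝟙-mono (yes p) e f = ≤-reflexive (sym (𝟙-yes e (f p)))
  𝟙-mono (no _)  e f = z≤n

  𝟙-iff : (d : Dec P) (e : Dec Q) → (P → Q) → (Q → P) → 𝟙 d ≡ 𝟙 e
  𝟙-iff d e f g = ≤-antisym (𝟙-mono d e f) (𝟙-mono e d g)

  𝟙-× : (d : Dec P) (e : Dec Q) → 𝟙 (d ×-dec e) ≡ 𝟙 d * 𝟙 e
  𝟙-× (yes _) (yes _) = refl
  𝟙-× (yes _) (no _)  = refl
  𝟙-× (no _)  _       = refl

  𝟙-¬ : (d : Dec P) → 𝟙 d + 𝟙 (¬? d) ≡ 1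
  𝟙-¬ (yes _) = refl
  𝟙-¬ (no _)  = refl

  -- In a sum weighted by an indicator, an estimate of the weighted term may assume the indicated
  -- condition.
  𝟙*-≤ : (d : Dec P) {m n : ℕ} → (P → m ≤ n) → 𝟙 d * m ≤ 𝟙 d * n
  𝟙*-≤ (yes p) f = *-monoʳ-≤ 1 (f p)
  𝟙*-≤ (no _)  f = z≤n

  𝟙*-cong : (d : Dec P) {m n : ℕ} → (P → m ≡ n) → 𝟙 d * m ≡ 𝟙 d * n
  𝟙*-cong (yes p) f = cong (1 *_) (f p)
  𝟙*-cong (no _)  f = refl

  ∑ : List A → (A → ℕ) → ℕ
  ∑ []       f = 0
  ∑ (x ∷ xs) f = f x + ∑ xs f

  ∑-cong : (xs : List A) {f g : A → ℕ} → (∀ x → f x ≡ g x) → ∑ xs f ≡ ∑ xs g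
  ∑-cong []       h = refl
  ∑-cong (x ∷ xs) h = cong₂ _+_ (h x) (∑-cong xs h)

  ∑-mono : (xs : List A) {f g : A → ℕ} → (∀ x → f x ≤ g x) → ∑ xs f ≤ ∑ xs g
  ∑-mono []       h = z≤n
  ∑-mono (x ∷ xs) h = +-mono-≤ (h x) (∑-mono xs h)

  ∑-0 : (xs : List A) → ∑ xs (λ _ → 0) ≡ 0
  ∑-0 []       = refl
  ∑-0 (x ∷ xs) = ∑-0 xs

  ∑-1 : (xs : List A) → ∑ xs (λ _ → 1) ≡ length xs
  ∑-1 []       = refl
  ∑-1 (x ∷ xs) = cong suc (∑-1 xs)

  ∑-+ : (xs : List A) (f g : A → ℕ) → ∑ xs (λ x → f x + g x) ≡ ∑ xs f + ∑ xs g
  ∑-+ []       f g = refl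
  ∑-+ (x ∷ xs) f g rewrite ∑-+ xs f g = interchange (f x) (g x) (∑ xs f) (∑ xs g)
    where
    interchange : ∀ a b c d → a + b + (c + d) ≡ a + c + (b + d)
    interchange = solveℕ 4 (λ a b c d → a :+: b :+: (c :+: d) :=: a :+: c :+: (b :+: d)) refl

  ∑-*ˡ : (xs : List A) (c : ℕ) (f : A → ℕ) → ∑ xs (λ x → c * f x) ≡ c * ∑ xs f
  ∑-*ˡ []       c f = sym (*-zeroʳ c)
  ∑-*ˡ (x ∷ xs) c f = trans (cong (c * f x +_) (∑-*ˡ xs c f)) (sym (*-distribˡ-+ c (f x) (∑ xs f)))

  ∑-*ʳ : (xs : List A) (c : ℕ) (f : A → ℕ) → ∑ xs (λ x → f x * c) ≡ ∑ xs f * c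
  ∑-*ʳ xs c f = trans (∑-cong xs (λ x → *-comm (f x) c)) (trans (∑-*ˡ xs c f) (*-comm c _))

  ∑-const : (xs : List A) (c : ℕ) → ∑ xs (λ _ → c) ≡ length xs * c
  ∑-const []       c = refl
  ∑-const (x ∷ xs) c = cong (c +_) (∑-const xs c)

  ∑-swap : (xs : List A) (ys : List B) (f : A → B → ℕ) →
           ∑ xs (λ x → ∑ ys (f x)) ≡ ∑ ys (λ y → ∑ xs (λ x → f x y))
  ∑-swap []       ys f = sym (∑-0 ys)
  ∑-swap (x ∷ xs) ys f = trans (cong (∑ ys (f x) +_) (∑-swap xs ys f))
                               (sym (∑-+ ys (f x) (λ y → ∑ xs (λ x → f x y))))

  ∑-pos : (xs : List A) {f : A → ℕ} → 1 ≤ ∑ xs f → ∃ λ x → 1 ≤ f x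
  ∑-pos (x ∷ xs) {f} h with f x in eq
  ... | zero  = ∑-pos xs h
  ... | suc m = x , ≤-trans (s≤s z≤n) (≤-reflexive (sym eq))

  ∑-term : (xs : List A) {f : A → ℕ} {x : A} → x ∈ xs → f x ≤ ∑ xs f
  ∑-term (y ∷ xs)     (here refl) = m≤m+n _ _
  ∑-term (y ∷ xs) {f} (there p)   = ≤-trans (∑-term xs p) (m≤n+m _ (f y))

  -- A strict inequality at one term would have to be compensated elsewhere, which the termwise
  -- bound forbids. This turns a total over a plane into exact values at its points.
  ∑-rigid : (xs : List A) {f g : A → ℕ} → (∀ x → f x ≤ g x) → ∑ xs g ≤ ∑ xs f →
            ∀ {x} → x ∈ xs → f x ≡ g x
  ∑-rigid (y ∷ xs) {f} {g} h s (here refl) = ≤-antisym (h y)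
    (+-cancelʳ-≤ (∑ xs g) (g y) (f y) (≤-trans s (+-monoʳ-≤ (f y) (∑-mono xs h))))
  ∑-rigid (y ∷ xs) {f} {g} h s (there p) = ∑-rigid xs h
    (+-cancelˡ-≤ (g y) _ _ (≤-trans s (+-monoˡ-≤ (∑ xs f) (h y)))) p

  ∑-map : (xs : List A) (g : A → B) (f : B → ℕ) → ∑ (map g xs) f ≡ ∑ xs (λ x → f (g x))
  ∑-map []       g f = refl
  ∑-map (x ∷ xs) g f = cong (f (g x) +_) (∑-map xs g f)

  ∑-++ : (xs ys : List A) (f : A → ℕ) → ∑ (xs ++ ys) f ≡ ∑ xs f + ∑ ys f
  ∑-++ []       ys f = refl
  ∑-++ (x ∷ xs) ys f = trans (cong (f x +_) (∑-++ xs ys f)) (sym (+-assoc (f x) _ _))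

  ∑-prod : {C : Set} (g : A → B → C) (xs : List A) (ys : List B) (f : C → ℕ) →
           ∑ (cartesianProductWith g xs ys) f ≡ ∑ xs (λ x → ∑ ys (λ y → f (g x y)))
  ∑-prod g []       ys f = refl
  ∑-prod g (x ∷ xs) ys f =
    trans (∑-++ (map (g x) ys) _ f) (cong₂ _+_ (∑-map ys (g x) f) (∑-prod g xs ys f))

  ∑-filter : {P : A → Set} (P? : ∀ x → Dec (P x)) (xs : List A) →
             length (filter P? xs) ≡ ∑ xs (λ x → 𝟙 (P? x))
  ∑-filter P? []       = refl
  ∑-filter P? (x ∷ xs) with P? x
  ... | yes _ = cong suc (∑-filter P? xs)
  ... | no  _ = ∑-filter P? xs

  ∑-filter-* : {P : A → Set} (P? : ∀ x → Dec (P x)) (xs : List A) (f : A → ℕ) →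
               ∑ (filter P? xs) f ≡ ∑ xs (λ x → 𝟙 (P? x) * f x)
  ∑-filter-* P? []       f = refl
  ∑-filter-* P? (x ∷ xs) f with P? x
  ... | yes _ = cong₂ _+_ (sym (*-identityˡ (f x))) (∑-filter-* P? xs f)
  ... | no  _ = ∑-filter-* P? xs f

  -- Finite types and counting in them.

  record Finite (A : Set) : Set where
    infix 4 _≟_
    field
      _≟_   : DecidableEquality A
      elems : List A
      -- No omission and no repetition in a single equation, in the form in which sums consume it.
      once  : ∀ a → ∑ elems (λ x → 𝟙 (x ≟ a)) ≡ 1

    size : ℕ
    size = length elems

    S : (A → ℕ) → ℕ
    S = ∑ elems

    S-single : ∀ a (f : A → ℕ) → S (λ x → 𝟙 (x ≟ a) * f x) ≡ f a
    S-single a f = begin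
      S (λ x → 𝟙 (x ≟ a) * f x) ≡⟨ ∑-cong elems (λ x → 𝟙*-cong (x ≟ a) (cong f)) ⟩
      S (λ x → 𝟙 (x ≟ a) * f a) ≡⟨ ∑-*ʳ elems (f a) _ ⟩
      S (λ x → 𝟙 (x ≟ a)) * f a ≡⟨ cong (_* f a) (once a) ⟩
      1 * f a                   ≡⟨ *-identityˡ (f a) ⟩
      f a                       ∎
      where open ≡-Reasoning

    complete : ∀ a → a ∈ elems
    complete a = go elems (≤-reflexive (sym (once a)))
      where
      go : ∀ xs → 1 ≤ ∑ xs (λ x → 𝟙 (x ≟ a)) → a ∈ xs
      go (x ∷ xs) h with x ≟ a
      ... | yes refl = here refl
      ... | no _     = there (go xs h)

    search : {P : A → Set} → (∀ x → Dec (P x)) → Dec (∃ P)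
    search P? = map′ (λ p → let x , _ , px = find p in x , px)
                     (λ (x , px) → lose (complete x) px) (any? P? elems)

    all : {P : A → Set} → (∀ x → Dec (P x)) → Dec (∀ x → P x)
    all P? with search (λ x → ¬? (P? x))
    ... | yes (x , ¬p) = no λ h → ¬p (h x)
    ... | no ¬∃        = yes λ x → dne x (P? x)
      where
      dne : ∀ x → Dec _ → _
      dne x (yes p) = p
      dne x (no ¬p) = ⊥-elim (¬∃ (x , ¬p))

    term : (f : A → ℕ) → ∀ x → f x ≤ S f
    term f x = ∑-term elems (complete x)

    S-const : ∀ c → S (λ _ → c) ≡ size * c
    S-const = ∑-const elems

    S-atMost : {P : A → Set} (P? : ∀ x → Dec (P x)) → (∀ x y → P x → P y → x ≡ y) →
               S (λ x → 𝟙 (P? x)) ≤ 1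
    S-atMost P? uniq with search P?
    ... | yes (a , pa) = ≤-trans (∑-mono elems (λ x → 𝟙-mono (P? x) (x ≟ a) (λ px → uniq x a px pa)))
                                 (≤-reflexive (once a))
    ... | no ¬∃ = ≤-trans (≤-reflexive (trans (∑-cong elems (λ x → 𝟙-no (P? x) (λ px → ¬∃ (x , px))))
                                              (∑-0 elems))) z≤n

    S-unique : {P : A → Set} (P? : ∀ x → Dec (P x)) → ∃ P → (∀ x y → P x → P y → x ≡ y) →
               S (λ x → 𝟙 (P? x)) ≡ 1
    S-unique P? (a , pa) uniq = ≤-antisym (S-atMost P? uniq)
      (≤-trans (≤-reflexive (sym (𝟙-yes (P? a) pa))) (term (λ x → 𝟙 (P? x)) a))

    -- Both sides are the sum of `f y` over the pairs with y = σ x, collapsed once along y and once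
    -- along x.
    S-bij : (σ τ : A → A) → (∀ x → τ (σ x) ≡ x) → (∀ x → σ (τ x) ≡ x) →
            (f : A → ℕ) → S (λ x → f (σ x)) ≡ S f
    S-bij σ τ τσ στ f = begin
      S (λ x → f (σ x)) ≡⟨ ∑-cong elems (λ x → S-single (σ x) f) ⟨
      S (λ x → S (λ y → 𝟙 (y ≟ σ x) * f y)) ≡⟨ ∑-swap elems elems _ ⟩
      S (λ y → S (λ x → 𝟙 (y ≟ σ x) * f y)) ≡⟨ ∑-cong elems (λ y → ∑-cong elems λ x → cong (_* f y)
        (𝟙-iff (y ≟ σ x) (x ≟ τ y) (λ e → trans (sym (τσ x)) (cong τ (sym e)))
                                   (λ e → trans (sym (στ y)) (cong σ (sym e))))) ⟩
      S (λ y → S (λ x → 𝟙 (x ≟ τ y) * f y)) ≡⟨ ∑-cong elems (λ y → S-single (τ y) (λ _ → f y)) ⟩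
      S f ∎
      where open ≡-Reasoning

  ∑-tab : ∀ n (g : Fin n → A) (f : A → ℕ) → ∑ (tabulate g) f ≡ ∑ (allFin n) (λ i → f (g i))
  ∑-tab n g f = trans (cong (λ xs → ∑ xs f) (sym (map-tabulate (λ i → i) g))) (∑-map (allFin n) g f)

  finFinite : ∀ n → Finite (Fin n)
  finFinite n = record { _≟_ = Fin._≟_ ; elems = allFin n ; once = once n }
    where
    once : ∀ n (a : Fin n) → ∑ (allFin n) (λ x → 𝟙 (x Fin.≟ a)) ≡ 1
    once (suc n) zero = cong suc (trans (∑-tab n suc _)
      (trans (∑-cong (allFin n) (λ x → 𝟙-no (suc x Fin.≟ zero) λ ())) (∑-0 (allFin n))))
    once (suc n) (suc a) = trans (∑-tab n suc _)
      (trans (∑-cong (allFin n) (λ x → 𝟙-iff (suc x Fin.≟ suc a) (x Fin.≟ a) Fin.suc-injective (cong suc))) (once n a))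

  vecFinite : Finite A → ∀ m → Finite (Vec A m)
  vecFinite {A = A} fin m = record { _≟_ = Vec.≡-dec F._≟_ ; elems = vecs m ; once = once m }
    where
    module F = Finite fin
    vecs : ∀ m → List (Vec A m)
    vecs zero    = [] ∷ []
    vecs (suc m) = cartesianProductWith _∷_ F.elems (vecs m)
    _≟v_ : ∀ {m} (u v : Vec A m) → Dec (u ≡ v)
    _≟v_ = Vec.≡-dec F._≟_
    once : ∀ m (a : Vec A m) → ∑ (vecs m) (λ x → 𝟙 (x ≟v a)) ≡ 1
    once zero    []       = refl
    once (suc m) (a ∷ as) = begin
      ∑ (vecs (suc m)) (λ x → 𝟙 (x ≟v (a ∷ as))) ≡⟨ ∑-prod _∷_ F.elems (vecs m) _ ⟩
      ∑ F.elems (λ x → ∑ (vecs m) (λ v → 𝟙 ((x ∷ v) ≟v (a ∷ as))))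
        ≡⟨ ∑-cong F.elems (λ x → trans (∑-cong (vecs m) λ v →
             trans (𝟙-iff ((x ∷ v) ≟v (a ∷ as)) ((x F.≟ a) ×-dec (v ≟v as))
               Vec.∷-injective (λ (e , e′) → cong₂ _∷_ e e′)) (𝟙-× (x F.≟ a) (v ≟v as)))
             (∑-*ˡ (vecs m) (𝟙 (x F.≟ a)) _)) ⟩
      ∑ F.elems (λ x → 𝟙 (x F.≟ a) * ∑ (vecs m) (λ v → 𝟙 (v ≟v as)))
        ≡⟨ F.S-single a _ ⟩
      ∑ (vecs m) (λ v → 𝟙 (v ≟v as)) ≡⟨ once m as ⟩
      1 ∎
      where open ≡-Reasoning

  S-vec : (fin : Finite A) (m : ℕ) (f : Vec A (suc m) → ℕ) →
          Finite.S (vecFinite fin (suc m)) f ≡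
          Finite.S fin (λ x → Finite.S (vecFinite fin m) (λ v → f (x ∷ v)))
  S-vec fin m f = ∑-prod _∷_ (Finite.elems fin) (Finite.elems (vecFinite fin m)) f

  size-vec : (fin : Finite A) (m : ℕ) → Finite.size (vecFinite fin m) ≡ Finite.size fin ^ m
  size-vec fin zero    = refl
  size-vec fin (suc m) = begin
    Finite.size (vecFinite fin (suc m)) ≡⟨ ∑-1 (Finite.elems (vecFinite fin (suc m))) ⟨
    Finite.S (vecFinite fin (suc m)) (λ _ → 1) ≡⟨ S-vec fin m (λ _ → 1) ⟩
    Finite.S fin (λ _ → Finite.S (vecFinite fin m) (λ _ → 1)) ≡⟨ Finite.S-const fin _ ⟩
    Finite.size fin * Finite.S (vecFinite fin m) (λ _ → 1) ≡⟨ cong (Finite.size fin *_) (trans (∑-1 (Finite.elems (vecFinite fin m))) (size-vec fin m)) ⟩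
    Finite.size fin * Finite.size fin ^ m ∎
    where open ≡-Reasoning

open FiniteSums

module PlanarArcs where
  open import Algebra.Structures using (IsCommutativeSemiring; IsCommutativeMonoid)
  open import Algebra.Bundles using (RawRing)
  import Algebra.Solver.Ring as RingSolver
  open import Algebra.Solver.Ring.AlmostCommutativeRing using (AlmostCommutativeRing; fromCommutativeSemiring; _-Raw-AlmostCommutative⟶_)
  open import Data.Bool using (Bool; true; false; _xor_; _∧_)
  open import Data.Empty using (⊥; ⊥-elim)
  open import Data.List using (List; []; _∷_; length; map; filter; take)
  open import Data.List.Properties using (length-map; length-take)
  open import Data.List.Membership.Propositional using (_∈_)
  open import Data.List.Membership.Propositional.Properties using (∈-map⁺; ∈-map⁻; ∈-filter⁻)
  import Data.List.Membership.DecPropositional as DecMembership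
  open import Data.List.Relation.Unary.All as All using (All; []; _∷_)
  open import Data.List.Relation.Unary.Any using (here; there)
  open import Data.List.Relation.Unary.AllPairs using ([]; _∷_)
  import Data.List.Relation.Unary.AllPairs.Properties as AllPairs
  open import Data.List.Relation.Unary.Unique.Propositional using (Unique)
  open import Data.Maybe using (Maybe; just; nothing)
  open import Data.Nat as ℕ using (ℕ; zero; suc)
  import Data.Nat.Properties as ℕ
  open import Data.Product using (_,_; proj₂)
  open import Relation.Binary using (DecidableEquality)
  open import Relation.Binary.PropositionalEquality
  open import Relation.Nullary using (¬_; Dec; yes; no)
  open import Relation.Nullary.Decidable using (¬?)

  private variable
    A B : Set

  -- Sums and products over lists in a commutative monoid.

  module Fold {M : Set} {_∙_ : M → M → M} {ε : M} (cm : IsCommutativeMonoid _≡_ _∙_ ε) where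
    open IsCommutativeMonoid cm using (assoc; comm; identityˡ; identityʳ)

    fold : List A → (A → M) → M
    fold []       f = ε
    fold (x ∷ xs) f = f x ∙ fold xs f

    fold-cong : (xs : List A) {f g : A → M} → (∀ {x} → x ∈ xs → f x ≡ g x) → fold xs f ≡ fold xs g
    fold-cong []       h = refl
    fold-cong (x ∷ xs) h = cong₂ _∙_ (h (here refl)) (fold-cong xs (λ p → h (there p)))

    fold-ε : (xs : List A) → fold xs (λ _ → ε) ≡ ε
    fold-ε []       = refl
    fold-ε (x ∷ xs) = trans (identityˡ _) (fold-ε xs)

    interchange : ∀ a b c d → (a ∙ b) ∙ (c ∙ d) ≡ (a ∙ c) ∙ (b ∙ d)
    interchange a b c d = begin
      (a ∙ b) ∙ (c ∙ d) ≡⟨ assoc a b _ ⟩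
      a ∙ (b ∙ (c ∙ d)) ≡⟨ cong (a ∙_) (sym (assoc b c d)) ⟩
      a ∙ ((b ∙ c) ∙ d) ≡⟨ cong (λ z → a ∙ (z ∙ d)) (comm b c) ⟩
      a ∙ ((c ∙ b) ∙ d) ≡⟨ cong (a ∙_) (assoc c b d) ⟩
      a ∙ (c ∙ (b ∙ d)) ≡⟨ assoc a c _ ⟨
      (a ∙ c) ∙ (b ∙ d) ∎
      where open ≡-Reasoning

    fold-∙ : (xs : List A) (f g : A → M) → fold xs (λ x → f x ∙ g x) ≡ fold xs f ∙ fold xs g
    fold-∙ []       f g = sym (identityˡ ε)
    fold-∙ (x ∷ xs) f g = trans (cong ((f x ∙ g x) ∙_) (fold-∙ xs f g)) (interchange _ _ _ _)

    fold-swap : (xs : List A) (ys : List B) (f : A → B → M) →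
                fold xs (λ x → fold ys (f x)) ≡ fold ys (λ y → fold xs (λ x → f x y))
    fold-swap []       ys f = sym (fold-ε ys)
    fold-swap (x ∷ xs) ys f = trans (cong (fold ys (f x) ∙_) (fold-swap xs ys f))
                                    (sym (fold-∙ ys (f x) _))

    fold-map : (xs : List A) (g : A → B) (f : B → M) → fold (map g xs) f ≡ fold xs (λ x → f (g x))
    fold-map []       g f = refl
    fold-map (x ∷ xs) g f = cong (f (g x) ∙_) (fold-map xs g f)

    when : {P : Set} → Dec P → M → M
    when (yes _) m = m
    when (no _)  m = ε

    when-yes : {P : Set} (d : Dec P) {m : M} → P → when d m ≡ m
    when-yes (yes _) _ = refl
    when-yes (no ¬p) p = ⊥-elim (¬p p)

    when-no : {P : Set} (d : Dec P) {m : M} → ¬ P → when d m ≡ ε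
    when-no (yes p) ¬p = ⊥-elim (¬p p)
    when-no (no _)  _  = refl

    when-¬ : {P : Set} (d : Dec P) (m : M) → m ≡ when d m ∙ when (¬? d) m
    when-¬ (yes _) m = sym (identityʳ m)
    when-¬ (no _)  m = sym (identityˡ m)

    fold-filter : {P : A → Set} (P? : ∀ x → Dec (P x)) (xs : List A) (f : A → M) →
                  fold (filter P? xs) f ≡ fold xs (λ x → when (P? x) (f x))
    fold-filter P? []       f = refl
    fold-filter P? (x ∷ xs) f with P? x
    ... | yes _ = cong (f x ∙_) (fold-filter P? xs f)
    ... | no  _ = trans (fold-filter P? xs f) (sym (identityˡ _))

    fold-single : (_≟_ : DecidableEquality A) {xs : List A} → Unique xs → {a : A} → a ∈ xs → (m : M) →
                  fold xs (λ x → when (x ≟ a) m) ≡ m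
    fold-single _≟_ {x ∷ xs} (x≢ ∷ _) {a} (here refl) m = begin
      when (x ≟ x) m ∙ fold xs (λ y → when (y ≟ x) m)
        ≡⟨ cong₂ _∙_ (when-yes (x ≟ x) refl)
             (fold-cong xs (λ {y} p → when-no (y ≟ x) (λ e → All.lookup x≢ p (sym e)))) ⟩
      m ∙ fold xs (λ _ → ε) ≡⟨ cong (m ∙_) (fold-ε xs) ⟩
      m ∙ ε                 ≡⟨ identityʳ m ⟩
      m                     ∎
      where open ≡-Reasoning
    fold-single _≟_ {x ∷ xs} (x≢ ∷ u) {a} (there p) m =
      trans (cong₂ _∙_ (when-no (x ≟ a) (All.lookup x≢ p)) (fold-single _≟_ u p m)) (identityˡ m)

    module _ (fin : Finite A) where
      open Finite fin

      fold-one : (a : A) (f : A → M) → fold elems (λ x → when (x ≟ a) (f x)) ≡ f a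
      fold-one a f = trans (fold-cong elems (λ {x} _ → replace x)) (go elems (once a))
        where
        replace : ∀ x → when (x ≟ a) (f x) ≡ when (x ≟ a) (f a)
        replace x with x ≟ a
        ... | yes refl = refl
        ... | no _     = refl
        none : ∀ xs → ∑ xs (λ x → 𝟙 (x ≟ a)) ≡ 0 → fold xs (λ x → when (x ≟ a) (f a)) ≡ ε
        none []       _ = refl
        none (x ∷ xs) h with x ≟ a
        ... | no _ = trans (identityˡ _) (none xs h)
        go : ∀ xs → ∑ xs (λ x → 𝟙 (x ≟ a)) ≡ 1 → fold xs (λ x → when (x ≟ a) (f a)) ≡ f a
        go (x ∷ xs) h with x ≟ a
        ... | yes refl = trans (cong (f x ∙_) (none xs (ℕ.suc-injective h))) (identityʳ _)
        ... | no _     = trans (identityˡ _) (go xs h)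

      fold-bij : (σ τ : A → A) → (∀ x → τ (σ x) ≡ x) → (∀ x → σ (τ x) ≡ x) →
                 (f : A → M) → fold elems (λ x → f (σ x)) ≡ fold elems f
      fold-bij σ τ τσ στ f = begin
        fold elems (λ x → f (σ x)) ≡⟨ fold-cong elems (λ {x} _ → fold-one (σ x) f) ⟨
        fold elems (λ x → fold elems (λ y → when (y ≟ σ x) (f y))) ≡⟨ fold-swap elems elems _ ⟩
        fold elems (λ y → fold elems (λ x → when (y ≟ σ x) (f y)))
          ≡⟨ fold-cong elems (λ {y} _ → fold-cong elems (λ {x} _ → switch y x)) ⟩
        fold elems (λ y → fold elems (λ x → when (x ≟ τ y) (f y)))
          ≡⟨ fold-cong elems (λ {y} _ → fold-one (τ y) (λ _ → f y)) ⟩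
        fold elems f ∎
        where
        open ≡-Reasoning
        switch : ∀ y x → when (y ≟ σ x) (f y) ≡ when (x ≟ τ y) (f y)
        switch y x with y ≟ σ x
        ... | yes refl = sym (when-yes (x ≟ τ (σ x)) (sym (τσ x)))
        ... | no y≢    = sym (when-no (x ≟ τ y) (λ e → y≢ (trans (sym (στ y)) (cong σ (sym e)))))

      open DecMembership _≟_ using (_∈?_)

      fold-sub : {xs : List A} → Unique xs → (f : A → M) →
                 fold xs f ≡ fold elems (λ z → when (z ∈? xs) (f z))
      fold-sub {xs} u f = begin
        fold xs f ≡⟨ fold-cong xs (λ {x} _ → fold-one x f) ⟨
        fold xs (λ x → fold elems (λ z → when (z ≟ x) (f z))) ≡⟨ fold-swap xs elems _ ⟩
        fold elems (λ z → fold xs (λ x → when (z ≟ x) (f z)))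
          ≡⟨ fold-cong elems (λ {z} _ → collapse z) ⟩
        fold elems (λ z → when (z ∈? xs) (f z)) ∎
        where
        open ≡-Reasoning
        flip : ∀ z x → when (z ≟ x) (f z) ≡ when (x ≟ z) (f z)
        flip z x with z ≟ x
        ... | yes refl = sym (when-yes (x ≟ x) refl)
        ... | no z≢    = sym (when-no (x ≟ z) (λ e → z≢ (sym e)))
        collapse : ∀ z → fold xs (λ x → when (z ≟ x) (f z)) ≡ when (z ∈? xs) (f z)
        collapse z with z ∈? xs
        ... | yes p = trans (fold-cong xs (λ {x} _ → flip z x)) (fold-single _≟_ u p (f z))
        ... | no ¬p = trans (fold-cong xs (λ {x} p → when-no (z ≟ x) (λ { refl → ¬p p }))) (fold-ε xs)

      fold-split : {xs : List A} → Unique xs → (f : A → M) →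
                   fold elems f ≡ fold xs f ∙ fold (filter (λ z → ¬? (z ∈? xs)) elems) f
      fold-split {xs} u f = begin
        fold elems f ≡⟨ fold-cong elems (λ {z} _ → when-¬ (z ∈? xs) (f z)) ⟩
        fold elems (λ z → when (z ∈? xs) (f z) ∙ when (¬? (z ∈? xs)) (f z)) ≡⟨ fold-∙ elems _ _ ⟩
        fold elems (λ z → when (z ∈? xs) (f z)) ∙ fold elems (λ z → when (¬? (z ∈? xs)) (f z))
          ≡⟨ cong₂ _∙_ (sym (fold-sub u f)) (sym (fold-filter _ elems f)) ⟩
        fold xs f ∙ fold (filter (λ z → ¬? (z ∈? xs)) elems) f ∎
        where open ≡-Reasoning

  -- Finite fields of characteristic two.

  record BinaryField : Set₁ where
    infixl 6 _+_
    infixl 7 _*_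
    field
      F       : Set
      finite  : Finite F
      _+_ _*_ : F → F → F
      0# 1#   : F
      inv     : F → F
      isCommutativeSemiring : IsCommutativeSemiring _≡_ _+_ _*_ 0# 1#
      x+x≡0   : ∀ x → x + x ≡ 0#
      1≢0     : 1# ≢ 0#
      -- A total inverse with this value at zero is multiplicative without side conditions, see
      -- `inv-*`.
      inv-0   : inv 0# ≡ 0#
      *-inv   : ∀ x → x ≢ 0# → x * inv x ≡ 1#

    open IsCommutativeSemiring isCommutativeSemiring public
      using (+-isCommutativeMonoid; *-isCommutativeMonoid; +-identityˡ; +-identityʳ; +-comm; +-assoc;
             *-identityˡ; *-identityʳ; *-comm; *-assoc; zeroˡ; zeroʳ; distribˡ; distribʳ)

    -- Ring normalisation with coefficients in GF(2), so that x + x = 0 is built in.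
    private
      GF2 : RawRing _ _
      GF2 = record { Carrier = Bool ; _≈_ = _≡_ ; _+_ = _xor_ ; _*_ = _∧_ ; -_ = λ x → x ; 0# = false ; 1# = true }

      acr : AlmostCommutativeRing _ _
      acr = fromCommutativeSemiring (record { isCommutativeSemiring = isCommutativeSemiring })

      ⟪_⟫ : Bool → F
      ⟪ false ⟫ = 0#
      ⟪ true ⟫  = 1#

      hom : GF2 -Raw-AlmostCommutative⟶ acr
      hom = record
        { ⟦_⟧    = ⟪_⟫
        ; +-homo = λ { false y → sym (+-identityˡ _) ; true false → sym (+-identityʳ _) ; true true → sym (x+x≡0 1#) }
        ; *-homo = λ { false y → sym (zeroˡ _) ; true y → sym (*-identityˡ _) }
        ; -‿homo = λ _ → refl
        ; 0-homo = refl
        ; 1-homo = refl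
        }

      dec : ∀ x y → Maybe (⟪ x ⟫ ≡ ⟪ y ⟫)
      dec false false = just refl
      dec true  true  = just refl
      dec _     _     = nothing

    module Solver = RingSolver GF2 acr hom dec

    open Finite finite public using (_≟_)

    q : ℕ
    q = Finite.size finite

    +≡0⇒≡ : ∀ {x y} → x + y ≡ 0# → x ≡ y
    +≡0⇒≡ {x} {y} h = begin
      x           ≡⟨ solve 2 (λ x y → x := (x :+ y) :+ y) refl x y ⟩
      (x + y) + y ≡⟨ cong (_+ y) h ⟩
      0# + y      ≡⟨ +-identityˡ y ⟩
      y           ∎
      where
      open ≡-Reasoning
      open Solver

    *-cancelˡ : ∀ {a x y} → a ≢ 0# → a * x ≡ a * y → x ≡ y
    *-cancelˡ {a} {x} {y} a≢0 h = begin
      x               ≡⟨ *-identityˡ x ⟨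
      1# * x          ≡⟨ cong (_* x) (*-inv a a≢0) ⟨
      a * inv a * x   ≡⟨ solve 3 (λ a b x → a :* b :* x := b :* (a :* x)) refl a (inv a) x ⟩
      inv a * (a * x) ≡⟨ cong (inv a *_) h ⟩
      inv a * (a * y) ≡⟨ solve 3 (λ a b x → b :* (a :* x) := a :* b :* x) refl a (inv a) y ⟩
      a * inv a * y   ≡⟨ cong (_* y) (*-inv a a≢0) ⟩
      1# * y          ≡⟨ *-identityˡ y ⟩
      y               ∎
      where
      open ≡-Reasoning
      open Solver

    *≡0 : ∀ {a x} → a ≢ 0# → a * x ≡ 0# → x ≡ 0#
    *≡0 {a} a≢0 h = *-cancelˡ a≢0 (trans h (sym (zeroʳ a)))

    *≢0 : ∀ {x y} → x ≢ 0# → y ≢ 0# → x * y ≢ 0#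
    *≢0 x≢0 y≢0 h = y≢0 (*≡0 x≢0 h)

    inv≢0 : ∀ {x} → x ≢ 0# → inv x ≢ 0#
    inv≢0 {x} x≢0 h = 1≢0 (trans (sym (*-inv x x≢0)) (trans (cong (x *_) h) (zeroʳ x)))

    inv-unique : ∀ {x y} → x * y ≡ 1# → y ≡ inv x
    inv-unique {x} {y} h = *-cancelˡ x≢0 (trans h (sym (*-inv x x≢0)))
      where
      x≢0 : x ≢ 0#
      x≢0 e = 1≢0 (trans (sym h) (trans (cong (_* y) e) (zeroˡ y)))

    inv-* : ∀ x y → inv (x * y) ≡ inv x * inv y
    inv-* x y with x ≟ 0# | y ≟ 0#
    ... | yes refl | _ = trans (cong inv (zeroˡ y)) (trans inv-0 (sym (trans (cong (_* inv y) inv-0) (zeroˡ _))))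
    ... | no _ | yes refl = trans (cong inv (zeroʳ x)) (trans inv-0 (sym (trans (cong (inv x *_) inv-0) (zeroʳ _))))
    ... | no x≢0 | no y≢0 = sym (inv-unique (begin
      x * y * (inv x * inv y) ≡⟨ solve 4 (λ x y a b → x :* y :* (a :* b) := (x :* a) :* (y :* b)) refl x y (inv x) (inv y) ⟩
      x * inv x * (y * inv y) ≡⟨ cong₂ _*_ (*-inv x x≢0) (*-inv y y≢0) ⟩
      1# * 1#                 ≡⟨ *-identityˡ 1# ⟩
      1#                      ∎))
      where
      open ≡-Reasoning
      open Solver

    inv-1 : inv 1# ≡ 1#
    inv-1 = sym (inv-unique (*-identityˡ 1#))

  Unique-map : {xs : List A} (f : A → B) → Unique xs →
               (∀ {i j} → i ∈ xs → j ∈ xs → i ≢ j → f i ≢ f j) → Unique (map f xs)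
  Unique-map f []       inj = []
  Unique-map {xs = x ∷ xs} f (x≢ ∷ u) inj =
    all xs x≢ (λ p → inj (here refl) (there p)) ∷ Unique-map f u (λ p r → inj (there p) (there r))
    where
    all : ∀ ys → All (x ≢_) ys → (∀ {j} → j ∈ ys → x ≢ j → f x ≢ f j) → All (f x ≢_) (map f ys)
    all []       []        g = []
    all (y ∷ ys) (n ∷ ns) g = g (here refl) n ∷ all ys ns (λ p → g (there p))

  -- Divided differences over a finite field.

  module Interpolation (K : BinaryField) where
    open BinaryField K
    open Finite finite using (elems)
    open DecMembership _≟_ using (_∈?_)

    private
      module Σ = Fold +-isCommutativeMonoid
      module Π = Fold *-isCommutativeMonoid

    Σ-*ˡ : (xs : List A) (c : F) (f : A → F) → Σ.fold xs (λ x → c * f x) ≡ c * Σ.fold xs f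
    Σ-*ˡ []       c f = sym (zeroʳ c)
    Σ-*ˡ (x ∷ xs) c f = trans (cong (c * f x +_) (Σ-*ˡ xs c f)) (sym (distribˡ c _ _))

    Π-≢0 : (xs : List A) (f : A → F) → (∀ {x} → x ∈ xs → f x ≢ 0#) → Π.fold xs f ≢ 0#
    Π-≢0 []       f h = 1≢0
    Π-≢0 (x ∷ xs) f h = *≢0 (h (here refl)) (Π-≢0 xs f (λ p → h (there p)))

    -- nz omits vanishing factors, so that ∏_{z ∈ S} nz (κ + z) is the product over S ∖ {κ}.
    nz : F → F
    nz x with x ≟ 0#
    ... | yes _ = 1#
    ... | no _  = x

    nz-0 : nz 0# ≡ 1#
    nz-0 with 0# ≟ 0#
    ... | yes _ = refl
    ... | no h  = ⊥-elim (h refl)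

    nz-id : ∀ {x} → x ≢ 0# → nz x ≡ x
    nz-id {x} h with x ≟ 0#
    ... | yes e = ⊥-elim (h e)
    ... | no _  = refl

    nz≢0 : ∀ x → nz x ≢ 0#
    nz≢0 x with x ≟ 0#
    ... | yes _ = 1≢0
    ... | no h  = h

    ≢⇒+≢0 : ∀ {x y} → x ≢ y → x + y ≢ 0#
    ≢⇒+≢0 h e = h (+≡0⇒≡ e)

    ∏nz : List A → (A → F) → F
    ∏nz xs f = Π.fold xs (λ x → nz (f x))

    ∏nz≢0 : (xs : List A) (f : A → F) → ∏nz xs f ≢ 0#
    ∏nz≢0 xs f = Π-≢0 xs _ (λ {x} _ → nz≢0 (f x))

    -- The divided difference, at the nodes `E`, of the monic polynomial with root list `T`.
    -- Equivalently, it is the coefficient of degree |E| - 1 in the Lagrange interpolant; `nz`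
    -- removes the factor of a node with itself.
    divDiff : List F → List F → F
    divDiff T E = Σ.fold E (λ κ → Π.fold T (κ +_) * inv (∏nz E (κ +_)))

    -- In characteristic two κ + m = (κ + e) + (e + m). The first part cancels the node `e` from the
    -- denominator at each other node and vanishes at `e` itself; the second part is a constant.
    divDiff-step : ∀ m T e E → All (e ≢_) E →
      divDiff (m ∷ T) (e ∷ E) ≡ divDiff T E + (e + m) * divDiff T (e ∷ E)
    divDiff-step m T e E e≢ = begin
      first (m ∷ T) + Σ.fold E (λ κ → (κ + m) * num κ * den κ)
        ≡⟨ cong₂ _+_ (*-assoc (e + m) (num e) (den e)) (Σ.fold-cong E (λ p → term p)) ⟩
      (e + m) * first T + Σ.fold E (λ κ → num κ * inv (∏nz E (κ +_)) + (e + m) * (num κ * den κ))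
        ≡⟨ cong ((e + m) * first T +_) (Σ.fold-∙ E _ _) ⟩
      (e + m) * first T + (divDiff T E + Σ.fold E (λ κ → (e + m) * (num κ * den κ)))
        ≡⟨ cong (λ z → (e + m) * first T + (divDiff T E + z)) (Σ-*ˡ E (e + m) _) ⟩
      (e + m) * first T + (divDiff T E + (e + m) * Σ.fold E (λ κ → num κ * den κ))
        ≡⟨ solve 4 (λ c a b d → c :* a :+ (b :+ c :* d) := b :+ c :* (a :+ d)) refl (e + m) (first T) (divDiff T E) _ ⟩
      divDiff T E + (e + m) * divDiff T (e ∷ E) ∎
      where
      open ≡-Reasoning
      open Solver
      num den : F → F
      num κ = Π.fold T (κ +_)
      den κ = inv (∏nz (e ∷ E) (κ +_))
      first : List F → F
      first T = Π.fold T (e +_) * den e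
      term : ∀ {κ} → κ ∈ E → (κ + m) * num κ * den κ ≡ num κ * inv (∏nz E (κ +_)) + (e + m) * (num κ * den κ)
      term {κ} p = begin
        (κ + m) * num κ * den κ
          ≡⟨ solve 5 (λ κ m e n d → (κ :+ m) :* n :* d := n :* ((κ :+ e) :* d) :+ (e :+ m) :* (n :* d)) refl κ m e (num κ) (den κ) ⟩
        num κ * ((κ + e) * den κ) + (e + m) * (num κ * den κ)
          ≡⟨ cong (λ z → num κ * z + (e + m) * (num κ * den κ)) cancel ⟩
        num κ * inv (∏nz E (κ +_)) + (e + m) * (num κ * den κ) ∎
        where
        κ+e≢0 : κ + e ≢ 0#
        κ+e≢0 = ≢⇒+≢0 (λ h → All.lookup e≢ p (sym h))
        cancel : (κ + e) * den κ ≡ inv (∏nz E (κ +_))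
        cancel = begin
          (κ + e) * inv (nz (κ + e) * ∏nz E (κ +_)) ≡⟨ cong (λ z → (κ + e) * inv (z * ∏nz E (κ +_))) (nz-id κ+e≢0) ⟩
          (κ + e) * inv ((κ + e) * ∏nz E (κ +_))    ≡⟨ cong ((κ + e) *_) (inv-* (κ + e) _) ⟩
          (κ + e) * (inv (κ + e) * inv (∏nz E (κ +_))) ≡⟨ *-assoc _ _ _ ⟨
          (κ + e) * inv (κ + e) * inv (∏nz E (κ +_))   ≡⟨ cong (_* inv (∏nz E (κ +_))) (*-inv _ κ+e≢0) ⟩
          1# * inv (∏nz E (κ +_)) ≡⟨ *-identityˡ _ ⟩
          inv (∏nz E (κ +_)) ∎

    divDiff-swap : ∀ T a b E → divDiff T (a ∷ b ∷ E) ≡ divDiff T (b ∷ a ∷ E)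
    divDiff-swap T a b E = begin
      g a + (g b + Σ.fold E g) ≡⟨ solve 3 (λ x y z → x :+ (y :+ z) := y :+ (x :+ z)) refl (g a) (g b) _ ⟩
      g b + (g a + Σ.fold E g) ≡⟨ Σ.fold-cong (b ∷ a ∷ E) (λ {κ} _ → cong (λ z → Π.fold T (κ +_) * inv z) (reorder κ)) ⟩
      divDiff T (b ∷ a ∷ E) ∎
      where
      open ≡-Reasoning
      open Solver
      g : F → F
      g κ = Π.fold T (κ +_) * inv (∏nz (a ∷ b ∷ E) (κ +_))
      reorder : ∀ κ → ∏nz (a ∷ b ∷ E) (κ +_) ≡ ∏nz (b ∷ a ∷ E) (κ +_)
      reorder κ = solve 3 (λ x y z → x :* (y :* z) := y :* (x :* z)) refl (nz (κ + a)) (nz (κ + b)) _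

    divDiff-one : ∀ e → divDiff [] (e ∷ []) ≡ 1#
    divDiff-one e = begin
      1# * inv (nz (e + e) * 1#) + 0# ≡⟨ +-identityʳ _ ⟩
      1# * inv (nz (e + e) * 1#)      ≡⟨ *-identityˡ _ ⟩
      inv (nz (e + e) * 1#)           ≡⟨ cong inv (*-identityʳ _) ⟩
      inv (nz (e + e))                ≡⟨ cong (λ z → inv (nz z)) (x+x≡0 e) ⟩
      inv (nz 0#)                     ≡⟨ cong inv nz-0 ⟩
      inv 1#                          ≡⟨ inv-1 ⟩
      1#                              ∎
      where open ≡-Reasoning

    -- The divided difference with the one root `b` at the nodes `a`, `b` and `E` is expanded by
    -- `divDiff-step` once along `a` and once along `b`. Comparing the two shows that (a + b) times
    -- the value sought is the sum of two values with one node fewer. Single nodes give 1 + 1 = 0 at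
    -- the bottom.
    divDiff-[] : ∀ n E → length E ≡ 2 ℕ.+ n → Unique E → divDiff [] E ≡ 0#
    divDiff-[] n (a ∷ b ∷ E) len ((a≢b ∷ a≢) ∷ b≢ ∷ u) = *≡0 (≢⇒+≢0 a≢b) (begin
      (a + b) * D (a ∷ b ∷ E)
        ≡⟨ solve 2 (λ x y → x := y :+ (y :+ x)) refl ((a + b) * D (a ∷ b ∷ E)) (D (b ∷ E)) ⟩
      D (b ∷ E) + (D (b ∷ E) + (a + b) * D (a ∷ b ∷ E))
        ≡⟨ cong (D (b ∷ E) +_) (divDiff-step b [] a (b ∷ E) (a≢b ∷ a≢)) ⟨
      D (b ∷ E) + divDiff (b ∷ []) (a ∷ b ∷ E)
        ≡⟨ cong (D (b ∷ E) +_) (divDiff-swap (b ∷ []) a b E) ⟩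
      D (b ∷ E) + divDiff (b ∷ []) (b ∷ a ∷ E)
        ≡⟨ cong (D (b ∷ E) +_) (divDiff-step b [] b (a ∷ E) ((λ e → a≢b (sym e)) ∷ b≢)) ⟩
      D (b ∷ E) + (D (a ∷ E) + (b + b) * D (b ∷ a ∷ E))
        ≡⟨ solve 4 (λ x y b z → x :+ (y :+ (b :+ b) :* z) := x :+ y) refl (D (b ∷ E)) (D (a ∷ E)) b (D (b ∷ a ∷ E)) ⟩
      D (b ∷ E) + D (a ∷ E) ≡⟨ rest n E (ℕ.suc-injective (ℕ.suc-injective len)) a≢ b≢ u ⟩
      0# ∎)
      where
      open ≡-Reasoning
      open Solver
      D : List F → F
      D = divDiff []
      rest : ∀ n E → length E ≡ n → All (a ≢_) E → All (b ≢_) E → Unique E → D (b ∷ E) + D (a ∷ E) ≡ 0#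
      rest zero    []      _  _  _  _ = trans (cong₂ _+_ (divDiff-one b) (divDiff-one a)) (x+x≡0 1#)
      rest (suc n) (c ∷ E) l  a≢ b≢ u = trans
        (cong₂ _+_ (divDiff-[] n (b ∷ c ∷ E) (cong suc l) (b≢ ∷ u)) (divDiff-[] n (a ∷ c ∷ E) (cong suc l) (a≢ ∷ u)))
        (+-identityˡ 0#)

    -- The degree |T| is at most |E| - 2, and `divDiff-step` removes one root at a time. The slack
    -- `n` is a parameter because one summand of the step keeps all the nodes and so gains slack.
    divDiff-vanishes : ∀ T n E → length E ≡ 2 ℕ.+ n ℕ.+ length T → Unique E → divDiff T E ≡ 0#
    divDiff-vanishes []      n E       len u = divDiff-[] n E (trans len (ℕ.+-identityʳ _)) u
    divDiff-vanishes (m ∷ T) n (e ∷ E) len (e≢ ∷ u) = begin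
      divDiff (m ∷ T) (e ∷ E) ≡⟨ divDiff-step m T e E e≢ ⟩
      divDiff T E + (e + m) * divDiff T (e ∷ E)
        ≡⟨ cong₂ (λ x y → x + (e + m) * y)
             (divDiff-vanishes T n E (ℕ.suc-injective (trans len (ℕ.+-suc (2 ℕ.+ n) _))) u)
             (divDiff-vanishes T (suc n) (e ∷ E) (trans len (ℕ.+-suc (2 ℕ.+ n) _)) (e≢ ∷ u)) ⟩
      0# + (e + m) * 0# ≡⟨ trans (+-identityˡ _) (zeroʳ _) ⟩
      0# ∎
      where open ≡-Reasoning

    -- When |E| = |T| + 1, the first summand of `divDiff-step` again has this shape, and the second
    -- falls under `divDiff-vanishes`. What remains is the leading coefficient.
    divDiff-leading : ∀ T E → length E ≡ 1 ℕ.+ length T → Unique E → divDiff T E ≡ 1#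
    divDiff-leading []      (e ∷ []) len u = divDiff-one e
    divDiff-leading (m ∷ T) (e ∷ E) len (e≢ ∷ u) = begin
      divDiff (m ∷ T) (e ∷ E) ≡⟨ divDiff-step m T e E e≢ ⟩
      divDiff T E + (e + m) * divDiff T (e ∷ E)
        ≡⟨ cong₂ (λ x y → x + (e + m) * y) (divDiff-leading T E (ℕ.suc-injective len) u)
             (divDiff-vanishes T 0 (e ∷ E) len (e≢ ∷ u)) ⟩
      1# + (e + m) * 0# ≡⟨ trans (cong (1# +_) (zeroʳ _)) (+-identityʳ _) ⟩
      1# ∎
      where open ≡-Reasoning

    allDiff : F
    allDiff = ∏nz elems (0# +_)

    ∏nz-all : ∀ κ → ∏nz elems (κ +_) ≡ allDiff
    ∏nz-all κ = trans (sym (Π.fold-cong elems (λ {z} _ → cong nz (+-identityˡ (κ + z)))))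
      (Π.fold-bij finite (κ +_) (κ +_) inv₂ inv₂ (λ z → nz (0# + z)))
      where
      inv₂ : ∀ x → κ + (κ + x) ≡ x
      inv₂ x = solve 2 (λ κ x → κ :+ (κ :+ x) := x) refl κ x
        where open Solver

    complement : List F → List F
    complement S = filter (λ z → ¬? (z ∈? S)) elems

    length-complement : ∀ {S} → Unique S → q ≡ length S ℕ.+ length (complement S)
    length-complement {S} u = trans (len elems) (trans (Nat.fold-split finite u (λ _ → 1)) (sym (cong₂ ℕ._+_ (len S) (len (complement S)))))
      where
      module Nat = Fold ℕ.+-0-isCommutativeMonoid
      len : (xs : List F) → length xs ≡ Nat.fold xs (λ _ → 1)
      len []       = refl
      len (x ∷ xs) = cong suc (len xs)

    -- The denominators 1 / ∏_{S} nz (κ + z) are, up to a constant, the values at κ of the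
    -- polynomial vanishing on the complement of S.
    interpolant : List F → List F → F
    interpolant S E = Σ.fold E (λ κ → inv (∏nz S (κ +_) * ∏nz E (κ +_)))

    interpolant-divDiff : ∀ {S E} → Unique S → (∀ {κ} → κ ∈ E → κ ∈ S) →
      interpolant S E ≡ inv allDiff * divDiff (complement S) E
    interpolant-divDiff {S} {E} u E⊆S = trans (Σ.fold-cong E term) (Σ-*ˡ E (inv allDiff) _)
      where
      open ≡-Reasoning
      open Solver
      T = complement S
      term : ∀ {κ} → κ ∈ E → inv (∏nz S (κ +_) * ∏nz E (κ +_)) ≡ inv allDiff * (Π.fold T (κ +_) * inv (∏nz E (κ +_)))
      term {κ} p = begin
        inv (∏nz S (κ +_) * ∏nz E (κ +_))       ≡⟨ inv-* _ _ ⟩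
        inv (∏nz S (κ +_)) * inv (∏nz E (κ +_)) ≡⟨ cong (_* inv (∏nz E (κ +_))) (sym (inv-unique (begin
          ∏nz S (κ +_) * (inv allDiff * Π.fold T (κ +_))
            ≡⟨ cong (λ z → ∏nz S (κ +_) * (inv allDiff * z)) (Π.fold-cong T (λ m → sym (nz-id (κ+m≢0 m)))) ⟩
          ∏nz S (κ +_) * (inv allDiff * ∏nz T (κ +_))
            ≡⟨ solve 3 (λ a b c → a :* (b :* c) := (a :* c) :* b) refl _ _ _ ⟩
          ∏nz S (κ +_) * ∏nz T (κ +_) * inv allDiff
            ≡⟨ cong (_* inv allDiff) (trans (sym (Π.fold-split finite u _)) (∏nz-all κ)) ⟩
          allDiff * inv allDiff ≡⟨ *-inv _ (∏nz≢0 elems _) ⟩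
          1# ∎))) ⟩
        inv allDiff * Π.fold T (κ +_) * inv (∏nz E (κ +_)) ≡⟨ *-assoc _ _ _ ⟩
        inv allDiff * (Π.fold T (κ +_) * inv (∏nz E (κ +_))) ∎
        where
        κ+m≢0 : ∀ {m} → m ∈ T → κ + m ≢ 0#
        κ+m≢0 m∈ = ≢⇒+≢0 (λ { refl → proj₂ (∈-filter⁻ (λ z → ¬? (z ∈? S)) {xs = elems} m∈) (E⊆S p) })

    -- The complement of `S` has q - |S| = |E| - 2 elements, so the polynomial with these roots has
    -- degree two less than the number of nodes.
    interpolant-vanishes : ∀ {S E} → Unique S → Unique E → (∀ {κ} → κ ∈ E → κ ∈ S) →
      length E ℕ.+ length S ≡ 2 ℕ.+ q → interpolant S E ≡ 0#
    interpolant-vanishes {S} {E} uS uE E⊆S len = begin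
      interpolant S E ≡⟨ interpolant-divDiff uS E⊆S ⟩
      inv allDiff * divDiff (complement S) E
        ≡⟨ cong (inv allDiff *_) (divDiff-vanishes (complement S) 0 E
             (ℕ.+-cancelʳ-≡ (length S) _ _ (trans len (cong (2 ℕ.+_) (trans (length-complement uS) (ℕ.+-comm (length S) _))))) uE) ⟩
      inv allDiff * 0# ≡⟨ zeroʳ _ ⟩
      0# ∎
      where open ≡-Reasoning

    -- Here q - |S| = |E| - 1, and the leading coefficient one survives up to the nonzero factor
    -- `inv allDiff`.
    interpolant-leading : ∀ {S E} → Unique S → Unique E → (∀ {κ} → κ ∈ E → κ ∈ S) →
      length E ℕ.+ length S ≡ 1 ℕ.+ q → interpolant S E ≢ 0#
    interpolant-leading {S} {E} uS uE E⊆S len h = *≢0 (inv≢0 (∏nz≢0 elems _)) 1≢0 (begin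
      inv allDiff * 1#
        ≡⟨ cong (inv allDiff *_) (divDiff-leading (complement S) E
             (ℕ.+-cancelʳ-≡ (length S) _ _ (trans len (cong suc (trans (length-complement uS) (ℕ.+-comm (length S) _))))) uE) ⟨
      inv allDiff * divDiff (complement S) E ≡⟨ interpolant-divDiff uS E⊆S ⟨
      interpolant S E ≡⟨ h ⟩
      0# ∎)
      where open ≡-Reasoning

    -- Fermat's theorem, symmetric double sums and the bound for affine arcs.

    infixr 8 _^_
    _^_ : F → ℕ → F
    x ^ zero  = 1#
    x ^ suc n = x * x ^ n

    ^-+ : ∀ x m n → x ^ (m ℕ.+ n) ≡ x ^ m * x ^ n
    ^-+ x zero    n = sym (*-identityˡ _)
    ^-+ x (suc m) n = trans (cong (x *_) (^-+ x m n)) (sym (*-assoc x _ _))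

    Π-const : (xs : List A) (c : F) → Π.fold xs (λ _ → c) ≡ c ^ length xs
    Π-const []       c = refl
    Π-const (x ∷ xs) c = cong (c *_) (Π-const xs c)

    -- Multiplication by `w` permutes the nonzero elements, so their factors `w` multiply to one;
    -- the factor at zero is the `w` that remains.
    fermat : ∀ {w} → w ≢ 0# → w ^ q ≡ w
    fermat {w} w≢0 = begin
      w ^ q ≡⟨ Π-const elems w ⟨
      Π.fold elems (λ _ → w) ≡⟨ Π.fold-cong elems (λ {z} _ → Π.when-¬ (z ≟ 0#) w) ⟩
      Π.fold elems (λ z → Π.when (z ≟ 0#) w * Π.when (¬? (z ≟ 0#)) w) ≡⟨ Π.fold-∙ elems _ _ ⟩
      Π.fold elems (λ z → Π.when (z ≟ 0#) w) * rest ≡⟨ cong₂ _*_ (Π.fold-one finite 0# (λ _ → w)) rest≡1 ⟩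
      w * 1# ≡⟨ *-identityʳ w ⟩
      w ∎
      where
      open ≡-Reasoning
      rest : F
      rest = Π.fold elems (λ z → Π.when (¬? (z ≟ 0#)) w)
      scale : ∀ z → nz (w * z) ≡ nz z * Π.when (¬? (z ≟ 0#)) w
      scale z with z ≟ 0#
      ... | yes refl = trans (cong nz (zeroʳ w)) (trans nz-0 (sym (*-identityʳ 1#)))
      ... | no z≢0   = trans (nz-id (*≢0 w≢0 z≢0)) (*-comm w z)
      rest≡1 : rest ≡ 1#
      rest≡1 = *-cancelˡ (∏nz≢0 elems (λ z → z)) (begin
        ∏nz elems (λ z → z) * rest ≡⟨ Π.fold-∙ elems _ _ ⟨
        Π.fold elems (λ z → nz z * Π.when (¬? (z ≟ 0#)) w) ≡⟨ Π.fold-cong elems (λ {z} _ → scale z) ⟨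
        ∏nz elems (w *_) ≡⟨ Π.fold-bij finite (w *_) (inv w *_)
           (λ x → trans (sym (*-assoc _ _ _)) (trans (cong (_* x) (trans (*-comm _ _) (*-inv w w≢0))) (*-identityˡ x)))
           (λ x → trans (sym (*-assoc _ _ _)) (trans (cong (_* x) (*-inv w w≢0)) (*-identityˡ x))) nz ⟩
        ∏nz elems (λ z → z) ≡⟨ *-identityʳ _ ⟨
        ∏nz elems (λ z → z) * 1# ∎)

    -- Off the diagonal the terms come in equal pairs, and equal pairs cancel in characteristic two.
    Σ-symmetric : (xs : List A) (f : A → A → F) → (∀ {i j} → i ∈ xs → j ∈ xs → f i j ≡ f j i) →
      Σ.fold xs (λ i → Σ.fold xs (f i)) ≡ Σ.fold xs (λ i → f i i)
    Σ-symmetric []       f h = refl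
    Σ-symmetric (x ∷ xs) f h = begin
      (f x x + row) + Σ.fold xs (λ i → f i x + Σ.fold xs (f i)) ≡⟨ cong ((f x x + row) +_) (Σ.fold-∙ xs _ _) ⟩
      (f x x + row) + (Σ.fold xs (λ i → f i x) + Σ.fold xs (λ i → Σ.fold xs (f i)))
        ≡⟨ cong₂ (λ a b → (f x x + row) + (a + b)) (Σ.fold-cong xs (λ p → h (there p) (here refl)))
             (Σ-symmetric xs f (λ p r → h (there p) (there r))) ⟩
      (f x x + row) + (row + Σ.fold xs (λ i → f i i))
        ≡⟨ solve 3 (λ a r d → (a :+ r) :+ (r :+ d) := a :+ d) refl (f x x) row _ ⟩
      f x x + Σ.fold xs (λ i → f i i) ∎
      where
      open ≡-Reasoning
      open Solver
      row : F
      row = Σ.fold xs (f x)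

    -- Let i ∈ E see every other point of A in a finite ratio κ = v / w.  Interpolating in the pencil
    -- at i and clearing the weights ∏ w leaves Σ_j 1 / H i j = 0 with H symmetric, so that in
    -- characteristic two only the diagonal survives; but the diagonal sum is an interpolant in y.
    module AffineArc {I : Set} (_≟ᴵ_ : DecidableEquality I) (x y : I → F) (A E : List I)
      (uA : Unique A) (uE : Unique E) (E⊆A : ∀ {i} → i ∈ E → i ∈ A) where

      u v w : I → I → F
      u i j = x i + x j
      v i j = y i + y j
      w i j = u i j + v i j

      -- Since w = u + v, this equals v i j · u i l + v i l · u i j, the determinant that vanishes
      -- when the three points are collinear.
      D : I → I → I → F
      D i j l = v i j * w i l + v i l * w i j

      vii≡0 : ∀ i → v i i ≡ 0#
      vii≡0 i = x+x≡0 (y i)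

      module _
        (u≢0 : ∀ {i j} → i ∈ A → j ∈ A → i ≢ j → u i j ≢ 0#)
        (v≢0 : ∀ {i j} → i ∈ A → j ∈ A → i ≢ j → v i j ≢ 0#)
        (w≢0 : ∀ {i j} → i ∈ E → j ∈ A → i ≢ j → w i j ≢ 0#)
        (D≢0 : ∀ {i j l} → i ∈ E → j ∈ A → l ∈ A → i ≢ j → i ≢ l → j ≢ l → D i j l ≢ 0#)
        -- One more than `length-tangents` allows. This exact value is used three times: for the
        -- interpolation in each pencil, for the final one in `y`, and for the exponent q + 1 to
        -- which Fermat's theorem is applied.
        (len : length E ℕ.+ length A ≡ 1 ℕ.+ q) where

        module Pencil {i : I} (i∈E : i ∈ E) where
          -- A coordinate on the pencil of lines at `i` with the direction w = 0 at infinity, v = 0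
          -- at zero and u = 0 at one. As `κ i` is zero, the point `i` itself occupies the place of
          -- the direction v = 0, which no other point of `A` takes.
          κ : I → F
          κ l = v i l * inv (w i l)

          κ-self : κ i ≡ 0#
          κ-self = trans (cong (_* inv (w i i)) (vii≡0 i)) (zeroˡ _)

          κ-* : ∀ {l} → l ∈ A → i ≢ l → κ l * w i l ≡ v i l
          κ-* {l} l∈ i≢l = begin
            v i l * inv (w i l) * w i l ≡⟨ solve 3 (λ a b c → a :* b :* c := a :* (c :* b)) refl (v i l) (inv (w i l)) (w i l) ⟩
            v i l * (w i l * inv (w i l)) ≡⟨ cong (v i l *_) (*-inv _ (w≢0 i∈E l∈ i≢l)) ⟩
            v i l * 1# ≡⟨ *-identityʳ _ ⟩
            v i l ∎
            where
            open ≡-Reasoning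
            open Solver

          κ+κ : ∀ {j l} → j ∈ A → l ∈ A → i ≢ j → i ≢ l → (κ j + κ l) * (w i j * w i l) ≡ D i j l
          κ+κ {j} {l} j∈ l∈ i≢j i≢l = begin
            (κ j + κ l) * (w i j * w i l)
              ≡⟨ solve 4 (λ a b c d → (a :+ b) :* (c :* d) := (a :* c) :* d :+ (b :* d) :* c) refl (κ j) (κ l) (w i j) (w i l) ⟩
            κ j * w i j * w i l + κ l * w i l * w i j
              ≡⟨ cong₂ (λ a b → a * w i l + b * w i j) (κ-* j∈ i≢j) (κ-* l∈ i≢l) ⟩
            D i j l ∎
            where
            open ≡-Reasoning
            open Solver

          κ+1 : ∀ {j} → j ∈ A → i ≢ j → (κ j + 1#) * w i j ≡ u i j
          κ+1 {j} j∈ i≢j = begin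
            (κ j + 1#) * w i j ≡⟨ solve 2 (λ a b → (a :+ con true) :* b := a :* b :+ b) refl (κ j) (w i j) ⟩
            κ j * w i j + w i j ≡⟨ cong (_+ w i j) (κ-* j∈ i≢j) ⟩
            v i j + (u i j + v i j) ≡⟨ solve 2 (λ a b → a :+ (b :+ a) := b) refl (v i j) (u i j) ⟩
            u i j ∎
            where
            open ≡-Reasoning
            open Solver

          κ≢0 : ∀ {l} → l ∈ A → i ≢ l → κ l ≢ 0#
          κ≢0 l∈ i≢l h = v≢0 (E⊆A i∈E) l∈ i≢l (trans (sym (κ-* l∈ i≢l)) (trans (cong (_* w i _) h) (zeroˡ _)))

          κ-inj : ∀ {j l} → j ∈ A → l ∈ A → j ≢ l → κ j ≢ κ l
          κ-inj {j} {l} j∈ l∈ j≢l e with i ≟ᴵ j | i ≟ᴵ l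
          ... | yes refl | yes refl = j≢l refl
          ... | yes refl | no i≢l   = κ≢0 l∈ i≢l (trans (sym e) κ-self)
          ... | no i≢j   | yes refl = κ≢0 j∈ i≢j (trans e κ-self)
          ... | no i≢j   | no i≢l   = D≢0 i∈E j∈ l∈ i≢j i≢l j≢l
            (trans (sym (κ+κ j∈ l∈ i≢j i≢l)) (trans (cong (_* (w i j * w i l)) (trans (cong (_+ κ l) e) (x+x≡0 _))) (zeroˡ _)))

          κ+1≢0 : ∀ {l} → l ∈ A → κ l + 1# ≢ 0#
          κ+1≢0 {l} l∈ h with i ≟ᴵ l
          ... | yes refl = 1≢0 (trans (sym (trans (cong (_+ 1#) κ-self) (+-identityˡ 1#))) h)
          ... | no i≢l   = u≢0 (E⊆A i∈E) l∈ i≢l (trans (sym (κ+1 l∈ i≢l)) (trans (cong (_* w i l) h) (zeroˡ _)))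

          weight : List I → F
          weight X = ∏nz X (w i)

          diagonal : ∀ X → (∀ {l} → l ∈ X → l ∈ A) → ∏nz X (λ l → κ i + κ l) * weight X ≡ ∏nz X (v i)
          diagonal X X⊆A = trans (sym (Π.fold-∙ X _ _)) (Π.fold-cong X (λ p → factor (X⊆A p)))
            where
            factor : ∀ {l} → l ∈ A → nz (κ i + κ l) * nz (w i l) ≡ nz (v i l)
            factor {l} l∈ with i ≟ᴵ l
            ... | yes refl = trans (cong₂ (λ a b → nz a * nz b) (x+x≡0 (κ i)) (trans (cong₂ _+_ (x+x≡0 (x i)) (vii≡0 i)) (+-identityˡ 0#)))
                             (trans (cong₂ _*_ nz-0 nz-0) (trans (*-identityˡ 1#) (sym (trans (cong nz (vii≡0 i)) nz-0))))
            ... | no i≢l = trans (cong₂ _*_ (trans (cong nz (trans (cong (_+ κ l) κ-self) (+-identityˡ _))) (nz-id (κ≢0 l∈ i≢l))) (nz-id (w≢0 i∈E l∈ i≢l)))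
                             (trans (κ-* l∈ i≢l) (sym (nz-id (v≢0 (E⊆A i∈E) l∈ i≢l))))

          -- Multiplying the factor at `l` by w i j · w i l turns it into the determinant `D i j l`.
          -- The factors at l = i and l = j degenerate and leave v i j and the square of w i j.
          offDiagonal : ∀ {j} X → j ∈ A → i ≢ j → Unique X → i ∈ X → j ∈ X → (∀ {l} → l ∈ X → l ∈ A) →
            ∏nz X (λ l → κ j + κ l) * (w i j ^ length X * weight X) ≡ v i j * (w i j * w i j) * ∏nz X (D i j)
          offDiagonal {j} X j∈ i≢j uX i∈X j∈X X⊆A = begin
            ∏nz X (λ l → κ j + κ l) * (w i j ^ length X * weight X)
              ≡⟨ cong (λ z → ∏nz X (λ l → κ j + κ l) * (z * weight X)) (Π-const X (w i j)) ⟨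
            ∏nz X (λ l → κ j + κ l) * (Π.fold X (λ _ → w i j) * weight X)
              ≡⟨ trans (cong (∏nz X (λ l → κ j + κ l) *_) (sym (Π.fold-∙ X _ _))) (sym (Π.fold-∙ X _ _)) ⟩
            Π.fold X (λ l → nz (κ j + κ l) * (w i j * nz (w i l)))
              ≡⟨ Π.fold-cong X (λ p → factor (X⊆A p)) ⟩
            Π.fold X (λ l → Π.when (l ≟ᴵ i) (v i j) * Π.when (l ≟ᴵ j) (w i j * w i j) * nz (D i j l))
              ≡⟨ trans (Π.fold-∙ X _ _) (cong (_* ∏nz X (D i j)) (Π.fold-∙ X _ _)) ⟩
            Π.fold X (λ l → Π.when (l ≟ᴵ i) (v i j)) * Π.fold X (λ l → Π.when (l ≟ᴵ j) (w i j * w i j)) * ∏nz X (D i j)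
              ≡⟨ cong₂ (λ a b → a * b * ∏nz X (D i j)) (Π.fold-single _≟ᴵ_ uX i∈X _) (Π.fold-single _≟ᴵ_ uX j∈X _) ⟩
            v i j * (w i j * w i j) * ∏nz X (D i j) ∎
            where
            open ≡-Reasoning
            open Solver
            wj : w i j ≢ 0#
            wj = w≢0 i∈E j∈ i≢j
            factor : ∀ {l} → l ∈ A → nz (κ j + κ l) * (w i j * nz (w i l)) ≡
                     Π.when (l ≟ᴵ i) (v i j) * Π.when (l ≟ᴵ j) (w i j * w i j) * nz (D i j l)
            factor {l} l∈ with l ≟ᴵ i | l ≟ᴵ j
            ... | yes refl | yes refl = ⊥-elim (i≢j refl)
            ... | yes refl | no _ = begin
              nz (κ j + κ l) * (w l j * nz (w l l))
                ≡⟨ cong₂ (λ a b → nz a * (w l j * nz b)) (trans (cong (κ j +_) κ-self) (+-identityʳ _))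
                     (trans (cong₂ _+_ (x+x≡0 (x l)) (vii≡0 l)) (+-identityˡ 0#)) ⟩
              nz (κ j) * (w l j * nz 0#) ≡⟨ cong₂ (λ a b → a * (w l j * b)) (nz-id (κ≢0 j∈ i≢j)) nz-0 ⟩
              κ j * (w l j * 1#) ≡⟨ cong (κ j *_) (*-identityʳ _) ⟩
              κ j * w l j ≡⟨ κ-* j∈ i≢j ⟩
              v l j ≡⟨ trans (*-identityʳ _) (*-identityʳ _) ⟨
              v l j * 1# * 1# ≡⟨ cong (v l j * 1# *_) (trans (cong nz D≡0) nz-0) ⟨
              v l j * 1# * nz (D l j l) ∎
              where
              D≡0 : D l j l ≡ 0#
              D≡0 = solve 4 (λ x x′ y y′ → (y :+ y′) :* ((x :+ x) :+ (y :+ y)) :+ (y :+ y) :* ((x :+ x′) :+ (y :+ y′)) := con false) refl (x l) (x j) (y l) (y j)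
            ... | no _ | yes refl = begin
              nz (κ l + κ l) * (w i l * nz (w i l))
                ≡⟨ cong₂ (λ a b → a * (w i l * b)) (trans (cong nz (x+x≡0 _)) nz-0) (nz-id wj) ⟩
              1# * (w i l * w i l) ≡⟨ *-identityʳ _ ⟨
              1# * (w i l * w i l) * 1# ≡⟨ cong (1# * (w i l * w i l) *_) (trans (cong nz (x+x≡0 _)) nz-0) ⟨
              1# * (w i l * w i l) * nz (D i l l) ∎
            ... | no l≢i | no l≢j = begin
              nz (κ j + κ l) * (w i j * nz (w i l))
                ≡⟨ cong₂ (λ a b → a * (w i j * b)) (nz-id (≢⇒+≢0 (κ-inj j∈ l∈ (λ e → l≢j (sym e))))) (nz-id (w≢0 i∈E l∈ i≢l)) ⟩
              (κ j + κ l) * (w i j * w i l) ≡⟨ κ+κ j∈ l∈ i≢j i≢l ⟩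
              D i j l ≡⟨ nz-id (D≢0 i∈E j∈ l∈ i≢j i≢l (λ e → l≢j (sym e))) ⟨
              nz (D i j l) ≡⟨ trans (cong (_* nz (D i j l)) (*-identityˡ 1#)) (*-identityˡ _) ⟨
              1# * 1# * nz (D i j l) ∎
              where
              i≢l : i ≢ l
              i≢l e = l≢i (sym e)

          -- The denominator of the interpolant in the pencil at `i`. The added 1# stands for the
          -- direction u = 0; the direction v = 0 is already present as `κ i`.
          G : I → F
          G j = ∏nz (1# ∷ map κ A) (κ j +_) * ∏nz (map κ E) (κ j +_)

          G-split : ∀ j → G j ≡ nz (κ j + 1#) * ∏nz A (λ l → κ j + κ l) * ∏nz E (λ l → κ j + κ l)
          G-split j = cong₂ (λ a b → nz (κ j + 1#) * a * b) (Π.fold-map A κ _) (Π.fold-map E κ _)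

          G-diagonal : G i * (weight A * weight E) ≡ ∏nz A (v i) * ∏nz E (v i)
          G-diagonal = begin
            G i * (weight A * weight E) ≡⟨ cong (_* (weight A * weight E)) (G-split i) ⟩
            nz (κ i + 1#) * a * e * (weight A * weight E)
              ≡⟨ cong (λ z → z * a * e * (weight A * weight E)) (trans (cong nz (trans (cong (_+ 1#) κ-self) (+-identityˡ 1#))) (nz-id 1≢0)) ⟩
            1# * a * e * (weight A * weight E)
              ≡⟨ solve 4 (λ a e b f → con true :* a :* e :* (b :* f) := (a :* b) :* (e :* f)) refl a e (weight A) (weight E) ⟩
            a * weight A * (e * weight E) ≡⟨ cong₂ _*_ (diagonal A (λ p → p)) (diagonal E E⊆A) ⟩
            ∏nz A (v i) * ∏nz E (v i) ∎
            where
            open ≡-Reasoning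
            open Solver
            a e : F
            a = ∏nz A (λ l → κ i + κ l)
            e = ∏nz E (λ l → κ i + κ l)

          -- Clearing denominators brings in w i j to the power |E| + |A| = q + 1, which is the
          -- square of w i j by `fermat`. One more factor w i j turns κ j + 1 into u i j. What is
          -- left is symmetric in `i` and `j`.
          G-offDiagonal : ∀ {j} → j ∈ E → i ≢ j →
            G j * (weight A * weight E) ≡ u i j * (v i j * v i j) * w i j * (∏nz A (D i j) * ∏nz E (D i j))
          G-offDiagonal {j} j∈E i≢j = *-cancelˡ (*≢0 wj (*≢0 wj wj)) (begin
            ω * (ω * ω) * (G j * (weight A * weight E)) ≡⟨ cong (λ z → ω * (ω * ω) * (z * (weight A * weight E))) (G-split j) ⟩
            ω * (ω * ω) * (nz (κ j + 1#) * a * e * (weight A * weight E))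
              ≡⟨ cong (λ z → z * (nz (κ j + 1#) * a * e * (weight A * weight E))) power ⟨
            ω * (ω ^ length E * ω ^ length A) * (nz (κ j + 1#) * a * e * (weight A * weight E))
              ≡⟨ solve 8 (λ ω n m c a e b f → ω :* (n :* m) :* (c :* a :* e :* (b :* f)) := (c :* ω) :* (a :* (m :* b)) :* (e :* (n :* f)))
                   refl ω (ω ^ length E) (ω ^ length A) (nz (κ j + 1#)) a e (weight A) (weight E) ⟩
            nz (κ j + 1#) * ω * (a * (ω ^ length A * weight A)) * (e * (ω ^ length E * weight E))
              ≡⟨ cong₂ _*_ (cong₂ _*_ (trans (cong (_* ω) (nz-id (κ+1≢0 j∈A))) (κ+1 j∈A i≢j))
                   (offDiagonal A j∈A i≢j uA (E⊆A i∈E) j∈A (λ p → p)))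
                   (offDiagonal E j∈A i≢j uE i∈E j∈E E⊆A) ⟩
            u i j * (v i j * (ω * ω) * ∏nz A (D i j)) * (v i j * (ω * ω) * ∏nz E (D i j))
              ≡⟨ solve 5 (λ u v ω d d′ → u :* (v :* (ω :* ω) :* d) :* (v :* (ω :* ω) :* d′) := ω :* (ω :* ω) :* (u :* (v :* v) :* ω :* (d :* d′)))
                   refl (u i j) (v i j) ω _ _ ⟩
            ω * (ω * ω) * (u i j * (v i j * v i j) * w i j * (∏nz A (D i j) * ∏nz E (D i j))) ∎)
            where
            open ≡-Reasoning
            open Solver
            ω a e : F
            ω = w i j
            a = ∏nz A (λ l → κ j + κ l)
            e = ∏nz E (λ l → κ j + κ l)
            j∈A = E⊆A j∈E
            wj : ω ≢ 0#
            wj = w≢0 i∈E j∈A i≢j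
            power : ω * (ω ^ length E * ω ^ length A) ≡ ω * (ω * ω)
            power = cong (ω *_) (trans (sym (^-+ ω (length E) (length A))) (trans (cong (ω ^_) len) (cong (ω *_) (fermat wj))))

          vanishing : Σ.fold E (λ j → inv (G j)) ≡ 0#
          vanishing = trans (sym (Σ.fold-map E κ _)) (interpolant-vanishes
            (ones A (λ p → p) ∷ Unique-map κ uA κ-inj) (Unique-map κ uE (λ p r → κ-inj (E⊆A p) (E⊆A r)))
            (λ p → let l , l∈ , e = ∈-map⁻ κ p in there (subst (_∈ map κ A) (sym e) (∈-map⁺ κ (E⊆A l∈))))
            (trans (cong₂ ℕ._+_ (length-map κ E) (cong suc (length-map κ A))) (trans (ℕ.+-suc (length E) _) (cong suc len))))
            where
            ones : ∀ X → (∀ {l} → l ∈ X → l ∈ A) → All (1# ≢_) (map κ X)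
            ones []      h = []
            ones (l ∷ X) h = (λ e → κ+1≢0 (h (here refl)) (trans (cong (_+ 1#) (sym e)) (x+x≡0 1#))) ∷ ones X (λ p → h (there p))

        H : I → I → F
        H i j with i ≟ᴵ j
        ... | yes _ = ∏nz A (v i) * ∏nz E (v i)
        ... | no _  = u i j * (v i j * v i j) * w i j * (∏nz A (D i j) * ∏nz E (D i j))

        H-sym : ∀ i j → H i j ≡ H j i
        H-sym i j with i ≟ᴵ j | j ≟ᴵ i
        ... | yes refl | yes _ = refl
        ... | yes refl | no h  = ⊥-elim (h refl)
        ... | no h  | yes refl = ⊥-elim (h refl)
        ... | no _  | no _ = cong₂ _*_
          (solve 4 (λ x x′ y y′ → (x :+ x′) :* ((y :+ y′) :* (y :+ y′)) :* ((x :+ x′) :+ (y :+ y′)) :=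
                                  (x′ :+ x) :* ((y′ :+ y) :* (y′ :+ y)) :* ((x′ :+ x) :+ (y′ :+ y))) refl (x i) (x j) (y i) (y j))
          (cong₂ _*_ (Π.fold-cong A (λ {l} _ → cong nz (D-sym l))) (Π.fold-cong E (λ {l} _ → cong nz (D-sym l))))
          where
          open Solver
          D-sym : ∀ l → D i j l ≡ D j i l
          D-sym l = solve 6 (λ x x′ x″ y y′ y″ →
            (y :+ y′) :* ((x :+ x″) :+ (y :+ y″)) :+ (y :+ y″) :* ((x :+ x′) :+ (y :+ y′)) :=
            (y′ :+ y) :* ((x′ :+ x″) :+ (y′ :+ y″)) :+ (y′ :+ y″) :* ((x′ :+ x) :+ (y′ :+ y)))
            refl (x i) (x j) (x l) (y i) (y j) (y l)

        H-diagonal : ∀ i → H i i ≡ ∏nz A (v i) * ∏nz E (v i)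
        H-diagonal i with i ≟ᴵ i
        ... | yes _ = refl
        ... | no h  = ⊥-elim (h refl)

        G-H : ∀ {i j} (i∈E : i ∈ E) → j ∈ E → Pencil.G i∈E j * (Pencil.weight i∈E A * Pencil.weight i∈E E) ≡ H i j
        G-H {i} {j} i∈E j∈E with i ≟ᴵ j
        ... | yes refl = Pencil.G-diagonal i∈E
        ... | no i≢j   = Pencil.G-offDiagonal i∈E j∈E i≢j

        row : ∀ {i} → i ∈ E → Σ.fold E (λ j → inv (H i j)) ≡ 0#
        row {i} i∈E = begin
          Σ.fold E (λ j → inv (H i j)) ≡⟨ Σ.fold-cong E (λ {j} p → trans (cong inv (sym (G-H i∈E p))) (trans (inv-* (G j) W) (*-comm _ _))) ⟩
          Σ.fold E (λ j → inv W * inv (G j)) ≡⟨ Σ-*ˡ E (inv W) _ ⟩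
          inv W * Σ.fold E (λ j → inv (G j)) ≡⟨ cong (inv W *_) vanishing ⟩
          inv W * 0# ≡⟨ zeroʳ _ ⟩
          0# ∎
          where
          open ≡-Reasoning
          open Pencil i∈E
          W : F
          W = weight A * weight E

        contradiction : ⊥
        contradiction = interpolant-leading (Unique-map y uA yy) (Unique-map y uE (λ p r → yy (E⊆A p) (E⊆A r)))
          (λ p → let l , l∈ , e = ∈-map⁻ y p in subst (_∈ map y A) (sym e) (∈-map⁺ y (E⊆A l∈)))
          (trans (cong₂ ℕ._+_ (length-map y E) (length-map y A)) len) (begin
            interpolant (map y A) (map y E) ≡⟨ Σ.fold-map E y _ ⟩
            Σ.fold E (λ i → inv (∏nz (map y A) (y i +_) * ∏nz (map y E) (y i +_)))
              ≡⟨ Σ.fold-cong E (λ {i} _ → cong₂ (λ a b → inv (a * b)) (Π.fold-map A y _) (Π.fold-map E y _)) ⟩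
            Σ.fold E (λ i → inv (∏nz A (v i) * ∏nz E (v i))) ≡⟨ Σ.fold-cong E (λ {i} _ → cong inv (H-diagonal i)) ⟨
            Σ.fold E (λ i → inv (H i i)) ≡⟨ Σ-symmetric E (λ i j → inv (H i j)) (λ {i} {j} _ _ → cong inv (H-sym i j)) ⟨
            Σ.fold E (λ i → Σ.fold E (λ j → inv (H i j))) ≡⟨ Σ.fold-cong E row ⟩
            Σ.fold E (λ _ → 0#) ≡⟨ Σ.fold-ε E ⟩
            0# ∎)
          where
          open ≡-Reasoning
          yy : ∀ {i j} → i ∈ A → j ∈ A → i ≢ j → y i ≢ y j
          yy {i} {j} p r i≢j e = v≢0 p r i≢j (trans (cong (_+ y j) e) (x+x≡0 _))

    module _ {I : Set} (_≟ᴵ_ : DecidableEquality I) (x y : I → F) (A E : List I)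
      (uA : Unique A) (uE : Unique E) (E⊆A : ∀ {i} → i ∈ E → i ∈ A) where
      open AffineArc _≟ᴵ_ x y A E uA uE E⊆A using (u; v; w; D)

      length-tangents :
        (∀ {i j} → i ∈ A → j ∈ A → i ≢ j → u i j ≢ 0#) →
        (∀ {i j} → i ∈ A → j ∈ A → i ≢ j → v i j ≢ 0#) →
        (∀ {i j} → i ∈ E → j ∈ A → i ≢ j → w i j ≢ 0#) →
        (∀ {i j l} → i ∈ E → j ∈ A → l ∈ A → i ≢ j → i ≢ l → j ≢ l → D i j l ≢ 0#) →
        length E ℕ.+ length A ℕ.≤ q
      length-tangents u≢0 v≢0 w≢0 D≢0 with length E ℕ.+ length A ℕ.≤? q
      ... | yes h = h
      -- `E` is cut down until the total is exactly q + 1; the conditions on `E` pass to sublists.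
      ... | no ≰  = ⊥-elim (AffineArc.contradiction _≟ᴵ_ x y A (take n E) uA (Unique-take n uE) (λ p → E⊆A (∈-take n p))
          u≢0 v≢0 (λ p → w≢0 (∈-take n p)) (λ p → D≢0 (∈-take n p))
          (trans (cong (ℕ._+ length A) (trans (length-take n E) (ℕ.m≤n⇒m⊓n≡m n≤))) (ℕ.m∸n+n≡m A≤)))
        where
        n : ℕ
        n = 1 ℕ.+ q ℕ.∸ length A
        -- The coordinate `x` is injective on `A`, so `A` has at most q points and the truncated
        -- subtraction in `n` is exact.
        A≤ : length A ℕ.≤ 1 ℕ.+ q
        A≤ = ℕ.m≤n⇒m≤1+n (subst (ℕ._≤ q) (length-map x A) (ℕ.m+n≤o⇒m≤o _ (ℕ.≤-reflexive (sym (length-complement ux)))))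
          where
          ux : Unique (map x A)
          ux = Unique-map x uA (λ {i} {j} p r i≢j e → u≢0 p r i≢j (trans (cong (_+ x j) e) (x+x≡0 _)))
        n≤ : n ℕ.≤ length E
        n≤ = ℕ.≤-trans (ℕ.∸-monoˡ-≤ (length A) (ℕ.≰⇒> ≰)) (ℕ.≤-reflexive (ℕ.m+n∸n≡m (length E) (length A)))
        ∈-take : ∀ n {xs : List I} {i} → i ∈ take n xs → i ∈ xs
        ∈-take (suc n) {x ∷ xs} (here e)  = here e
        ∈-take (suc n) {x ∷ xs} (there p) = there (∈-take n p)
        Unique-take : ∀ n {xs : List I} → Unique xs → Unique (take n xs)
        Unique-take n = AllPairs.take⁺ n

open PlanarArcs

module CapGeometry where
  open import Data.Bool using (true; false)
  open import Data.Empty using (⊥; ⊥-elim)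
  open import Data.Fin using (Fin)
  import Data.Fin.Properties as Fin
  open import Data.List using (List; []; _∷_; allFin; filter; length)
  open import Data.List.Properties using (length-tabulate)
  open import Data.List.Membership.Propositional using (_∈_; _∉_)
  open import Data.List.Membership.Propositional.Properties using (∈-filter⁻)
  import Data.List.Membership.DecPropositional as DecMembership
  open import Data.List.Relation.Unary.Any using (here; there)
  open import Data.List.Relation.Unary.Unique.Propositional using (Unique)
  import Data.List.Relation.Unary.Unique.Propositional.Properties as Unique
  open import Data.Nat as ℕ using (ℕ; zero; suc; _+_; _*_; _∸_; _^_; _≤_; _<_; s≤s; z≤n)
  open import Data.Nat.Divisibility using (_∣_; ∣m+n∣m⇒∣n; ∣⇒≤; m∣m*n)
  import Data.Nat.Properties as ℕ
  open import Data.Nat.Solver using (module +-*-Solver)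
  open +-*-Solver using () renaming (solve to solveℕ; _:+_ to _:+:_; _:*_ to _:*:_; _:=_ to _:=:_; con to κ)
  open import Data.Product using (∃; _×_; _,_; proj₁; proj₂)
  open import Data.Sum using (_⊎_; inj₁; inj₂)
  open import Data.Unit using (⊤; tt)
  open import Data.Vec using (Vec; []; _∷_; map; replicate)
  import Data.Vec.Properties as Vec
  open import Data.Vec.Relation.Unary.All using (All; []; _∷_)
  open import Relation.Binary.PropositionalEquality hiding (J)
  open import Relation.Nullary using (¬_; Dec; yes; no)
  open import Relation.Nullary.Decidable using (¬?; _×-dec_; _→-dec_; True; toWitness; decidable-stable)

  -- Linear algebra over a finite field, with dimensions obtained by counting.

  module LinearAlgebra (K : BinaryField) where
    open BinaryField K renaming (_+_ to _⊹_; _*_ to _·_)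
    open Finite finite using (elems)

    private variable
      d m m′ : ℕ

    infixl 6 _⊕_
    infixr 8 _•_

    𝟎 : Vec F d
    𝟎 = replicate _ 0#

    _⊕_ : Vec F d → Vec F d → Vec F d
    []      ⊕ []      = []
    (x ∷ u) ⊕ (y ∷ v) = (x ⊹ y) ∷ (u ⊕ v)

    _•_ : F → Vec F d → Vec F d
    a • []      = []
    a • (x ∷ u) = (a · x) ∷ (a • u)

    ⊕-comm : (u v : Vec F d) → u ⊕ v ≡ v ⊕ u
    ⊕-comm []      []      = refl
    ⊕-comm (x ∷ u) (y ∷ v) = cong₂ _∷_ (+-comm x y) (⊕-comm u v)

    ⊕-assoc : (u v w : Vec F d) → (u ⊕ v) ⊕ w ≡ u ⊕ (v ⊕ w)
    ⊕-assoc []      []      []      = refl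
    ⊕-assoc (x ∷ u) (y ∷ v) (z ∷ w) = cong₂ _∷_ (+-assoc x y z) (⊕-assoc u v w)

    ⊕-identityˡ : (u : Vec F d) → 𝟎 ⊕ u ≡ u
    ⊕-identityˡ []      = refl
    ⊕-identityˡ (x ∷ u) = cong₂ _∷_ (+-identityˡ x) (⊕-identityˡ u)

    ⊕-identityʳ : (u : Vec F d) → u ⊕ 𝟎 ≡ u
    ⊕-identityʳ u = trans (⊕-comm u 𝟎) (⊕-identityˡ u)

    ⊕-self : (u : Vec F d) → u ⊕ u ≡ 𝟎
    ⊕-self []      = refl
    ⊕-self (x ∷ u) = cong₂ _∷_ (x+x≡0 x) (⊕-self u)

    •-distribˡ : ∀ a (u v : Vec F d) → a • (u ⊕ v) ≡ a • u ⊕ a • v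
    •-distribˡ a []      []      = refl
    •-distribˡ a (x ∷ u) (y ∷ v) = cong₂ _∷_ (distribˡ a x y) (•-distribˡ a u v)

    •-distribʳ : ∀ a b (u : Vec F d) → (a ⊹ b) • u ≡ a • u ⊕ b • u
    •-distribʳ a b []      = refl
    •-distribʳ a b (x ∷ u) = cong₂ _∷_ (distribʳ x a b) (•-distribʳ a b u)

    •-assoc : ∀ a b (u : Vec F d) → a • (b • u) ≡ (a · b) • u
    •-assoc a b []      = refl
    •-assoc a b (x ∷ u) = cong₂ _∷_ (sym (*-assoc a b x)) (•-assoc a b u)

    1• : (u : Vec F d) → 1# • u ≡ u
    1• []      = refl
    1• (x ∷ u) = cong₂ _∷_ (*-identityˡ x) (1• u)

    0• : (u : Vec F d) → 0# • u ≡ 𝟎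
    0• []      = refl
    0• (x ∷ u) = cong₂ _∷_ (zeroˡ x) (0• u)

    •-𝟎 : ∀ a → a • 𝟎 {d} ≡ 𝟎
    •-𝟎 {zero}  a = refl
    •-𝟎 {suc d} a = cong₂ _∷_ (zeroʳ a) (•-𝟎 a)

    ⊕≡𝟎⇒≡ : {u v : Vec F d} → u ⊕ v ≡ 𝟎 → u ≡ v
    ⊕≡𝟎⇒≡ {u = u} {v} h = begin
      u           ≡⟨ ⊕-identityʳ u ⟨
      u ⊕ 𝟎       ≡⟨ cong (u ⊕_) (⊕-self v) ⟨
      u ⊕ (v ⊕ v) ≡⟨ ⊕-assoc u v v ⟨
      u ⊕ v ⊕ v   ≡⟨ cong (_⊕ v) h ⟩
      𝟎 ⊕ v       ≡⟨ ⊕-identityˡ v ⟩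
      v           ∎
      where open ≡-Reasoning

    inv-• : ∀ {a} (u : Vec F d) → a ≢ 0# → inv a • (a • u) ≡ u
    inv-• {a = a} u a≢0 = trans (•-assoc (inv a) a u)
      (trans (cong (_• u) (trans (*-comm (inv a) a) (*-inv a a≢0))) (1• u))

    •≡⇒ : ∀ {a} {u v : Vec F d} → a ≢ 0# → a • u ≡ v → u ≡ inv a • v
    •≡⇒ {a = a} {u} a≢0 h = trans (sym (inv-• u a≢0)) (cong (inv a •_) h)

    -- Sealed so that the arguments of dot can be inferred.
    abstract
      dot : Vec F d → Vec F d → F
      dot []      []      = 0#
      dot (x ∷ u) (y ∷ v) = x · y ⊹ dot u v

      dot-[] : dot [] [] ≡ 0#
      dot-[] = refl

      dot-∷ : ∀ x y (u v : Vec F d) → dot (x ∷ u) (y ∷ v) ≡ x · y ⊹ dot u v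
      dot-∷ x y u v = refl

      dot-comm : (u v : Vec F d) → dot u v ≡ dot v u
      dot-comm []      []      = refl
      dot-comm (x ∷ u) (y ∷ v) = cong₂ _⊹_ (*-comm x y) (dot-comm u v)

      dot-⊕ : (a u v : Vec F d) → dot a (u ⊕ v) ≡ dot a u ⊹ dot a v
      dot-⊕ []      []      []      = sym (+-identityˡ 0#)
      dot-⊕ (z ∷ a) (x ∷ u) (y ∷ v) = trans (cong (z · (x ⊹ y) ⊹_) (dot-⊕ a u v))
        (solve 5 (λ z x y p r → z :* (x :+ y) :+ (p :+ r) := (z :* x :+ p) :+ (z :* y :+ r)) refl z x y _ _)
        where open Solver

      dot-• : ∀ c (a u : Vec F d) → dot a (c • u) ≡ c · dot a u
      dot-• c []      []      = sym (zeroʳ c)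
      dot-• c (z ∷ a) (x ∷ u) = trans (cong (z · (c · x) ⊹_) (dot-• c a u))
        (solve 4 (λ z c x p → z :* (c :* x) :+ c :* p := c :* (z :* x :+ p)) refl z c x _)
        where open Solver

      dot-𝟎 : (a : Vec F d) → dot a 𝟎 ≡ 0#
      dot-𝟎 []      = refl
      dot-𝟎 (x ∷ a) = trans (cong₂ _⊹_ (zeroʳ x) (dot-𝟎 a)) (+-identityˡ 0#)

    dot-𝟎ˡ : (a : Vec F d) → dot 𝟎 a ≡ 0#
    dot-𝟎ˡ a = trans (dot-comm 𝟎 a) (dot-𝟎 a)

    comb : Vec F m → Vec (Vec F d) m → Vec F d
    comb []       []       = 𝟎
    comb (c ∷ cs) (u ∷ us) = c • u ⊕ comb cs us

    dots : Vec (Vec F d) m → Vec F d → Vec F m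
    dots us a = map (dot a) us

    dot-comb : (a : Vec F d) (c : Vec F m) (us : Vec (Vec F d) m) → dot a (comb c us) ≡ dot c (dots us a)
    dot-comb a []       []       = trans (dot-𝟎 a) (sym dot-[])
    dot-comb a (c ∷ cs) (u ∷ us) = trans (dot-⊕ a (c • u) _)
      (trans (cong₂ _⊹_ (dot-• c a u) (dot-comb a cs us)) (sym (dot-∷ c _ cs _)))

    comb-• : ∀ a (c : Vec F m) (us : Vec (Vec F d) m) → comb (a • c) us ≡ a • comb c us
    comb-• a []       []       = sym (•-𝟎 a)
    comb-• a (c ∷ cs) (u ∷ us) = trans (cong₂ _⊕_ (sym (•-assoc a c u)) (comb-• a cs us)) (sym (•-distribˡ a _ _))

    comb-⊕ : (b c : Vec F m) (us : Vec (Vec F d) m) → comb (b ⊕ c) us ≡ comb b us ⊕ comb c us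
    comb-⊕ []       []       []       = sym (⊕-identityˡ 𝟎)
    comb-⊕ (b ∷ bs) (c ∷ cs) (u ∷ us) = trans (cong₂ _⊕_ (•-distribʳ b c u) (comb-⊕ bs cs us)) (go _ _ _ _)
      where
      go : (a b c e : Vec F d) → (a ⊕ b) ⊕ (c ⊕ e) ≡ (a ⊕ c) ⊕ (b ⊕ e)
      go []      []      []      []      = refl
      go (x ∷ a) (y ∷ b) (z ∷ c) (t ∷ e) = cong₂ _∷_
        (solve 4 (λ x y z t → (x :+ y) :+ (z :+ t) := (x :+ z) :+ (y :+ t)) refl x y z t) (go a b c e)
        where open Solver

    comb-𝟎 : (us : Vec (Vec F d) m) → comb 𝟎 us ≡ 𝟎
    comb-𝟎 []       = refl
    comb-𝟎 (u ∷ us) = trans (cong₂ _⊕_ (0• u) (comb-𝟎 us)) (⊕-identityˡ 𝟎)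

    Ind : Vec (Vec F d) m → Set
    Ind us = ∀ c → comb c us ≡ 𝟎 → c ≡ 𝟎

    Span : Vec (Vec F d) m → Vec F d → Set
    Span us v = ∃ λ c → v ≡ comb c us

    -- Sealed so that sums over vectors are never unfolded during unification.
    abstract
      finV : ∀ m → Finite (Vec F m)
      finV = vecFinite finite

      size-finV : ∀ m → Finite.size (finV m) ≡ q ^ m
      size-finV = size-vec finite

      S-∷ : ∀ m (f : Vec F (suc m) → ℕ) → Finite.S (finV (suc m)) f ≡ ∑ elems (λ x → Finite.S (finV m) (λ v → f (x ∷ v)))
      S-∷ = S-vec finite

    module V {m : ℕ} where
      open Finite (finV m) public

    SV : (Vec F m → ℕ) → ℕ
    SV {m} = Finite.S (finV m)

    abstract
      span? : (us : Vec (Vec F d) m) (v : Vec F d) → Dec (Span us v)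
      span? us v = V.search (λ c → v V.≟ comb c us)

    Ind⇒inj : {us : Vec (Vec F d) m} → Ind us → ∀ {b c} → comb b us ≡ comb c us → b ≡ c
    Ind⇒inj {us = us} ind {b} {c} e = ⊕≡𝟎⇒≡ (ind (b ⊕ c)
      (trans (comb-⊕ b c us) (trans (cong (_⊕ comb c us) e) (⊕-self _))))

    Ind-tail : {u : Vec F d} {us : Vec (Vec F d) m} → Ind (u ∷ us) → Ind us
    Ind-tail {u = u} {us} ind c h = Vec.∷-injectiveʳ
      (ind (0# ∷ c) (trans (cong₂ _⊕_ (0• u) h) (⊕-identityˡ 𝟎)))

    Ind-∷ : {v : Vec F d} {us : Vec (Vec F d) m} → Ind us → ¬ Span us v → Ind (v ∷ us)
    Ind-∷ {v = v} {us} ind v∉ (c ∷ cs) h with c ≟ 0#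
    ... | yes refl = cong (0# ∷_) (ind cs (trans (sym (⊕-identityˡ _)) (trans (cong (_⊕ comb cs us) (sym (0• v))) h)))
    ... | no c≢0   = ⊥-elim (v∉ (inv c • cs , trans (•≡⇒ c≢0 (⊕≡𝟎⇒≡ h)) (sym (comb-• (inv c) cs us))))

    Ind⇒∉Span : {v : Vec F d} {us : Vec (Vec F d) m} → Ind (v ∷ us) → ¬ Span us v
    Ind⇒∉Span {v = v} {us} ind (c , e) = 1≢0 (Vec.∷-injectiveˡ
      (ind (1# ∷ c) (trans (cong₂ _⊕_ (1• v) (sym e)) (⊕-self v))))

    Ind-swap : {u v : Vec F d} {us : Vec (Vec F d) m} → Ind (u ∷ v ∷ us) → Ind (v ∷ u ∷ us)
    Ind-swap {u = u} {v} {us} ind (c ∷ c′ ∷ cs) h =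
      let e = ind (c′ ∷ c ∷ cs) (trans (go (c′ • u) (c • v) (comb cs us)) h)
      in cong₂ _∷_ (Vec.∷-injectiveˡ (Vec.∷-injectiveʳ e))
           (cong₂ _∷_ (Vec.∷-injectiveˡ e) (Vec.∷-injectiveʳ (Vec.∷-injectiveʳ e)))
      where
      go : (a b c : Vec F d) → a ⊕ (b ⊕ c) ≡ b ⊕ (a ⊕ c)
      go a b c = trans (sym (⊕-assoc a b c)) (trans (cong (_⊕ c) (⊕-comm a b)) (⊕-assoc b a c))

    Ind-swap₂ : {t u v : Vec F d} {us : Vec (Vec F d) m} → Ind (t ∷ u ∷ v ∷ us) → Ind (t ∷ v ∷ u ∷ us)
    Ind-swap₂ ind (b ∷ c ∷ c′ ∷ cs) h =
      let e = ind (b ∷ c′ ∷ c ∷ cs) (trans (cong (b • _ ⊕_) (go (c′ • _) (c • _) (comb cs _))) h)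
          e′ = Vec.∷-injectiveʳ e
      in cong₂ _∷_ (Vec.∷-injectiveˡ e) (cong₂ _∷_ (Vec.∷-injectiveˡ (Vec.∷-injectiveʳ e′))
           (cong₂ _∷_ (Vec.∷-injectiveˡ e′) (Vec.∷-injectiveʳ (Vec.∷-injectiveʳ e′))))
      where
      go : (a b c : Vec F d) → a ⊕ (b ⊕ c) ≡ b ⊕ (a ⊕ c)
      go a b c = trans (sym (⊕-assoc a b c)) (trans (cong (_⊕ c) (⊕-comm a b)) (⊕-assoc b a c))

    Ind-nonzero : {v : Vec F d} → v ≢ 𝟎 → Ind (v ∷ [])
    Ind-nonzero v≢𝟎 = Ind-∷ {us = []} (λ { [] _ → refl }) (λ { ([] , e) → v≢𝟎 e })

    Ind-head≢𝟎 : {v : Vec F d} {us : Vec (Vec F d) m} → Ind (v ∷ us) → v ≢ 𝟎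
    Ind-head≢𝟎 {us = us} ind e = Ind⇒∉Span ind (𝟎 , trans e (sym (comb-𝟎 us)))

    -- The number of nonzero vectors on a point, and of covectors that define the same plane.
    p : ℕ
    p = ℕ.pred q

    q≡1+p : q ≡ suc p
    q≡1+p = sym (ℕ.suc-pred q ⦃ ℕ.>-nonZero (ℕ.≤-trans (Finite.term finite (λ _ → 1) 0#) (ℕ.≤-reflexive (∑-1 elems))) ⦄)

    2≤q : 2 ≤ q
    2≤q = ℕ.≤-trans (ℕ.≤-reflexive (sym (cong₂ _+_ (Finite.once finite 0#) (Finite.once finite 1#))))
      (ℕ.≤-trans (ℕ.≤-reflexive (sym (∑-+ elems _ _))) (ℕ.≤-trans (∑-mono elems excl) (ℕ.≤-reflexive (∑-1 elems))))
      where
      excl : ∀ x → 𝟙 (x ≟ 0#) + 𝟙 (x ≟ 1#) ≤ 1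
      excl x with x ≟ 0# | x ≟ 1#
      ... | yes refl | yes e = ⊥-elim (1≢0 (sym e))
      ... | yes _ | no _  = s≤s z≤n
      ... | no _  | yes _ = s≤s z≤n
      ... | no _  | no _  = z≤n

    p≢0 : p ≢ 0
    p≢0 e = ℕ.1+n≰n (ℕ.≤-trans 2≤q (ℕ.≤-reflexive (trans q≡1+p (cong suc e))))

    -- If the first entry of `a` is nonzero, the first entry of `c` is determined by the others; if
    -- it is zero, the first entry of `c` is free and the rest is a smaller instance.
    kernel-≢𝟎 : (a : Vec F m) → a ≢ 𝟎 → q * SV (λ c → 𝟙 (dot c a ≟ 0#)) ≡ q ^ m
    kernel-≢𝟎 []      a≢𝟎 = ⊥-elim (a≢𝟎 refl)
    kernel-≢𝟎 {suc m} (x ∷ a) a≢𝟎 with x ≟ 0#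
    ... | yes refl = cong (q *_) (begin
      SV (λ c → 𝟙 (dot c (0# ∷ a) ≟ 0#)) ≡⟨ S-∷ m _ ⟩
      ∑ elems (λ c → SV (λ cs → 𝟙 (dot (c ∷ cs) (0# ∷ a) ≟ 0#)))
        ≡⟨ ∑-cong elems (λ c → ∑-cong V.elems (λ cs → cong (λ z → 𝟙 (z ≟ 0#))
             (trans (dot-∷ c 0# cs a) (trans (cong (_⊹ dot cs a) (zeroʳ c)) (+-identityˡ _))))) ⟩
      ∑ elems (λ c → SV (λ cs → 𝟙 (dot cs a ≟ 0#))) ≡⟨ ∑-const elems _ ⟩
      q * SV (λ cs → 𝟙 (dot cs a ≟ 0#)) ≡⟨ kernel-≢𝟎 a (λ e → a≢𝟎 (cong (0# ∷_) e)) ⟩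
      q ^ m ∎)
      where open ≡-Reasoning
    ... | no x≢0 = cong (q *_) (begin
      SV (λ c → 𝟙 (dot c (x ∷ a) ≟ 0#)) ≡⟨ S-∷ m _ ⟩
      ∑ elems (λ c → SV (λ cs → 𝟙 (dot (c ∷ cs) (x ∷ a) ≟ 0#)))
        ≡⟨ ∑-cong elems (λ c → ∑-cong V.elems (λ cs → cong (λ z → 𝟙 (z ≟ 0#)) (dot-∷ c x cs a))) ⟩
      ∑ elems (λ c → SV (λ cs → 𝟙 (c · x ⊹ dot cs a ≟ 0#))) ≡⟨ ∑-swap elems (V.elems {m}) _ ⟩
      SV (λ cs → ∑ elems (λ c → 𝟙 (c · x ⊹ dot cs a ≟ 0#))) ≡⟨ ∑-cong V.elems (λ cs → one (dot cs a)) ⟩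
      SV (λ (cs : Vec F m) → 1) ≡⟨ trans (∑-1 (V.elems {m})) (size-finV m) ⟩
      q ^ m ∎)
      where
      open ≡-Reasoning
      one : ∀ y → ∑ elems (λ c → 𝟙 (c · x ⊹ y ≟ 0#)) ≡ 1
      one y = Finite.S-unique finite (λ c → c · x ⊹ y ≟ 0#)
        (y · inv x , trans (cong (_⊹ y) (trans (*-assoc _ _ _) (trans (cong (y ·_) (trans (*-comm _ _) (*-inv x x≢0))) (*-identityʳ y)))) (x+x≡0 y))
        (λ c c′ h h′ → *-cancelˡ x≢0 (trans (*-comm x c) (trans (trans (+≡0⇒≡ h) (sym (+≡0⇒≡ h′))) (*-comm c′ x))))

    -- The factor q on the left avoids the exponent m - 1, and the indicator merges the zero vector
    -- with the others, so that the formula can be summed over all `a`.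
    kernel-size : (a : Vec F m) → q * SV (λ c → 𝟙 (dot c a ≟ 0#)) ≡ q ^ m * (1 + p * 𝟙 (a V.≟ 𝟎))
    kernel-size {m} a with a V.≟ 𝟎
    ... | yes refl = begin
      q * SV (λ c → 𝟙 (dot c (𝟎 {m}) ≟ 0#)) ≡⟨ cong (q *_) (trans (∑-cong (V.elems {m}) (λ c → 𝟙-yes (dot c 𝟎 ≟ 0#) (dot-𝟎 c)))
        (trans (∑-1 (V.elems {m})) (size-finV m))) ⟩
      q * q ^ m             ≡⟨ ℕ.*-comm q _ ⟩
      q ^ m * q             ≡⟨ cong (q ^ m *_) (trans q≡1+p (cong suc (sym (ℕ.*-identityʳ p)))) ⟩
      q ^ m * suc (p * 1) ∎
      where open ≡-Reasoning
    ... | no a≢𝟎 = trans (kernel-≢𝟎 a a≢𝟎) (trans (sym (ℕ.*-identityʳ _)) (cong (λ z → q ^ m * suc z) (sym (ℕ.*-zeroʳ p))))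

    q≢0 : ℕ.NonZero q
    q≢0 = ℕ.>-nonZero (ℕ.≤-trans (s≤s z≤n) 2≤q)

    ann? : (us : Vec (Vec F d) m) (a : Vec F d) → Dec (dots us a ≡ 𝟎)
    ann? us a = dots us a V.≟ 𝟎

    annSize relSize : Vec (Vec F d) m → ℕ
    annSize us = SV (λ a → 𝟙 (ann? us a))
    relSize us = SV (λ c → 𝟙 (comb c us V.≟ 𝟎))

    -- Count the pairs (c , a) with a · (Σ cᵢ uᵢ) = 0 in both orders.
    annSize-relSize : (us : Vec (Vec F d) m) → q ^ m * annSize us ≡ q ^ d * relSize us
    annSize-relSize {d} {m} us = ℕ.*-cancelˡ-≡ _ _ p ⦃ ℕ.≢-nonZero p≢0 ⦄ (ℕ.+-cancelˡ-≡ (q ^ m * q ^ d) _ _ (begin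
      q ^ m * q ^ d + p * (q ^ m * annSize us) ≡⟨ arith (q ^ m) (q ^ d) p (annSize us) ⟩
      q ^ m * (q ^ d + p * annSize us) ≡⟨ total (q ^ m) (λ a → ann? us a) ⟨
      SV (λ a → q ^ m * (1 + p * 𝟙 (ann? us a))) ≡⟨ ∑-cong V.elems (λ a → kernel-size (dots us a)) ⟨
      SV (λ a → q * SV (λ c → 𝟙 (dot c (dots us a) ≟ 0#))) ≡⟨ ∑-*ˡ (V.elems {d}) q _ ⟩
      q * SV (λ a → SV (λ c → 𝟙 (dot c (dots us a) ≟ 0#)))
        ≡⟨ cong (q *_) (∑-cong V.elems (λ a → ∑-cong V.elems (λ c → cong (λ z → 𝟙 (z ≟ 0#)) (sym (dot-comb a c us))))) ⟩
      q * SV (λ a → SV (λ c → 𝟙 (dot a (comb c us) ≟ 0#))) ≡⟨ cong (q *_) (∑-swap (V.elems {d}) (V.elems {m}) _) ⟩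
      q * SV (λ c → SV (λ a → 𝟙 (dot a (comb c us) ≟ 0#))) ≡⟨ ∑-*ˡ (V.elems {m}) q _ ⟨
      SV (λ c → q * SV (λ a → 𝟙 (dot a (comb c us) ≟ 0#))) ≡⟨ ∑-cong V.elems (λ c → kernel-size (comb c us)) ⟩
      SV (λ c → q ^ d * (1 + p * 𝟙 (comb c us V.≟ 𝟎))) ≡⟨ total (q ^ d) (λ c → comb c us V.≟ 𝟎) ⟩
      q ^ d * (q ^ m + p * relSize us) ≡⟨ arith′ (q ^ m) (q ^ d) p (relSize us) ⟩
      q ^ m * q ^ d + p * (q ^ d * relSize us) ∎))
      where
      open ≡-Reasoning
      arith : ∀ a b p x → a * b + p * (a * x) ≡ a * (b + p * x)
      arith = solveℕ 4 (λ a b p x → a :*: b :+: p :*: (a :*: x) :=: a :*: (b :+: p :*: x)) refl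
      arith′ : ∀ a b p x → b * (a + p * x) ≡ a * b + p * (b * x)
      arith′ = solveℕ 4 (λ a b p x → b :*: (a :+: p :*: x) :=: a :*: b :+: p :*: (b :*: x)) refl
      total : ∀ {n} c {P : Vec F n → Set} (P? : ∀ a → Dec (P a)) →
        SV (λ a → c * (1 + p * 𝟙 (P? a))) ≡ c * (q ^ n + p * SV (λ a → 𝟙 (P? a)))
      total {n} c P? = trans (∑-*ˡ (V.elems {n}) c _) (cong (c *_) (trans (∑-+ (V.elems {n}) _ _)
        (cong₂ _+_ (trans (∑-1 (V.elems {n})) (size-finV n)) (∑-*ˡ (V.elems {n}) p _))))

    relSize-Ind : {us : Vec (Vec F d) m} → Ind us → relSize us ≡ 1
    relSize-Ind {us = us} ind = V.S-unique (λ c → comb c us V.≟ 𝟎) (𝟎 , comb-𝟎 us)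
      (λ c c′ h h′ → trans (ind c h) (sym (ind c′ h′)))

    annSize-Ind : {us : Vec (Vec F d) m} → Ind us → q ^ m * annSize us ≡ q ^ d
    annSize-Ind {d} {us = us} ind = trans (annSize-relSize us) (trans (cong (q ^ d *_) (relSize-Ind ind)) (ℕ.*-identityʳ _))

    -- The q^m combinations of `us` are distinct and all lie in the annihilator of `ws`, whose size
    -- times q^m′ is q^d.
    perp-dimension : {us : Vec (Vec F d) m} {ws : Vec (Vec F d) m′} → Ind us → Ind ws →
      All (λ u → dots ws u ≡ 𝟎) us → m + m′ ≤ d
    perp-dimension {d} {m} {m′} {us} {ws} ius iws perp with m + m′ ℕ.≤? d
    ... | yes h = h
    ... | no ≰ = ⊥-elim (ℕ.<⇒≱ (ℕ.^-monoʳ-< q 2≤q (ℕ.≰⇒> ≰)) (begin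
      q ^ (m + m′)       ≡⟨ ℕ.^-distribˡ-+-* q m m′ ⟩
      q ^ m * q ^ m′   ≤⟨ ℕ.*-monoˡ-≤ (q ^ m′) size≤ ⟩
      annSize ws * q ^ m′ ≡⟨ ℕ.*-comm _ (q ^ m′) ⟩
      q ^ m′ * annSize ws ≡⟨ annSize-Ind iws ⟩
      q ^ d ∎))
      where
      open ℕ.≤-Reasoning
      ann-comb : ∀ {n} {vs : Vec (Vec F d) n} → All (λ u → dots ws u ≡ 𝟎) vs → ∀ c → dots ws (comb c vs) ≡ 𝟎
      ann-comb [] [] = zeroes ws
        where
        zeroes : ∀ {n} (ws : Vec (Vec F d) n) → dots ws 𝟎 ≡ 𝟎
        zeroes []       = refl
        zeroes (w ∷ ws) = cong₂ _∷_ (dot-𝟎ˡ w) (zeroes ws)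
      ann-comb {vs = v ∷ vs} (h ∷ hs) (c ∷ cs) = step ws h (ann-comb hs cs)
        where
        step : ∀ {n} (ws : Vec (Vec F d) n) → dots ws v ≡ 𝟎 → dots ws (comb cs vs) ≡ 𝟎 → dots ws (c • v ⊕ comb cs vs) ≡ 𝟎
        step []       _ _ = refl
        step (w ∷ ws) h h′ = cong₂ _∷_
          (trans (dot-comm _ w) (trans (dot-⊕ w (c • v) _) (trans (cong₂ _⊹_
            (trans (dot-• c w v) (trans (cong (c ·_) (trans (dot-comm w v) (Vec.∷-injectiveˡ h))) (zeroʳ c)))
            (trans (dot-comm w _) (Vec.∷-injectiveˡ h′))) (+-identityˡ 0#))))
          (step ws (Vec.∷-injectiveʳ h) (Vec.∷-injectiveʳ h′))
      at-most : ∀ a → SV (λ c → 𝟙 (a V.≟ comb c us)) ≤ 𝟙 (ann? ws a)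
      at-most a with ann? ws a
      ... | yes _  = V.S-atMost (λ c → a V.≟ comb c us) (λ c c′ h h′ → Ind⇒inj ius (trans (sym h) h′))
      ... | no ¬an = ℕ.≤-reflexive (trans (∑-cong V.elems (λ c → 𝟙-no (a V.≟ comb c us) (λ { refl → ¬an (ann-comb perp c) }))) (∑-0 (V.elems {m})))
      size≤ : q ^ m ≤ annSize ws
      size≤ = begin
        q ^ m ≡⟨ trans (∑-1 (V.elems {m})) (size-finV m) ⟨
        SV (λ (c : Vec F m) → 1) ≡⟨ ∑-cong V.elems (λ c → V.once (comb c us)) ⟨
        SV (λ c → SV (λ a → 𝟙 (a V.≟ comb c us))) ≡⟨ ∑-swap (V.elems {m}) (V.elems {d}) _ ⟩
        SV (λ a → SV (λ c → 𝟙 (a V.≟ comb c us))) ≤⟨ ∑-mono V.elems at-most ⟩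
        annSize ws ∎

    -- A vector outside the span would give m + 1 independent vectors in the annihilator of `ws`,
    -- one more than `perp-dimension` admits.
    perp⇒Span : {us : Vec (Vec F d) m} {ws : Vec (Vec F d) m′} → Ind us → Ind ws →
      All (λ u → dots ws u ≡ 𝟎) us → m + m′ ≡ d → ∀ {v} → dots ws v ≡ 𝟎 → Span us v
    perp⇒Span {us = us} ius iws perp dim {v} h with span? us v
    ... | yes s = s
    ... | no v∉ = ⊥-elim (ℕ.1+n≰n (ℕ.≤-trans (perp-dimension (Ind-∷ ius v∉) iws (h ∷ perp)) (ℕ.≤-reflexive (sym dim))))

  -- Deducing inequalities between natural numbers from linear combinations.

  module Arithmetic where
    -- To deduce x ≤ y from a ≤ b it suffices to exhibit y + a as x + b plus a slack.
    lin : ∀ {a b x y} → a ≤ b → ∀ z → x + b + z ≡ y + a → x ≤ y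
    lin {a} {b} {x} {y} a≤b z e = ℕ.+-cancelʳ-≤ b x y
      (ℕ.≤-trans (ℕ.≤-trans (ℕ.m≤m+n (x + b) z) (ℕ.≤-reflexive e)) (ℕ.+-monoʳ-≤ y a≤b))

    lin≡ : ∀ {a b x y} → a ≡ b → x + b ≡ y + a → x ≡ y
    lin≡ {a} {x = x} {y} refl e = ℕ.+-cancelʳ-≡ a x y e

    p*-cancel : ∀ {p a b} → p ≢ 0 → p * a ≡ p * b → a ≡ b
    p*-cancel {p} p≢0 = ℕ.*-cancelˡ-≡ _ _ p ⦃ ℕ.≢-nonZero p≢0 ⦄

    p*-cancel-≤ : ∀ {p a b} → p ≢ 0 → p * a ≤ p * b → a ≤ b
    p*-cancel-≤ {p} p≢0 = ℕ.*-cancelˡ-≤ p ⦃ ℕ.≢-nonZero p≢0 ⦄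

    qp≢0 : ∀ {q p} → q ≡ suc p → p ≢ 0 → q * p ≢ 0
    qp≢0 {p = zero}  refl p≢0 e = p≢0 refl
    qp≢0 {p = suc p} refl p≢0 ()

  open Arithmetic public

  -- Numerical consequences of t + 3 ≤ √5 q.

  module Numbers where
    square-mono : ∀ {a b} → a ≤ b → a * a ≤ b * b
    square-mono h = ℕ.*-mono-≤ h h

    private
      -- As √5 q < T + 4, the integer t is at most T, and t (t - 1) ≤ T (T - 1) is then already too
      -- small.
      below : ∀ q T t → 5 * (q * q) < (T + 4) * (T + 4) → T * (T ∸ 1) < q * (5 * q ∸ 15) →
              (t + 3) * (t + 3) ≤ 5 * (q * q) → q * (5 * q ∸ 15) + t ≤ t * t → ⊥
      below q T t lt lt′ le le′ with t ℕ.≤? T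
      ... | no t≰T = ℕ.<⇒≱ lt (ℕ.≤-trans (square-mono (ℕ.≤-trans (ℕ.≤-reflexive (ℕ.+-suc T 3)) (ℕ.+-monoˡ-≤ 3 (ℕ.≰⇒> t≰T)))) le)
      ... | yes t≤T = ℕ.<⇒≱ lt′ (ℕ.≤-trans (shift t le′) (ℕ.*-mono-≤ t≤T (ℕ.∸-monoˡ-≤ 1 t≤T)))
        where
        shift : ∀ t {z} → z + t ≤ t * t → z ≤ t * (t ∸ 1)
        shift zero    h = ℕ.≤-trans (ℕ.m≤m+n _ 0) h
        shift (suc t) {z} h = ℕ.+-cancelʳ-≤ (suc t) z (suc t * t) (ℕ.≤-trans h (ℕ.≤-reflexive (trans (ℕ.*-suc (suc t) t) (ℕ.+-comm (suc t) _))))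

      decide : ∀ {a b} {w : True (a ℕ.<? b)} → a < b
      decide {w = w} = toWitness w

      -- Combining the two hypotheses cancels the squares and gives 7t ≤ 15q - 9. Because 225 < 5 ·
      -- 49, this upper bound on t contradicts the second hypothesis as soon as q ≥ 20.
      above : ∀ r t → (t + 3) * (t + 3) ≤ 5 * ((20 + r) * (20 + r)) → (20 + r) * (5 * (20 + r) ∸ 15) + t ≤ t * t → ⊥
      above r t le le′ = contra t le (subst (λ z → (20 + r) * z + t ≤ t * t) (trans (cong (_∸ 15) (five r)) (ℕ.m+n∸n≡m (5 * r + 85) 15)) le′)
        where
        five : ∀ r → 5 * (20 + r) ≡ 5 * r + 85 + 15
        five = solveℕ 1 (λ r → κ 5 :*: (κ 20 :+: r) :=: κ 5 :*: r :+: κ 85 :+: κ 15) refl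
        contra : ∀ t → (t + 3) * (t + 3) ≤ 5 * ((20 + r) * (20 + r)) → (20 + r) * (5 * r + 85) + t ≤ t * t → ⊥
        contra (suc t) le le′ = ℕ.1+n≰n (lin {x = 1} {y = 0}
            (ℕ.+-mono-≤ (ℕ.*-monoʳ-≤ 49 le′) (ℕ.*-mono-≤ (ℕ.+-monoʳ-≤ 7 7t≤) 7t≤)) (20 * r * r + 440 * r + 655) (ring r t))
          where
          7t≤ : 7 * t ≤ 15 * r + 284
          7t≤ = lin (ℕ.+-mono-≤ le le′) 0 (ring₁ r t)
            where
            ring₁ : ∀ r t → 7 * t + (5 * ((20 + r) * (20 + r)) + suc t * suc t) + 0 ≡ 15 * r + 284 + ((suc t + 3) * (suc t + 3) + ((20 + r) * (5 * r + 85) + suc t))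
            ring₁ = solveℕ 2 (λ r t → κ 7 :*: t :+: (κ 5 :*: ((κ 20 :+: r) :*: (κ 20 :+: r)) :+: (κ 1 :+: t) :*: (κ 1 :+: t)) :+: κ 0 :=: κ 15 :*: r :+: κ 284 :+: (((κ 1 :+: t) :+: κ 3) :*: ((κ 1 :+: t) :+: κ 3) :+: ((κ 20 :+: r) :*: (κ 5 :*: r :+: κ 85) :+: (κ 1 :+: t)))) refl
          ring : ∀ r t → 1 + (49 * (suc t * suc t) + (7 + (15 * r + 284)) * (15 * r + 284)) + (20 * r * r + 440 * r + 655) ≡
            0 + (49 * ((20 + r) * (5 * r + 85) + suc t) + (7 + 7 * t) * (7 * t))
          ring = solveℕ 2 (λ r t → κ 1 :+: (κ 49 :*: ((κ 1 :+: t) :*: (κ 1 :+: t)) :+: (κ 7 :+: (κ 15 :*: r :+: κ 284)) :*: (κ 15 :*: r :+: κ 284)) :+: (κ 20 :*: r :*: r :+: κ 440 :*: r :+: κ 655) :=: κ 0 :+: (κ 49 :*: ((κ 20 :+: r) :*: (κ 5 :*: r :+: κ 85) :+: (κ 1 :+: t)) :+: (κ 7 :+: κ 7 :*: t) :*: (κ 7 :*: t))) refl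
        contra zero le le′ = ℕ.<⇒≱ {0} {85} (s≤s z≤n)
          (ℕ.≤-trans (ℕ.m≤n+m 85 (5 * r)) (ℕ.≤-trans (ℕ.m≤m+n _ ((19 + r) * (5 * r + 85))) (ℕ.≤-trans (ℕ.m≤m+n _ 0) le′)))

    -- At t = √5 q - 3 the inequalities miss each other by (7√5 - 15) q - 12, which is positive only
    -- from q = 19 on; the smaller even q are settled by the integer part of √5 q. Evenness matters
    -- here, since q = 9 and t = 17 satisfy both inequalities.
    no-middle-plane : ∀ h q t → q ≡ 2 * h → 8 ≤ q → (t + 3) * (t + 3) ≤ 5 * (q * q) → q * (5 * q ∸ 15) + t ≤ t * t → ⊥
    no-middle-plane 0 _ t refl ()
    no-middle-plane 1 _ t refl (s≤s (s≤s ()))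
    no-middle-plane 2 _ t refl (s≤s (s≤s (s≤s (s≤s ()))))
    no-middle-plane 3 _ t refl (s≤s (s≤s (s≤s (s≤s (s≤s (s≤s ()))))))
    no-middle-plane 4 _ t refl _ = below 8 14 t decide decide
    no-middle-plane 5 _ t refl _ = below 10 19 t decide decide
    no-middle-plane 6 _ t refl _ = below 12 23 t decide decide
    no-middle-plane 7 _ t refl _ = below 14 28 t decide decide
    no-middle-plane 8 _ t refl _ = below 16 32 t decide decide
    no-middle-plane 9 _ t refl _ = below 18 37 t decide decide
    no-middle-plane (suc (suc (suc (suc (suc (suc (suc (suc (suc (suc h)))))))))) q t e _ le le′ =
      above (2 * h) t (subst (λ z → (t + 3) * (t + 3) ≤ 5 * (z * z)) q≡ le) (subst (λ z → z * (5 * z ∸ 15) + t ≤ t * t) q≡ le′)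
      where
      q≡ : q ≡ 20 + 2 * h
      q≡ = trans e (ℕ.*-distribˡ-+ 2 10 h)

    -- This is (n - 5)(s - 5) ≥ 0 with n + s = q + 2 inserted.
    product≥ : ∀ {q n s} → 5 ≤ n → 5 ≤ s → n + s ≡ q + 2 → 5 * q ∸ 15 ≤ n * s
    product≥ {q} {n} {s} 5≤n 5≤s e = ℕ.≤-trans (ℕ.∸-monoˡ-≤ 15 (go (n ∸ 5) (s ∸ 5) (ℕ.m+[n∸m]≡n 5≤n) (ℕ.m+[n∸m]≡n 5≤s) e)) (ℕ.≤-reflexive (ℕ.m+n∸n≡m (n * s) 15))
      where
      go : ∀ a b → 5 + a ≡ n → 5 + b ≡ s → n + s ≡ q + 2 → 5 * q ≤ n * s + 15
      go a b refl refl e = lin {5 * (q + 2)} {5 * (5 + a + (5 + b))} (ℕ.≤-reflexive (cong (5 *_) (sym e))) (a * b) (ring q a b)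
        where
        ring : ∀ q a b → 5 * q + 5 * (5 + a + (5 + b)) + a * b ≡ (5 + a) * (5 + b) + 15 + 5 * (q + 2)
        ring = solveℕ 3 (λ q a b → κ 5 :*: q :+: κ 5 :*: (κ 5 :+: a :+: (κ 5 :+: b)) :+: a :*: b :=: (κ 5 :+: a) :*: (κ 5 :+: b) :+: κ 15 :+: κ 5 :*: (q :+: κ 2)) refl

    -- Otherwise t + 3 ≥ 3q - 6, whose square exceeds 5q² from q = 8 on; at q = 8 the comparison is
    -- 324 > 320.
    t-bound : ∀ {q t} → 8 ≤ q → (t + 3) * (t + 3) ≤ 5 * (q * q) → t + 10 ≤ 3 * q
    t-bound {q} {t} 8≤q le with t + 10 ℕ.≤? 3 * q
    ... | yes h = h
    ... | no h  = ⊥-elim (go (q ∸ 8) (ℕ.m+[n∸m]≡n 8≤q))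
      where
      go : ∀ r → 8 + r ≡ q → ⊥
      go r refl = ℕ.1+n≰n (lin {x = 1} {y = 0} (ℕ.+-mono-≤ (square-mono 3r≤) le) (4 * r * r + 28 * r + 3) (ring r t))
        where
        3r≤ : 3 * r + 18 ≤ t + 3
        3r≤ = lin (ℕ.≰⇒> h) 0 (ring₀ r t)
          where
          ring₀ : ∀ r t → 3 * r + 18 + (t + 10) + 0 ≡ t + 3 + suc (3 * (8 + r))
          ring₀ = solveℕ 2 (λ r t → κ 3 :*: r :+: κ 18 :+: (t :+: κ 10) :+: κ 0 :=: t :+: κ 3 :+: (κ 1 :+: (κ 3 :*: (κ 8 :+: r)))) refl
        ring : ∀ r t → 1 + ((t + 3) * (t + 3) + 5 * ((8 + r) * (8 + r))) + (4 * r * r + 28 * r + 3) ≡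
          0 + ((3 * r + 18) * (3 * r + 18) + (t + 3) * (t + 3))
        ring = solveℕ 2 (λ r t → κ 1 :+: ((t :+: κ 3) :*: (t :+: κ 3) :+: κ 5 :*: ((κ 8 :+: r) :*: (κ 8 :+: r))) :+: (κ 4 :*: r :*: r :+: κ 28 :*: r :+: κ 3) :=: κ 0 :+: ((κ 3 :*: r :+: κ 18) :*: (κ 3 :*: r :+: κ 18) :+: (t :+: κ 3) :*: (t :+: κ 3))) refl

    -- The last inequality is what `tangent-sum` would give for a tangent all of whose planes
    -- contain many cap points.
    q²-bound : ∀ {q t} → 8 ≤ q → (t + 3) * (t + 3) ≤ 5 * (q * q) → q * q ≤ 2 * q + 3 * t → ⊥
    q²-bound {q} {t} 8≤q le h = go (q ∸ 8) (ℕ.m+[n∸m]≡n 8≤q) le h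
      where
      go : ∀ r → 8 + r ≡ q → (t + 3) * (t + 3) ≤ 5 * (q * q) → q * q ≤ 2 * q + 3 * t → ⊥
      go r refl le h = ℕ.1+n≰n (lin {x = 1} {y = 0} (ℕ.+-mono-≤ (square-mono 3t≥) (ℕ.*-monoʳ-≤ 9 le))
          (368 + 876 * r + 265 * r * r + 28 * r * r * r + r * r * r * r) (ring r t))
        where
        3t≥ : 57 + 14 * r + r * r ≤ 3 * (t + 3)
        3t≥ = lin h 0 (ring₀ r t)
          where
          ring₀ : ∀ r t → 57 + 14 * r + r * r + (2 * (8 + r) + 3 * t) + 0 ≡ 3 * (t + 3) + (8 + r) * (8 + r)
          ring₀ = solveℕ 2 (λ r t → κ 57 :+: κ 14 :*: r :+: r :*: r :+: (κ 2 :*: (κ 8 :+: r) :+: κ 3 :*: t) :+: κ 0 :=: κ 3 :*: (t :+: κ 3) :+: (κ 8 :+: r) :*: (κ 8 :+: r)) refl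
        ring : ∀ r t → 1 + (3 * (t + 3) * (3 * (t + 3)) + 9 * (5 * ((8 + r) * (8 + r)))) + (368 + 876 * r + 265 * r * r + 28 * r * r * r + r * r * r * r) ≡
          0 + ((57 + 14 * r + r * r) * (57 + 14 * r + r * r) + 9 * ((t + 3) * (t + 3)))
        ring = solveℕ 2 (λ r t → κ 1 :+: (κ 3 :*: (t :+: κ 3) :*: (κ 3 :*: (t :+: κ 3)) :+: κ 9 :*: (κ 5 :*: ((κ 8 :+: r) :*: (κ 8 :+: r)))) :+: (κ 368 :+: κ 876 :*: r :+: κ 265 :*: r :*: r :+: κ 28 :*: r :*: r :*: r :+: r :*: r :*: r :*: r) :=: κ 0 :+: ((κ 57 :+: κ 14 :*: r :+: r :*: r) :*: (κ 57 :+: κ 14 :*: r :+: r :*: r) :+: κ 9 :*: ((t :+: κ 3) :*: (t :+: κ 3)))) refl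

  -- Caps as families of coordinate vectors.

  record CapOver (K : BinaryField) : Set where
    field
      k     : ℕ
      P     : Fin k → Vec (BinaryField.F K) 4
      ind₂  : ∀ i j → i ≢ j → LinearAlgebra.Ind K (P i ∷ P j ∷ [])
      ind₃  : ∀ i j l → i ≢ j → i ≢ l → j ≢ l → LinearAlgebra.Ind K (P i ∷ P j ∷ P l ∷ [])
      -- A second cap point puts the multiples of `P i` on some secant, so that `Tan i` excludes
      -- them.
      other : ∀ (i : Fin k) → ∃ λ j → j ≢ i

  Complete : (K : BinaryField) → CapOver K → Set
  Complete K C = ∀ v → (∀ i → ¬ LinearAlgebra.Span K (P i ∷ []) v) →
    ∃ λ i → ∃ λ j → i ≢ j × LinearAlgebra.Span K (P i ∷ P j ∷ []) v
    where open CapOver C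

  -- Planes, secants and tangents of a cap.

  module Caps (K : BinaryField) (C : CapOver K) where
    open BinaryField K renaming (_+_ to _⊹_; _*_ to _·_)
    open LinearAlgebra K
    open CapOver C

    V4 : Set
    V4 = Vec F 4

    plane? : ∀ {m} (us : Vec V4 m) (c : V4) → Dec (c ≢ 𝟎 × dots us c ≡ 𝟎)
    plane? us c = ¬? (c V.≟ 𝟎) ×-dec ann? us c

    -- Every plane is counted p times, once for each covector defining it.
    planes : ∀ {m} → Vec V4 m → ℕ
    planes us = SV (λ c → 𝟙 (plane? us c))

    zero-ann : ∀ {m} (us : Vec V4 m) → dots us 𝟎 ≡ 𝟎
    zero-ann []       = refl
    zero-ann (u ∷ us) = cong₂ _∷_ (dot-𝟎ˡ u) (zero-ann us)

    1+planes : ∀ {m} (us : Vec V4 m) → 1 + planes us ≡ annSize us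
    1+planes us = begin
      1 + planes us ≡⟨ cong (_+ planes us) (V.once 𝟎) ⟨
      SV (λ c → 𝟙 (c V.≟ 𝟎)) + planes us ≡⟨ ∑-+ (V.elems {4}) _ _ ⟨
      SV (λ c → 𝟙 (c V.≟ 𝟎) + 𝟙 (plane? us c)) ≡⟨ ∑-cong (V.elems {4}) point ⟩
      annSize us ∎
      where
      open ≡-Reasoning
      point : ∀ c → 𝟙 (c V.≟ 𝟎) + 𝟙 (plane? us c) ≡ 𝟙 (ann? us c)
      point c with c V.≟ 𝟎
      ... | yes refl = sym (𝟙-yes (ann? us 𝟎) (zero-ann us))
      ... | no c≢𝟎   = 𝟙-iff (yes c≢𝟎 ×-dec ann? us c) (ann? us c) proj₂ (λ h → c≢𝟎 , h)

    annSize₁ : ∀ {u : V4} → Ind (u ∷ []) → annSize (u ∷ []) ≡ q * (q * q)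
    annSize₁ ind = ℕ.*-cancelˡ-≡ _ _ q ⦃ q≢0 ⦄ (trans (trans (arith q _) (annSize-Ind ind)) (arith′ q))
      where
      arith : ∀ q a → q * a ≡ q * 1 * a
      arith = solveℕ 2 (λ q a → q :*: a :=: q :*: κ 1 :*: a) refl
      arith′ : ∀ q → q * (q * (q * (q * 1))) ≡ q * (q * (q * q))
      arith′ = solveℕ 1 (λ q → q :*: (q :*: (q :*: (q :*: κ 1))) :=: q :*: (q :*: (q :*: q))) refl

    annSize₂ : ∀ {u v : V4} → Ind (u ∷ v ∷ []) → annSize (u ∷ v ∷ []) ≡ q * q
    annSize₂ ind = ℕ.*-cancelˡ-≡ _ _ q ⦃ q≢0 ⦄ (ℕ.*-cancelˡ-≡ _ _ q ⦃ q≢0 ⦄ (trans (trans (arith q _) (annSize-Ind ind)) (arith′ q)))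
      where
      arith : ∀ q a → q * (q * a) ≡ q * (q * 1) * a
      arith = solveℕ 2 (λ q a → q :*: (q :*: a) :=: q :*: (q :*: κ 1) :*: a) refl
      arith′ : ∀ q → q * (q * (q * (q * 1))) ≡ q * (q * (q * q))
      arith′ = solveℕ 1 (λ q → q :*: (q :*: (q :*: (q :*: κ 1))) :=: q :*: (q :*: (q :*: q))) refl

    annSize₃ : ∀ {u v w : V4} → Ind (u ∷ v ∷ w ∷ []) → annSize (u ∷ v ∷ w ∷ []) ≡ q
    annSize₃ ind = ℕ.*-cancelˡ-≡ _ _ q ⦃ q≢0 ⦄ (ℕ.*-cancelˡ-≡ _ _ q ⦃ q≢0 ⦄ (ℕ.*-cancelˡ-≡ _ _ q ⦃ q≢0 ⦄
        (trans (trans (arith q _) (annSize-Ind ind)) (arith′ q))))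
      where
      arith : ∀ q a → q * (q * (q * a)) ≡ q * (q * (q * 1)) * a
      arith = solveℕ 2 (λ q a → q :*: (q :*: (q :*: a)) :=: q :*: (q :*: (q :*: κ 1)) :*: a) refl
      arith′ : ∀ q → q * (q * (q * (q * 1))) ≡ q * (q * (q * q))
      arith′ = solveℕ 1 (λ q → q :*: (q :*: (q :*: (q :*: κ 1))) :=: q :*: (q :*: (q :*: q))) refl

    planes₂ : ∀ {u v : V4} → Ind (u ∷ v ∷ []) → planes (u ∷ v ∷ []) ≡ p * (q + 1)
    planes₂ ind = ℕ.suc-injective (trans (1+planes _) (trans (annSize₂ ind) (arith q≡1+p)))
      where
      arith : ∀ {q p} → q ≡ suc p → q * q ≡ suc (p * (q + 1))
      arith {p = p} refl = go p
        where
        go : ∀ p → suc p * suc p ≡ suc (p * (suc p + 1))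
        go = solveℕ 1 (λ p → (κ 1 :+: p) :*: (κ 1 :+: p) :=: (κ 1 :+: (p :*: ((κ 1 :+: p) :+: κ 1)))) refl

    planes₃ : ∀ {u v w : V4} → Ind (u ∷ v ∷ w ∷ []) → planes (u ∷ v ∷ w ∷ []) ≡ p
    planes₃ ind = ℕ.suc-injective (trans (1+planes _) (trans (annSize₃ ind) q≡1+p))

    -- The vectors may be dependent: the zero relation makes `relSize` at least one, and
    -- `annSize-relSize` then gives at least q annihilators.
    nonzero-annihilator : ∀ (u v w : V4) → ∃ λ c → c ≢ 𝟎 × dots (u ∷ v ∷ w ∷ []) c ≡ 𝟎
    nonzero-annihilator u v w =
      let c , h = ∑-pos (V.elems {4}) {λ c → 𝟙 (plane? us c)} (ℕ.s≤s⁻¹ (ℕ.≤-trans 2≤ (ℕ.≤-reflexive (sym (1+planes us)))))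
      in c , 𝟙-pos (plane? us c) h
      where
      us = u ∷ v ∷ w ∷ []
      2≤ : 2 ≤ annSize us
      2≤ = ℕ.≤-trans 2≤q (ℕ.*-cancelˡ-≤ (q ^ 3) ⦃ ℕ.m^n≢0 q 3 ⦃ q≢0 ⦄ ⦄ (begin
        q ^ 3 * q          ≡⟨ ℕ.*-comm (q ^ 3) q ⟩
        q ^ 4                ≡⟨ ℕ.*-identityʳ _ ⟨
        q ^ 4 * 1          ≤⟨ ℕ.*-monoʳ-≤ (q ^ 4) (ℕ.≤-trans (ℕ.≤-reflexive (sym (𝟙-yes (comb 𝟎 us V.≟ 𝟎) (comb-𝟎 us)))) (V.term (λ c → 𝟙 (comb c us V.≟ 𝟎)) 𝟎)) ⟩
        q ^ 4 * relSize us ≡⟨ annSize-relSize us ⟨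
        q ^ 3 * annSize us ∎))
        where open ℕ.≤-Reasoning

    S-span : ∀ {m} {us : Vec V4 m} → Ind us → (f : V4 → ℕ) →
             SV (λ v → 𝟙 (span? us v) * f v) ≡ SV (λ c → f (comb c us))
    S-span {m} {us} ind f = begin
      SV (λ v → 𝟙 (span? us v) * f v) ≡⟨ ∑-cong (V.elems {4}) (λ v → trans (cong (_* f v) (expand v)) (sym (∑-*ʳ (V.elems {m}) (f v) _))) ⟩
      SV (λ v → SV (λ c → 𝟙 (v V.≟ comb c us) * f v)) ≡⟨ ∑-swap (V.elems {4}) (V.elems {m}) _ ⟩
      SV (λ c → SV (λ v → 𝟙 (v V.≟ comb c us) * f v)) ≡⟨ ∑-cong (V.elems {m}) (λ c → V.S-single (comb c us) f) ⟩
      SV (λ c → f (comb c us)) ∎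
      where
      open ≡-Reasoning
      expand : ∀ v → 𝟙 (span? us v) ≡ SV (λ c → 𝟙 (v V.≟ comb c us))
      expand v with span? us v
      ... | yes s = sym (V.S-unique (λ c → v V.≟ comb c us) s (λ c c′ h h′ → Ind⇒inj ind (trans (sym h) h′)))
      ... | no ¬s = sym (trans (∑-cong (V.elems {m}) (λ c → 𝟙-no (v V.≟ comb c us) (λ e → ¬s (c , e)))) (∑-0 (V.elems {m})))

    spanInPlane : ∀ {m} {us : Vec V4 m} → Ind us → ∀ a →
      q * SV (λ v → 𝟙 (span? us v) * 𝟙 (dot a v ≟ 0#)) ≡ q ^ m * (1 + p * 𝟙 (ann? us a))
    spanInPlane {m} {us} ind a = trans (cong (q *_) (trans (S-span ind _)
      (∑-cong (V.elems {m}) (λ c → cong (λ z → 𝟙 (z ≟ 0#)) (dot-comb a c us))))) (kernel-size (dots us a))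

    spanInPlane₁ : ∀ {u} → Ind (u ∷ []) → ∀ a →
      SV (λ v → 𝟙 (span? (u ∷ []) v) * 𝟙 (dot a v ≟ 0#)) ≡ 1 + p * 𝟙 (dot a u ≟ 0#)
    spanInPlane₁ {u} ind a = ℕ.*-cancelˡ-≡ _ _ q ⦃ q≢0 ⦄ (trans (spanInPlane ind a)
      (cong₂ (λ x y → x * (1 + p * y)) (ℕ.*-identityʳ q)
        (𝟙-iff (ann? (u ∷ []) a) (dot a u ≟ 0#) Vec.∷-injectiveˡ (cong (_∷ [])))))

    spanInPlane₂ : ∀ {u w} → Ind (u ∷ w ∷ []) → ∀ a →
      SV (λ v → 𝟙 (span? (u ∷ w ∷ []) v) * 𝟙 (dot a v ≟ 0#)) ≡
      q * (1 + p * (𝟙 (dot a u ≟ 0#) * 𝟙 (dot a w ≟ 0#)))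
    spanInPlane₂ {u} {w} ind a = ℕ.*-cancelˡ-≡ _ _ q ⦃ q≢0 ⦄ (trans (spanInPlane ind a)
      (trans (cong (λ y → q ^ 2 * (1 + p * y)) (trans (𝟙-iff (ann? (u ∷ w ∷ []) a) ((dot a u ≟ 0#) ×-dec (dot a w ≟ 0#))
        (λ e → Vec.∷-injectiveˡ e , Vec.∷-injectiveˡ (Vec.∷-injectiveʳ e)) (λ (e , e′) → cong₂ (λ x y → x ∷ y ∷ []) e e′)) (𝟙-× (dot a u ≟ 0#) (dot a w ≟ 0#))))
        (arith q _)))
      where
      arith : ∀ q x → q * (q * 1) * x ≡ q * (q * x)
      arith = solveℕ 2 (λ q x → q :*: (q :*: κ 1) :*: x :=: q :*: (q :*: x)) refl

    planeSize : ∀ {a} → a ≢ 𝟎 → SV (λ v → 𝟙 (dot a v ≟ 0#)) ≡ q * (q * q)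
    planeSize {a} a≢𝟎 = trans (∑-cong (V.elems {4}) (λ v → 𝟙-iff (dot a v ≟ 0#) (ann? (a ∷ []) v)
      (λ e → cong (_∷ []) (trans (dot-comm v a) e)) (λ e → trans (dot-comm a v) (Vec.∷-injectiveˡ e)))) (annSize₁ (Ind-nonzero a≢𝟎))

    SV-1 : SV (λ (v : V4) → 1) ≡ q * (q * (q * q))
    SV-1 = trans (∑-1 (V.elems {4})) (trans (size-finV 4) (arith q))
      where
      arith : ∀ q → q * (q * (q * (q * 1))) ≡ q * (q * (q * q))
      arith = solveℕ 1 (λ q → q :*: (q :*: (q :*: (q :*: κ 1))) :=: q :*: (q :*: (q :*: q))) refl

    span₁ : ∀ {u v : V4} α → v ≡ α • u → Span (u ∷ []) v
    span₁ α e = α ∷ [] , trans e (sym (⊕-identityʳ _))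

    span₁⁻ : ∀ {u v : V4} → Span (u ∷ []) v → ∃ λ α → v ≡ α • u
    span₁⁻ (α ∷ [] , e) = α , trans e (⊕-identityʳ _)

    span₂ : ∀ {u w v : V4} α β → v ≡ α • u ⊕ β • w → Span (u ∷ w ∷ []) v
    span₂ α β e = α ∷ β ∷ [] , trans e (cong (α • _ ⊕_) (sym (⊕-identityʳ _)))

    span₂⁻ : ∀ {u w v : V4} → Span (u ∷ w ∷ []) v → ∃ λ α → ∃ λ β → v ≡ α • u ⊕ β • w
    span₂⁻ (α ∷ β ∷ [] , e) = α , β , trans e (cong (α • _ ⊕_) (⊕-identityʳ _))

    span₁⇒₂ : ∀ {u w v : V4} → Span (u ∷ []) v → Span (u ∷ w ∷ []) v
    span₁⇒₂ {w = w} s = let α , e = span₁⁻ s in span₂ α 0# (trans e (sym (trans (cong (α • _ ⊕_) (0• w)) (⊕-identityʳ _))))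

    dot-⊕• : ∀ (c : V4) α β u w → dot c (α • u ⊕ β • w) ≡ α · dot c u ⊹ β · dot c w
    dot-⊕• c α β u w = trans (dot-⊕ c _ _) (cong₂ _⊹_ (dot-• α c u) (dot-• β c w))

    ind₁ : ∀ i → Ind (P i ∷ [])
    ind₁ i = let j , j≢i = other i in Ind-tail (ind₂ j i j≢i)

    Sk : (Fin k → ℕ) → ℕ
    Sk = Finite.S (finFinite k)

    Sk-1 : Sk (λ _ → 1) ≡ k
    Sk-1 = trans (∑-1 (allFin k)) (length-tabulate {n = k} (λ i → i))

    Sk-const : ∀ c → Sk (λ _ → c) ≡ k * c
    Sk-const c = trans (∑-const (allFin k) c) (cong (_* c) (length-tabulate {n = k} (λ i → i)))

    OnLine : Fin k → Fin k → V4 → Set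
    OnLine i j = Span (P i ∷ P j ∷ [])

    Tan : Fin k → V4 → Set
    Tan i v = ∀ j → j ≢ i → ¬ OnLine i j v

    opaque
      tan? : ∀ i v → Dec (Tan i v)
      tan? i v = Finite.all (finFinite k) (λ j → ¬? (j Fin.≟ i) →-dec ¬? (span? (P i ∷ P j ∷ []) v))

    Tan⇒∉ : ∀ {i v} → Tan i v → ¬ Span (P i ∷ []) v
    Tan⇒∉ {i} h s = let j , j≢i = other i in h j j≢i (span₁⇒₂ s)

    Tan⇒Ind₂ : ∀ {i v} → Tan i v → Ind (v ∷ P i ∷ [])
    Tan⇒Ind₂ {i} h = Ind-∷ (ind₁ i) (Tan⇒∉ h)

    Tan⇒Ind₃ : ∀ {i v} → Tan i v → ∀ j → j ≢ i → Ind (v ∷ P i ∷ P j ∷ [])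
    Tan⇒Ind₃ {i} h j j≢i = Ind-∷ (ind₂ i j (λ e → j≢i (sym e))) (h j j≢i)

    x : V4 → ℕ
    x v = Sk (λ i → 𝟙 (tan? i v))

    on? : ∀ c i → Dec (dot c (P i) ≡ 0#)
    on? c i = dot c (P i) ≟ 0#

    n : V4 → ℕ
    n c = Sk (λ i → 𝟙 (on? c i))

    unique-secant : ∀ {i v} → ¬ Span (P i ∷ []) v → ∀ {j l} → j ≢ i → l ≢ i → OnLine i j v → OnLine i l v → j ≡ l
    unique-secant {i} {v} v∉ {j} {l} j≢i l≢i s s′ with j Fin.≟ l
    ... | yes e  = e
    ... | no j≢l = ⊥-elim (β≢0 (Vec.∷-injectiveˡ (Vec.∷-injectiveʳ rel)))
      where
      α = proj₁ (span₂⁻ s)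
      β = proj₁ (proj₂ (span₂⁻ s))
      e = proj₂ (proj₂ (span₂⁻ s))
      α′ = proj₁ (span₂⁻ s′)
      β′ = proj₁ (proj₂ (span₂⁻ s′))
      e′ = proj₂ (proj₂ (span₂⁻ s′))
      β≢0 : β ≢ 0#
      β≢0 β≡0 = v∉ (span₁ α (trans e (trans (cong (λ z → α • P i ⊕ z • P j) β≡0) (trans (cong (α • P i ⊕_) (0• (P j))) (⊕-identityʳ _)))))
      rearrange : ∀ {d} α α′ β β′ (u v w : Vec F d) → (α ⊹ α′) • u ⊕ (β • v ⊕ (β′ • w ⊕ 𝟎)) ≡ (α • u ⊕ β • v) ⊕ (α′ • u ⊕ β′ • w)
      rearrange α α′ β β′ []      []      []      = refl
      rearrange α α′ β β′ (x ∷ u) (y ∷ v) (z ∷ w) = cong₂ _∷_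
        (solve 7 (λ α α′ β β′ x y z → (α :+ α′) :* x :+ (β :* y :+ (β′ :* z :+ con false)) := (α :* x :+ β :* y) :+ (α′ :* x :+ β′ :* z)) refl α α′ β β′ x y z)
        (rearrange α α′ β β′ u v w)
        where open Solver
      rel : (α ⊹ α′) ∷ β ∷ β′ ∷ [] ≡ 𝟎
      rel = ind₃ i j l (λ e → j≢i (sym e)) (λ e → l≢i (sym e)) j≢l _
        (trans (rearrange α α′ β β′ (P i) (P j) (P l)) (trans (cong₂ _⊕_ (sym e) (sym e′)) (⊕-self v)))

    -- A vector is tangent at P i, lies on exactly one secant through P i, or is a multiple of P i;
    -- in the last case it lies on all the secants.
    lines-partition : ∀ i v → 𝟙 (tan? i v) + Sk (λ j → 𝟙 (¬? (j Fin.≟ i)) * 𝟙 (span? (P i ∷ P j ∷ []) v)) + 2 * 𝟙 (span? (P i ∷ []) v)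
                      ≡ 1 + k * 𝟙 (span? (P i ∷ []) v)
    lines-partition i v with span? (P i ∷ []) v
    -- A multiple of `P i` lies on k - 1 secants; the coefficient 2 balances this against 1 + k
    -- without a subtraction.
    ... | yes s = begin
      𝟙 (tan? i v) + Sk (λ j → 𝟙 (¬? (j Fin.≟ i)) * 𝟙 (span? (P i ∷ P j ∷ []) v)) + 2
        ≡⟨ cong₂ (λ a b → a + b + 2) (𝟙-no (tan? i v) (λ h → Tan⇒∉ h s))
             (∑-cong (allFin k) (λ j → trans (cong (𝟙 (¬? (j Fin.≟ i)) *_) (𝟙-yes (span? _ v) (span₁⇒₂ s))) (ℕ.*-identityʳ _))) ⟩
      Sk (λ j → 𝟙 (¬? (j Fin.≟ i))) + 2 ≡⟨ trans (ℕ.+-suc others 1) (cong suc (ℕ.+-comm others 1)) ⟩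
      1 + (1 + others) ≡⟨ cong (λ z → 1 + (z + others)) (Finite.once (finFinite k) i) ⟨
      1 + (Sk (λ j → 𝟙 (j Fin.≟ i)) + others) ≡⟨ cong (1 +_) (trans (sym (∑-+ (allFin k) _ _)) (trans (∑-cong (allFin k) (λ j → 𝟙-¬ (j Fin.≟ i))) Sk-1)) ⟩
      1 + k ≡⟨ cong (1 +_) (ℕ.*-identityʳ k) ⟨
      1 + k * 1 ∎
      where
      open ≡-Reasoning
      others = Sk (λ j → 𝟙 (¬? (j Fin.≟ i)))
    ... | no v∉ = trans (ℕ.+-identityʳ _) (trans count (cong suc (sym (ℕ.*-zeroʳ k))))
      where
      both : ∀ j → Dec (j ≢ i × OnLine i j v)
      both j = ¬? (j Fin.≟ i) ×-dec span? (P i ∷ P j ∷ []) v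
      count : 𝟙 (tan? i v) + Sk (λ j → 𝟙 (¬? (j Fin.≟ i)) * 𝟙 (span? (P i ∷ P j ∷ []) v)) ≡ 1
      count with tan? i v
      ... | yes h = cong suc (trans (∑-cong (allFin k) (λ j → trans (sym (𝟙-× (¬? (j Fin.≟ i)) (span? _ v))) (𝟙-no (both j) (λ (a , b) → h j a b)))) (∑-0 (allFin k)))
      ... | no ¬h = trans (∑-cong (allFin k) (λ j → sym (𝟙-× (¬? (j Fin.≟ i)) (span? _ v))))
        (Finite.S-unique (finFinite k) both exists (λ j l (a , b) (a′ , b′) → unique-secant v∉ a a′ b b′))
        where
        exists : ∃ λ j → j ≢ i × OnLine i j v
        exists with Finite.search (finFinite k) both
        ... | yes e = e
        ... | no ¬e = ⊥-elim (¬h (λ j a b → ¬e (j , a , b)))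

    -- A tangent at `P i` inside the plane contributes its q² - q = q p vectors off `P i`; when the
    -- plane misses `P i`, every tangent contributes the p vectors of one point.
    tanCount : Fin k → V4 → ℕ
    tanCount i a = SV (λ v → 𝟙 (dot a v ≟ 0#) * 𝟙 (tan? i v))

    m : Fin k → V4 → ℕ
    m i a = Sk (λ j → 𝟙 (¬? (j Fin.≟ i)) * 𝟙 (on? a j))

    n-split : ∀ i a → n a ≡ 𝟙 (on? a i) + m i a
    n-split i a = begin
      n a ≡⟨ ∑-cong (allFin k) (λ j → split (j Fin.≟ i) (𝟙 (on? a j))) ⟩
      Sk (λ j → 𝟙 (j Fin.≟ i) * 𝟙 (on? a j) + 𝟙 (¬? (j Fin.≟ i)) * 𝟙 (on? a j)) ≡⟨ ∑-+ (allFin k) _ _ ⟩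
      Sk (λ j → 𝟙 (j Fin.≟ i) * 𝟙 (on? a j)) + m i a ≡⟨ cong (_+ m i a) (Finite.S-single (finFinite k) i (λ j → 𝟙 (on? a j))) ⟩
      𝟙 (on? a i) + m i a ∎
      where
      open ≡-Reasoning
      split : {Q : Set} (d : Dec Q) (z : ℕ) → z ≡ 𝟙 d * z + 𝟙 (¬? d) * z
      split (yes _) z = sym (trans (ℕ.+-identityʳ _) (ℕ.+-identityʳ z))
      split (no _)  z = sym (ℕ.+-identityʳ z)

    others-count : ∀ i → 1 + Sk (λ j → 𝟙 (¬? (j Fin.≟ i))) ≡ k
    others-count i = trans (cong (_+ Sk (λ j → 𝟙 (¬? (j Fin.≟ i)))) (sym (Finite.once (finFinite k) i)))
      (trans (sym (∑-+ (allFin k) _ _)) (trans (∑-cong (allFin k) (λ j → 𝟙-¬ (j Fin.≟ i))) Sk-1))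

    tanCount-formula : ∀ i a → let ε = 𝟙 (on? a i) in
      tanCount i a + (Sk (λ j → 𝟙 (¬? (j Fin.≟ i))) * q + m i a * (q * p * ε)) + 2 * (1 + p * ε)
        ≡ SV (λ v → 𝟙 (dot a v ≟ 0#)) + k * (1 + p * ε)
    tanCount-formula i a = begin
      tanCount i a + (O * q + m i a * (q * p * ε)) + 2 * (1 + p * ε)
        ≡⟨ cong₂ (λ y z → tanCount i a + y + 2 * z) (sym secants) (sym (spanInPlane₁ (ind₁ i) a)) ⟩
      tanCount i a + Sk (λ j → 𝟙 (¬? (j Fin.≟ i)) * SV (λ v → 𝟙 (span? (P i ∷ P j ∷ []) v) * o v)) + 2 * SV (λ v → σ v * o v)
        ≡⟨ cong₂ (λ y z → tanCount i a + y + z)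
             (trans (∑-cong (allFin k) (λ j → sym (∑-*ˡ (V.elems {4}) (𝟙 (¬? (j Fin.≟ i))) _))) (trans (∑-swap (allFin k) (V.elems {4}) _)
               (∑-cong (V.elems {4}) (λ v → trans (∑-cong (allFin k) (λ j → reorder (𝟙 (¬? (j Fin.≟ i))) (𝟙 (span? (P i ∷ P j ∷ []) v)) (o v))) (∑-*ˡ (allFin k) (o v) _)))))
             (sym (∑-*ˡ (V.elems {4}) 2 _)) ⟩
      tanCount i a + SV (λ v → o v * sec v) + SV (λ v → 2 * (σ v * o v))
        ≡⟨ trans (cong (_+ SV (λ v → 2 * (σ v * o v))) (sym (∑-+ (V.elems {4}) _ _))) (sym (∑-+ (V.elems {4}) _ _)) ⟩
      SV (λ v → o v * 𝟙 (tan? i v) + o v * sec v + 2 * (σ v * o v))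
        ≡⟨ ∑-cong (V.elems {4}) (λ v → trans (collect (o v) (𝟙 (tan? i v)) (sec v) (σ v)) (trans (cong (o v *_) (lines-partition i v)) (expand (o v) k (σ v)))) ⟩
      SV (λ v → o v + k * (σ v * o v)) ≡⟨ trans (∑-+ (V.elems {4}) _ _) (cong (SV o +_) (∑-*ˡ (V.elems {4}) k _)) ⟩
      SV o + k * SV (λ v → σ v * o v) ≡⟨ cong (λ z → SV o + k * z) (spanInPlane₁ (ind₁ i) a) ⟩
      SV o + k * (1 + p * ε) ∎
      where
      open ≡-Reasoning
      ε = 𝟙 (on? a i)
      O = Sk (λ j → 𝟙 (¬? (j Fin.≟ i)))
      o σ sec : V4 → ℕ
      o v = 𝟙 (dot a v ≟ 0#)
      σ v = 𝟙 (span? (P i ∷ []) v)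
      sec v = Sk (λ j → 𝟙 (¬? (j Fin.≟ i)) * 𝟙 (span? (P i ∷ P j ∷ []) v))
      reorder : ∀ x y z → x * (y * z) ≡ z * (x * y)
      reorder = solveℕ 3 (λ x y z → x :*: (y :*: z) :=: z :*: (x :*: y)) refl
      collect : ∀ o t s z → o * t + o * s + 2 * (z * o) ≡ o * (t + s + 2 * z)
      collect = solveℕ 4 (λ o t s z → o :*: t :+: o :*: s :+: κ 2 :*: (z :*: o) :=: o :*: (t :+: s :+: κ 2 :*: z)) refl
      expand : ∀ o k z → o * (1 + k * z) ≡ o + k * (z * o)
      expand = solveℕ 3 (λ o k z → o :*: (κ 1 :+: k :*: z) :=: o :+: k :*: (z :*: o)) refl
      distribute : ∀ x q p e y → x * (q * (1 + p * (e * y))) ≡ x * q + (x * y) * (q * p * e)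
      distribute = solveℕ 5 (λ x q p e y → x :*: (q :*: (κ 1 :+: p :*: (e :*: y))) :=: x :*: q :+: (x :*: y) :*: (q :*: p :*: e)) refl
      secants : Sk (λ j → 𝟙 (¬? (j Fin.≟ i)) * SV (λ v → 𝟙 (span? (P i ∷ P j ∷ []) v) * o v)) ≡ O * q + m i a * (q * p * ε)
      secants = trans (∑-cong (allFin k) (λ j → trans
          (𝟙*-cong (¬? (j Fin.≟ i)) (λ j≢i → spanInPlane₂ (ind₂ i j (λ e → j≢i (sym e))) a))
          (distribute (𝟙 (¬? (j Fin.≟ i))) q p ε (𝟙 (on? a j)))))
        (trans (∑-+ (allFin k) _ _) (cong₂ _+_ (∑-*ʳ (allFin k) q _) (∑-*ʳ (allFin k) _ _)))

    tanCount-incident : ∀ i {a} → dot a (P i) ≡ 0# → tanCount i a + m i a * (q * p) + q ≡ SV (λ v → 𝟙 (dot a v ≟ 0#))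
    tanCount-incident i {a} h = arith (tanCount i a) (Sk (λ j → 𝟙 (¬? (j Fin.≟ i)))) (m i a) q≡1+p (sym (others-count i))
      (subst (λ ε → tanCount i a + (Sk (λ j → 𝟙 (¬? (j Fin.≟ i))) * q + m i a * (q * p * ε)) + 2 * (1 + p * ε) ≡ SV (λ v → 𝟙 (dot a v ≟ 0#)) + k * (1 + p * ε))
        (𝟙-yes (on? a i) h) (tanCount-formula i a))
      where
      arith : ∀ T O m {q p A k} → q ≡ suc p → k ≡ suc O →
        T + (O * q + m * (q * p * 1)) + 2 * (1 + p * 1) ≡ A + k * (1 + p * 1) → T + m * (q * p) + q ≡ A
      arith T O m {p = p} {A} refl refl e = lin≡ e (ring T O m p A)
        where
        ring : ∀ T O m p A → T + m * (suc p * p) + suc p + (A + suc O * (1 + p * 1)) ≡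
          A + (T + (O * suc p + m * (suc p * p * 1)) + 2 * (1 + p * 1))
        ring = solveℕ 5 (λ T O m p A → T :+: m :*: ((κ 1 :+: p) :*: p) :+: (κ 1 :+: p) :+: (A :+: (κ 1 :+: O) :*: (κ 1 :+: p :*: κ 1)) :=: A :+: (T :+: (O :*: (κ 1 :+: p) :+: m :*: ((κ 1 :+: p) :*: p :*: κ 1)) :+: κ 2 :*: (κ 1 :+: p :*: κ 1))) refl

    n≡1+m : ∀ {i a} → dot a (P i) ≡ 0# → n a ≡ suc (m i a)
    n≡1+m {i} {a} h = trans (n-split i a) (cong (_+ m i a) (𝟙-yes (on? a i) h))

    plane-tangents : ∀ i {a} → a ≢ 𝟎 → dot a (P i) ≡ 0# → tanCount i a + m i a * (q * p) ≡ (q + 1) * (q * p)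
    plane-tangents i {a} a≢𝟎 h = arith (tanCount i a + m i a * (q * p)) q≡1+p (trans (tanCount-incident i h) (planeSize a≢𝟎))
      where
      arith : ∀ T {q p} → q ≡ suc p → T + q ≡ q * (q * q) → T ≡ (q + 1) * (q * p)
      arith T {p = p} refl e = lin≡ e (ring T p)
        where
        ring : ∀ T p → T + suc p * (suc p * suc p) ≡ (suc p + 1) * (suc p * p) + (T + suc p)
        ring = solveℕ 2 (λ T p → T :+: (κ 1 :+: p) :*: ((κ 1 :+: p) :*: (κ 1 :+: p)) :=: ((κ 1 :+: p) :+: κ 1) :*: ((κ 1 :+: p) :*: p) :+: (T :+: (κ 1 :+: p))) refl

    n≤q+2 : ∀ {a} → a ≢ 𝟎 → n a ≤ q + 2
    n≤q+2 {a} a≢𝟎 with n a in eq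
    ... | zero  = z≤n
    ... | suc n′ = let i , h = ∑-pos (allFin k) {λ i → 𝟙 (on? a i)} (ℕ.≤-trans (s≤s z≤n) (ℕ.≤-reflexive (sym eq)))
                       h′ = 𝟙-pos (on? a i) h
                   in subst₂ _≤_ (trans (sym (n≡1+m h′)) eq) (sym (ℕ.+-suc q 1))
                      (s≤s (ℕ.*-cancelʳ-≤ _ _ (q * p) ⦃ ℕ.≢-nonZero (qp≢0 q≡1+p p≢0) ⦄
                        (ℕ.m+n≤o⇒n≤o (tanCount i a) (ℕ.≤-reflexive (plane-tangents i a≢𝟎 h′)))))

    opaque
      -- The number of tangents inside the plane at each of its cap points: q + 1 lines less n - 1
      -- secants.
      s : V4 → ℕ
      s a = q + 2 ∸ n a

      n+s : ∀ {a} → a ≢ 𝟎 → n a + s a ≡ q + 2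
      n+s a≢𝟎 = ℕ.m+[n∸m]≡n (n≤q+2 a≢𝟎)

    m+s : ∀ {i a} → a ≢ 𝟎 → dot a (P i) ≡ 0# → m i a + s a ≡ q + 1
    m+s {i} {a} a≢𝟎 h = ℕ.suc-injective (trans (cong (_+ s a) (sym (n≡1+m h))) (trans (n+s a≢𝟎) (ℕ.+-suc q 1)))

    tanCount-on : ∀ i {a} → a ≢ 𝟎 → dot a (P i) ≡ 0# → tanCount i a ≡ q * p * s a
    tanCount-on i {a} a≢𝟎 h = arith (tanCount i a) (m i a) (q * p) (s a) (plane-tangents i a≢𝟎 h) (m+s a≢𝟎 h)
      where
      arith : ∀ T m r s {q} → T + m * r ≡ (q + 1) * r → m + s ≡ q + 1 → T ≡ r * s
      arith T m r s e e′ rewrite sym e′ = lin≡ e (ring T m r s)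
        where
        ring : ∀ T m r s → T + (m + s) * r ≡ r * s + (T + m * r)
        ring = solveℕ 4 (λ T m r s → T :+: (m :+: s) :*: r :=: r :*: s :+: (T :+: m :*: r)) refl

    tangents : Fin k → ℕ
    tangents i = SV (λ v → 𝟙 (tan? i v))

    -- The zero covector in `tanCount-incident` replaces the plane by the whole space, where all
    -- tangents at `P i` are counted.
    tangents-raw : ∀ i → tangents i + (k ∸ 1) * (q * p) ≡ (q * q + q + 1) * (q * p)
    tangents-raw i = arith (tangents i) (k ∸ 1) q≡1+p (begin
      tangents i + (k ∸ 1) * (q * p) + q
        ≡⟨ cong₂ (λ a b → a + b * (q * p) + q) (∑-cong V.elems λ v → sym (trans (cong (_* 𝟙 (tan? i v)) (𝟙-yes (dot 𝟎 v ≟ 0#) (dot-𝟎ˡ v))) (ℕ.*-identityˡ _))) m≡ ⟩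
      tanCount i 𝟎 + m i 𝟎 * (q * p) + q ≡⟨ tanCount-incident i (dot-𝟎ˡ (P i)) ⟩
      SV (λ v → 𝟙 (dot 𝟎 v ≟ 0#)) ≡⟨ ∑-cong V.elems (λ v → 𝟙-yes (dot 𝟎 v ≟ 0#) (dot-𝟎ˡ v)) ⟩
      SV (λ (v : V4) → 1) ≡⟨ SV-1 ⟩
      q * (q * (q * q)) ∎)
      where
      open ≡-Reasoning
      m≡ : k ∸ 1 ≡ m i 𝟎
      m≡ = trans (cong (_∸ 1) (sym (others-count i))) (∑-cong (allFin k) (λ j → sym (trans (cong (𝟙 (¬? (j Fin.≟ i)) *_) (𝟙-yes (on? 𝟎 j) (dot-𝟎ˡ (P j)))) (ℕ.*-identityʳ _))))
      arith : ∀ T O {q p} → q ≡ suc p → T + O * (q * p) + q ≡ q * (q * (q * q)) → T + O * (q * p) ≡ (q * q + q + 1) * (q * p)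
      arith T O {p = p} refl e = lin≡ e (ring T O p)
        where
        ring : ∀ T O p → T + O * (suc p * p) + suc p * (suc p * (suc p * suc p)) ≡
          (suc p * suc p + suc p + 1) * (suc p * p) + (T + O * (suc p * p) + suc p)
        ring = solveℕ 3 (λ T O p → T :+: O :*: ((κ 1 :+: p) :*: p) :+: (κ 1 :+: p) :*: ((κ 1 :+: p) :*: ((κ 1 :+: p) :*: (κ 1 :+: p))) :=: ((κ 1 :+: p) :*: (κ 1 :+: p) :+: (κ 1 :+: p) :+: κ 1) :*: ((κ 1 :+: p) :*: p) :+: (T :+: O :*: ((κ 1 :+: p) :*: p) :+: (κ 1 :+: p))) refl

    k≤ : Fin k → k ≤ q * q + q + 2
    k≤ i = subst₂ _≤_ (others-count i) (sym (ℕ.+-suc (q * q + q) 1))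
      (s≤s (subst (_≤ q * q + q + 1) (cong (_∸ 1) (sym (others-count i)))
        (ℕ.*-cancelʳ-≤ _ _ (q * p) ⦃ ℕ.≢-nonZero (qp≢0 q≡1+p p≢0) ⦄ (ℕ.m+n≤o⇒n≤o (tangents i) (ℕ.≤-reflexive (tangents-raw i))))))

    opaque
      t : ℕ
      t = q * q + q + 2 ∸ k

      k+t : Fin k → k + t ≡ q * q + q + 2
      k+t i = ℕ.m+[n∸m]≡n (k≤ i)

    others+t : ∀ i → Sk (λ j → 𝟙 (¬? (j Fin.≟ i))) + t ≡ q * q + q + 1
    others+t i = ℕ.suc-injective (trans (cong (_+ t) (others-count i)) (trans (k+t i) (ℕ.+-suc (q * q + q) 1)))

    tangents≡ : ∀ i → tangents i ≡ q * p * t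
    tangents≡ i = arith (tangents i) (k ∸ 1) (q * p) t (tangents-raw i)
      (trans (cong (λ z → z ∸ 1 + t) (sym (others-count i))) (others+t i))
      where
      arith : ∀ T m r s {z} → T + m * r ≡ z * r → m + s ≡ z → T ≡ r * s
      arith T m r s e e′ rewrite sym e′ = lin≡ e (ring T m r s)
        where
        ring : ∀ T m r s → T + (m + s) * r ≡ r * s + (T + m * r)
        ring = solveℕ 4 (λ T m r s → T :+: (m :+: s) :*: r :=: r :*: s :+: (T :+: m :*: r)) refl

    tanCount-off : ∀ i {a} → a ≢ 𝟎 → dot a (P i) ≢ 0# → tanCount i a ≡ p * t
    tanCount-off i {a} a≢𝟎 h = arith (tanCount i a) (Sk (λ j → 𝟙 (¬? (j Fin.≟ i)))) (m i a) t q≡1+p (sym (others-count i)) (others+t i)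
      (trans (subst (λ ε → tanCount i a + (Sk (λ j → 𝟙 (¬? (j Fin.≟ i))) * q + m i a * (q * p * ε)) + 2 * (1 + p * ε) ≡ SV (λ v → 𝟙 (dot a v ≟ 0#)) + k * (1 + p * ε))
        (𝟙-no (on? a i) h) (tanCount-formula i a)) (cong (_+ k * (1 + p * 0)) (planeSize a≢𝟎)))
      where
      arith : ∀ T O m t {q p k} → q ≡ suc p → k ≡ suc O → O + t ≡ q * q + q + 1 →
        T + (O * q + m * (q * p * 0)) + 2 * (1 + p * 0) ≡ q * (q * q) + k * (1 + p * 0) → T ≡ p * t
      arith T O m t {p = p} refl refl e′ e = lin≡ (cong₂ _+_ e (cong (p *_) (sym e′))) (ring T O m t p)
        where
        ring : ∀ T O m t p → T + (suc p * (suc p * suc p) + suc O * (1 + p * 0) + p * (O + t)) ≡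
          p * t + (T + (O * suc p + m * (suc p * p * 0)) + 2 * (1 + p * 0) + p * (suc p * suc p + suc p + 1))
        ring = solveℕ 5 (λ T O m t p → T :+: ((κ 1 :+: p) :*: ((κ 1 :+: p) :*: (κ 1 :+: p)) :+: (κ 1 :+: O) :*: (κ 1 :+: p :*: κ 0) :+: p :*: (O :+: t)) :=: p :*: t :+: (T :+: (O :*: (κ 1 :+: p) :+: m :*: ((κ 1 :+: p) :*: p :*: κ 0)) :+: κ 2 :*: (κ 1 :+: p :*: κ 0) :+: p :*: ((κ 1 :+: p) :*: (κ 1 :+: p) :+: (κ 1 :+: p) :+: κ 1))) refl

    -- Pairs of a vector of the plane and a tangent through it, counted by the cap point of the
    -- tangent, which either lies in the plane or not.
    plane-sum : ∀ {a} → a ≢ 𝟎 → SV (λ v → 𝟙 (dot a v ≟ 0#) * x v) + n a * (p * t) ≡ n a * (q * p * s a) + k * (p * t)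
    plane-sum {a} a≢𝟎 = begin
      SV (λ v → 𝟙 (dot a v ≟ 0#) * x v) + n a * (p * t)
        ≡⟨ cong₂ _+_ (trans (∑-cong V.elems (λ v → sym (∑-*ˡ (allFin k) (𝟙 (dot a v ≟ 0#)) _))) (∑-swap V.elems (allFin k) _)) (sym (∑-*ʳ (allFin k) _ _)) ⟩
      Sk (λ i → tanCount i a) + Sk (λ i → 𝟙 (on? a i) * (p * t)) ≡⟨ ∑-+ (allFin k) _ _ ⟨
      Sk (λ i → tanCount i a + 𝟙 (on? a i) * (p * t)) ≡⟨ ∑-cong (allFin k) each ⟩
      Sk (λ i → 𝟙 (on? a i) * (q * p * s a) + p * t) ≡⟨ ∑-+ (allFin k) _ _ ⟩
      Sk (λ i → 𝟙 (on? a i) * (q * p * s a)) + Sk (λ _ → p * t) ≡⟨ cong₂ _+_ (∑-*ʳ (allFin k) _ _) (Sk-const _) ⟩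
      n a * (q * p * s a) + k * (p * t) ∎
      where
      open ≡-Reasoning
      each : ∀ i → tanCount i a + 𝟙 (on? a i) * (p * t) ≡ 𝟙 (on? a i) * (q * p * s a) + p * t
      each i with on? a i
      ... | yes h = cong₂ _+_ (trans (tanCount-on i a≢𝟎 h) (sym (ℕ.+-identityʳ _))) (ℕ.+-identityʳ _)
      ... | no h  = trans (ℕ.+-identityʳ _) (tanCount-off i a≢𝟎 h)

    plane-∷ : ∀ {r} (us : Vec V4 r) l c → 𝟙 (plane? us c) * 𝟙 (on? c l) ≡ 𝟙 (plane? (P l ∷ us) c)
    plane-∷ us l c = trans (sym (𝟙-× (plane? us c) (on? c l)))
      (𝟙-iff (plane? us c ×-dec on? c l) (plane? (P l ∷ us) c)
        (λ ((c≢𝟎 , h) , e) → c≢𝟎 , cong₂ _∷_ e h) (λ (c≢𝟎 , h) → (c≢𝟎 , Vec.∷-injectiveʳ h) , Vec.∷-injectiveˡ h))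

    S-planes-n : ∀ {r} (us : Vec V4 r) → SV (λ c → 𝟙 (plane? us c) * n c) ≡ Sk (λ l → planes (P l ∷ us))
    S-planes-n us = trans (∑-cong V.elems (λ c → trans (sym (∑-*ˡ (allFin k) (𝟙 (plane? us c)) _)) (∑-cong (allFin k) (λ l → plane-∷ us l c))))
      (∑-swap V.elems (allFin k) _)

    planes-repeat : ∀ {r} (us : Vec V4 r) {u} → (∀ c → dots us c ≡ 𝟎 → dot c u ≡ 0#) → planes (u ∷ us) ≡ planes us
    planes-repeat us {u} h = ∑-cong V.elems (λ c → 𝟙-iff (plane? (u ∷ us) c) (plane? us c)
      (λ (c≢𝟎 , e) → c≢𝟎 , Vec.∷-injectiveʳ e) (λ (c≢𝟎 , e) → c≢𝟎 , cong₂ _∷_ (h c e) e))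

    -- The two points of the secant lie in all of its q + 1 planes, any other cap point in exactly
    -- one.
    secant-n : ∀ {i j} → i ≢ j → SV (λ c → 𝟙 (plane? (P i ∷ P j ∷ []) c) * n c) ≡ k * p + 2 * (p * q)
    secant-n {i} {j} i≢j = begin
      SV (λ c → 𝟙 (plane? us c) * n c) ≡⟨ S-planes-n us ⟩
      Sk (λ l → planes (P l ∷ us)) ≡⟨ ∑-cong (allFin k) each ⟩
      Sk (λ l → p + (𝟙 (l Fin.≟ i) + 𝟙 (l Fin.≟ j)) * (p * q)) ≡⟨ ∑-+ (allFin k) _ _ ⟩
      Sk (λ _ → p) + Sk (λ l → (𝟙 (l Fin.≟ i) + 𝟙 (l Fin.≟ j)) * (p * q)) ≡⟨ cong₂ _+_ (Sk-const p) (∑-*ʳ (allFin k) _ _) ⟩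
      k * p + Sk (λ l → 𝟙 (l Fin.≟ i) + 𝟙 (l Fin.≟ j)) * (p * q)
        ≡⟨ cong (λ z → k * p + z * (p * q)) (trans (∑-+ (allFin k) _ _) (cong₂ _+_ (Finite.once (finFinite k) i) (Finite.once (finFinite k) j))) ⟩
      k * p + 2 * (p * q) ∎
      where
      open ≡-Reasoning
      us = P i ∷ P j ∷ []
      arith : ∀ p q → p * (q + 1) ≡ p + 1 * (p * q)
      arith = solveℕ 2 (λ p q → p :*: (q :+: κ 1) :=: p :+: κ 1 :*: (p :*: q)) refl
      each : ∀ l → planes (P l ∷ us) ≡ p + (𝟙 (l Fin.≟ i) + 𝟙 (l Fin.≟ j)) * (p * q)
      each l with l Fin.≟ i | l Fin.≟ j
      ... | yes refl | yes refl = ⊥-elim (i≢j refl)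
      ... | yes refl | no _ = trans (planes-repeat us (λ c e → Vec.∷-injectiveˡ e)) (trans (planes₂ (ind₂ i j i≢j)) (arith p q))
      ... | no _ | yes refl = trans (planes-repeat us (λ c e → Vec.∷-injectiveˡ (Vec.∷-injectiveʳ e))) (trans (planes₂ (ind₂ i j i≢j)) (arith p q))
      ... | no l≢i | no l≢j = trans (planes₃ (ind₃ l i j l≢i l≢j i≢j)) (sym (ℕ.+-identityʳ p))

    Tan⇒Ind₃′ : ∀ {i v} → Tan i v → ∀ j → j ≢ i → Ind (P j ∷ v ∷ P i ∷ [])
    Tan⇒Ind₃′ h j j≢i = Ind-swap (Ind-swap₂ (Tan⇒Ind₃ h j j≢i))

    tangent-n : ∀ {i v} → Tan i v → SV (λ c → 𝟙 (plane? (v ∷ P i ∷ []) c) * n c) ≡ k * p + p * q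
    tangent-n {i} {v} h = begin
      SV (λ c → 𝟙 (plane? us c) * n c) ≡⟨ S-planes-n us ⟩
      Sk (λ l → planes (P l ∷ us)) ≡⟨ ∑-cong (allFin k) each ⟩
      Sk (λ l → p + 𝟙 (l Fin.≟ i) * (p * q)) ≡⟨ ∑-+ (allFin k) _ _ ⟩
      Sk (λ _ → p) + Sk (λ l → 𝟙 (l Fin.≟ i) * (p * q)) ≡⟨ cong₂ _+_ (Sk-const p) (Finite.S-single (finFinite k) i (λ _ → p * q)) ⟩
      k * p + p * q ∎
      where
      open ≡-Reasoning
      us = v ∷ P i ∷ []
      arith : ∀ p q → p * (q + 1) ≡ p + 1 * (p * q)
      arith = solveℕ 2 (λ p q → p :*: (q :+: κ 1) :=: p :+: κ 1 :*: (p :*: q)) refl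
      each : ∀ l → planes (P l ∷ us) ≡ p + 𝟙 (l Fin.≟ i) * (p * q)
      each l with l Fin.≟ i
      ... | yes refl = trans (planes-repeat us (λ c e → Vec.∷-injectiveˡ (Vec.∷-injectiveʳ e))) (trans (planes₂ (Tan⇒Ind₂ h)) (arith p q))
      ... | no l≢i = trans (planes₃ (Tan⇒Ind₃′ h l l≢i)) (sym (ℕ.+-identityʳ p))

    S-planes-n+s : ∀ {r} (us : Vec V4 r) → SV (λ c → 𝟙 (plane? us c) * n c) + SV (λ c → 𝟙 (plane? us c) * s c) ≡ planes us * (q + 2)
    S-planes-n+s us = trans (sym (∑-+ V.elems _ _)) (trans (∑-cong V.elems (λ c → trans (sym (ℕ.*-distribˡ-+ (𝟙 (plane? us c)) (n c) (s c)))
      (𝟙*-cong (plane? us c) (λ (c≢𝟎 , _) → n+s c≢𝟎)))) (∑-*ʳ V.elems (q + 2) _))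

    -- (q + 1)(q + 2) - (k + 2q) = t. Through this identity a bound by s in every plane of a secant
    -- becomes a bound by t in space.
    secant-s : ∀ {i j} → i ≢ j → SV (λ c → 𝟙 (plane? (P i ∷ P j ∷ []) c) * s c) ≡ p * t
    secant-s {i} {j} i≢j = arith p q k t _ (trans (trans (cong (_+ SV (λ c → 𝟙 (plane? (P i ∷ P j ∷ []) c) * s c)) (sym (secant-n i≢j))) (S-planes-n+s (P i ∷ P j ∷ []))) (cong (_* (q + 2)) (planes₂ (ind₂ i j i≢j)))) (k+t i)
      where
      arith : ∀ p q k t z → k * p + 2 * (p * q) + z ≡ p * (q + 1) * (q + 2) → k + t ≡ q * q + q + 2 → z ≡ p * t
      arith p q k t z e e′ = lin≡ (cong₂ _+_ e (cong (p *_) (sym e′))) (ring p q k t z)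
        where
        ring : ∀ p q k t z → z + (p * (q + 1) * (q + 2) + p * (k + t)) ≡ p * t + (k * p + 2 * (p * q) + z + p * (q * q + q + 2))
        ring = solveℕ 5 (λ p q k t z → z :+: (p :*: (q :+: κ 1) :*: (q :+: κ 2) :+: p :*: (k :+: t)) :=: p :*: t :+: (k :*: p :+: κ 2 :*: (p :*: q) :+: z :+: p :*: (q :*: q :+: q :+: κ 2))) refl

    -- (q + 1)(q + 2) - (k + q) = q + t, since only one cap point is now common to all the planes.
    tangent-s : ∀ {i v} → Tan i v → SV (λ c → 𝟙 (plane? (v ∷ P i ∷ []) c) * s c) ≡ p * (q + t)
    tangent-s {i} {v} h = arith p q k t _ (trans (trans (cong (_+ SV (λ c → 𝟙 (plane? (v ∷ P i ∷ []) c) * s c)) (sym (tangent-n h))) (S-planes-n+s (v ∷ P i ∷ []))) (cong (_* (q + 2)) (planes₂ (Tan⇒Ind₂ h)))) (k+t i)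
      where
      arith : ∀ p q k t z → k * p + p * q + z ≡ p * (q + 1) * (q + 2) → k + t ≡ q * q + q + 2 → z ≡ p * (q + t)
      arith p q k t z e e′ = lin≡ (cong₂ _+_ e (cong (p *_) (sym e′))) (ring p q k t z)
        where
        ring : ∀ p q k t z → z + (p * (q + 1) * (q + 2) + p * (k + t)) ≡ p * (q + t) + (k * p + p * q + z + p * (q * q + q + 2))
        ring = solveℕ 5 (λ p q k t z → z :+: (p :*: (q :+: κ 1) :*: (q :+: κ 2) :+: p :*: (k :+: t)) :=: p :*: (q :+: t) :+: (k :*: p :+: p :*: q :+: z :+: p :*: (q :*: q :+: q :+: κ 2))) refl

    Sf : (F → ℕ) → ℕ
    Sf = Finite.S finite

    -- The points of a tangent line.

    module OnTangent {i : Fin k} {v : V4} (h : Tan i v) where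
      -- One vector for each of the q points of the tangent other than `P i`.
      Q : F → V4
      Q λ′ = v ⊕ λ′ • P i

      private
        back : ∀ {d} λ′ α β (v u w : Vec F d) → v ⊕ λ′ • u ≡ α • u ⊕ β • w → v ≡ (α ⊹ λ′) • u ⊕ β • w
        back λ′ α β v u w e = begin
          v ≡⟨ ⊕-identityʳ v ⟨
          v ⊕ 𝟎 ≡⟨ cong (v ⊕_) (⊕-self (λ′ • u)) ⟨
          v ⊕ (λ′ • u ⊕ λ′ • u) ≡⟨ ⊕-assoc v _ _ ⟨
          v ⊕ λ′ • u ⊕ λ′ • u ≡⟨ cong (_⊕ λ′ • u) e ⟩
          α • u ⊕ β • w ⊕ λ′ • u ≡⟨ go α β λ′ u w ⟩
          (α ⊹ λ′) • u ⊕ β • w ∎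
          where
          open ≡-Reasoning
          go : ∀ {d} α β λ′ (u w : Vec F d) → α • u ⊕ β • w ⊕ λ′ • u ≡ (α ⊹ λ′) • u ⊕ β • w
          go α β λ′ []      []      = refl
          go α β λ′ (x ∷ u) (y ∷ w) = cong₂ _∷_
            (solve 5 (λ α β λ′ x y → α :* x :+ β :* y :+ λ′ :* x := (α :+ λ′) :* x :+ β :* y) refl α β λ′ x y) (go α β λ′ u w)
            where open Solver

      Q-tan : ∀ λ′ → Tan i (Q λ′)
      Q-tan λ′ j j≢i s = let α , β , e = span₂⁻ s in h j j≢i (span₂ (α ⊹ λ′) β (back λ′ α β v (P i) (P j) e))

      module InPlane {c : V4} (c≢𝟎 : c ≢ 𝟎) (cv : dot c v ≡ 0#) (ci : dot c (P i) ≡ 0#)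
        {j : Fin k} (j≢i : j ≢ i) (cj : dot c (P j) ≡ 0#) where

        cQ : ∀ λ′ → dot c (Q λ′) ≡ 0#
        cQ λ′ = trans (dot-⊕ c v _) (trans (cong₂ _⊹_ cv (trans (dot-• λ′ c (P i)) (trans (cong (λ′ ·_) ci) (zeroʳ λ′)))) (+-identityˡ 0#))

        Q∉ : ∀ λ′ → ¬ Span (P j ∷ []) (Q λ′)
        Q∉ λ′ s = let α , e = span₁⁻ s in h j j≢i (span₂ (0# ⊹ λ′) α (back λ′ 0# α v (P i) (P j)
          (trans e (sym (trans (cong (_⊕ α • P j) (0• (P i))) (⊕-identityˡ _))))))

        not-i : ∀ λ′ → ¬ OnLine j i (Q λ′)
        not-i λ′ s = let α , β , e = span₂⁻ s in h j j≢i (span₂ (β ⊹ λ′) α (back λ′ β α v (P i) (P j) (trans e (⊕-comm _ _))))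

        on-c : ∀ λ′ l → OnLine j l (Q λ′) → dot c (P l) ≡ 0#
        on-c λ′ l s with span₂⁻ s
        ... | α , β , e = *≡0 β≢0 (begin
          β · dot c (P l) ≡⟨ +-identityˡ _ ⟨
          0# ⊹ β · dot c (P l) ≡⟨ cong (_⊹ β · dot c (P l)) (trans (cong (α ·_) cj) (zeroʳ α)) ⟨
          α · dot c (P j) ⊹ β · dot c (P l) ≡⟨ dot-⊕• c α β (P j) (P l) ⟨
          dot c (α • P j ⊕ β • P l) ≡⟨ cong (dot c) e ⟨
          dot c (Q λ′) ≡⟨ cQ λ′ ⟩
          0# ∎)
          where
          open ≡-Reasoning
          β≢0 : β ≢ 0#
          β≢0 z = Q∉ λ′ (span₁ α (trans e (trans (cong (λ y → α • P j ⊕ y • P l) z) (trans (cong (α • P j ⊕_) (0• (P l))) (⊕-identityʳ _)))))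

        meets : ∀ l → l ≢ i → l ≢ j → dot c (P l) ≡ 0# → ∃ λ λ′ → OnLine j l (Q λ′)
        meets l l≢i l≢j cl with perp⇒Span {us = P i ∷ P j ∷ P l ∷ []} {ws = c ∷ []}
            (ind₃ i j l (λ e → j≢i (sym e)) (λ e → l≢i (sym e)) (λ e → l≢j (sym e))) (Ind-nonzero c≢𝟎)
            (⊥⇒ ci ∷ ⊥⇒ cj ∷ ⊥⇒ cl ∷ []) refl {v} (⊥⇒ cv)
          where
          ⊥⇒ : ∀ {u} → dot c u ≡ 0# → dots (c ∷ []) u ≡ 𝟎
          ⊥⇒ {u} e = cong (_∷ []) (trans (dot-comm u c) e)
        ... | α ∷ β ∷ γ ∷ [] , e = α , span₂ β γ (trans (cong (_⊕ α • P i) e) (go α β γ (P i) (P j) (P l)))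
          where
          go : ∀ {d} α β γ (u w z : Vec F d) → α • u ⊕ (β • w ⊕ (γ • z ⊕ 𝟎)) ⊕ α • u ≡ β • w ⊕ γ • z
          go α β γ []      []      []      = refl
          go α β γ (x ∷ u) (y ∷ w) (t ∷ z) = cong₂ _∷_
            (solve 6 (λ α β γ x y t → α :* x :+ (β :* y :+ (γ :* t :+ con false)) :+ α :* x := β :* y :+ γ :* t) refl α β γ x y t) (go α β γ u w z)
            where open Solver

        once : ∀ l → l ≢ i → l ≢ j → ∀ λ′ μ → OnLine j l (Q λ′) → OnLine j l (Q μ) → λ′ ≡ μ
        once l l≢i l≢j λ′ μ s s′ = +≡0⇒≡ (Vec.∷-injectiveˡ (ind₃ i j l (λ e → j≢i (sym e)) (λ e → l≢i (sym e)) (λ e → l≢j (sym e)) ((λ′ ⊹ μ) ∷ (α ⊹ α′) ∷ (β ⊹ β′) ∷ [])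
          (trans (go λ′ μ α β α′ β′ v (P i) (P j) (P l)) (trans (cong₂ _⊕_ (trans (cong (_⊕ (α • P j ⊕ β • P l)) e) (⊕-self _)) (trans (cong (_⊕ (α′ • P j ⊕ β′ • P l)) e′) (⊕-self _))) (⊕-identityˡ 𝟎)))))
          where
          α = proj₁ (span₂⁻ s)
          β = proj₁ (proj₂ (span₂⁻ s))
          e = proj₂ (proj₂ (span₂⁻ s))
          α′ = proj₁ (span₂⁻ s′)
          β′ = proj₁ (proj₂ (span₂⁻ s′))
          e′ = proj₂ (proj₂ (span₂⁻ s′))
          go : ∀ {d} λ′ μ α β α′ β′ (v u w z : Vec F d) →
            (λ′ ⊹ μ) • u ⊕ ((α ⊹ α′) • w ⊕ ((β ⊹ β′) • z ⊕ 𝟎)) ≡ (v ⊕ λ′ • u ⊕ (α • w ⊕ β • z)) ⊕ (v ⊕ μ • u ⊕ (α′ • w ⊕ β′ • z))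
          go λ′ μ α β α′ β′ []      []      []      []      = refl
          go λ′ μ α β α′ β′ (o ∷ v) (x ∷ u) (y ∷ w) (t ∷ z) = cong₂ _∷_
            (solve 10 (λ λ′ μ α β α′ β′ o x y t → (λ′ :+ μ) :* x :+ ((α :+ α′) :* y :+ ((β :+ β′) :* t :+ con false)) :=
               (o :+ λ′ :* x :+ (α :* y :+ β :* t)) :+ (o :+ μ :* x :+ (α′ :* y :+ β′ :* t))) refl λ′ μ α β α′ β′ o x y t)
            (go λ′ μ α β α′ β′ v u w z)
            where open Solver

        line : Fin k → F → ℕ
        line l λ′ = 𝟙 (¬? (l Fin.≟ j)) * 𝟙 (span? (P j ∷ P l ∷ []) (Q λ′))

        lines : ∀ l → Sf (line l) + (𝟙 (l Fin.≟ i) + 𝟙 (l Fin.≟ j)) ≡ 𝟙 (on? c l)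
        lines l with l Fin.≟ j | l Fin.≟ i
        ... | yes refl | yes refl = ⊥-elim (j≢i refl)
        ... | yes refl | no _ = trans (cong (_+ 1) (∑-0 (Finite.elems finite))) (sym (𝟙-yes (on? c l) cj))
        ... | no _ | yes refl = trans (cong (_+ 1) (trans (∑-cong (Finite.elems finite) (λ λ′ → trans (ℕ.+-identityʳ _) (𝟙-no (span? _ (Q λ′)) (not-i λ′)))) (∑-0 (Finite.elems finite)))) (sym (𝟙-yes (on? c l) ci))
        ... | no l≢j | no l≢i = trans (ℕ.+-identityʳ _) (trans (∑-cong (Finite.elems finite) (λ λ′ → ℕ.+-identityʳ _)) (count (on? c l)))
          where
          L? : ∀ λ′ → Dec (OnLine j l (Q λ′))
          L? λ′ = span? (P j ∷ P l ∷ []) (Q λ′)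
          count : (d : Dec (dot c (P l) ≡ 0#)) → Sf (λ λ′ → 𝟙 (L? λ′)) ≡ 𝟙 d
          count (yes cl) = Finite.S-unique finite L? (meets l l≢i l≢j cl) (once l l≢i l≢j)
          count (no ¬cl) = trans (∑-cong (Finite.elems finite) (λ λ′ → 𝟙-no (L? λ′) (λ s → ¬cl (on-c λ′ l s)))) (∑-0 (Finite.elems finite))

        -- Each `Q λ′` determines a line through `P j` in the plane. Such a line is tangent at `P j`
        -- or a secant, and each cap point other than `P i` and `P j` accounts for one of the
        -- secants.
        tangents-through : Sf (λ λ′ → 𝟙 (tan? j (Q λ′))) + n c ≡ q + 2
        tangents-through = begin
          T + n c ≡⟨ cong (T +_) (∑-cong (allFin k) lines) ⟨
          T + Sk (λ l → Sf (line l) + (𝟙 (l Fin.≟ i) + 𝟙 (l Fin.≟ j)))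
            ≡⟨ cong (T +_) (trans (∑-+ (allFin k) _ _) (cong₂ _+_ (∑-swap (allFin k) (Finite.elems finite) line)
                 (trans (∑-+ (allFin k) _ _) (cong₂ _+_ (Finite.once (finFinite k) i) (Finite.once (finFinite k) j))))) ⟩
          T + (Sf (λ λ′ → Sk (λ l → line l λ′)) + 2) ≡⟨ trans (sym (ℕ.+-assoc T _ 2)) (cong (_+ 2) (sym (∑-+ (Finite.elems finite) _ _))) ⟩
          Sf (λ λ′ → 𝟙 (tan? j (Q λ′)) + Sk (λ l → line l λ′)) + 2 ≡⟨ cong (_+ 2) (trans (∑-cong (Finite.elems finite) one) (∑-1 (Finite.elems finite))) ⟩
          q + 2 ∎
          where
          open ≡-Reasoning
          T = Sf (λ λ′ → 𝟙 (tan? j (Q λ′)))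
          one : ∀ λ′ → 𝟙 (tan? j (Q λ′)) + Sk (λ l → line l λ′) ≡ 1
          one λ′ = ℕ.+-cancelʳ-≡ 0 _ _ (trans (subst (λ ε → 𝟙 (tan? j (Q λ′)) + Sk (λ l → line l λ′) + 2 * ε ≡ 1 + k * ε)
            (𝟙-no (span? (P j ∷ []) (Q λ′)) (Q∉ λ′)) (lines-partition j (Q λ′))) (cong suc (ℕ.*-zeroʳ k)))

      us : Vec V4 2
      us = v ∷ P i ∷ []

      Λ : Fin k → ℕ
      Λ j = Sf (λ λ′ → 𝟙 (tan? j (Q λ′)))

      -- The tangent itself counts at each of its q points. Any other cap point spans with it one
      -- plane `c`, and by `tangents-through` exactly s c of its tangents meet the given one off
      -- `P i`.
      tangent-sum : p * Sf (λ λ′ → x (Q λ′)) ≡ p * q + SV (λ c → 𝟙 (plane? us c) * (m i c * s c))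
      tangent-sum = begin
        p * Sf (λ λ′ → x (Q λ′)) ≡⟨ cong (p *_) (∑-swap (Finite.elems finite) (allFin k) _) ⟩
        p * Sk Λ ≡⟨ cong (p *_) (trans (∑-cong (allFin k) split) (∑-+ (allFin k) _ _)) ⟩
        p * (Sk (λ j → 𝟙 (j Fin.≟ i) * Λ j) + Sk (λ j → 𝟙 (¬? (j Fin.≟ i)) * Λ j))
          ≡⟨ cong (λ z → p * (z + Sk (λ j → 𝟙 (¬? (j Fin.≟ i)) * Λ j))) (trans (Finite.S-single (finFinite k) i Λ) Λi) ⟩
        p * (q + Sk (λ j → 𝟙 (¬? (j Fin.≟ i)) * Λ j)) ≡⟨ ℕ.*-distribˡ-+ p q _ ⟩
        p * q + p * Sk (λ j → 𝟙 (¬? (j Fin.≟ i)) * Λ j) ≡⟨ cong (p * q +_) rest ⟩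
        p * q + SV (λ c → 𝟙 (plane? us c) * (m i c * s c)) ∎
        where
        open ≡-Reasoning
        split : ∀ j → Λ j ≡ 𝟙 (j Fin.≟ i) * Λ j + 𝟙 (¬? (j Fin.≟ i)) * Λ j
        split j with j Fin.≟ i
        ... | yes _ = sym (trans (ℕ.+-identityʳ _) (ℕ.+-identityʳ _))
        ... | no _  = sym (ℕ.+-identityʳ _)
        Λi : Λ i ≡ q
        Λi = trans (∑-cong (Finite.elems finite) (λ λ′ → 𝟙-yes (tan? i (Q λ′)) (Q-tan λ′))) (∑-1 (Finite.elems finite))
        reorder : ∀ a b c d → a * ((b * c) * d) ≡ b * (a * c * d)
        reorder = solveℕ 4 (λ a b c d → a :*: ((b :*: c) :*: d) :=: b :*: (a :*: c :*: d)) refl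
        local : ∀ c j → 𝟙 (¬? (j Fin.≟ i)) * (𝟙 (plane? us c) * 𝟙 (on? c j) * s c) ≡ 𝟙 (¬? (j Fin.≟ i)) * (𝟙 (plane? (P j ∷ us) c) * Λ j)
        local c j = 𝟙*-cong (¬? (j Fin.≟ i)) (λ j≢i → trans (cong (_* s c) (plane-∷ us j c)) (𝟙*-cong (plane? (P j ∷ us) c) (λ (c≢𝟎 , e) →
          ℕ.+-cancelˡ-≡ (n c) _ _ (trans (n+s c≢𝟎) (sym (trans (ℕ.+-comm (n c) _)
            (InPlane.tangents-through c≢𝟎 (Vec.∷-injectiveˡ (Vec.∷-injectiveʳ e)) (Vec.∷-injectiveˡ (Vec.∷-injectiveʳ (Vec.∷-injectiveʳ e))) j≢i (Vec.∷-injectiveˡ e))))))))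
        rest : p * Sk (λ j → 𝟙 (¬? (j Fin.≟ i)) * Λ j) ≡ SV (λ c → 𝟙 (plane? us c) * (m i c * s c))
        rest = sym (begin
          SV (λ c → 𝟙 (plane? us c) * (m i c * s c))
            ≡⟨ ∑-cong V.elems (λ c → trans (cong (𝟙 (plane? us c) *_) (sym (∑-*ʳ (allFin k) (s c) _))) (trans (sym (∑-*ˡ (allFin k) (𝟙 (plane? us c)) _))
                 (∑-cong (allFin k) (λ j → trans (reorder (𝟙 (plane? us c)) (𝟙 (¬? (j Fin.≟ i))) (𝟙 (on? c j)) (s c)) (local c j))))) ⟩
          SV (λ c → Sk (λ j → 𝟙 (¬? (j Fin.≟ i)) * (𝟙 (plane? (P j ∷ us) c) * Λ j))) ≡⟨ ∑-swap V.elems (allFin k) _ ⟩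
          Sk (λ j → SV (λ c → 𝟙 (¬? (j Fin.≟ i)) * (𝟙 (plane? (P j ∷ us) c) * Λ j)))
            ≡⟨ ∑-cong (allFin k) (λ j → trans (∑-*ˡ V.elems (𝟙 (¬? (j Fin.≟ i))) _) (𝟙*-cong (¬? (j Fin.≟ i)) (λ j≢i → trans (∑-*ʳ V.elems (Λ j) _) (cong (_* Λ j) (planes₃ (Tan⇒Ind₃′ h j j≢i)))))) ⟩
          Sk (λ j → 𝟙 (¬? (j Fin.≟ i)) * (p * Λ j)) ≡⟨ ∑-cong (allFin k) (λ j → swap (𝟙 (¬? (j Fin.≟ i))) p (Λ j)) ⟩
          Sk (λ j → p * (𝟙 (¬? (j Fin.≟ i)) * Λ j)) ≡⟨ ∑-*ˡ (allFin k) p _ ⟩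
          p * Sk (λ j → 𝟙 (¬? (j Fin.≟ i)) * Λ j) ∎)
          where
          swap : ∀ a b c → a * (b * c) ≡ b * (a * c)
          swap = solveℕ 3 (λ a b c → a :*: (b :*: c) :=: b :*: (a :*: c)) refl

    -- Tangents through a point on a secant.

    module OnSecant {i j : Fin k} (i≢j : i ≢ j) {v : V4} {α β : F} (α≢0 : α ≢ 0#) (β≢0 : β ≢ 0#)
      (v≡ : v ≡ α • P i ⊕ β • P j) where

      ¬tan-i : ¬ Tan i v
      ¬tan-i h = h j (λ e → i≢j (sym e)) (span₂ α β v≡)

      ¬tan-j : ¬ Tan j v
      ¬tan-j h = h i i≢j (span₂ β α (trans v≡ (⊕-comm _ _)))

      module _ {c : V4} (c≢𝟎 : c ≢ 𝟎) (ci : dot c (P i) ≡ 0#) (cj : dot c (P j) ≡ 0#) where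

        member? : ∀ l → Dec ((l ≢ i × l ≢ j) × dot c (P l) ≡ 0#)
        member? l = (¬? (l Fin.≟ i) ×-dec ¬? (l Fin.≟ j)) ×-dec on? c l

        A E : List (Fin k)
        A = filter member? (allFin k)
        E = filter (λ l → tan? l v) A

        uA : Unique A
        uA = Unique.filter⁺ member? (Unique.allFin⁺ k)

        uE : Unique E
        uE = Unique.filter⁺ (λ l → tan? l v) uA

        A⁻ : ∀ {l} → l ∈ A → (l ≢ i × l ≢ j) × dot c (P l) ≡ 0#
        A⁻ p = proj₂ (∈-filter⁻ member? {xs = allFin k} p)

        E⊆A : ∀ {l} → l ∈ E → l ∈ A
        E⊆A p = proj₁ (∈-filter⁻ (λ l → tan? l v) {xs = A} p)

        E-tan : ∀ {l} → l ∈ E → Tan l v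
        E-tan p = proj₂ (∈-filter⁻ (λ l → tan? l v) {xs = A} p)

        -- Affine coordinates in the plane c with respect to α • P i, β • P j and the origin P z;
        -- v is the point at infinity of the lines x ⊹ y = const.
        module Coordinates {z : Fin k} (z∈ : z ∈ A) where
          R R′ : V4
          R  = α • P i
          R′ = β • P j

          coords : Fin k → Vec F 3
          coords l with span? (P i ∷ P j ∷ P z ∷ []) (P l)
          ... | yes (cs , _) = cs
          ... | no _         = 𝟎

          a b g X Y : Fin k → F
          a l with a ∷ _ ∷ _ ∷ [] ← coords l = a
          b l with _ ∷ b ∷ _ ∷ [] ← coords l = b
          g l with _ ∷ _ ∷ g ∷ [] ← coords l = g
          X l = inv (g l) · (a l · inv α)
          Y l = inv (g l) · (b l · inv β)

          z≢i = proj₁ (proj₁ (A⁻ z∈))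
          z≢j = proj₂ (proj₁ (A⁻ z∈))

          P≡ : ∀ {l} → l ∈ A → P l ≡ a l • P i ⊕ (b l • P j ⊕ (g l • P z ⊕ 𝟎))
          P≡ {l} l∈ with span? (P i ∷ P j ∷ P z ∷ []) (P l)
          ... | yes (_ ∷ _ ∷ _ ∷ [] , e) = e
          ... | no out = ⊥-elim (out (perp⇒Span {us = P i ∷ P j ∷ P z ∷ []} {ws = c ∷ []}
              (ind₃ i j z i≢j (λ e → z≢i (sym e)) (λ e → z≢j (sym e))) (Ind-nonzero c≢𝟎)
              (⊥⇒ ci ∷ ⊥⇒ cj ∷ ⊥⇒ (proj₂ (A⁻ z∈)) ∷ []) refl (⊥⇒ (proj₂ (A⁻ l∈)))))
            where
            ⊥⇒ : ∀ {u} → dot c u ≡ 0# → dots (c ∷ []) u ≡ 𝟎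
            ⊥⇒ {u} e = cong (_∷ []) (trans (dot-comm u c) e)

          -- Otherwise `P l` would be a third cap point on the secant, which is the line at infinity
          -- of these coordinates.
          g≢0 : ∀ {l} → l ∈ A → g l ≢ 0#
          g≢0 {l} l∈ g≡0 = Ind⇒∉Span (ind₃ l i j (proj₁ (proj₁ (A⁻ l∈))) (proj₂ (proj₁ (A⁻ l∈))) i≢j)
            (a l ∷ b l ∷ [] , trans (P≡ l∈) (cong (λ y → a l • P i ⊕ (b l • P j ⊕ y))
              (trans (⊕-identityʳ _) (trans (cong (_• P z) g≡0) (0• (P z))))))

          N : Fin k → V4
          N l = X l • R ⊕ (Y l • R′ ⊕ P z)

          N≡ : ∀ {l} → l ∈ A → inv (g l) • P l ≡ N l
          N≡ {l} l∈ = begin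
            inv (g l) • P l ≡⟨ cong (inv (g l) •_) (P≡ l∈) ⟩
            inv (g l) • (a l • P i ⊕ (b l • P j ⊕ (g l • P z ⊕ 𝟎)))
              ≡⟨ trans (•-distribˡ _ _ _) (cong₂ _⊕_ (•-assoc _ _ _) (trans (•-distribˡ _ _ _) (cong₂ _⊕_ (•-assoc _ _ _) (trans (cong (inv (g l) •_) (⊕-identityʳ _)) (inv-• (P z) (g≢0 l∈)))))) ⟩
            (inv (g l) · a l) • P i ⊕ ((inv (g l) · b l) • P j ⊕ P z)
              ≡⟨ cong₂ (λ y w → y ⊕ (w ⊕ P z)) (rescale (inv (g l)) (a l) α≢0 (P i)) (rescale (inv (g l)) (b l) β≢0 (P j)) ⟩
            N l ∎
            where
            open ≡-Reasoning
            rescale : ∀ h a {α} → α ≢ 0# → (u : V4) → (h · a) • u ≡ (h · (a · inv α)) • (α • u)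
            rescale h a {α} α≢0 u = sym (trans (•-assoc _ _ _) (cong (_• u) (begin
              h · (a · inv α) · α ≡⟨ solve 4 (λ h a b c → h :* (a :* b) :* c := h :* (a :* (c :* b))) refl h a (inv α) α ⟩
              h · (a · (α · inv α)) ≡⟨ cong (λ y → h · (a · y)) (*-inv α α≢0) ⟩
              h · (a · 1#) ≡⟨ cong (h ·_) (*-identityʳ a) ⟩
              h · a ∎)))
              where open Solver

          N+N : ∀ l l′ → N l ⊕ N l′ ≡ (X l ⊹ X l′) • R ⊕ (Y l ⊹ Y l′) • R′
          N+N l l′ = go (X l) (X l′) (Y l) (Y l′) R R′ (P z)
            where
            go : ∀ {d} x x′ y y′ (r r′ z : Vec F d) → (x • r ⊕ (y • r′ ⊕ z)) ⊕ (x′ • r ⊕ (y′ • r′ ⊕ z)) ≡ (x ⊹ x′) • r ⊕ (y ⊹ y′) • r′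
            go x x′ y y′ []      []        []      = refl
            go x x′ y y′ (r ∷ rs) (r′ ∷ rs′) (z ∷ zs) = cong₂ _∷_
              (solve 7 (λ x x′ y y′ r r′ z → (x :* r :+ (y :* r′ :+ z)) :+ (x′ :* r :+ (y′ :* r′ :+ z)) := (x :+ x′) :* r :+ (y :+ y′) :* r′) refl x x′ y y′ r r′ z)
              (go x x′ y y′ rs rs′ zs)
              where open Solver

          u w′ w : Fin k → Fin k → F
          u l l′ = X l ⊹ X l′
          w′ l l′ = Y l ⊹ Y l′
          w l l′ = u l l′ ⊹ w′ l l′

          -- The sum of two normalised points is the point at infinity of the line joining them; if
          -- that were a cap point, three cap points would be collinear.
          relation : ∀ {l l′} r → l ∈ A → l′ ∈ A → l ≢ l′ → r ≢ l → r ≢ l′ → ∀ γ → N l ⊕ N l′ ≡ γ • P r → ⊥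
          relation {l} {l′} r l∈ l′∈ l≢l′ r≢l r≢l′ γ e = inv≢0 (g≢0 l∈) (Vec.∷-injectiveˡ
            (ind₃ l l′ r l≢l′ (λ e → r≢l (sym e)) (λ e → r≢l′ (sym e)) (inv (g l) ∷ inv (g l′) ∷ γ ∷ []) (begin
              inv (g l) • P l ⊕ (inv (g l′) • P l′ ⊕ (γ • P r ⊕ 𝟎)) ≡⟨ cong₂ (λ y y′ → y ⊕ (y′ ⊕ (γ • P r ⊕ 𝟎))) (N≡ l∈) (N≡ l′∈) ⟩
              N l ⊕ (N l′ ⊕ (γ • P r ⊕ 𝟎)) ≡⟨ trans (cong (λ y → N l ⊕ (N l′ ⊕ y)) (⊕-identityʳ _)) (sym (⊕-assoc _ _ _)) ⟩
              N l ⊕ N l′ ⊕ γ • P r ≡⟨ trans (cong (_⊕ γ • P r) e) (⊕-self _) ⟩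
              𝟎 ∎)))
            where open ≡-Reasoning

          u≢0 : ∀ {l l′} → l ∈ A → l′ ∈ A → l ≢ l′ → u l l′ ≢ 0#
          u≢0 {l} {l′} l∈ l′∈ l≢l′ h = relation j l∈ l′∈ l≢l′ (λ e → proj₂ (proj₁ (A⁻ l∈)) (sym e)) (λ e → proj₂ (proj₁ (A⁻ l′∈)) (sym e)) (w′ l l′ · β)
            (trans (N+N l l′) (trans (cong (λ y → y • R ⊕ w′ l l′ • R′) h) (trans (cong (_⊕ w′ l l′ • R′) (0• R)) (trans (⊕-identityˡ _) (•-assoc _ _ _)))))

          w′≢0 : ∀ {l l′} → l ∈ A → l′ ∈ A → l ≢ l′ → w′ l l′ ≢ 0#
          w′≢0 {l} {l′} l∈ l′∈ l≢l′ h = relation i l∈ l′∈ l≢l′ (λ e → proj₁ (proj₁ (A⁻ l∈)) (sym e)) (λ e → proj₁ (proj₁ (A⁻ l′∈)) (sym e)) (u l l′ · α)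
            (trans (N+N l l′) (trans (cong (λ y → u l l′ • R ⊕ y • R′) h) (trans (cong (u l l′ • R ⊕_) (0• R′)) (trans (⊕-identityʳ _) (•-assoc _ _ _)))))

          -- If u and w′ agree, N l + N l′ is a multiple of R + R′, which is `v`; the line of the
          -- two cap points then passes through `v`, against tangency at `P l`.
          w≢0 : ∀ {l l′} → l ∈ E → l′ ∈ A → l ≢ l′ → w l l′ ≢ 0#
          w≢0 {l} {l′} l∈E l′∈ l≢l′ h = E-tan l∈E l′ (λ e → l≢l′ (sym e)) (span₂ (inv ω · inv (g l)) (inv ω · inv (g l′)) (begin
            v ≡⟨ inv-• v (u≢0 (E⊆A l∈E) l′∈ l≢l′) ⟨
            inv ω • (ω • v) ≡⟨ cong (inv ω •_) (begin
              ω • v ≡⟨ cong (ω •_) v≡ ⟩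
              ω • (R ⊕ R′) ≡⟨ •-distribˡ ω R R′ ⟩
              ω • R ⊕ ω • R′ ≡⟨ cong (λ y → ω • R ⊕ y • R′) (+≡0⇒≡ h) ⟩
              ω • R ⊕ w′ l l′ • R′ ≡⟨ N+N l l′ ⟨
              N l ⊕ N l′ ≡⟨ cong₂ _⊕_ (N≡ (E⊆A l∈E)) (N≡ l′∈) ⟨
              inv (g l) • P l ⊕ inv (g l′) • P l′ ∎) ⟩
            inv ω • (inv (g l) • P l ⊕ inv (g l′) • P l′) ≡⟨ trans (•-distribˡ _ _ _) (cong₂ _⊕_ (•-assoc _ _ _) (•-assoc _ _ _)) ⟩
            (inv ω · inv (g l)) • P l ⊕ (inv ω · inv (g l′)) • P l′ ∎))
            where
            open ≡-Reasoning
            ω = u l l′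

          D≢0 : ∀ {l r r′} → l ∈ E → r ∈ A → r′ ∈ A → l ≢ r → l ≢ r′ → r ≢ r′ → w′ l r · w l r′ ⊹ w′ l r′ · w l r ≢ 0#
          D≢0 {l} {r} {r′} l∈E r∈ r′∈ l≢r l≢r′ r≢r′ h = *≢0 (w≢0 l∈E r′∈ l≢r′) (inv≢0 (g≢0 r∈)) (Vec.∷-injectiveˡ
            (ind₃ r r′ l r≢r′ (λ e → l≢r (sym e)) (λ e → l≢r′ (sym e))
              -- The coefficients of the three normalised points add up to zero, so the origin `P z`
              -- drops out and only `D` times R + R′ remains.
              (w l r′ · inv (g r) ∷ w l r · inv (g r′) ∷ (w l r′ ⊹ w l r) · inv (g l) ∷ []) (begin
              (ω′ · inv (g r)) • P r ⊕ ((ω · inv (g r′)) • P r′ ⊕ (((ω′ ⊹ ω) · inv (g l)) • P l ⊕ 𝟎))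
                ≡⟨ cong₂ _⊕_ (pull r∈) (cong₂ _⊕_ (pull r′∈) (trans (⊕-identityʳ _) (pull (E⊆A l∈E)))) ⟩
              ω′ • N r ⊕ (ω • N r′ ⊕ (ω′ ⊹ ω) • N l)
                ≡⟨ go (X l) (X r) (X r′) (Y l) (Y r) (Y r′) R R′ (P z) ⟩
              D • R ⊕ D • R′ ≡⟨ cong (λ y → y • R ⊕ y • R′) h ⟩
              0# • R ⊕ 0# • R′ ≡⟨ trans (cong₂ _⊕_ (0• R) (0• R′)) (⊕-identityˡ 𝟎) ⟩
              𝟎 ∎)))
            where
            open ≡-Reasoning
            ω′ = w l r′
            ω = w l r
            D = w′ l r · w l r′ ⊹ w′ l r′ · w l r
            pull : ∀ {o γ} → o ∈ A → (γ · inv (g o)) • P o ≡ γ • N o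
            pull {o} {γ} o∈ = trans (sym (•-assoc γ (inv (g o)) (P o))) (cong (γ •_) (N≡ o∈))
            go : ∀ {d} x x′ x″ y y′ y″ (r r′ z : Vec F d) →
              ((x ⊹ x″) ⊹ (y ⊹ y″)) • (x′ • r ⊕ (y′ • r′ ⊕ z)) ⊕ (((x ⊹ x′) ⊹ (y ⊹ y′)) • (x″ • r ⊕ (y″ • r′ ⊕ z)) ⊕ (((x ⊹ x″) ⊹ (y ⊹ y″)) ⊹ ((x ⊹ x′) ⊹ (y ⊹ y′))) • (x • r ⊕ (y • r′ ⊕ z))) ≡
              ((y ⊹ y′) · ((x ⊹ x″) ⊹ (y ⊹ y″)) ⊹ (y ⊹ y″) · ((x ⊹ x′) ⊹ (y ⊹ y′))) • r ⊕ ((y ⊹ y′) · ((x ⊹ x″) ⊹ (y ⊹ y″)) ⊹ (y ⊹ y″) · ((x ⊹ x′) ⊹ (y ⊹ y′))) • r′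
            go x x′ x″ y y′ y″ []       []         []       = refl
            go x x′ x″ y y′ y″ (r ∷ rs) (r′ ∷ rs′) (z ∷ zs) = cong₂ _∷_
              (solve 9 (λ x x′ x″ y y′ y″ r r′ z →
                ((x :+ x″) :+ (y :+ y″)) :* (x′ :* r :+ (y′ :* r′ :+ z)) :+ (((x :+ x′) :+ (y :+ y′)) :* (x″ :* r :+ (y″ :* r′ :+ z)) :+ (((x :+ x″) :+ (y :+ y″)) :+ ((x :+ x′) :+ (y :+ y′))) :* (x :* r :+ (y :* r′ :+ z))) :=
                ((y :+ y′) :* ((x :+ x″) :+ (y :+ y″)) :+ (y :+ y″) :* ((x :+ x′) :+ (y :+ y′))) :* r :+ ((y :+ y′) :* ((x :+ x″) :+ (y :+ y″)) :+ (y :+ y″) :* ((x :+ x′) :+ (y :+ y′))) :* r′) refl x x′ x″ y y′ y″ r r′ z)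
              (go x x′ x″ y y′ y″ rs rs′ zs)
              where open Solver

          bound : length E + length A ≤ q
          bound = Interpolation.length-tangents K Fin._≟_ X Y A E uA uE E⊆A u≢0 w′≢0 w≢0 D≢0

        bound : length E + length A ≤ q
        bound with A in eq
        -- Without a third cap point in the plane there is no origin for coordinates, and both lists
        -- are empty.
        ... | []    = z≤n
        ... | z ∷ _ = subst (λ B → length (filter (λ l → tan? l v) B) + length B ≤ q) eq (Coordinates.bound {z} (subst (z ∈_) (sym eq) (here refl)))

        length-A : length A + 2 ≡ n c
        length-A = begin
          length A + 2 ≡⟨ cong₂ _+_ (∑-filter member? (allFin k)) (sym (cong₂ _+_ (Finite.once (finFinite k) i) (Finite.once (finFinite k) j))) ⟩
          Sk (λ l → 𝟙 (member? l)) + (Sk (λ l → 𝟙 (l Fin.≟ i)) + Sk (λ l → 𝟙 (l Fin.≟ j)))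
            ≡⟨ trans (cong (Sk (λ l → 𝟙 (member? l)) +_) (sym (∑-+ (allFin k) _ _))) (sym (∑-+ (allFin k) _ _)) ⟩
          Sk (λ l → 𝟙 (member? l) + (𝟙 (l Fin.≟ i) + 𝟙 (l Fin.≟ j))) ≡⟨ ∑-cong (allFin k) each ⟩
          n c ∎
          where
          open ≡-Reasoning
          each : ∀ l → 𝟙 (member? l) + (𝟙 (l Fin.≟ i) + 𝟙 (l Fin.≟ j)) ≡ 𝟙 (on? c l)
          each l with l Fin.≟ i | l Fin.≟ j
          ... | yes refl | yes refl = ⊥-elim (i≢j refl)
          ... | yes refl | no _ = sym (𝟙-yes (on? c l) ci)
          ... | no _ | yes refl = sym (𝟙-yes (on? c l) cj)
          ... | no l≢i | no l≢j = trans (ℕ.+-identityʳ _) (𝟙-iff ((yes l≢i ×-dec yes l≢j) ×-dec on? c l) (on? c l) proj₂ (λ h → (l≢i , l≢j) , h))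

        length-E : length E ≡ Sk (λ l → 𝟙 (on? c l) * 𝟙 (tan? l v))
        length-E = trans (∑-filter (λ l → tan? l v) A) (trans (∑-filter-* member? (allFin k) _) (∑-cong (allFin k) each))
          where
          each : ∀ l → 𝟙 (member? l) * 𝟙 (tan? l v) ≡ 𝟙 (on? c l) * 𝟙 (tan? l v)
          each l = trans (sym (𝟙-× (member? l) (tan? l v))) (trans (𝟙-iff (member? l ×-dec tan? l v) (on? c l ×-dec tan? l v)
            (λ ((_ , h) , t) → h , t) (λ (h , t) → (((λ { refl → ¬tan-i t }) , (λ { refl → ¬tan-j t })) , h) , t)) (𝟙-× (on? c l) (tan? l v)))

        plane-bound : Sk (λ l → 𝟙 (on? c l) * 𝟙 (tan? l v)) + n c ≤ q + 2
        plane-bound = subst₂ (λ y z → y + z ≤ q + 2) length-E length-A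
          (subst (_≤ q + 2) (ℕ.+-assoc (length E) (length A) 2) (ℕ.+-monoˡ-≤ 2 bound))

      -- `plane-bound` is added over the planes through the secant. A tangent through `v` touches
      -- the cap at a third point and so lies in exactly one of these planes.
      x≤t : x v ≤ t
      x≤t = p*-cancel-≤ p≢0 (arith k t {p} {q} {x v} (ℕ.≤-trans (ℕ.≤-reflexive lhs) (ℕ.≤-trans (∑-mono V.elems each) (ℕ.≤-reflexive rhs))) (k+t i))
        where
        us = P i ∷ P j ∷ []
        open ≡-Reasoning
        each : ∀ c → 𝟙 (plane? us c) * (Sk (λ l → 𝟙 (on? c l) * 𝟙 (tan? l v)) + n c) ≤ 𝟙 (plane? us c) * (q + 2)
        each c = 𝟙*-≤ (plane? us c) (λ (c≢𝟎 , e) → plane-bound c≢𝟎 (Vec.∷-injectiveˡ e) (Vec.∷-injectiveˡ (Vec.∷-injectiveʳ e)))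
        through : ∀ l → planes (P l ∷ us) * 𝟙 (tan? l v) ≡ p * 𝟙 (tan? l v)
        through l = trans (ℕ.*-comm (planes (P l ∷ us)) _) (trans (𝟙*-cong (tan? l v) (λ h →
          planes₃ (ind₃ l i j (λ { refl → ¬tan-i h }) (λ { refl → ¬tan-j h }) i≢j))) (ℕ.*-comm (𝟙 (tan? l v)) p))
        rhs : SV (λ c → 𝟙 (plane? us c) * (q + 2)) ≡ p * (q + 1) * (q + 2)
        rhs = trans (∑-*ʳ V.elems (q + 2) _) (cong (_* (q + 2)) (planes₂ (ind₂ i j i≢j)))
        lhs : p * x v + (k * p + 2 * (p * q)) ≡ SV (λ c → 𝟙 (plane? us c) * (Sk (λ l → 𝟙 (on? c l) * 𝟙 (tan? l v)) + n c))
        lhs = sym (begin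
          SV (λ c → 𝟙 (plane? us c) * (Sk (λ l → 𝟙 (on? c l) * 𝟙 (tan? l v)) + n c))
            ≡⟨ trans (∑-cong V.elems (λ c → ℕ.*-distribˡ-+ (𝟙 (plane? us c)) _ _)) (∑-+ V.elems _ _) ⟩
          SV (λ c → 𝟙 (plane? us c) * Sk (λ l → 𝟙 (on? c l) * 𝟙 (tan? l v))) + SV (λ c → 𝟙 (plane? us c) * n c)
            ≡⟨ cong₂ _+_ (trans (∑-cong V.elems (λ c → trans (sym (∑-*ˡ (allFin k) (𝟙 (plane? us c)) _)) (∑-cong (allFin k) (λ l → trans (sym (ℕ.*-assoc (𝟙 (plane? us c)) _ _)) (cong (_* 𝟙 (tan? l v)) (plane-∷ us l c))))))
                 (trans (∑-swap V.elems (allFin k) _) (trans (∑-cong (allFin k) (λ l → trans (∑-*ʳ V.elems (𝟙 (tan? l v)) _) (through l))) (∑-*ˡ (allFin k) p _)))) (secant-n i≢j) ⟩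
          p * x v + (k * p + 2 * (p * q)) ∎)
        arith : ∀ k t {p q z} → p * z + (k * p + 2 * (p * q)) ≤ p * (q + 1) * (q + 2) → k + t ≡ q * q + q + 2 → p * z ≤ p * t
        arith k t {p} {q} {z} h e = lin (ℕ.+-mono-≤ h (ℕ.≤-reflexive (cong (p *_) (sym e)))) 0 (ring p q k t z)
          where
          ring : ∀ p q k t z → p * z + (p * (q + 1) * (q + 2) + p * (k + t)) + 0 ≡ p * t + (p * z + (k * p + 2 * (p * q)) + p * (q * q + q + 2))
          ring = solveℕ 5 (λ p q k t z → p :*: z :+: (p :*: (q :+: κ 1) :*: (q :+: κ 2) :+: p :*: (k :+: t)) :+: κ 0 :=: p :*: t :+: (p :*: z :+: (k :*: p :+: κ 2 :*: (p :*: q)) :+: p :*: (q :*: q :+: q :+: κ 2))) refl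

    -- Complete caps and the inequality for a plane.

    module CompleteCaps (complete : Complete K C) where

      onK? : ∀ v → Dec (∃ λ i → Span (P i ∷ []) v)
      onK? v = Finite.search (finFinite k) (λ i → span? (P i ∷ []) v)

      x-onK : ∀ {v} → (∃ λ i → Span (P i ∷ []) v) → x v ≡ 0
      x-onK {v} (i , s) = trans (∑-cong (allFin k) (λ j → 𝟙-no (tan? j v) (none j))) (∑-0 (allFin k))
        where
        none : ∀ j → ¬ Tan j v
        none j h with i Fin.≟ j
        ... | yes refl = Tan⇒∉ h s
        ... | no i≢j   = let α , e = span₁⁻ s in h i i≢j (span₂ 0# α (trans e (sym (trans (cong (_⊕ α • P i) (0• (P j))) (⊕-identityˡ _)))))

      x≤t : ∀ v → x v ≤ t
      x≤t v with onK? v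
      ... | yes on = ℕ.≤-trans (ℕ.≤-reflexive (x-onK on)) z≤n
      ... | no off with complete v (λ i s → off (i , s))
      ...   | i , j , i≢j , s with span₂⁻ s
      ...     | α , β , e = OnSecant.x≤t i≢j α≢0 β≢0 e
        where
        α≢0 : α ≢ 0#
        α≢0 refl = off (j , span₁ β (trans e (trans (cong (_⊕ β • P j) (0• (P i))) (⊕-identityˡ _))))
        β≢0 : β ≢ 0#
        β≢0 refl = off (i , span₁ α (trans e (trans (cong (α • P i ⊕_) (0• (P j))) (⊕-identityʳ _))))

      span₁-count : ∀ {u} → Ind (u ∷ []) → SV (λ v → 𝟙 (span? (u ∷ []) v)) ≡ q
      span₁-count ind = trans (∑-cong V.elems (λ v → sym (ℕ.*-identityʳ _))) (trans (S-span ind (λ _ → 1)) (trans (∑-1 V.elems) (trans (size-finV 1) (ℕ.*-identityʳ q))))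

      -- Every cap point of the plane contributes q multiples. These sets meet only in the zero
      -- vector, which the left side counts n a + 1 times in all and the right side at least as
      -- often.
      onK-count : ∀ a → Fin k → n a * q + 1 ≤ SV (λ v → 𝟙 (dot a v ≟ 0#) * 𝟙 (onK? v)) + n a
      onK-count a i₀ = begin
        n a * q + 1 ≡⟨ cong₂ _+_ points (sym (V.once 𝟎)) ⟩
        SV (λ v → Sk (λ i → 𝟙 (on? a i) * 𝟙 (span? (P i ∷ []) v))) + SV (λ v → 𝟙 (v V.≟ 𝟎)) ≡⟨ ∑-+ V.elems _ _ ⟨
        SV (λ v → Sk (λ i → 𝟙 (on? a i) * 𝟙 (span? (P i ∷ []) v)) + 𝟙 (v V.≟ 𝟎)) ≤⟨ ∑-mono V.elems each ⟩
        SV (λ v → 𝟙 (dot a v ≟ 0#) * 𝟙 (onK? v) + 𝟙 (v V.≟ 𝟎) * n a)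
          ≡⟨ trans (∑-+ V.elems _ _) (cong (SV (λ v → 𝟙 (dot a v ≟ 0#) * 𝟙 (onK? v)) +_) (V.S-single 𝟎 (λ _ → n a))) ⟩
        SV (λ v → 𝟙 (dot a v ≟ 0#) * 𝟙 (onK? v)) + n a ∎
        where
        open ℕ.≤-Reasoning
        points : n a * q ≡ SV (λ v → Sk (λ i → 𝟙 (on? a i) * 𝟙 (span? (P i ∷ []) v)))
        points = trans (sym (∑-*ʳ (allFin k) q _)) (trans (∑-cong (allFin k) (λ i → trans (cong (𝟙 (on? a i) *_) (sym (span₁-count (ind₁ i)))) (sym (∑-*ˡ V.elems (𝟙 (on? a i)) _)))) (∑-swap (allFin k) V.elems _))
        each : ∀ v → Sk (λ i → 𝟙 (on? a i) * 𝟙 (span? (P i ∷ []) v)) + 𝟙 (v V.≟ 𝟎) ≤ 𝟙 (dot a v ≟ 0#) * 𝟙 (onK? v) + 𝟙 (v V.≟ 𝟎) * n a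
        each v with v V.≟ 𝟎
        ... | yes refl = ℕ.≤-trans (ℕ.+-monoˡ-≤ 1 (∑-mono (allFin k) (λ i → ℕ.≤-trans (ℕ.*-monoʳ-≤ (𝟙 (on? a i)) (𝟙-≤1 (span? (P i ∷ []) 𝟎))) (ℕ.≤-reflexive (ℕ.*-identityʳ _)))))
          (ℕ.≤-reflexive (trans (ℕ.+-comm (n a) 1) (cong₂ _+_ (sym (cong₂ _*_ (𝟙-yes (dot a 𝟎 ≟ 0#) (dot-𝟎 a)) (𝟙-yes (onK? 𝟎) (i₀ , span₁ 0# (sym (0• (P i₀))))))) (sym (ℕ.*-identityˡ (n a))))))
        ... | no v≢𝟎 = subst₂ _≤_ (sym (ℕ.+-identityʳ _)) (sym (ℕ.+-identityʳ _)) bound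
          where
          both? : ∀ i → Dec (dot a (P i) ≡ 0# × Span (P i ∷ []) v)
          both? i = on? a i ×-dec span? (P i ∷ []) v
          uniq : ∀ i j → dot a (P i) ≡ 0# × Span (P i ∷ []) v → dot a (P j) ≡ 0# × Span (P j ∷ []) v → i ≡ j
          uniq i j (_ , s) (_ , s′) with i Fin.≟ j
          ... | yes e = e
          ... | no i≢j = let α , e = span₁⁻ s ; β , e′ = span₁⁻ s′ in ⊥-elim (v≢𝟎 (trans e (trans (cong (_• P i) (Vec.∷-injectiveˡ
                  (ind₂ i j i≢j (α ∷ β ∷ []) (trans (cong₂ _⊕_ (sym e) (trans (⊕-identityʳ _) (sym e′))) (⊕-self v))))) (0• (P i)))))
          bound : Sk (λ i → 𝟙 (on? a i) * 𝟙 (span? (P i ∷ []) v)) ≤ 𝟙 (dot a v ≟ 0#) * 𝟙 (onK? v)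
          bound with Finite.search (finFinite k) both?
          ... | yes (i , ai , s) = ℕ.≤-trans (ℕ.≤-reflexive (∑-cong (allFin k) (λ i → sym (𝟙-× (on? a i) (span? (P i ∷ []) v))))) (ℕ.≤-trans (Finite.S-atMost (finFinite k) both? uniq)
              (ℕ.≤-reflexive (sym (cong₂ _*_ (𝟙-yes (dot a v ≟ 0#) av) (𝟙-yes (onK? v) (i , s))))))
            where
            av : dot a v ≡ 0#
            av = let α , e = span₁⁻ s in trans (cong (dot a) e) (trans (dot-• α a (P i)) (trans (cong (α ·_) ai) (zeroʳ α)))
          ... | no ¬∃ = ℕ.≤-trans (ℕ.≤-reflexive (trans (∑-cong (allFin k) (λ i → trans (sym (𝟙-× (on? a i) (span? (P i ∷ []) v))) (𝟙-no (both? i) (λ b → ¬∃ (i , b))))) (∑-0 (allFin k)))) z≤n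

      -- Each point off the cap lies on at most t tangents; summed over the points of a plane.
      plane-inequality : ∀ {a} → a ≢ 𝟎 → Fin k → n a * (q * s a) + t ≤ t * t
      plane-inequality {a} a≢𝟎 i₀ = arith (n a) (s a) k t q≡1+p p≢0 (plane-sum a≢𝟎) sum (onK-count a i₀) (k+t i₀)
        where
        X = SV (λ v → 𝟙 (dot a v ≟ 0#) * x v)
        Y = SV (λ v → 𝟙 (dot a v ≟ 0#) * 𝟙 (onK? v))
        each : ∀ v → 𝟙 (dot a v ≟ 0#) * x v + 𝟙 (dot a v ≟ 0#) * 𝟙 (onK? v) * t ≤ 𝟙 (dot a v ≟ 0#) * t
        each v = subst (_≤ 𝟙 (dot a v ≟ 0#) * t) (factor (𝟙 (dot a v ≟ 0#)) (x v) (𝟙 (onK? v)) t) (ℕ.*-monoʳ-≤ (𝟙 (dot a v ≟ 0#)) point)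
          where
          factor : ∀ o x y t → o * (x + y * t) ≡ o * x + o * y * t
          factor = solveℕ 4 (λ o x y t → o :*: (x :+: y :*: t) :=: o :*: x :+: o :*: y :*: t) refl
          point : x v + 𝟙 (onK? v) * t ≤ t
          point with onK? v
          ... | yes on = ℕ.≤-reflexive (trans (cong (_+ (t + 0)) (x-onK on)) (ℕ.+-identityʳ t))
          ... | no _   = subst (_≤ t) (sym (ℕ.+-identityʳ (x v))) (x≤t v)
        sum : X + Y * t ≤ q * (q * q) * t
        sum = subst₂ _≤_ (trans (∑-+ V.elems _ _) (cong (X +_) (∑-*ʳ V.elems t _))) (trans (∑-*ʳ V.elems t _) (cong (_* t) (planeSize a≢𝟎))) (∑-mono V.elems each)
        arith : ∀ n s k t {q p X Y} → q ≡ suc p → p ≢ 0 → X + n * (p * t) ≡ n * (q * p * s) + k * (p * t) →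
          X + Y * t ≤ q * (q * q) * t → n * q + 1 ≤ Y + n → k + t ≡ q * q + q + 2 → n * (q * s) + t ≤ t * t
        arith n s k t {p = p} {X} {Y} refl p≢0 e le le′ e′ = p*-cancel-≤ p≢0
          (lin (ℕ.+-mono-≤ (ℕ.≤-reflexive (sym e)) (ℕ.+-mono-≤ le (ℕ.+-mono-≤ (ℕ.*-monoˡ-≤ t le′) (ℕ.≤-reflexive (cong (p * t *_) (sym e′)))))) 0 (ring n s k t p X Y))
          where
          ring : ∀ n s k t p X Y → p * (n * (suc p * s) + t) + (X + n * (p * t) + (suc p * (suc p * suc p) * t + ((Y + n) * t + p * t * (k + t)))) + 0 ≡
            p * (t * t) + (n * (suc p * p * s) + k * (p * t) + (X + Y * t + ((n * suc p + 1) * t + p * t * (suc p * suc p + suc p + 2))))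
          ring = solveℕ 7 (λ n s k t p X Y → p :*: (n :*: ((κ 1 :+: p) :*: s) :+: t) :+: (X :+: n :*: (p :*: t) :+: ((κ 1 :+: p) :*: ((κ 1 :+: p) :*: (κ 1 :+: p)) :*: t :+: ((Y :+: n) :*: t :+: p :*: t :*: (k :+: t)))) :+: κ 0 :=: p :*: (t :*: t) :+: (n :*: ((κ 1 :+: p) :*: p :*: s) :+: k :*: (p :*: t) :+: (X :+: Y :*: t :+: ((n :*: (κ 1 :+: p) :+: κ 1) :*: t :+: p :*: t :*: ((κ 1 :+: p) :*: (κ 1 :+: p) :+: (κ 1 :+: p) :+: κ 2))))) refl

      -- The planes with few cap points.

      module SmallDeficit (h : ℕ) (q≡2h : q ≡ 2 * h) (8≤q : 8 ≤ q) (t-small : (t + 3) * (t + 3) ≤ 5 * (q * q)) (t-large : q + 2 ≤ t) where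
        open Numbers

        t+10≤3q : t + 10 ≤ 3 * q
        t+10≤3q = t-bound 8≤q t-small

        few-or-many : ∀ {a} → a ≢ 𝟎 → Fin k → n a ≤ 4 ⊎ s a ≤ 4
        few-or-many {a} a≢𝟎 i with n a ℕ.≤? 4 | s a ℕ.≤? 4
        ... | yes le | _      = inj₁ le
        ... | no _   | yes le = inj₂ le
        ... | no n≰4 | no s≰4 = ⊥-elim (no-middle-plane h q t q≡2h 8≤q t-small
          (ℕ.≤-trans (ℕ.+-monoˡ-≤ t (ℕ.≤-trans (ℕ.*-monoʳ-≤ q (product≥ {q} {n a} {s a} (ℕ.≰⇒> n≰4) (ℕ.≰⇒> s≰4) (n+s a≢𝟎))) (ℕ.≤-reflexive (swap q (n a) (s a))))) (plane-inequality a≢𝟎 i)))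
          where
          swap : ∀ a b c → a * (b * c) ≡ b * (a * c)
          swap = solveℕ 3 (λ a b c → a :*: (b :*: c) :=: b :*: (a :*: c)) refl

        record Small (i : Fin k) (a : V4) : Set where
          constructor mkSmall
          field
            a≢𝟎 : a ≢ 𝟎
            ai  : dot a (P i) ≡ 0#
            n≤4 : n a ≤ 4
        open Small

        Σx≤ : ∀ (f : F → V4) → Sf (λ λ′ → x (f λ′)) ≤ q * t
        Σx≤ f = ℕ.≤-trans (∑-mono (Finite.elems finite) (λ λ′ → x≤t (f λ′))) (ℕ.≤-reflexive (∑-const (Finite.elems finite) t))

        opaque
          -- Otherwise s ≤ 4 and hence m ≥ q - 3 in every plane through the tangent. Then
          -- `tangent-sum` and `tangent-s` give q + (q - 3)(q + t) ≤ q t, which is q² ≤ 2q + 3t.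
          small-through : ∀ {i v} → Tan i v → ∃ λ a → Small i a × dot a v ≡ 0#
          small-through {i} {v} tan with V.search (λ c → plane? (v ∷ P i ∷ []) c ×-dec (n c ℕ.≤? 4))
          ... | yes (c , (c≢𝟎 , e) , le) = c , mkSmall c≢𝟎 (Vec.∷-injectiveˡ (Vec.∷-injectiveʳ e)) le , Vec.∷-injectiveˡ e
          ... | no ¬∃ = ⊥-elim (q²-bound {q} {t} 8≤q t-small (arith {q} {p} {t} {X = SV (λ c → 𝟙 (plane? us c) * (m i c * s c))} q≡1+p p≢0 (OnTangent.tangent-sum tan) (Σx≤ Q) sum))
            where
            Q : F → V4
            Q = OnTangent.Q tan
            us : Vec V4 2
            us = OnTangent.us tan
            each : ∀ c → 𝟙 (plane? us c) * (q * s c) ≤ 𝟙 (plane? us c) * (m i c * s c + 3 * s c)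
            each c = 𝟙*-≤ (plane? us c) λ (c≢𝟎 , e) → case (few-or-many c≢𝟎 i) (λ le → ⊥-elim (¬∃ (c , (c≢𝟎 , e) , le)))
              (λ le → ℕ.≤-trans (ℕ.*-monoˡ-≤ (s c) (lin {1 + q + s c} {m i c + s c + 4} {q} {m i c + 3}
                  (subst (λ z → 1 + q + s c ≤ z + 4) (sym (m+s c≢𝟎 (Vec.∷-injectiveˡ (Vec.∷-injectiveʳ e)))) (ℕ.≤-trans (ℕ.+-monoʳ-≤ (1 + q) le) (ℕ.≤-reflexive (cong (_+ 4) (ℕ.+-comm 1 q)))))
                  0 (ring (m i c) (s c) q))) (ℕ.≤-reflexive (ℕ.*-distribʳ-+ (s c) (m i c) 3)))
              where
              case : ∀ {A B : Set} {D : Set} → A ⊎ B → (A → D) → (B → D) → D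
              case (inj₁ a) f g = f a
              case (inj₂ b) f g = g b
              ring : ∀ m s q → q + (m + s + 4) + 0 ≡ m + 3 + (1 + q + s)
              ring = solveℕ 3 (λ m s q → q :+: (m :+: s :+: κ 4) :+: κ 0 :=: m :+: κ 3 :+: (κ 1 :+: q :+: s)) refl
            sum : q * (p * (q + t)) ≤ SV (λ c → 𝟙 (plane? us c) * (m i c * s c)) + 3 * (p * (q + t))
            sum = subst₂ _≤_ (trans (∑-cong V.elems (λ c → swap (𝟙 (plane? us c)) q (s c))) (trans (∑-*ˡ V.elems q _) (cong (q *_) (tangent-s tan))))
              (trans (∑-cong V.elems (λ c → expand (𝟙 (plane? us c)) (m i c * s c) (s c))) (trans (∑-+ V.elems _ _) (cong (SV (λ c → 𝟙 (plane? us c) * (m i c * s c)) +_) (trans (∑-*ˡ V.elems 3 _) (cong (3 *_) (tangent-s tan))))))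
              (∑-mono V.elems each)
              where
              swap : ∀ a b c → a * (b * c) ≡ b * (a * c)
              swap = solveℕ 3 (λ a b c → a :*: (b :*: c) :=: b :*: (a :*: c)) refl
              expand : ∀ a b c → a * (b + 3 * c) ≡ a * b + 3 * (a * c)
              expand = solveℕ 3 (λ a b c → a :*: (b :+: κ 3 :*: c) :=: a :*: b :+: κ 3 :*: (a :*: c)) refl
            arith : ∀ {q p t X S} → q ≡ suc p → p ≢ 0 → p * S ≡ p * q + X → S ≤ q * t → q * (p * (q + t)) ≤ X + 3 * (p * (q + t)) → q * q ≤ 2 * q + 3 * t
            arith {q} {p} {t} {X} {S} _ p≢0 e le le′ = p*-cancel-≤ p≢0 (lin (ℕ.+-mono-≤ (ℕ.≤-reflexive (sym e)) (ℕ.+-mono-≤ (ℕ.*-monoʳ-≤ p le) le′)) 0 (ring q p t X S))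
              where
              ring : ∀ q p t X S → p * (q * q) + (p * S + (p * (q * t) + (X + 3 * (p * (q + t))))) + 0 ≡
                p * (2 * q + 3 * t) + (p * q + X + (p * S + q * (p * (q + t))))
              ring = solveℕ 5 (λ q p t X S → p :*: (q :*: q) :+: (p :*: S :+: (p :*: (q :*: t) :+: (X :+: κ 3 :*: (p :*: (q :+: t))))) :+: κ 0 :=: p :*: (κ 2 :*: q :+: κ 3 :*: t) :+: (p :*: q :+: X :+: (p :*: S :+: q :*: (p :*: (q :+: t))))) refl

        on : V4 → V4 → ℕ
        on a v = 𝟙 (dot a v ≟ 0#)

        -- For two different planes through `P i` this is q p or zero, according to whether their
        -- common line is a tangent at `P i`.
        J : Fin k → V4 → V4 → ℕ
        J i a b = SV (λ v → on a v * on b v * 𝟙 (tan? i v))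

        line-size : ∀ {a b} → Ind (a ∷ b ∷ []) → SV (λ v → on a v * on b v) ≡ q * q
        line-size {a} {b} ind = trans (∑-cong V.elems (λ v → trans (sym (𝟙-× (dot a v ≟ 0#) (dot b v ≟ 0#))) (𝟙-iff ((dot a v ≟ 0#) ×-dec (dot b v ≟ 0#)) (ann? (a ∷ b ∷ []) v)
          (λ (e , e′) → cong₂ (λ y z → y ∷ z ∷ []) (trans (dot-comm v a) e) (trans (dot-comm v b) e′))
          (λ e → trans (dot-comm a v) (Vec.∷-injectiveˡ e) , trans (dot-comm b v) (Vec.∷-injectiveˡ (Vec.∷-injectiveʳ e)))))) (annSize₂ ind)

        perp-span₁ : ∀ {a u v} → dot a u ≡ 0# → Span (u ∷ []) v → dot a v ≡ 0#
        perp-span₁ {a} {u} au sp = let α , e = span₁⁻ sp in trans (cong (dot a) e) (trans (dot-• α a u) (trans (cong (α ·_) au) (zeroʳ α)))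

        line-point : ∀ {i a b} → dot a (P i) ≡ 0# → dot b (P i) ≡ 0# → SV (λ v → on a v * on b v * 𝟙 (span? (P i ∷ []) v)) ≡ q
        line-point {i} {a} {b} ai bi = trans (∑-cong V.elems (λ v → each v)) (span₁-count (ind₁ i))
          where
          each : ∀ v → on a v * on b v * 𝟙 (span? (P i ∷ []) v) ≡ 𝟙 (span? (P i ∷ []) v)
          each v with span? (P i ∷ []) v
          ... | yes sp = cong₂ (λ y z → y * z * 1) (𝟙-yes (dot a v ≟ 0#) (perp-span₁ ai sp)) (𝟙-yes (dot b v ≟ 0#) (perp-span₁ bi sp))
          ... | no _   = ℕ.*-zeroʳ (on a v * on b v)

        q²≡ : q * q ≡ q * p + q
        q²≡ = arith q≡1+p
          where
          arith : ∀ {q p} → q ≡ suc p → q * q ≡ q * p + q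
          arith {p = p} refl = ring p
            where
            ring : ∀ p → suc p * suc p ≡ suc p * p + suc p
            ring = solveℕ 1 (λ p → (κ 1 :+: p) :*: (κ 1 :+: p) :=: (κ 1 :+: p) :*: p :+: (κ 1 :+: p)) refl

        J≤ : ∀ {i a b} → Ind (a ∷ b ∷ []) → dot a (P i) ≡ 0# → dot b (P i) ≡ 0# → J i a b ≤ q * p
        J≤ {i} {a} {b} ind ai bi = ℕ.+-cancelʳ-≤ q _ _ (subst₂ _≤_ (trans (∑-+ V.elems _ _) (cong (J i a b +_) (line-point ai bi))) (trans (line-size ind) q²≡) (∑-mono V.elems each))
          where
          each : ∀ v → on a v * on b v * 𝟙 (tan? i v) + on a v * on b v * 𝟙 (span? (P i ∷ []) v) ≤ on a v * on b v
          each v = ℕ.≤-trans (ℕ.≤-reflexive (sym (ℕ.*-distribˡ-+ (on a v * on b v) _ _))) (ℕ.≤-trans (ℕ.*-monoʳ-≤ (on a v * on b v) excl) (ℕ.≤-reflexive (ℕ.*-identityʳ _)))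
            where
            excl : 𝟙 (tan? i v) + 𝟙 (span? (P i ∷ []) v) ≤ 1
            excl with tan? i v | span? (P i ∷ []) v
            ... | yes tn | yes sp = ⊥-elim (Tan⇒∉ tn sp)
            ... | yes _ | no _ = s≤s z≤n
            ... | no _ | yes _ = s≤s z≤n
            ... | no _ | no _ = z≤n

        s≡ : ∀ {i a} → Small i a → q ≤ s a + 2
        s≡ {i} {a} sm = lin {n a} {4} (n≤4 sm) 0 (trans (ring q) (trans (cong (_+ 2) (sym (n+s (a≢𝟎 sm)))) (ring′ (n a) (s a))))
          where
          ring : ∀ q → q + 4 + 0 ≡ q + 2 + 2
          ring = solveℕ 1 (λ q → q :+: κ 4 :+: κ 0 :=: q :+: κ 2 :+: κ 2) refl
          ring′ : ∀ n s → n + s + 2 ≡ s + 2 + n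
          ring′ = solveℕ 2 (λ n s → n :+: s :+: κ 2 :=: s :+: κ 2 :+: n) refl

        qp-cancel-≤ : ∀ {a b} → q * p * a ≤ q * p * b → a ≤ b
        qp-cancel-≤ = p*-cancel-≤ (qp≢0 q≡1+p p≢0)

        -- Each of the planes contains at least q - 2 tangents at `P i`, and two planes share at
        -- most one. This gives 3 (q - 2) ≤ t + 3, against t + 10 ≤ 3q.
        three-small : ∀ {i a b c} → Small i a → Small i b → Small i c → Ind (a ∷ b ∷ []) → Ind (a ∷ c ∷ []) → Ind (b ∷ c ∷ []) → ⊥
        three-small {i} {a} {b} {c} A B C ab ac bc = ℕ.1+n≰n (lin {x = 1} {y = 0} (ℕ.+-mono-≤ count (ℕ.+-mono-≤ t+10≤3q (ℕ.+-mono-≤ (s≡ A) (ℕ.+-mono-≤ (s≡ B) (s≡ C))))) 0 (ring q (s a) (s b) (s c) t))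
          where
          each : ∀ v → on a v * 𝟙 (tan? i v) + on b v * 𝟙 (tan? i v) + on c v * 𝟙 (tan? i v) ≤
            𝟙 (tan? i v) + (on a v * on b v * 𝟙 (tan? i v) + on a v * on c v * 𝟙 (tan? i v) + on b v * on c v * 𝟙 (tan? i v))
          each v with dot a v ≟ 0# | dot b v ≟ 0# | dot c v ≟ 0# | tan? i v
          ... | w₁ | w₂ | w₃ | no _ = ℕ.≤-reflexive (zeros (𝟙 w₁) (𝟙 w₂) (𝟙 w₃))
            where
            zeros : ∀ a b c → a * 0 + b * 0 + c * 0 ≡ 0 + (a * b * 0 + a * c * 0 + b * c * 0)
            zeros = solveℕ 3 (λ a b c → a :*: κ 0 :+: b :*: κ 0 :+: c :*: κ 0 :=: κ 0 :+: (a :*: b :*: κ 0 :+: a :*: c :*: κ 0 :+: b :*: c :*: κ 0)) refl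
          ... | yes _ | yes _ | yes _ | yes _ = ℕ.n≤1+n 3
          ... | yes _ | yes _ | no _  | yes _ = ℕ.≤-refl
          ... | yes _ | no _  | yes _ | yes _ = ℕ.≤-refl
          ... | no _  | yes _ | yes _ | yes _ = ℕ.≤-refl
          ... | yes _ | no _  | no _  | yes _ = ℕ.≤-refl
          ... | no _  | yes _ | no _  | yes _ = ℕ.≤-refl
          ... | no _  | no _  | yes _ | yes _ = ℕ.≤-refl
          ... | no _  | no _  | no _  | yes _ = z≤n
          sums : tanCount i a + tanCount i b + tanCount i c ≤ tangents i + (J i a b + J i a c + J i b c)
          sums = subst₂ _≤_ (trans (∑-+ V.elems _ _) (cong (_+ tanCount i c) (∑-+ V.elems _ _)))
            (trans (∑-+ V.elems _ _) (cong (tangents i +_) (trans (∑-+ V.elems _ _) (cong (_+ J i b c) (∑-+ V.elems _ _))))) (∑-mono V.elems each)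
          count : s a + s b + s c ≤ t + 3
          count = qp-cancel-≤ (begin
            q * p * (s a + s b + s c) ≡⟨ dist (q * p) (s a) (s b) (s c) ⟩
            q * p * s a + q * p * s b + q * p * s c ≡⟨ cong₂ _+_ (cong₂ _+_ (tanCount-on i (a≢𝟎 A) (ai A)) (tanCount-on i (a≢𝟎 B) (ai B))) (tanCount-on i (a≢𝟎 C) (ai C)) ⟨
            tanCount i a + tanCount i b + tanCount i c ≤⟨ sums ⟩
            tangents i + (J i a b + J i a c + J i b c) ≤⟨ ℕ.+-mono-≤ (ℕ.≤-reflexive (tangents≡ i)) (ℕ.+-mono-≤ (ℕ.+-mono-≤ (J≤ ab (ai A) (ai B)) (J≤ ac (ai A) (ai C))) (J≤ bc (ai B) (ai C))) ⟩
            q * p * t + (q * p + q * p + q * p) ≡⟨ collect (q * p) t ⟩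
            q * p * (t + 3) ∎)
            where
            open ℕ.≤-Reasoning
            dist : ∀ r a b c → r * (a + b + c) ≡ r * a + r * b + r * c
            dist = solveℕ 4 (λ r a b c → r :*: (a :+: b :+: c) :=: r :*: a :+: r :*: b :+: r :*: c) refl
            collect : ∀ r t → r * t + (r + r + r) ≡ r * (t + 3)
            collect = solveℕ 2 (λ r t → r :*: t :+: (r :+: r :+: r) :=: r :*: (t :+: κ 3)) refl
          ring : ∀ q a b c t → 1 + (t + 3 + (3 * q + (a + 2 + (b + 2 + (c + 2))))) + 0 ≡ 0 + (a + b + c + (t + 10 + (q + (q + q))))
          ring = solveℕ 5 (λ q a b c t → κ 1 :+: (t :+: κ 3 :+: (κ 3 :*: q :+: (a :+: κ 2 :+: (b :+: κ 2 :+: (c :+: κ 2))))) :+: κ 0 :=: κ 0 :+: (a :+: b :+: c :+: (t :+: κ 10 :+: (q :+: (q :+: q))))) refl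

        separated : ∀ {a b v} → a ≢ 𝟎 → dot a v ≡ 0# → dot b v ≢ 0# → Ind (b ∷ a ∷ [])
        separated {a} {b} {v} a≢𝟎 av bv = Ind-∷ (Ind-nonzero a≢𝟎) (λ sp → let γ , e = span₁⁻ sp in
          bv (trans (cong (λ z → dot z v) e) (trans (dot-comm _ v) (trans (dot-• γ v a) (trans (cong (γ ·_) (trans (dot-comm v a) av)) (zeroʳ γ))))))

        record Two (i : Fin k) (a b : V4) : Set where
          constructor mkTwo
          field
            sa    : Small i a
            sb    : Small i b
            ind   : Ind (a ∷ b ∷ [])
            cover : ∀ v → Tan i v → dot a v ≡ 0# ⊎ dot b v ≡ 0#
        open Two

        Two-sym : ∀ {i a b} → Two i a b → Two i b a
        Two-sym T = mkTwo (sb T) (sa T) (Ind-swap (ind T)) (λ v tn → flip (cover T v tn))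
          where
          flip : ∀ {A B : Set} → A ⊎ B → B ⊎ A
          flip (inj₁ x) = inj₂ x
          flip (inj₂ y) = inj₁ y

        s≤q+1 : ∀ {i a} → a ≢ 𝟎 → dot a (P i) ≡ 0# → s a ≤ q + 1
        s≤q+1 {i} {a} a≢𝟎 ai = ℕ.m+n≤o⇒n≤o (m i a) (ℕ.≤-reflexive (m+s a≢𝟎 ai))

        opaque
          -- A plane contains at most q + 1 tangents at `P i`, and `t-large` supplies more than
          -- that.
          tangent-outside : ∀ {i a} → Small i a → ∃ λ v → Tan i v × dot a v ≢ 0#
          tangent-outside {i} {a} A with V.search (λ v → tan? i v ×-dec ¬? (dot a v ≟ 0#))
          ... | yes r = r
          ... | no ¬∃ = ⊥-elim (ℕ.1+n≰n {q + 1} (ℕ.≤-trans (ℕ.≤-trans (ℕ.≤-reflexive (sym (ℕ.+-suc q 1))) t-large) (ℕ.≤-trans (qp-cancel-≤ (begin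
            q * p * t ≡⟨ tangents≡ i ⟨
            tangents i ≤⟨ ∑-mono V.elems each ⟩
            tanCount i a ≡⟨ tanCount-on i (a≢𝟎 A) (ai A) ⟩
            q * p * s a ∎)) (s≤q+1 (a≢𝟎 A) (ai A)))))
            where
            open ℕ.≤-Reasoning
            each : ∀ v → 𝟙 (tan? i v) ≤ on a v * 𝟙 (tan? i v)
            each v with tan? i v | dot a v ≟ 0#
            ... | no _ | _ = z≤n
            ... | yes _ | yes _ = ℕ.≤-refl
            ... | yes tn | no av = ⊥-elim (¬∃ (v , tn , av))

        opaque
          -- A tangent outside `a` lies in a small plane `b`; a tangent outside both would produce a
          -- third small plane.
          second : ∀ {i a} → Small i a → ∃ λ b → Two i a b
          second {i} {a} A =
            let v , tn , av = tangent-outside A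
                b , B , bv = small-through tn
                ab = separated (a≢𝟎 B) bv av
            in b , mkTwo A B ab (λ w tw → covers B ab w tw)
            where
            covers : ∀ {b} → Small i b → Ind (a ∷ b ∷ []) → ∀ w → Tan i w → dot a w ≡ 0# ⊎ dot b w ≡ 0#
            covers {b} B ab w tw with dot a w ≟ 0# | dot b w ≟ 0#
            ... | yes e | _ = inj₁ e
            ... | no _ | yes e = inj₂ e
            ... | no aw | no bw = let c , C , cw = small-through tw in
              ⊥-elim (three-small A B C ab (separated (a≢𝟎 C) cw aw) (separated (a≢𝟎 C) cw bw))

        positive-t : 1 ≤ t
        positive-t = ℕ.≤-trans (ℕ.≤-trans (s≤s z≤n) (ℕ.m≤n+m 2 q)) t-large

        opaque
          some-tangent : ∀ i → ∃ λ v → Tan i v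
          some-tangent i = let v , e = ∑-pos V.elems {λ v → 𝟙 (tan? i v)} (ℕ.≤-trans (ℕ.n≢0⇒n>0 nz) (ℕ.≤-reflexive (sym (tangents≡ i)))) in v , 𝟙-pos (tan? i v) e
            where
            nz : q * p * t ≢ 0
            nz e = ℕ.≢-nonZero⁻¹ (q * p * t) ⦃ ℕ.m*n≢0 (q * p) t ⦃ ℕ.≢-nonZero (qp≢0 q≡1+p p≢0) ⦄ ⦃ ℕ.>-nonZero positive-t ⦄ ⦄ e

        opaque
          two : ∀ i → ∃ λ a → ∃ λ b → Two i a b
          two i = let v , tn = some-tangent i
                      a , A , _ = small-through tn
                  in a , second A

        -- The tangents at `P i` inside `c` also lie in `a` or `b`, so they are among the two lines
        -- that `c` shares with these planes.
        s≤2 : ∀ {i a b c} → Two i a b → c ≢ 𝟎 → dot c (P i) ≡ 0# → ¬ Span (a ∷ []) c → ¬ Span (b ∷ []) c → s c ≤ 2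
        s≤2 {i} {a} {b} {c} T c≢𝟎 ci c∉a c∉b = qp-cancel-≤ (begin
          q * p * s c ≡⟨ tanCount-on i c≢𝟎 ci ⟨
          tanCount i c ≤⟨ ∑-mono V.elems each ⟩
          SV (λ v → on c v * on a v * 𝟙 (tan? i v) + on c v * on b v * 𝟙 (tan? i v)) ≡⟨ ∑-+ V.elems _ _ ⟩
          J i c a + J i c b ≤⟨ ℕ.+-mono-≤ (J≤ (Ind-∷ (Ind-nonzero (a≢𝟎 (sa T))) c∉a) ci (ai (sa T))) (J≤ (Ind-∷ (Ind-nonzero (a≢𝟎 (sb T))) c∉b) ci (ai (sb T))) ⟩
          q * p + q * p ≡⟨ double (q * p) ⟩
          q * p * 2 ∎)
          where
          open ℕ.≤-Reasoning
          double : ∀ r → r + r ≡ r * 2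
          double = solveℕ 1 (λ r → r :+: r :=: r :*: κ 2) refl
          each : ∀ v → on c v * 𝟙 (tan? i v) ≤ on c v * on a v * 𝟙 (tan? i v) + on c v * on b v * 𝟙 (tan? i v)
          each v with dot c v ≟ 0# | tan? i v
          ... | no _ | _ = z≤n
          ... | yes _ | no _ = z≤n
          ... | yes _ | yes tn with cover T v tn
          ...   | inj₁ e = ℕ.≤-trans (ℕ.≤-reflexive (sym (cong (λ z → (z + 0) * 1) (𝟙-yes (dot a v ≟ 0#) e)))) (ℕ.m≤m+n _ _)
          ...   | inj₂ e = ℕ.≤-trans (ℕ.≤-reflexive (sym (cong (λ z → (z + 0) * 1) (𝟙-yes (dot b v ≟ 0#) e)))) (ℕ.m≤n+m _ _)

        prop? : ∀ (a c : V4) → Dec (c ≢ 𝟎 × Span (a ∷ []) c)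
        prop? a c = ¬? (c V.≟ 𝟎) ×-dec span? (a ∷ []) c

        prop-count : ∀ {a} → a ≢ 𝟎 → SV (λ c → 𝟙 (prop? a c)) ≡ p
        prop-count {a} a≢𝟎 = ℕ.suc-injective (begin
          1 + SV (λ c → 𝟙 (prop? a c)) ≡⟨ cong (_+ SV (λ c → 𝟙 (prop? a c))) (V.once 𝟎) ⟨
          SV (λ c → 𝟙 (c V.≟ 𝟎)) + SV (λ c → 𝟙 (prop? a c)) ≡⟨ ∑-+ V.elems _ _ ⟨
          SV (λ c → 𝟙 (c V.≟ 𝟎) + 𝟙 (prop? a c)) ≡⟨ ∑-cong V.elems each ⟩
          SV (λ c → 𝟙 (span? (a ∷ []) c)) ≡⟨ trans (span₁-count (Ind-nonzero a≢𝟎)) q≡1+p ⟩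
          suc p ∎)
          where
          open ≡-Reasoning
          each : ∀ c → 𝟙 (c V.≟ 𝟎) + 𝟙 (prop? a c) ≡ 𝟙 (span? (a ∷ []) c)
          each c with c V.≟ 𝟎
          ... | yes refl = sym (𝟙-yes (span? (a ∷ []) 𝟎) (span₁ 0# (sym (0• a))))
          ... | no c≢𝟎   = 𝟙-iff (yes c≢𝟎 ×-dec span? (a ∷ []) c) (span? (a ∷ []) c) proj₂ (λ e → c≢𝟎 , e)

        prop⇒ : ∀ {a c v} → Span (a ∷ []) c → dot a v ≡ 0# → dot c v ≡ 0#
        prop⇒ {a} {c} {v} sp av = trans (dot-comm c v) (perp-span₁ (trans (dot-comm v a) av) sp)

        prop⇐ : ∀ {a c v} → c ≢ 𝟎 → Span (a ∷ []) c → dot c v ≡ 0# → dot a v ≡ 0#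
        prop⇐ {a} {c} {v} c≢𝟎 sp cv with span₁⁻ sp
        ... | γ , e = *≡0 γ≢0 (trans (cong (γ ·_) (dot-comm a v)) (trans (sym (dot-• γ v a)) (trans (cong (dot v) (sym e)) (trans (dot-comm v c) cv))))
          where
          γ≢0 : γ ≢ 0#
          γ≢0 refl = c≢𝟎 (trans e (0• a))

        prop-n : ∀ {a c} → c ≢ 𝟎 → Span (a ∷ []) c → n c ≡ n a
        prop-n {a} {c} c≢𝟎 sp = ∑-cong (allFin k) (λ i → 𝟙-iff (on? c i) (on? a i) (prop⇐ c≢𝟎 sp) (prop⇒ sp))

        prop-s : ∀ {a c} → a ≢ 𝟎 → c ≢ 𝟎 → Span (a ∷ []) c → s c ≡ s a
        prop-s {a} {c} a≢𝟎 c≢𝟎 sp = ℕ.+-cancelˡ-≡ (n c) _ _ (trans (n+s c≢𝟎) (trans (sym (n+s a≢𝟎)) (cong (_+ s a) (sym (prop-n c≢𝟎 sp)))))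

        d : V4 → ℕ
        d v = t ∸ x v

        x+d : ∀ v → x v + d v ≡ t
        x+d v = ℕ.m+[n∸m]≡n (x≤t v)

        Sx+Sd : ∀ (f : F → V4) → Sf (λ λ′ → x (f λ′)) + Sf (λ λ′ → d (f λ′)) ≡ q * t
        Sx+Sd f = trans (sym (∑-+ (Finite.elems finite) _ _)) (trans (∑-cong (Finite.elems finite) (λ λ′ → x+d (f λ′))) (∑-const (Finite.elems finite) t))

        q+1≡p+2 : q + 1 ≡ p + 2
        q+1≡p+2 = trans (cong (_+ 1) q≡1+p) (ring p)
          where
          ring : ∀ p → suc p + 1 ≡ p + 2
          ring = solveℕ 1 (λ p → (κ 1 :+: p) :+: κ 1 :=: p :+: κ 2) refl

        -- In `tangent-sum` the plane `a` contributes (q + 1 - s) s. By `s≤2` every other plane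
        -- through the tangent has m ≥ q - 1, and `tangent-s` gives the total of their s. The
        -- resulting lower bound for the sum of `x` leaves only this much room below q t.
        deficiency : ∀ {i a b v} → Two i a b → (tn : Tan i v) → dot a v ≡ 0# → dot b v ≢ 0# →
          Sf (λ λ′ → d (OnTangent.Q tn λ′)) + q * q + 2 * s a ≤ s a * s a + t
        deficiency {i} {a} {b} {v} T tn av bv = arith (s a) t q≡1+p p≢0 (OnTangent.tangent-sum tn) (Sx+Sd Q) sum
          where
          Q : F → V4
          Q = OnTangent.Q tn
          us : Vec V4 2
          us = OnTangent.us tn
          X = SV (λ c → 𝟙 (plane? us c) * (m i c * s c))
          each : ∀ c → 𝟙 (plane? us c) * (p * s c) + 𝟙 (prop? a c) * (2 * s a) ≤ 𝟙 (plane? us c) * (m i c * s c) + 𝟙 (prop? a c) * (s a * s a)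
          each c with prop? a c | plane? us c
          ... | no _ | no _ = z≤n
          ... | yes (c≢𝟎 , sp) | no ¬pl = ⊥-elim (¬pl (c≢𝟎 , cong₂ (λ y z → y ∷ z ∷ []) (prop⇒ sp av) (prop⇒ sp (ai (sa T)))))
          ... | yes (c≢𝟎 , sp) | yes (_ , e) = ℕ.≤-reflexive (subst (λ z → 1 * (p * s c) + 1 * (2 * z) ≡ 1 * (m i c * s c) + 1 * (z * z)) (prop-s (a≢𝟎 (sa T)) c≢𝟎 sp)
              (trans (ring₁ p (s c)) (trans (cong (_* s c) (trans (sym q+1≡p+2) (sym (m+s c≢𝟎 (Vec.∷-injectiveˡ (Vec.∷-injectiveʳ e)))))) (ring₂ (m i c) (s c)))))
            where
            ring₁ : ∀ p s → 1 * (p * s) + 1 * (2 * s) ≡ (p + 2) * s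
            ring₁ = solveℕ 2 (λ p s → κ 1 :*: (p :*: s) :+: κ 1 :*: (κ 2 :*: s) :=: (p :+: κ 2) :*: s) refl
            ring₂ : ∀ m s → (m + s) * s ≡ 1 * (m * s) + 1 * (s * s)
            ring₂ = solveℕ 2 (λ m s → (m :+: s) :*: s :=: κ 1 :*: (m :*: s) :+: κ 1 :*: (s :*: s)) refl
          ... | no ¬pr | yes (c≢𝟎 , e) = ℕ.+-monoˡ-≤ 0 (ℕ.*-monoʳ-≤ 1 (ℕ.*-monoˡ-≤ (s c) (lin {p + 2 + s c} {m i c + s c + 2} {p} {m i c}
              (subst (λ z → p + 2 + s c ≤ z + 2) (trans (sym q+1≡p+2) (sym (m+s c≢𝟎 ci))) (ℕ.+-monoʳ-≤ (p + 2) s≤)) 0 (ring p (m i c) (s c)))))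
            where
            ci = Vec.∷-injectiveˡ (Vec.∷-injectiveʳ e)
            s≤ : s c ≤ 2
            s≤ = s≤2 T c≢𝟎 ci (λ sp → ¬pr (c≢𝟎 , sp)) (λ sp → bv (prop⇐ c≢𝟎 sp (Vec.∷-injectiveˡ e)))
            ring : ∀ p m s → p + (m + s + 2) + 0 ≡ m + (p + 2 + s)
            ring = solveℕ 3 (λ p m s → p :+: (m :+: s :+: κ 2) :+: κ 0 :=: m :+: (p :+: κ 2 :+: s)) refl
          sum : p * (p * (q + t)) + p * (2 * s a) ≤ X + p * (s a * s a)
          sum = subst₂ _≤_ (trans (∑-+ V.elems _ _) (cong₂ _+_ (trans (∑-cong V.elems (λ c → swap (𝟙 (plane? us c)) p (s c))) (trans (∑-*ˡ V.elems p _) (cong (p *_) (tangent-s tn)))) (trans (∑-*ʳ V.elems _ _) (cong (_* (2 * s a)) (prop-count (a≢𝟎 (sa T)))))))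
            (trans (∑-+ V.elems _ _) (cong (X +_) (trans (∑-*ʳ V.elems _ _) (cong (_* (s a * s a)) (prop-count (a≢𝟎 (sa T))))))) (∑-mono V.elems each)
            where
            swap : ∀ a b c → a * (b * c) ≡ b * (a * c)
            swap = solveℕ 3 (λ a b c → a :*: (b :*: c) :=: b :*: (a :*: c)) refl
          arith : ∀ s t {q p X S δ} → q ≡ suc p → p ≢ 0 → p * S ≡ p * q + X → S + δ ≡ q * t →
            p * (p * (q + t)) + p * (2 * s) ≤ X + p * (s * s) → δ + q * q + 2 * s ≤ s * s + t
          arith s t {p = p} {X} {S} {δ} refl p≢0 e e′ le = p*-cancel-≤ p≢0 (lin (ℕ.+-mono-≤ le (ℕ.≤-reflexive (cong₂ _+_ (sym e) (cong (p *_) e′)))) 0 (ring s t p X S δ))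
            where
            ring : ∀ s t p X S δ → p * (δ + suc p * suc p + 2 * s) + (X + p * (s * s) + (p * S + p * (suc p * t))) + 0 ≡
              p * (s * s + t) + (p * (p * (suc p + t)) + p * (2 * s) + (p * suc p + X + p * (S + δ)))
            ring = solveℕ 6 (λ s t p X S δ → p :*: (δ :+: (κ 1 :+: p) :*: (κ 1 :+: p) :+: κ 2 :*: s) :+: (X :+: p :*: (s :*: s) :+: (p :*: S :+: p :*: ((κ 1 :+: p) :*: t))) :+: κ 0 :=: p :*: (s :*: s :+: t) :+: (p :*: (p :*: ((κ 1 :+: p) :+: t)) :+: p :*: (κ 2 :*: s) :+: (p :*: (κ 1 :+: p) :+: X :+: p :*: (S :+: δ)))) refl

        2≤s : ∀ {i a} → Small i a → 2 ≤ s a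
        2≤s A = ℕ.+-cancelʳ-≤ 2 _ _ (ℕ.≤-trans (ℕ.≤-trans (s≤s (s≤s (s≤s (s≤s z≤n)))) 8≤q) (s≡ A))

        opaque
          -- At least two tangents at `P i` lie in `a`, and at most one of them is the line common
          -- to both planes.
          tangent-in-one : ∀ {i a b} → Two i a b → ∃ λ v → Tan i v × dot a v ≡ 0# × dot b v ≢ 0#
          tangent-in-one {i} {a} {b} T with V.search (λ v → tan? i v ×-dec ((dot a v ≟ 0#) ×-dec ¬? (dot b v ≟ 0#)))
          ... | yes r = r
          ... | no ¬∃ = ⊥-elim (ℕ.1+n≰n (ℕ.≤-trans (2≤s (sa T)) (qp-cancel-≤ (begin
            q * p * s a ≡⟨ tanCount-on i (a≢𝟎 (sa T)) (ai (sa T)) ⟨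
            tanCount i a ≤⟨ ∑-mono V.elems each ⟩
            J i a b ≤⟨ J≤ (ind T) (ai (sa T)) (ai (sb T)) ⟩
            q * p ≡⟨ ℕ.*-identityʳ _ ⟨
            q * p * 1 ∎))))
            where
            open ℕ.≤-Reasoning
            each : ∀ v → on a v * 𝟙 (tan? i v) ≤ on a v * on b v * 𝟙 (tan? i v)
            each v with dot a v ≟ 0# | tan? i v | dot b v ≟ 0#
            ... | no _ | _ | _ = z≤n
            ... | yes _ | no _ | _ = z≤n
            ... | yes _ | yes _ | yes _ = ℕ.≤-refl
            ... | yes e | yes tn | no e′ = ⊥-elim (¬∃ (v , tn , e , e′))

        opaque
          -- `deficiency` yields q² + 2s ≤ s² + t with s = q + 2 - n. For n = 3 and n = 4 this means
          -- t ≥ 4q - 3 and t ≥ 6q - 8, beyond the bound 3q; for n = 2 it means t ≥ 2q.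
          one-or-two : ∀ {i a b} → Two i a b → (n a ≡ 1 × s a ≡ q + 1) ⊎ (n a ≡ 2 × s a ≡ q × 2 * q ≤ t)
          one-or-two {i} {a} {b} T = go (n a) refl (n≤4 (sa T))
            where
            main : q * q + 2 * s a ≤ s a * s a + t
            main = let v , tn , av , bv = tangent-in-one T ; δ = Sf (λ λ′ → d (OnTangent.Q tn λ′)) in
              ℕ.m+n≤o⇒n≤o δ (ℕ.≤-trans (ℕ.≤-reflexive (sym (ℕ.+-assoc δ (q * q) (2 * s a)))) (deficiency T tn av bv))
            arith₃ : ∀ s q t → 3 + s ≡ q + 2 → q * q + 2 * s ≤ s * s + t → t + 10 ≤ 3 * q → ⊥
            arith₃ s q t e le le′ with ℕ.+-cancelʳ-≡ 2 q (suc s) (trans (sym e) (ring₀ s))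
              where
              ring₀ : ∀ s → 3 + s ≡ suc s + 2
              ring₀ = solveℕ 1 (λ s → κ 3 :+: s :=: (κ 1 :+: s) :+: κ 2) refl
            ... | refl = ℕ.1+n≰n (lin {x = 1} {y = 0} (ℕ.+-mono-≤ le le′) (s + 7) (ring s t))
              where
              ring : ∀ s t → 1 + (s * s + t + 3 * suc s) + (s + 7) ≡ 0 + (suc s * suc s + 2 * s + (t + 10))
              ring = solveℕ 2 (λ s t → κ 1 :+: (s :*: s :+: t :+: κ 3 :*: (κ 1 :+: s)) :+: (s :+: κ 7) :=: κ 0 :+: ((κ 1 :+: s) :*: (κ 1 :+: s) :+: κ 2 :*: s :+: (t :+: κ 10))) refl
            arith₄ : ∀ s q t → 4 + s ≡ q + 2 → q * q + 2 * s ≤ s * s + t → t + 10 ≤ 3 * q → ⊥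
            arith₄ s q t e le le′ with ℕ.+-cancelʳ-≡ 2 q (2 + s) (trans (sym e) (ring₀ s))
              where
              ring₀ : ∀ s → 4 + s ≡ 2 + s + 2
              ring₀ = solveℕ 1 (λ s → κ 4 :+: s :=: κ 2 :+: s :+: κ 2) refl
            ... | refl = ℕ.1+n≰n (lin {x = 1} {y = 0} (ℕ.+-mono-≤ le le′) (3 * s + 7) (ring s t))
              where
              ring : ∀ s t → 1 + (s * s + t + 3 * (2 + s)) + (3 * s + 7) ≡ 0 + ((2 + s) * (2 + s) + 2 * s + (t + 10))
              ring = solveℕ 2 (λ s t → κ 1 :+: (s :*: s :+: t :+: κ 3 :*: (κ 2 :+: s)) :+: (κ 3 :*: s :+: κ 7) :=: κ 0 :+: ((κ 2 :+: s) :*: (κ 2 :+: s) :+: κ 2 :*: s :+: (t :+: κ 10))) refl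
            arith₂ : ∀ s q t → 2 + s ≡ q + 2 → q * q + 2 * s ≤ s * s + t → s ≡ q × 2 * q ≤ t
            arith₂ s q t e le with ℕ.+-cancelʳ-≡ 2 s q (trans (ℕ.+-comm s 2) e)
            ... | refl = refl , ℕ.+-cancelˡ-≤ (s * s) _ _ le
            go : ∀ z → n a ≡ z → z ≤ 4 → (n a ≡ 1 × s a ≡ q + 1) ⊎ (n a ≡ 2 × s a ≡ q × 2 * q ≤ t)
            go 0 e _ with () ← trans (sym (n≡1+m (ai (sa T)))) e
            go 1 e _ = inj₁ (e , ℕ.suc-injective (trans (trans (cong (_+ s a) (sym e)) (n+s (a≢𝟎 (sa T)))) (ℕ.+-suc q 1)))
            go 2 e _ = inj₂ (e , arith₂ (s a) q t (trans (cong (_+ s a) (sym e)) (n+s (a≢𝟎 (sa T)))) main)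
            go 3 e _ = ⊥-elim (arith₃ (s a) q t (trans (cong (_+ s a) (sym e)) (n+s (a≢𝟎 (sa T)))) main t+10≤3q)
            go 4 e _ = ⊥-elim (arith₄ (s a) q t (trans (cong (_+ s a) (sym e)) (n+s (a≢𝟎 (sa T)))) main t+10≤3q)
            go (suc (suc (suc (suc (suc z))))) e (s≤s (s≤s (s≤s (s≤s ()))))

        inclusion-exclusion : ∀ {i a b} → Two i a b → q * p * t + J i a b ≡ q * p * (s a + s b)
        inclusion-exclusion {i} {a} {b} T = begin
          q * p * t + J i a b ≡⟨ cong (_+ J i a b) (tangents≡ i) ⟨
          tangents i + J i a b ≡⟨ ∑-+ V.elems _ _ ⟨
          SV (λ v → 𝟙 (tan? i v) + on a v * on b v * 𝟙 (tan? i v)) ≡⟨ ∑-cong V.elems each ⟩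
          SV (λ v → on a v * 𝟙 (tan? i v) + on b v * 𝟙 (tan? i v)) ≡⟨ ∑-+ V.elems _ _ ⟩
          tanCount i a + tanCount i b ≡⟨ cong₂ _+_ (tanCount-on i (a≢𝟎 (sa T)) (ai (sa T))) (tanCount-on i (a≢𝟎 (sb T)) (ai (sb T))) ⟩
          q * p * s a + q * p * s b ≡⟨ ℕ.*-distribˡ-+ (q * p) (s a) (s b) ⟨
          q * p * (s a + s b) ∎
          where
          open ≡-Reasoning
          each : ∀ v → 𝟙 (tan? i v) + on a v * on b v * 𝟙 (tan? i v) ≡ on a v * 𝟙 (tan? i v) + on b v * 𝟙 (tan? i v)
          each v with tan? i v | dot a v ≟ 0# | dot b v ≟ 0#
          ... | no _ | w | w′ = zeros (𝟙 w) (𝟙 w′)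
            where
            zeros : ∀ a b → 0 + a * b * 0 ≡ a * 0 + b * 0
            zeros = solveℕ 2 (λ a b → κ 0 :+: a :*: b :*: κ 0 :=: a :*: κ 0 :+: b :*: κ 0) refl
          ... | yes _ | yes _ | yes _ = refl
          ... | yes _ | yes _ | no _ = refl
          ... | yes _ | no _ | yes _ = refl
          ... | yes tn | no av | no bv with cover T v tn
          ...   | inj₁ e = ⊥-elim (av e)
          ...   | inj₂ e = ⊥-elim (bv e)

        n-one : ∀ {i a} → n a ≡ 1 → dot a (P i) ≡ 0# → ∀ j → dot a (P j) ≡ 0# → j ≡ i
        n-one {i} {a} e a⊥ j aj with j Fin.≟ i
        ... | yes r = r
        ... | no j≢i = ⊥-elim (ℕ.1+n≰n (ℕ.≤-trans (ℕ.≤-reflexive (sym (cong₂ _*_ (𝟙-yes (¬? (j Fin.≟ i)) j≢i) (𝟙-yes (on? a j) aj))))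
          (ℕ.≤-trans (Finite.term (finFinite k) (λ j → 𝟙 (¬? (j Fin.≟ i)) * 𝟙 (on? a j)) j) (ℕ.≤-reflexive (ℕ.suc-injective (trans (sym (n≡1+m a⊥)) e))))))

        n-one-tan : ∀ {i a v} → n a ≡ 1 → dot a (P i) ≡ 0# → dot a v ≡ 0# → ¬ Span (P i ∷ []) v → Tan i v
        n-one-tan {i} {a} {v} e a⊥ av v∉ j j≢i sp with span₂⁻ sp
        ... | α , β , e′ with β ≟ 0#
        ...   | yes refl = v∉ (span₁ α (trans e′ (trans (cong (α • P i ⊕_) (0• (P j))) (⊕-identityʳ _))))
        ...   | no β≢0 = j≢i (n-one e a⊥ j (*≡0 β≢0 (begin
          β · dot a (P j) ≡⟨ +-identityˡ _ ⟨
          0# ⊹ β · dot a (P j) ≡⟨ cong (_⊹ β · dot a (P j)) (trans (cong (α ·_) a⊥) (zeroʳ α)) ⟨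
          α · dot a (P i) ⊹ β · dot a (P j) ≡⟨ dot-⊕• a α β (P i) (P j) ⟨
          dot a (α • P i ⊕ β • P j) ≡⟨ cong (dot a) e′ ⟨
          dot a v ≡⟨ av ⟩
          0# ∎)))
          where open ≡-Reasoning

        -- If `P i` is the only cap point of `a`, every line of `a` through it is a tangent, in
        -- particular the one shared with `b`.
        J-one : ∀ {i a b} → Two i a b → n a ≡ 1 → J i a b ≡ q * p
        J-one {i} {a} {b} T e = ℕ.+-cancelʳ-≡ q _ _ (trans (cong (J i a b +_) (sym (line-point (ai (sa T)) (ai (sb T))))) (trans (sym (∑-+ V.elems _ _))
          (trans (∑-cong V.elems each) (trans (line-size (ind T)) q²≡))))
          where
          each : ∀ v → on a v * on b v * 𝟙 (tan? i v) + on a v * on b v * 𝟙 (span? (P i ∷ []) v) ≡ on a v * on b v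
          each v with dot a v ≟ 0# | span? (P i ∷ []) v
          ... | no _ | _ = refl
          ... | yes _ | yes sp = trans (cong₂ (λ y z → y + z) (trans (cong (1 * on b v *_) (𝟙-no (tan? i v) (λ tn → Tan⇒∉ tn sp))) (ℕ.*-zeroʳ (1 * on b v))) (ℕ.*-identityʳ (1 * on b v))) refl
          ... | yes av | no v∉ = trans (cong₂ (λ y z → y + z) (trans (cong (1 * on b v *_) (𝟙-yes (tan? i v) (n-one-tan e (ai (sa T)) av v∉))) (ℕ.*-identityʳ (1 * on b v))) (ℕ.*-zeroʳ (1 * on b v))) (ℕ.+-identityʳ _)

        t+1 : ∀ {i a b} → Two i a b → n a ≡ 1 → t + 1 ≡ s a + s b
        t+1 {i} {a} {b} T e = p*-cancel (qp≢0 q≡1+p p≢0) (trans (trans (ℕ.*-distribˡ-+ (q * p) t 1) (cong (q * p * t +_) (trans (ℕ.*-identityʳ _) (sym (J-one T e))))) (inclusion-exclusion T))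

        data Kind (i : Fin k) (a b : V4) : Set where
          one-one : n a ≡ 1 → n b ≡ 1 → t ≡ 2 * q + 1 → Kind i a b
          one-two : n a ≡ 1 → n b ≡ 2 → t ≡ 2 * q → Kind i a b
          two-one : n a ≡ 2 → n b ≡ 1 → t ≡ 2 * q → Kind i a b
          two-two : n a ≡ 2 → n b ≡ 2 → t ≡ 2 * q → J i a b ≡ 0 → Kind i a b

        opaque
          -- By inclusion and exclusion, s a + s b is t, plus one if the common line is a tangent. A
          -- plane with one point makes that line a tangent. If both planes have two points, t ≤ 2q,
          -- and `one-or-two` forces equality and no common tangent.
          kind : ∀ {i a b} → Two i a b → Kind i a b
          kind {i} {a} {b} T with one-or-two T | one-or-two (Two-sym T)
          ... | inj₁ (na , sa≡) | inj₁ (nb , sb≡) = one-one na nb (ℕ.+-cancelʳ-≡ 1 _ _ (trans (t+1 T na) (trans (cong₂ _+_ sa≡ sb≡) (ring q))))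
            where
            ring : ∀ q → q + 1 + (q + 1) ≡ 2 * q + 1 + 1
            ring = solveℕ 1 (λ q → q :+: κ 1 :+: (q :+: κ 1) :=: κ 2 :*: q :+: κ 1 :+: κ 1) refl
          ... | inj₁ (na , sa≡) | inj₂ (nb , sb≡ , _) = one-two na nb (ℕ.+-cancelʳ-≡ 1 _ _ (trans (t+1 T na) (trans (cong₂ _+_ sa≡ sb≡) (ring q))))
            where
            ring : ∀ q → q + 1 + q ≡ 2 * q + 1
            ring = solveℕ 1 (λ q → q :+: κ 1 :+: q :=: κ 2 :*: q :+: κ 1) refl
          ... | inj₂ (na , sa≡ , _) | inj₁ (nb , sb≡) = two-one na nb (ℕ.+-cancelʳ-≡ 1 _ _ (trans (t+1 (Two-sym T) nb) (trans (cong₂ _+_ sb≡ sa≡) (ring q))))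
            where
            ring : ∀ q → q + 1 + q ≡ 2 * q + 1
            ring = solveℕ 1 (λ q → q :+: κ 1 :+: q :=: κ 2 :*: q :+: κ 1) refl
          ... | inj₂ (na , sa≡ , 2q≤t) | inj₂ (nb , sb≡ , _) = two-two na nb t≡ (ℕ.+-cancelˡ-≡ (q * p * t) _ _ (trans ie (trans (cong (q * p *_) (sym t≡)) (sym (ℕ.+-identityʳ _)))))
            where
            ring : ∀ q → q + q ≡ 2 * q
            ring = solveℕ 1 (λ q → q :+: q :=: κ 2 :*: q) refl
            ie : q * p * t + J i a b ≡ q * p * (2 * q)
            ie = trans (inclusion-exclusion T) (cong (q * p *_) (trans (cong₂ _+_ sa≡ sb≡) (ring q)))
            t≡ : t ≡ 2 * q
            t≡ = ℕ.≤-antisym (qp-cancel-≤ (ℕ.≤-trans (ℕ.m≤m+n _ (J i a b)) (ℕ.≤-reflexive ie))) 2q≤t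

        dot-⊕•ˡ : ∀ α β (a b v : V4) → dot (α • a ⊕ β • b) v ≡ α · dot a v ⊹ β · dot b v
        dot-⊕•ˡ α β a b v = trans (dot-comm _ v) (trans (dot-⊕• v α β a b) (cong₂ (λ y z → α · y ⊹ β · z) (dot-comm v a) (dot-comm v b)))

        -- A vector of `c` that lies in one of `a` and `b` lies in both, so the common line is the
        -- only possible tangent in `c`.
        s-pencil : ∀ {i a b c α β} → Two i a b → c ≢ 𝟎 → dot c (P i) ≡ 0# → c ≡ α • a ⊕ β • b → α ≢ 0# → β ≢ 0# → s c ≤ 1
        s-pencil {i} {a} {b} {c} {α} {β} T c≢𝟎 ci e α≢0 β≢0 = qp-cancel-≤ (begin
          q * p * s c ≡⟨ tanCount-on i c≢𝟎 ci ⟨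
          tanCount i c ≤⟨ ∑-mono V.elems each ⟩
          J i a b ≤⟨ J≤ (ind T) (ai (sa T)) (ai (sb T)) ⟩
          q * p ≡⟨ ℕ.*-identityʳ _ ⟨
          q * p * 1 ∎)
          where
          open ℕ.≤-Reasoning
          each : ∀ v → on c v * 𝟙 (tan? i v) ≤ on a v * on b v * 𝟙 (tan? i v)
          each v with dot c v ≟ 0# | tan? i v
          ... | no _ | _ = z≤n
          ... | yes _ | no _ = z≤n
          ... | yes cv | yes tn = ℕ.≤-reflexive (sym (cong₂ (λ y z → y * z * 1) (𝟙-yes (dot a v ≟ 0#) (proj₁ both)) (𝟙-yes (dot b v ≟ 0#) (proj₂ both))))
            where
            eq : α · dot a v ⊹ β · dot b v ≡ 0#
            eq = trans (sym (dot-⊕•ˡ α β a b v)) (trans (cong (λ z → dot z v) (sym e)) cv)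
            both : dot a v ≡ 0# × dot b v ≡ 0#
            both with cover T v tn
            ... | inj₁ av = av , *≡0 β≢0 (trans (sym (+-identityˡ _)) (trans (cong (_⊹ β · dot b v) (sym (trans (cong (α ·_) av) (zeroʳ α)))) eq))
            ... | inj₂ bv = *≡0 α≢0 (trans (sym (+-identityʳ _)) (trans (cong (α · dot a v ⊹_) (sym (trans (cong (β ·_) bv) (zeroʳ β)))) eq)) , bv

        perp-span₂ : ∀ {a b c y} → dot a y ≡ 0# → dot b y ≡ 0# → Span (a ∷ b ∷ []) c → dot c y ≡ 0#
        perp-span₂ {a} {b} {c} {y} ay by sp with span₂⁻ sp
        ... | α , β , e = trans (cong (λ z → dot z y) e) (trans (dot-⊕•ˡ α β a b y) (trans (cong₂ _⊹_ (trans (cong (α ·_) ay) (zeroʳ α)) (trans (cong (β ·_) by) (zeroʳ β))) (+-identityˡ 0#)))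

        -- Two different planes of a pencil meet only in its axis. If a · y were nonzero, the
        -- coefficient vectors of `c` and `c′` would have zero determinant.
        perp-pencil : ∀ {a b c c′ y} → Ind (c ∷ c′ ∷ []) → Span (a ∷ b ∷ []) c → Span (a ∷ b ∷ []) c′ →
          dot c y ≡ 0# → dot c′ y ≡ 0# → dot a y ≡ 0#
        perp-pencil {a} {b} {c} {c′} {y} ind-c sp sp′ cy cy′ with span₂⁻ sp | span₂⁻ sp′ | dot a y ≟ 0#
        ... | _ | _ | yes e = e
        ... | α , β , e | α′ , β′ , e′ | no ay = ⊥-elim (Ind-head≢𝟎 ind-c (trans e (trans (cong₂ (λ y z → y • a ⊕ z • b) α≡0 β≡0) (trans (cong₂ _⊕_ (0• a) (0• b)) (⊕-identityˡ 𝟎)))))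
          where
          open Solver
          X = dot a y
          Z = dot b y
          eq : α · X ⊹ β · Z ≡ 0#
          eq = trans (sym (dot-⊕•ˡ α β a b y)) (trans (cong (λ z → dot z y) (sym e)) cy)
          eq′ : α′ · X ⊹ β′ · Z ≡ 0#
          eq′ = trans (sym (dot-⊕•ˡ α′ β′ a b y)) (trans (cong (λ z → dot z y) (sym e′)) cy′)
          det : α · β′ ⊹ α′ · β ≡ 0#
          det = *≡0 ay (trans (solve 6 (λ α β α′ β′ x z → x :* (α :* β′ :+ α′ :* β) := β′ :* (α :* x :+ β :* z) :+ β :* (α′ :* x :+ β′ :* z)) refl α β α′ β′ X Z)
            (trans (cong₂ (λ u w → β′ · u ⊹ β · w) eq eq′) (trans (cong₂ _⊹_ (zeroʳ β′) (zeroʳ β)) (+-identityˡ 0#))))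
          go : ∀ {d} α β α′ β′ γ γ′ (a b : Vec F d) → γ • (α • a ⊕ β • b) ⊕ (γ′ • (α′ • a ⊕ β′ • b) ⊕ 𝟎) ≡ (γ · α ⊹ γ′ · α′) • a ⊕ (γ · β ⊹ γ′ · β′) • b
          go α β α′ β′ γ γ′ []      []      = refl
          go α β α′ β′ γ γ′ (x ∷ a) (y ∷ b) = cong₂ _∷_
            (solve 8 (λ α β α′ β′ γ γ′ x y → γ :* (α :* x :+ β :* y) :+ (γ′ :* (α′ :* x :+ β′ :* y) :+ con false) := (γ :* α :+ γ′ :* α′) :* x :+ (γ :* β :+ γ′ :* β′) :* y) refl α β α′ β′ γ γ′ x y)
            (go α β α′ β′ γ γ′ a b)
          relation : ∀ γ γ′ → γ · α ⊹ γ′ · α′ ≡ 0# → γ · β ⊹ γ′ · β′ ≡ 0# → (γ ∷ γ′ ∷ []) ≡ 𝟎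
          relation γ γ′ r r′ = ind-c (γ ∷ γ′ ∷ []) (trans (cong₂ (λ u w → γ • u ⊕ (γ′ • w ⊕ 𝟎)) e e′) (trans (go α β α′ β′ γ γ′ a b)
            (trans (cong₂ (λ u w → u • a ⊕ w • b) r r′) (trans (cong₂ _⊕_ (0• a) (0• b)) (⊕-identityˡ 𝟎)))))
          first : (β′ ∷ β ∷ []) ≡ 𝟎
          first = relation β′ β (trans (solve 4 (λ α β α′ β′ → β′ :* α :+ β :* α′ := α :* β′ :+ α′ :* β) refl α β α′ β′) det)
            (solve 2 (λ β β′ → β′ :* β :+ β :* β′ := con false) refl β β′)
          second′ : (α′ ∷ α ∷ []) ≡ 𝟎
          second′ = relation α′ α (solve 2 (λ α α′ → α′ :* α :+ α :* α′ := con false) refl α α′)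
            (trans (solve 4 (λ α β α′ β′ → α′ :* β :+ α :* β′ := α :* β′ :+ α′ :* β) refl α β α′ β′) det)
          α≡0 : α ≡ 0#
          α≡0 = Vec.∷-injectiveˡ (Vec.∷-injectiveʳ second′)
          β≡0 : β ≡ 0#
          β≡0 = Vec.∷-injectiveˡ (Vec.∷-injectiveʳ first)

        span₂-swap : ∀ {a b c} → Span (a ∷ b ∷ []) c → Span (b ∷ a ∷ []) c
        span₂-swap sp = let α , β , e = span₂⁻ sp in span₂ β α (trans e (⊕-comm _ _))

        span₂-scale : ∀ {a b c c′} → Span (a ∷ b ∷ []) c′ → Span (c′ ∷ []) c → Span (a ∷ b ∷ []) c
        span₂-scale {a} {b} sp sp′ = let γ , e = span₁⁻ sp′ ; cs , e′ = sp in γ • cs , trans e (trans (cong (γ •_) e′) (sym (comb-• γ cs (a ∷ b ∷ []))))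

        -- The case t = 2q + 1.

        module Concurrent (t≡ : t ≡ 2 * q + 1) where
          record Ones (i : Fin k) : Set where
            constructor mkOnes
            field
              {a b} : V4
              pair  : Two i a b
              na    : n a ≡ 1
              nb    : n b ≡ 1

            ⊥a : dot a (P i) ≡ 0#
            ⊥a = ai (sa pair)

            ⊥b : dot b (P i) ≡ 0#
            ⊥b = ai (sb pair)
          open Ones

          opaque
            ones : ∀ i → Ones i
            ones i with two i
            ... | _ , _ , T with kind T
            ...   | one-one na nb _ = mkOnes T na nb
            ...   | one-two _ _ e   = ⊥-elim (ℕ.1+n≢n (trans (ℕ.+-comm 1 (2 * q)) (trans (sym t≡) e)))
            ...   | two-one _ _ e   = ⊥-elim (ℕ.1+n≢n (trans (ℕ.+-comm 1 (2 * q)) (trans (sym t≡) e)))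
            ...   | two-two _ _ e _ = ⊥-elim (ℕ.1+n≢n (trans (ℕ.+-comm 1 (2 * q)) (trans (sym t≡) e)))

          opaque
            -- The plane joining `P l` to the line at `P i`. Both coefficients are nonzero because
            -- `P i` is the only cap point of either plane, and `s-pencil` applies.
            pencil-plane : ∀ {i} (O : Ones i) l → l ≢ i → ∃ λ c → c ≢ 𝟎 × dot c (P i) ≡ 0# × dot c (P l) ≡ 0# × Span (a O ∷ b O ∷ []) c × s c ≤ 1
            pencil-plane {i} O l l≢i = c , c≢𝟎 , ci , cl , span₂ β α refl , s-pencil (pair O) c≢𝟎 ci refl β≢0 α≢0
              where
              open Solver
              α β : F
              α = dot (a O) (P l)
              β = dot (b O) (P l)
              c : V4
              c = β • a O ⊕ α • b O
              α≢0 : α ≢ 0#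
              α≢0 e = l≢i (n-one (na O) (⊥a O) l e)
              β≢0 : β ≢ 0#
              β≢0 e = l≢i (n-one (nb O) (⊥b O) l e)
              c≢𝟎 : c ≢ 𝟎
              c≢𝟎 e = β≢0 (Vec.∷-injectiveˡ (ind (pair O) (β ∷ α ∷ []) (trans (cong (β • a O ⊕_) (⊕-identityʳ _)) e)))
              ci : dot c (P i) ≡ 0#
              ci = perp-span₂ (⊥a O) (⊥b O) (span₂ β α refl)
              cl : dot c (P l) ≡ 0#
              cl = trans (dot-⊕•ˡ β α (a O) (b O) (P l)) (solve 2 (λ α β → β :* α :+ α :* β := con false) refl α β)

          record Meeting {i l : Fin k} (O : Ones i) (O′ : Ones l) : Set where
            constructor mkMeeting
            field
              {c}   : V4
              c≢𝟎   : c ≢ 𝟎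
              ci    : dot c (P i) ≡ 0#
              cl    : dot c (P l) ≡ 0#
              span  : Span (a O ∷ b O ∷ []) c
              span′ : Span (a O′ ∷ b O′ ∷ []) c

          -- All planes through the secant have s ≤ 2. Two different ones with s ≤ 1 would bring the
          -- total down to 2q, while `secant-s` makes it t = 2q + 1. Hence the lines at `P i` and
          -- `P l` are coplanar.
          not-skew : ∀ {i l c c′} (O : Ones i) → l ≢ i → c ≢ 𝟎 → dot c (P i) ≡ 0# → dot c (P l) ≡ 0# → s c ≤ 1 →
            c′ ≢ 𝟎 → dot c′ (P i) ≡ 0# → dot c′ (P l) ≡ 0# → s c′ ≤ 1 → ¬ ¬ Span (c′ ∷ []) c
          not-skew {i} {l} {c} {c′} O l≢i c≢𝟎 ci cl s≤1 c′≢𝟎 c′i c′l s′≤1 c∦ = ℕ.1+n≰n (lin {x = 1} {y = 0} sum′ 0 (ring q))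
            where
            us : Vec V4 2
            us = P i ∷ P l ∷ []
            each : ∀ e → 𝟙 (plane? us e) * s e + (𝟙 (prop? c e) + 𝟙 (prop? c′ e)) ≤ 𝟙 (plane? us e) * 2
            each e = go e (plane? us e) (prop? c e) (prop? c′ e)
              where
              go : ∀ e (d : Dec (e ≢ 𝟎 × dots us e ≡ 𝟎)) (d₁ : Dec (e ≢ 𝟎 × Span (c ∷ []) e)) (d₂ : Dec (e ≢ 𝟎 × Span (c′ ∷ []) e)) →
                   𝟙 d * s e + (𝟙 d₁ + 𝟙 d₂) ≤ 𝟙 d * 2
              go e (no ¬pl) (yes (e≢𝟎 , r)) (_) = ⊥-elim (¬pl (e≢𝟎 , cong₂ (λ y z → y ∷ z ∷ []) (prop⇒ r ci) (prop⇒ r cl)))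
              go e (no ¬pl) (no _) (yes (e≢𝟎 , r)) = ⊥-elim (¬pl (e≢𝟎 , cong₂ (λ y z → y ∷ z ∷ []) (prop⇒ r c′i) (prop⇒ r c′l)))
              go e (no _) (no _) (no _) = z≤n
              go e (yes _) (yes (e≢𝟎 , r)) (yes (_ , r′)) = ⊥-elim (c∦ (both r r′ e≢𝟎))
                where
                both : Span (c ∷ []) e → Span (c′ ∷ []) e → e ≢ 𝟎 → Span (c′ ∷ []) c
                both r r′ e≢𝟎 with span₁⁻ r | span₁⁻ r′
                ... | γ , g | γ′ , g′ = span₁ (inv γ · γ′) (trans (•≡⇒ γ≢0 (sym g)) (trans (cong (inv γ •_) g′) (•-assoc _ _ _)))
                  where
                  γ≢0 : γ ≢ 0#
                  γ≢0 refl = e≢𝟎 (trans g (0• c))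
              go e (yes _) (yes (e≢𝟎 , r)) (no _) = ℕ.≤-trans (ℕ.+-monoˡ-≤ 1 (ℕ.≤-reflexive (trans (ℕ.*-identityˡ _) (prop-s c≢𝟎 e≢𝟎 r)))) (ℕ.+-monoˡ-≤ 1 s≤1)
              go e (yes _) (no _) (yes (e≢𝟎 , r)) = ℕ.≤-trans (ℕ.+-monoˡ-≤ 1 (ℕ.≤-reflexive (trans (ℕ.*-identityˡ _) (prop-s c′≢𝟎 e≢𝟎 r)))) (ℕ.+-monoˡ-≤ 1 s′≤1)
              go e (yes (e≢𝟎 , r)) (no _) (no _) = ℕ.≤-trans (ℕ.≤-reflexive (ℕ.+-identityʳ _)) (ℕ.*-monoʳ-≤ 1 (s≤2 (pair O) e≢𝟎 ei
                  (λ z → l≢i (n-one (na O) (⊥a O) l (prop⇐ e≢𝟎 z el))) (λ z → l≢i (n-one (nb O) (⊥b O) l (prop⇐ e≢𝟎 z el)))))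
                where
                ei : dot e (P i) ≡ 0#
                ei = Vec.∷-injectiveˡ r
                el : dot e (P l) ≡ 0#
                el = Vec.∷-injectiveˡ (Vec.∷-injectiveʳ r)
            sum : p * t + (p + p) ≤ p * (q + 1) * 2
            sum = subst₂ _≤_ (trans (∑-+ V.elems _ _) (cong₂ _+_ (secant-s (λ e → l≢i (sym e))) (trans (∑-+ V.elems _ _) (cong₂ _+_ (prop-count c≢𝟎) (prop-count c′≢𝟎)))))
              (trans (∑-*ʳ V.elems 2 _) (cong (_* 2) (planes₂ (ind₂ i l (λ e → l≢i (sym e)))))) (∑-mono V.elems each)
            sum′ : 2 * q + 1 + 2 ≤ (q + 1) * 2
            sum′ = p*-cancel-≤ p≢0 (subst₂ _≤_ (trans (cong (λ z → p * z + (p + p)) t≡) (r₁ p (2 * q + 1))) (ℕ.*-assoc p (q + 1) 2) sum)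
              where
              r₁ : ∀ p z → p * z + (p + p) ≡ p * (z + 2)
              r₁ = solveℕ 2 (λ p z → p :*: z :+: (p :+: p) :=: p :*: (z :+: κ 2)) refl
            ring : ∀ q → 1 + (q + 1) * 2 + 0 ≡ 0 + (2 * q + 1 + 2)
            ring = solveℕ 1 (λ q → κ 1 :+: (q :+: κ 1) :*: κ 2 :+: κ 0 :=: κ 0 :+: (κ 2 :*: q :+: κ 1 :+: κ 2)) refl

          meeting-plane : ∀ {i l} (O : Ones i) (O′ : Ones l) → l ≢ i → Meeting O O′
          meeting-plane {i} {l} O O′ l≢i =
            let c , c≢𝟎 , ci , cl , sp , s≤1 = pencil-plane O l l≢i
                c′ , c′≢𝟎 , c′l , c′i , sp′ , s′≤1 = pencil-plane O′ i (λ e → l≢i (sym e))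
            in mkMeeting c≢𝟎 ci cl sp (span₂-scale sp′ (decidable-stable (span? (c′ ∷ []) c) (not-skew O l≢i c≢𝟎 ci cl s≤1 c′≢𝟎 c′i c′l s′≤1)))

          module Centre {i l : Fin k} (l≢i : l ≢ i) (O : Ones i) (O′ : Ones l) (M : Meeting O O′)
            {Q : V4} (Q≢𝟎 : Q ≢ 𝟎) (aQ : dot (a O) Q ≡ 0#) (bQ : dot (b O) Q ≡ 0#) (a′Q : dot (a O′) Q ≡ 0#) where
            open Meeting M

            cQ : dot c Q ≡ 0#
            cQ = perp-span₂ aQ bQ span

            -- The planes `c` and `a O′` are two different members of the pencil at `P l`, and both
            -- contain `Q`.
            b′Q : dot (b O′) Q ≡ 0#
            b′Q = perp-pencil {b O′} {a O′} (Ind-∷ (Ind-nonzero (a≢𝟎 (sa (pair O′)))) c∦a′) (span₂-swap span′)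
              (span₂ 0# 1# (sym (trans (cong₂ _⊕_ (0• (b O′)) (1• (a O′))) (⊕-identityˡ (a O′))))) cQ a′Q
              where
              c∦a′ : ¬ Span (a O′ ∷ []) c
              c∦a′ r = l≢i (sym (n-one (na O′) (⊥a O′) i (prop⇐ c≢𝟎 r ci)))

            -- The line at `P r` is coplanar with the lines at `P i` and `P l`, both of which pass
            -- through `Q`. The two joining planes differ and meet in the line at `P r`, which
            -- therefore contains `Q`.
            tangent-at : ∀ r → dot c (P r) ≢ 0# → Tan r Q
            tangent-at r cr = n-one-tan (na Oᵣ) (⊥a Oᵣ) aᵣQ Q∉
              where
              Oᵣ = ones r
              M₁ = meeting-plane O Oᵣ (λ { refl → cr ci })
              M₂ = meeting-plane O′ Oᵣ (λ { refl → cr cl })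
              module M₁ = Meeting M₁
              module M₂ = Meeting M₂
              -- A common joining plane would contain the line at `P i` as well as `P l`, as `c`
              -- does; but it contains `P r`, and `c` does not.
              c₁∦c₂ : ¬ Span (M₂.c ∷ []) M₁.c
              c₁∦c₂ z = l≢i (n-one (na O) (⊥a O) l
                (perp-pencil {a O} {b O} (separated M₁.c≢𝟎 M₁.cl cr) span M₁.span cl (perp-span₂ (⊥a O′) (⊥b O′) (span₂-scale M₂.span z))))
              aᵣQ : dot (a Oᵣ) Q ≡ 0#
              aᵣQ = perp-pencil {a Oᵣ} {b Oᵣ} (Ind-∷ (Ind-nonzero M₂.c≢𝟎) c₁∦c₂) M₁.span′ M₂.span′
                (perp-span₂ aQ bQ M₁.span) (perp-span₂ a′Q b′Q M₂.span)
              Q∉ : ¬ Span (P r ∷ []) Q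
              Q∉ z with span₁⁻ z
              ... | γ , e with γ ≟ 0#
              ...   | yes refl = Q≢𝟎 (trans e (0• (P r)))
              ...   | no γ≢0 = cr (*≡0 γ≢0 (trans (sym (dot-• γ c (P r))) (trans (cong (dot c) (sym e)) cQ)))
            k≤x+n : k ≤ x Q + n c
            k≤x+n = subst₂ _≤_ Sk-1 (∑-+ (allFin k) _ _) (∑-mono (allFin k) each)
              where
              each : ∀ r → 1 ≤ 𝟙 (tan? r Q) + 𝟙 (on? c r)
              each r with on? c r
              ... | yes _ = ℕ.m≤n+m 1 _
              ... | no cr = ℕ.≤-trans (ℕ.≤-reflexive (sym (𝟙-yes (tan? r Q) (tangent-at r cr)))) (ℕ.m≤m+n _ 0)
            impossible : ⊥
            -- Here k = q² - q + 1, while `x Q` is at most 2q + 1 and `n c` at most q + 2.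
            impossible = ℕ.<⇒≱ {4 * q + 2} {q * q} 4q+2< (arith q t k (n c) (x Q) t≡ (k+t i) k≤x+n (x≤t Q) (n≤q+2 c≢𝟎))
              where
              arith : ∀ q t k n x → t ≡ 2 * q + 1 → k + t ≡ q * q + q + 2 → k ≤ x + n → x ≤ t → n ≤ q + 2 → q * q ≤ 4 * q + 2
              arith q _ k n x refl e le le′ le″ = lin (ℕ.+-mono-≤ (ℕ.≤-reflexive (sym e)) (ℕ.+-mono-≤ le (ℕ.+-mono-≤ le′ le″))) 0 (ring q k n x)
                where
                ring : ∀ q k n x → q * q + (k + (2 * q + 1) + (x + n + (2 * q + 1 + (q + 2)))) + 0 ≡ 4 * q + 2 + (q * q + q + 2 + (k + (x + n)))
                ring = solveℕ 4 (λ q k n x → q :*: q :+: (k :+: (κ 2 :*: q :+: κ 1) :+: (x :+: n :+: (κ 2 :*: q :+: κ 1 :+: (q :+: κ 2)))) :+: κ 0 :=: κ 4 :*: q :+: κ 2 :+: (q :*: q :+: q :+: κ 2 :+: (k :+: (x :+: n)))) refl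
              4q+2< : 4 * q + 2 < q * q
              4q+2< = ℕ.≤-trans (lin {4 * 8} {4 * q} (ℕ.*-monoʳ-≤ 4 8≤q) 29 (ring q)) (ℕ.*-monoˡ-≤ q 8≤q)
                where
                ring : ∀ q → suc (4 * q + 2) + 4 * q + 29 ≡ 8 * q + 4 * 8
                ring = solveℕ 1 (λ q → (κ 1 :+: (κ 4 :*: q :+: κ 2)) :+: κ 4 :*: q :+: κ 29 :=: κ 8 :*: q :+: κ 4 :*: κ 8) refl

          impossible : Fin k → ⊥
          impossible i =
            let l , l≢i = other i
                O = ones i
                O′ = ones l
                -- The point where the line at `P i` meets one of the planes of `P l`; coplanarity
                -- will put it on the line at `P l`.
                Q , Q≢𝟎 , e = nonzero-annihilator (a O) (b O) (a O′)
            in Centre.impossible l≢i O O′ (meeting-plane O O′ l≢i) Q≢𝟎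
                 (trans (dot-comm (a O) Q) (Vec.∷-injectiveˡ e)) (trans (dot-comm (b O) Q) (Vec.∷-injectiveˡ (Vec.∷-injectiveʳ e)))
                 (trans (dot-comm (a O′) Q) (Vec.∷-injectiveˡ (Vec.∷-injectiveʳ (Vec.∷-injectiveʳ e))))

        -- Planes with two cap points, and the case t = 2q.

        another : ∀ {i a} → dot a (P i) ≡ 0# → n a ≡ 2 → ∃ λ l → l ≢ i × dot a (P l) ≡ 0#
        another {i} {a} a⊥ na =
          let l , le = ∑-pos (allFin k) {λ j → 𝟙 (¬? (j Fin.≟ i)) * 𝟙 (on? a j)} (ℕ.≤-reflexive (sym (ℕ.suc-injective (trans (sym (n≡1+m a⊥)) na))))
          in l , 𝟙-pos (¬? (l Fin.≟ i) ×-dec on? a l) (ℕ.≤-trans le (ℕ.≤-reflexive (sym (𝟙-× (¬? (l Fin.≟ i)) (on? a l)))))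

        n-two : ∀ {i l j a} → n a ≡ 2 → l ≢ i → dot a (P i) ≡ 0# → dot a (P l) ≡ 0# → dot a (P j) ≡ 0# → j ≢ i → j ≡ l
        n-two {i} {l} {j} {a} na l≢i a⊥i a⊥l a⊥j j≢i with j Fin.≟ l
        ... | yes e = e
        ... | no j≢l = ⊥-elim (ℕ.1+n≰n (ℕ.≤-trans (ℕ.≤-reflexive (sym three)) (ℕ.≤-trans (∑-mono (allFin k) each) (ℕ.≤-reflexive na))))
          where
          three : Sk (λ r → 𝟙 (r Fin.≟ i) + (𝟙 (r Fin.≟ l) + 𝟙 (r Fin.≟ j))) ≡ 3
          three = trans (∑-+ (allFin k) _ _) (cong₂ _+_ (Finite.once (finFinite k) i) (trans (∑-+ (allFin k) _ _) (cong₂ _+_ (Finite.once (finFinite k) l) (Finite.once (finFinite k) j))))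
          each : ∀ r → 𝟙 (r Fin.≟ i) + (𝟙 (r Fin.≟ l) + 𝟙 (r Fin.≟ j)) ≤ 𝟙 (on? a r)
          each r with r Fin.≟ i | r Fin.≟ l | r Fin.≟ j
          ... | yes refl | yes refl | _ = ⊥-elim (l≢i refl)
          ... | yes refl | no _ | yes refl = ⊥-elim (j≢i refl)
          ... | no _ | yes refl | yes refl = ⊥-elim (j≢l refl)
          ... | yes refl | no _ | no _ = ℕ.≤-reflexive (sym (𝟙-yes (on? a r) a⊥i))
          ... | no _ | yes refl | no _ = ℕ.≤-reflexive (sym (𝟙-yes (on? a r) a⊥l))
          ... | no _ | no _ | yes refl = ℕ.≤-reflexive (sym (𝟙-yes (on? a r) a⊥j))
          ... | no _ | no _ | no _ = z≤n

        n≡2⇒s≡q : ∀ {a} → a ≢ 𝟎 → n a ≡ 2 → s a ≡ q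
        n≡2⇒s≡q {a} a≢𝟎 na = ℕ.+-cancelˡ-≡ 2 _ _ (trans (cong (_+ s a) (sym na)) (trans (n+s a≢𝟎) (ℕ.+-comm q 2)))

        -- With s = q and t = 2q the room left by `deficiency` is exactly zero.
        no-deficiency : ∀ {i a b v} → t ≡ 2 * q → Two i a b → n a ≡ 2 → (tn : Tan i v) → dot a v ≡ 0# → dot b v ≢ 0# → d v ≡ 0
        no-deficiency {i} {a} {b} {v} t≡ T na tn av bv = ℕ.n≤0⇒n≡0 (begin
          -- The vector `v` is the point of its own tangent with parameter zero.
          d v ≡⟨ cong d (trans (cong (v ⊕_) (0• (P i))) (⊕-identityʳ v)) ⟨
          d (OnTangent.Q tn 0#) ≤⟨ Finite.term finite (λ λ′ → d (OnTangent.Q tn λ′)) 0# ⟩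
          Sf (λ λ′ → d (OnTangent.Q tn λ′)) ≤⟨ arith q (Sf (λ λ′ → d (OnTangent.Q tn λ′))) (subst₂ (λ y z → Sf (λ λ′ → d (OnTangent.Q tn λ′)) + q * q + 2 * y ≤ y * y + z) (n≡2⇒s≡q (a≢𝟎 (sa T)) na) t≡ (deficiency T tn av bv)) ⟩
          0 ∎)
          where
          open ℕ.≤-Reasoning
          arith : ∀ q δ → δ + q * q + 2 * q ≤ q * q + 2 * q → δ ≤ 0
          arith q δ le = lin le 0 (ring q δ)
            where
            ring : ∀ q δ → δ + (q * q + 2 * q) + 0 ≡ 0 + (δ + q * q + 2 * q)
            ring = solveℕ 2 (λ q δ → δ :+: (q :*: q :+: κ 2 :*: q) :+: κ 0 :=: κ 0 :+: (δ :+: q :*: q :+: κ 2 :*: q)) refl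

        -- One and two cap points in the planes at the same point.

        module Mixed (t≡ : t ≡ 2 * q) {i : Fin k} {a b : V4} (T : Two i a b) (na : n a ≡ 2) (nb : n b ≡ 1)
          {l : Fin k} (l≢i : l ≢ i) (al : dot a (P l) ≡ 0#) {b′ : V4} (T′ : Two l a b′)
          {v : V4} (tn : Tan i v) (av : dot a v ≡ 0#) (bv : dot b v ≡ 0#) where
          Q : F → V4
          Q = OnTangent.Q tn

          us : Vec V4 2
          us = OnTangent.us tn

          δ : ℕ
          δ = Sf (λ λ′ → d (Q λ′))

          -- The planes through this tangent form the pencil of `a` and `b`. The product m s is zero
          -- for `b`, equal to q for `a`, and at most q for the others, where s ≤ 1. So `x` adds up
          -- to at most q + q² along the line, against q t = 2q².
          lower : q * q ≤ q + δ
          lower = arith q≡1+p p≢0 (OnTangent.tangent-sum tn) (trans (Sx+Sd Q) (cong (q *_) t≡)) sum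
            where
            X = SV (λ c → 𝟙 (plane? us c) * (m i c * s c))
            go : ∀ c (d₁ : Dec (c ≢ 𝟎 × dots us c ≡ 𝟎)) (d₂ : Dec (c ≢ 𝟎 × Span (b ∷ []) c)) (d₃ : Dec (Span (a ∷ []) c)) →
                 𝟙 d₁ * (m i c * s c) + 𝟙 d₂ * q ≤ 𝟙 d₁ * q
            go c (no ¬pl) (yes (c≢𝟎 , r)) _ = ⊥-elim (¬pl (c≢𝟎 , cong₂ (λ y z → y ∷ z ∷ []) (prop⇒ r bv) (prop⇒ r (ai (sb T)))))
            go c (no _) (no _) _ = z≤n
            go c (yes (c≢𝟎 , e)) (yes (_ , r)) _ = ℕ.≤-reflexive (cong (λ z → 1 * (z * s c) + 1 * q) m≡0)
              where
              m≡0 : m i c ≡ 0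
              m≡0 = ℕ.suc-injective (trans (sym (n≡1+m (prop⇒ r (ai (sb T))))) (trans (prop-n c≢𝟎 r) nb))
            go c (yes (c≢𝟎 , e)) (no _) (yes r) = ℕ.≤-reflexive (trans (ℕ.+-identityʳ _) (cong (1 *_) (trans (cong₂ _*_ m≡1 (trans (prop-s (a≢𝟎 (sa T)) c≢𝟎 r) (n≡2⇒s≡q (a≢𝟎 (sa T)) na))) (ℕ.*-identityˡ q))))
              where
              m≡1 : m i c ≡ 1
              m≡1 = ℕ.suc-injective (trans (sym (n≡1+m (prop⇒ r (ai (sa T))))) (trans (prop-n c≢𝟎 r) na))
            go c (yes (c≢𝟎 , e)) (no c∦b) (no c∦a) = ℕ.≤-trans (ℕ.≤-reflexive (ℕ.+-identityʳ _)) (ℕ.*-monoʳ-≤ 1 (product (m i c) (s c) (m+s c≢𝟎 ci) s≤1))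
              where
              cv : dot c v ≡ 0#
              cv = Vec.∷-injectiveˡ e
              ci : dot c (P i) ≡ 0#
              ci = Vec.∷-injectiveˡ (Vec.∷-injectiveʳ e)
              in-pencil : Span (a ∷ b ∷ []) c
              in-pencil = perp⇒Span (ind T) (Tan⇒Ind₂ tn) (cong₂ (λ y z → y ∷ z ∷ []) av (ai (sa T)) ∷ cong₂ (λ y z → y ∷ z ∷ []) bv (ai (sb T)) ∷ []) refl e
              coefficients : ∀ α β → c ≡ α • a ⊕ β • b → α ≢ 0# × β ≢ 0#
              coefficients α β r = (λ { refl → c∦b (c≢𝟎 , span₁ β (trans r (trans (cong (_⊕ β • b) (0• a)) (⊕-identityˡ _)))) }) ,
                                   (λ { refl → c∦a (span₁ α (trans r (trans (cong (α • a ⊕_) (0• b)) (⊕-identityʳ _)))) })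
              s≤1 : s c ≤ 1
              s≤1 = let α , β , r = span₂⁻ in-pencil ; α≢0 , β≢0 = coefficients α β r in s-pencil T c≢𝟎 ci r α≢0 β≢0
              product : ∀ m s → m + s ≡ q + 1 → s ≤ 1 → m * s ≤ q
              product m 0 _ _ = ℕ.≤-trans (ℕ.≤-reflexive (ℕ.*-zeroʳ m)) z≤n
              product m 1 e _ = ℕ.≤-reflexive (trans (ℕ.*-identityʳ m) (ℕ.+-cancelʳ-≡ 1 m q e))
              product m (suc (suc _)) _ (s≤s ())
            sum : X + p * q ≤ p * (q + 1) * q
            sum = subst₂ _≤_ (trans (∑-+ V.elems _ _) (cong (X +_) (trans (∑-*ʳ V.elems q _) (cong (_* q) (prop-count (a≢𝟎 (sb T)))))))
              (trans (∑-*ʳ V.elems q _) (cong (_* q) (planes₂ (Tan⇒Ind₂ tn)))) (∑-mono V.elems (λ c → go c (plane? us c) (prop? b c) (span? (a ∷ []) c)))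
            arith : ∀ {q p X S δ} → q ≡ suc p → p ≢ 0 → p * S ≡ p * q + X → S + δ ≡ q * (2 * q) → X + p * q ≤ p * (q + 1) * q → q * q ≤ q + δ
            arith {q} {p} {X} {S} {δ} _ p≢0 e e′ le = p*-cancel-≤ p≢0 (lin (ℕ.+-mono-≤ le (ℕ.≤-reflexive (cong₂ _+_ e (cong (p *_) (sym e′))))) 0 (ring q p X S δ))
              where
              ring : ∀ q p X S δ → p * (q * q) + (p * (q + 1) * q + (p * q + X + p * (S + δ))) + 0 ≡ p * (q + δ) + (X + p * q + (p * S + p * (q * (2 * q))))
              ring = solveℕ 5 (λ q p X S δ → p :*: (q :*: q) :+: (p :*: (q :+: κ 1) :*: q :+: (p :*: q :+: X :+: p :*: (S :+: δ))) :+: κ 0 :=: p :*: (q :+: δ) :+: (X :+: p :*: q :+: (p :*: S :+: p :*: (q :*: (κ 2 :*: q))))) refl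

          -- The only cap points of `a` are `P i` and `P l`, so a line of `a` through `P l` other
          -- than their secant is a tangent.
          tan-l : ∀ λ′ → Tan l (Q λ′)
          tan-l λ′ j j≢l sp with j Fin.≟ i
          ... | yes refl = OnTangent.InPlane.not-i tn (a≢𝟎 (sa T)) av (ai (sa T)) l≢i al λ′ sp
          ... | no j≢i   = j≢l (n-two na l≢i (ai (sa T)) al (OnTangent.InPlane.on-c tn (a≢𝟎 (sa T)) av (ai (sa T)) l≢i al λ′ j sp) j≢i)

          b′Q : ∀ λ′ → dot b′ (Q λ′) ≡ dot b′ v ⊹ λ′ · dot b′ (P i)
          b′Q λ′ = trans (dot-⊕ b′ v _) (cong (dot b′ v ⊹_) (dot-• λ′ b′ (P i)))

          -- Two such points would put the whole line into `b′`. Together with `P l` it spans the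
          -- plane `a`, which is different from `b′`.
          unique : ∀ λ′ μ → dot b′ (Q λ′) ≡ 0# → dot b′ (Q μ) ≡ 0# → λ′ ≡ μ
          unique λ′ μ e e′ with λ′ ≟ μ
          ... | yes r = r
          ... | no λ≢μ = ⊥-elim (ℕ.1+n≰n (perp-dimension (Tan⇒Ind₃ tn l l≢i) (ind T′)
              (pair av b′v ∷ pair (ai (sa T)) b′i ∷ pair al (ai (sb T′)) ∷ [])))
            where
            open Solver
            pair : ∀ {u} → dot a u ≡ 0# → dot b′ u ≡ 0# → dots (a ∷ b′ ∷ []) u ≡ 𝟎
            pair {u} r r′ = cong₂ (λ y z → y ∷ z ∷ []) (trans (dot-comm u a) r) (trans (dot-comm u b′) r′)
            b′i : dot b′ (P i) ≡ 0#
            b′i = *≡0 (λ r → λ≢μ (+≡0⇒≡ r)) (trans (solve 4 (λ x y l m → (l :+ m) :* y := (x :+ l :* y) :+ (x :+ m :* y)) refl (dot b′ v) (dot b′ (P i)) λ′ μ)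
              (trans (cong₂ _⊹_ (trans (sym (b′Q λ′)) e) (trans (sym (b′Q μ)) e′)) (+-identityˡ 0#)))
            b′v : dot b′ v ≡ 0#
            b′v = trans (sym (trans (cong (dot b′ v ⊹_) (trans (cong (λ′ ·_) b′i) (zeroʳ λ′))) (+-identityʳ _))) (trans (sym (b′Q λ′)) e)

          -- The line is now viewed from `P l`: its points outside `b′` fall under `no-deficiency`
          -- for `T′`, and at most one point remains.
          upper : δ ≤ t
          upper = ℕ.≤-trans (∑-mono (Finite.elems finite) each) (ℕ.≤-trans (ℕ.≤-reflexive (∑-*ʳ (Finite.elems finite) t _))
            (ℕ.≤-trans (ℕ.*-monoˡ-≤ t (Finite.S-atMost finite (λ λ′ → dot b′ (Q λ′) ≟ 0#) unique)) (ℕ.≤-reflexive (ℕ.*-identityˡ t))))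
            where
            each : ∀ λ′ → d (Q λ′) ≤ 𝟙 (dot b′ (Q λ′) ≟ 0#) * t
            each λ′ = go (dot b′ (Q λ′) ≟ 0#)
              where
              go : (e : Dec (dot b′ (Q λ′) ≡ 0#)) → d (Q λ′) ≤ 𝟙 e * t
              go (yes _) = ℕ.≤-trans (ℕ.m∸n≤m t (x (Q λ′))) (ℕ.≤-reflexive (sym (ℕ.*-identityˡ t)))
              go (no ne) = ℕ.≤-trans (ℕ.≤-reflexive (no-deficiency t≡ T′ na (tan-l λ′) (OnTangent.InPlane.cQ tn (a≢𝟎 (sa T)) av (ai (sa T)) l≢i al λ′) ne)) z≤n

          impossible : ⊥
          impossible = ℕ.<⇒≱ 3q< (ℕ.≤-trans lower (ℕ.≤-trans (ℕ.+-monoʳ-≤ q (ℕ.≤-trans upper (ℕ.≤-reflexive t≡))) (ℕ.≤-reflexive (ring q))))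
            where
            ring : ∀ q → q + 2 * q ≡ 3 * q
            ring = solveℕ 1 (λ q → q :+: κ 2 :*: q :=: κ 3 :*: q) refl
            3q< : 3 * q < q * q
            3q< = ℕ.*-monoˡ-< q ⦃ q≢0 ⦄ (ℕ.≤-trans (s≤s (s≤s (s≤s (s≤s z≤n)))) 8≤q)

        no-mixed : ∀ {i a b} → t ≡ 2 * q → Two i a b → n a ≡ 2 → n b ≡ 1 → ⊥
        no-mixed {i} {a} {b} t≡ T na nb =
          let l , l≢i , al = another (ai (sa T)) na
              -- The plane `a` is small at its other cap point as well, hence can serve as one of
              -- the two planes there.
              b′ , T′ = second (mkSmall (a≢𝟎 (sa T)) al (n≤4 (sa T)))
              v , le = ∑-pos V.elems {λ v → on b v * on a v * 𝟙 (tan? i v)} (ℕ.≤-trans (ℕ.n≢0⇒n>0 (qp≢0 q≡1+p p≢0)) (ℕ.≤-reflexive (sym (J-one (Two-sym T) nb))))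
              (bv , av) , tn = 𝟙-pos (((dot b v ≟ 0#) ×-dec (dot a v ≟ 0#)) ×-dec tan? i v) (ℕ.≤-trans le (ℕ.≤-reflexive (sym (trans (𝟙-× ((dot b v ≟ 0#) ×-dec (dot a v ≟ 0#)) (tan? i v)) (cong (_* 𝟙 (tan? i v)) (𝟙-× (dot b v ≟ 0#) (dot a v ≟ 0#)))))))
          in Mixed.impossible t≡ T na nb l≢i al T′ tn av bv

        open DecMembership (Fin._≟_ {k}) using (_∈?_)
        pick : {R : Fin k → Set} (R? : ∀ r → Dec (R r)) (L : List (Fin k)) → length L < Sk (λ r → 𝟙 (R? r)) → ∃ λ r → R r × r ∉ L
        pick {R} R? L lt = result (Finite.search (finFinite k) (λ r → R? r ×-dec ¬? (r ∈? L)))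
          where
          covered : ∀ r L → 𝟙 (r ∈? L) ≤ ∑ L (λ l → 𝟙 (r Fin.≟ l))
          covered r L with r ∈? L
          ... | yes p = ℕ.≤-trans (ℕ.≤-reflexive (sym (𝟙-yes (r Fin.≟ r) refl))) (∑-term L {λ l → 𝟙 (r Fin.≟ l)} p)
          ... | no _  = z≤n
          result : Dec (∃ λ r → R r × r ∉ L) → ∃ λ r → R r × r ∉ L
          result (yes e) = e
          result (no ¬e) = ⊥-elim (ℕ.<⇒≱ lt (begin
            Sk (λ r → 𝟙 (R? r)) ≤⟨ ∑-mono (allFin k) (λ r → ℕ.≤-trans (𝟙-mono (R? r) (r ∈? L) (inside r)) (covered r L)) ⟩
            Sk (λ r → ∑ L (λ l → 𝟙 (r Fin.≟ l))) ≡⟨ ∑-swap (allFin k) L _ ⟩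
            ∑ L (λ l → Sk (λ r → 𝟙 (r Fin.≟ l))) ≡⟨ ∑-cong L (λ l → Finite.once (finFinite k) l) ⟩
            ∑ L (λ _ → 1) ≡⟨ ∑-1 L ⟩
            length L ∎))
            where
            open ℕ.≤-Reasoning
            inside : ∀ r → R r → r ∈ L
            inside r Rr with r ∈? L
            ... | yes p = p
            ... | no ¬p = ⊥-elim (¬e (r , Rr , ¬p))

        -- The line has q² vectors, of which only q are multiples of `P i`. Any other vector on it
        -- is not on a tangent at `P i`, so it lies on a secant through `P i`, and that secant is
        -- the line itself.
        secant-in-line : ∀ {i c a} → Ind (c ∷ a ∷ []) → dot c (P i) ≡ 0# → dot a (P i) ≡ 0# →
          (∀ v → dot c v ≡ 0# → dot a v ≡ 0# → ¬ Tan i v) → ∃ λ j → j ≢ i × dot c (P j) ≡ 0# × dot a (P j) ≡ 0#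
        secant-in-line {i} {c} {a} ca ci a⊥i no-tan = result (V.search point?)
          where
          point? : ∀ v → Dec ((dot c v ≡ 0# × dot a v ≡ 0#) × ¬ Span (P i ∷ []) v)
          point? v = ((dot c v ≟ 0#) ×-dec (dot a v ≟ 0#)) ×-dec ¬? (span? (P i ∷ []) v)
          on-secant : ∀ {v} → dot c v ≡ 0# → dot a v ≡ 0# → ¬ Span (P i ∷ []) v → Dec (∃ λ j → j ≢ i × OnLine i j v) → ∃ λ j → j ≢ i × dot c (P j) ≡ 0# × dot a (P j) ≡ 0#
          on-secant cv av v∉ (no ¬e) = ⊥-elim (no-tan _ cv av (λ j j≢i sp → ¬e (j , j≢i , sp)))
          on-secant {v} cv av v∉ (yes (j , j≢i , sp)) = j , j≢i , along ci cv , along a⊥i av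
            where
            α = proj₁ (span₂⁻ sp)
            β = proj₁ (proj₂ (span₂⁻ sp))
            v≡ : v ≡ α • P i ⊕ β • P j
            v≡ = proj₂ (proj₂ (span₂⁻ sp))
            β≢0 : β ≢ 0#
            β≢0 r = v∉ (span₁ α (trans v≡ (trans (cong (λ z → α • P i ⊕ z • P j) r) (trans (cong (α • P i ⊕_) (0• (P j))) (⊕-identityʳ _)))))
            along : ∀ {e} → dot e (P i) ≡ 0# → dot e v ≡ 0# → dot e (P j) ≡ 0#
            along {e} ei ev = *≡0 β≢0 (trans (sym (+-identityˡ _)) (trans (cong (_⊹ β · dot e (P j)) (sym (trans (cong (α ·_) ei) (zeroʳ α))))
              (trans (sym (dot-⊕• e α β (P i) (P j))) (trans (cong (dot e) (sym v≡)) ev))))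
          result : Dec (∃ λ v → (dot c v ≡ 0# × dot a v ≡ 0#) × ¬ Span (P i ∷ []) v) → ∃ λ j → j ≢ i × dot c (P j) ≡ 0# × dot a (P j) ≡ 0#
          result (yes (v , (cv , av) , v∉)) = on-secant cv av v∉ (Finite.search (finFinite k) (λ j → ¬? (j Fin.≟ i) ×-dec span? (P i ∷ P j ∷ []) v))
          result (no ¬∃) = ⊥-elim (ℕ.<⇒≱ (ℕ.m<m*n q q ⦃ q≢0 ⦄ 2≤q) (ℕ.≤-trans (ℕ.≤-reflexive (sym (line-size ca))) (ℕ.≤-trans (∑-mono V.elems each) (ℕ.≤-reflexive (span₁-count (ind₁ i))))))
            where
            each : ∀ v → on c v * on a v ≤ 𝟙 (span? (P i ∷ []) v)
            each v = ℕ.≤-trans (ℕ.≤-reflexive (sym (𝟙-× (dot c v ≟ 0#) (dot a v ≟ 0#)))) (𝟙-mono _ (span? (P i ∷ []) v) (λ e → decidable-stable (span? (P i ∷ []) v) (λ v∉ → ¬∃ (v , e , v∉))))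

        span₂-count : ∀ {u w} → Ind (u ∷ w ∷ []) → SV (λ v → 𝟙 (span? (u ∷ w ∷ []) v)) ≡ q * q
        span₂-count ind = trans (∑-cong V.elems (λ v → sym (ℕ.*-identityʳ _))) (trans (S-span ind (λ _ → 1)) (trans (∑-1 V.elems) (trans (size-finV 2) (cong (q *_) (ℕ.*-identityʳ q)))))

        Span-⊕ : ∀ {r} {us : Vec V4 r} {v v′} → Span us v → Span us v′ → Span us (v ⊕ v′)
        Span-⊕ {us = us} (cs , e) (cs′ , e′) = cs ⊕ cs′ , trans (cong₂ _⊕_ e e′) (sym (comb-⊕ cs cs′ us))

        Span-• : ∀ {r} {us : Vec V4 r} {v} α → Span us v → Span us (α • v)
        Span-• {us = us} α (cs , e) = α • cs , trans (cong (α •_) e) (sym (comb-• α cs us))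

        -- For a fixed coefficient of `w` at most one coefficient of `u` is possible, since the
        -- difference of two would put `u` into the other span.
        meet-count : ∀ {u w} {ws : Vec V4 2} → Ind (u ∷ w ∷ []) → ¬ Span ws u →
          SV (λ v → 𝟙 (span? (u ∷ w ∷ []) v) * 𝟙 (span? ws v)) ≤ q
        meet-count {u} {w} {ws} ind u∉ = begin
          SV (λ v → 𝟙 (span? (u ∷ w ∷ []) v) * 𝟙 (span? ws v)) ≡⟨ S-span ind _ ⟩
          SV (λ cs → 𝟙 (span? ws (comb cs (u ∷ w ∷ [])))) ≡⟨ S-∷ 1 _ ⟩
          Sf (λ α → SV (λ bs → 𝟙 (span? ws (comb (α ∷ bs) (u ∷ w ∷ []))))) ≡⟨ ∑-swap (Finite.elems finite) V.elems _ ⟩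
          SV (λ bs → Sf (λ α → 𝟙 (span? ws (comb (α ∷ bs) (u ∷ w ∷ []))))) ≤⟨ ∑-mono V.elems (λ bs → Finite.S-atMost finite (λ α → span? ws (comb (α ∷ bs) (u ∷ w ∷ []))) (unique bs)) ⟩
          SV (λ (bs : Vec F 1) → 1) ≡⟨ trans (∑-1 V.elems) (trans (size-finV 1) (ℕ.*-identityʳ q)) ⟩
          q ∎
          where
          open ℕ.≤-Reasoning
          collapse : (a b c : V4) → (a ⊕ c) ⊕ (b ⊕ c) ≡ a ⊕ b
          collapse a b c = go a b c
            where
            go : ∀ {d} (a b c : Vec F d) → (a ⊕ c) ⊕ (b ⊕ c) ≡ a ⊕ b
            go []      []      []      = refl
            go (x ∷ a) (y ∷ b) (z ∷ c) = cong₂ _∷_ (solve 3 (λ x y z → (x :+ z) :+ (y :+ z) := x :+ y) refl x y z) (go a b c)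
              where open Solver
          unique : ∀ (bs : Vec F 1) α α′ → Span ws (comb (α ∷ bs) (u ∷ w ∷ [])) → Span ws (comb (α′ ∷ bs) (u ∷ w ∷ [])) → α ≡ α′
          unique bs α α′ sp sp′ with α ≟ α′
          ... | yes e = e
          ... | no α≢ = ⊥-elim (u∉ (subst (Span ws) (inv-• u (λ r → α≢ (+≡0⇒≡ r)))
            (Span-• (inv (α ⊹ α′)) (subst (Span ws) (trans (collapse (α • u) (α′ • u) (comb bs (w ∷ []))) (sym (•-distribʳ α α′ u))) (Span-⊕ sp sp′)))))

        -- Two cap points in both planes at every cap point.

        module Paired (t≡ : t ≡ 2 * q) where
          record Pairs (i : Fin k) : Set where
            constructor mkPairs
            field
              {a b} : V4
              pair  : Two i a b
              na    : n a ≡ 2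
              nb    : n b ≡ 2
              J≡0   : J i a b ≡ 0

            ⊥a : dot a (P i) ≡ 0#
            ⊥a = ai (sa pair)

            a≢ : a ≢ 𝟎
            a≢ = a≢𝟎 (sa pair)

            skew : ∀ v → dot b v ≡ 0# → dot a v ≡ 0# → ¬ Tan i v
            skew v bv av tn = ℕ.1+n≰n (ℕ.≤-trans (ℕ.≤-reflexive (sym (cong₂ _*_ (cong₂ _*_ (𝟙-yes (dot a v ≟ 0#) av) (𝟙-yes (dot b v ≟ 0#) bv)) (𝟙-yes (tan? i v) tn))))
              (ℕ.≤-trans (V.term (λ v → on a v * on b v * 𝟙 (tan? i v)) v) (ℕ.≤-reflexive J≡0)))

            tangent-full : ∀ {v} → Tan i v → x v ≡ t
            tangent-full {v} tn = trans (sym (ℕ.+-identityʳ (x v))) (trans (cong (x v +_) (sym (d≡0 (cover pair v tn)))) (x+d v))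
              where
              d≡0 : dot a v ≡ 0# ⊎ dot b v ≡ 0# → d v ≡ 0
              d≡0 (inj₁ av) = no-deficiency t≡ pair na tn av (λ bv → skew v bv av tn)
              d≡0 (inj₂ bv) = no-deficiency t≡ (Two-sym pair) nb tn bv (λ av → skew v bv av tn)

            -- By `plane-sum` the values of `x` on `a` total q p q t. The q p q vectors of `a` on
            -- tangents at `P i` already reach this with the value t each, so all others have the
            -- value zero.
            exact : ∀ {v} → dot a v ≡ 0# → x v ≡ 𝟙 (tan? i v) * t
            exact {v} av = sym (trans (sym (ℕ.*-identityˡ _)) (trans (cong (_* (𝟙 (tan? i v) * t)) (sym (𝟙-yes (dot a v ≟ 0#) av)))
              (trans (∑-rigid V.elems {λ v → on a v * (𝟙 (tan? i v) * t)} {λ v → on a v * x v} (λ v → ℕ.*-monoʳ-≤ (on a v) (each v (tan? i v))) total (V.complete v))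
                (trans (cong (_* x v) (𝟙-yes (dot a v ≟ 0#) av)) (ℕ.*-identityˡ _)))))
              where
              each : ∀ v (e : Dec (Tan i v)) → 𝟙 e * t ≤ x v
              each v (yes tn) = ℕ.≤-reflexive (trans (ℕ.*-identityˡ t) (sym (tangent-full tn)))
              each v (no _)   = z≤n
              lhs : SV (λ v → on a v * (𝟙 (tan? i v) * t)) ≡ q * p * q * t
              lhs = trans (∑-cong V.elems (λ v → sym (ℕ.*-assoc (on a v) _ t))) (trans (∑-*ʳ V.elems t _)
                (cong (_* t) (trans (tanCount-on i a≢ ⊥a) (cong (q * p *_) (n≡2⇒s≡q a≢ na)))))
              arith : ∀ {p q k t X s n} → n ≡ 2 → s ≡ q → t ≡ 2 * q → X + n * (p * t) ≡ n * (q * p * s) + k * (p * t) → k + t ≡ q * q + q + 2 → X ≡ q * p * q * t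
              arith {p} {q} {k} {X = X} refl refl refl e e′ = lin≡ (cong₂ _+_ e (cong (p * (2 * q) *_) e′)) (ring p q k X)
                where
                ring : ∀ p q k X → X + (2 * (q * p * q) + k * (p * (2 * q)) + p * (2 * q) * (q * q + q + 2)) ≡
                  q * p * q * (2 * q) + (X + 2 * (p * (2 * q)) + p * (2 * q) * (k + 2 * q))
                ring = solveℕ 4 (λ p q k X → X :+: (κ 2 :*: (q :*: p :*: q) :+: k :*: (p :*: (κ 2 :*: q)) :+: p :*: (κ 2 :*: q) :*: (q :*: q :+: q :+: κ 2)) :=: q :*: p :*: q :*: (κ 2 :*: q) :+: (X :+: κ 2 :*: (p :*: (κ 2 :*: q)) :+: p :*: (κ 2 :*: q) :*: (k :+: κ 2 :*: q))) refl
              total : SV (λ v → on a v * x v) ≤ SV (λ v → on a v * (𝟙 (tan? i v) * t))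
              total = ℕ.≤-reflexive (trans (arith {p} {q} {k} {t} na (n≡2⇒s≡q a≢ na) t≡ (plane-sum a≢) (k+t i)) (sym lhs))

            zero-line : ∀ {j} → j ≢ i → dot a (P j) ≡ 0# → ∀ {v} → Span (P i ∷ P j ∷ []) v → x v ≡ 0
            zero-line {j} j≢i aj {v} sp = trans (exact av) (cong (_* t) (𝟙-no (tan? i v) (λ tn → tn j j≢i sp)))
              where
              av : dot a v ≡ 0#
              av = trans (dot-comm a v) (perp-span₂ (trans (dot-comm (P i) a) ⊥a) (trans (dot-comm (P j) a) aj) sp)
          open Pairs

          from-kind : ∀ {i a b} → Two i a b → Kind i a b → Pairs i
          from-kind T (one-one _ _ e)    = ⊥-elim (ℕ.1+n≢n (trans (ℕ.+-comm 1 (2 * q)) (trans (sym e) t≡)))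
          from-kind T (one-two na nb _)  = ⊥-elim (no-mixed t≡ (Two-sym T) nb na)
          from-kind T (two-one na nb _)  = ⊥-elim (no-mixed t≡ T na nb)
          from-kind T (two-two na nb _ e) = mkPairs T na nb e

          pairs : ∀ i → Pairs i
          pairs i = let a , b , T = two i in from-kind T (kind T)

          x-values : ∀ v → x v ≡ 0 ⊎ x v ≡ t
          x-values v with x v in e
          ... | zero  = inj₁ refl
          ... | suc y = let i , le = ∑-pos (allFin k) {λ i → 𝟙 (tan? i v)} (ℕ.≤-trans (s≤s z≤n) (ℕ.≤-reflexive (sym e)))
                        in inj₂ (trans (sym e) (tangent-full (pairs i) (𝟙-pos (tan? i v) le)))

          -- Planes with q + 2 cap points.

          module Hyperoval {c : V4} (c≢𝟎 : c ≢ 𝟎) (sc : s c ≡ 0) where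
            nc : n c ≡ q + 2
            nc = trans (sym (ℕ.+-identityʳ (n c))) (trans (cong (n c +_) (sym sc)) (n+s c≢𝟎))

            no-tangents : ∀ {r} → dot c (P r) ≡ 0# → ∀ v → dot c v ≡ 0# → ¬ Tan r v
            no-tangents {r} cr v cv tn = ℕ.1+n≰n (ℕ.≤-trans (ℕ.≤-reflexive (sym (cong₂ _*_ (𝟙-yes (dot c v ≟ 0#) cv) (𝟙-yes (tan? r v) tn))))
              (ℕ.≤-trans (V.term (λ v → on c v * 𝟙 (tan? r v)) v) (ℕ.≤-reflexive (trans (tanCount-on r c≢𝟎 cr) (trans (cong (q * p *_) sc) (ℕ.*-zeroʳ (q * p)))))))

            -- The plane `a` at `P r` has two cap points and so is not `c`. The line common to both
            -- carries no tangent at `P r`, hence is a secant, and `zero-line` applies to it inside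
            -- `a`.
            mate : ∀ r → dot c (P r) ≡ 0# → ∃ λ j → j ≢ r × dot c (P j) ≡ 0# × (∀ {v} → Span (P r ∷ P j ∷ []) v → x v ≡ 0)
            mate r cr = let D = pairs r ; j , j≢r , cj , aj = secant-in-line (ind-c D) cr (⊥a D) (λ v cv _ → no-tangents cr v cv) in j , j≢r , cj , zero-line D j≢r aj
              where
              ind-c : (D : Pairs r) → Ind (c ∷ a D ∷ [])
              ind-c D = Ind-∷ (Ind-nonzero (a≢ D)) (λ sp → ℕ.1+n≰n (ℕ.≤-trans (ℕ.≤-trans (s≤s (s≤s (s≤s z≤n))) (ℕ.≤-trans 8≤q (ℕ.m≤m+n q 2))) (ℕ.≤-reflexive (trans (sym nc) (trans (prop-n c≢𝟎 sp) (na D))))))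

            record Line (r : Fin k) : Set where
              constructor mkLine
              field
                {j}   : Fin k
                j≢r   : j ≢ r
                cr    : dot c (P r) ≡ 0#
                cj    : dot c (P j) ≡ 0#
                zeros : ∀ {v} → Span (P r ∷ P j ∷ []) v → x v ≡ 0

              U : V4 → ℕ
              U v = 𝟙 (span? (P r ∷ P j ∷ []) v)
            open Line

            opaque
              line-from : ∀ {r} → dot c (P r) ≡ 0# → Line r
              line-from {r} cr = let j , j≢r , cj , z = mate r cr in mkLine {j = j} j≢r cr cj z

            U-count : ∀ {r} (ℓ : Line r) → SV (U ℓ) ≡ q * q
            U-count {r} ℓ = span₂-count (ind₂ r (j ℓ) (λ e → j≢r ℓ (sym e)))

            U-meet : ∀ {r r′} (ℓ : Line r) (ℓ′ : Line r′) → r′ ≢ r → r′ ≢ j ℓ → SV (λ v → U ℓ′ v * U ℓ v) ≤ q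
            U-meet {r} {r′} ℓ ℓ′ ≢r ≢j = meet-count (ind₂ r′ (j ℓ′) (λ e → j≢r ℓ′ (sym e))) (Ind⇒∉Span (ind₃ r′ r (j ℓ) ≢r ≢j (λ e → j≢r ℓ (sym e))))

            zero? : ∀ v → Dec (dot c v ≡ 0# × x v ≡ 0)
            zero? v = (dot c v ≟ 0#) ×-dec (x v ℕ.≟ 0)

            Z : ℕ
            Z = SV (λ v → 𝟙 (zero? v))

            U⇒zero : ∀ {r} (ℓ : Line r) → ∀ {v} → Span (P r ∷ P (j ℓ) ∷ []) v → dot c v ≡ 0# × x v ≡ 0
            U⇒zero {r} ℓ {v} sp = trans (dot-comm c v) (perp-span₂ (trans (dot-comm (P r) c) (cr ℓ)) (trans (dot-comm (P (j ℓ)) c) (cj ℓ)) sp) , zeros ℓ sp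

            -- Four lines of q² vectors, with at most q vectors in each of the six pairwise
            -- intersections. Choosing every new point off the earlier lines makes the lines
            -- distinct.
            four-lines : ∀ {r₀ r₁ r₂ r₃} (ℓ₀ : Line r₀) (ℓ₁ : Line r₁) (ℓ₂ : Line r₂) (ℓ₃ : Line r₃) → r₁ ≢ r₀ → r₁ ≢ j ℓ₀ → r₂ ≢ r₀ → r₂ ≢ j ℓ₀ → r₂ ≢ r₁ → r₂ ≢ j ℓ₁ →
              r₃ ≢ r₀ → r₃ ≢ j ℓ₀ → r₃ ≢ r₁ → r₃ ≢ j ℓ₁ → r₃ ≢ r₂ → r₃ ≢ j ℓ₂ → 4 * (q * q) ≤ Z + 6 * q
            four-lines {r₀} {r₁} {r₂} {r₃} ℓ₀ ℓ₁ ℓ₂ ℓ₃ n₁₀ m₁₀ n₂₀ m₂₀ n₂₁ m₂₁ n₃₀ m₃₀ n₃₁ m₃₁ n₃₂ m₃₂ = begin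
              4 * (q * q) ≡⟨ four (q * q) ⟩
              q * q + (q * q + (q * q + q * q)) ≡⟨ cong₂ _+_ (U-count ℓ₀) (cong₂ _+_ (U-count ℓ₁) (cong₂ _+_ (U-count ℓ₂) (U-count ℓ₃))) ⟨
              SV (U ℓ₀) + (SV (U ℓ₁) + (SV (U ℓ₂) + SV (U ℓ₃)))
                ≡⟨ trans (∑-+ V.elems _ _) (cong (SV (U ℓ₀) +_) (trans (∑-+ V.elems _ _) (cong (SV (U ℓ₁) +_) (∑-+ V.elems _ _)))) ⟨
              SV (λ v → U ℓ₀ v + (U ℓ₁ v + (U ℓ₂ v + U ℓ₃ v))) ≤⟨ ∑-mono V.elems (λ v → bonferroni v (span? _ v) (span? _ v) (span? _ v) (span? _ v)) ⟩
              SV (λ v → 𝟙 (zero? v) + (M ℓ₁ ℓ₀ v + (M ℓ₂ ℓ₀ v + (M ℓ₂ ℓ₁ v + (M ℓ₃ ℓ₀ v + (M ℓ₃ ℓ₁ v + M ℓ₃ ℓ₂ v))))))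
                ≡⟨ trans (∑-+ V.elems _ _) (cong (Z +_) (trans (∑-+ V.elems _ _) (cong (SV (M ℓ₁ ℓ₀) +_) (trans (∑-+ V.elems _ _) (cong (SV (M ℓ₂ ℓ₀) +_) (trans (∑-+ V.elems _ _) (cong (SV (M ℓ₂ ℓ₁) +_) (trans (∑-+ V.elems _ _) (cong (SV (M ℓ₃ ℓ₀) +_) (∑-+ V.elems _ _)))))))))) ⟩
              Z + (SV (M ℓ₁ ℓ₀) + (SV (M ℓ₂ ℓ₀) + (SV (M ℓ₂ ℓ₁) + (SV (M ℓ₃ ℓ₀) + (SV (M ℓ₃ ℓ₁) + SV (M ℓ₃ ℓ₂))))))
                ≤⟨ ℕ.+-monoʳ-≤ Z (ℕ.+-mono-≤ (U-meet ℓ₀ ℓ₁ n₁₀ m₁₀) (ℕ.+-mono-≤ (U-meet ℓ₀ ℓ₂ n₂₀ m₂₀) (ℕ.+-mono-≤ (U-meet ℓ₁ ℓ₂ n₂₁ m₂₁) (ℕ.+-mono-≤ (U-meet ℓ₀ ℓ₃ n₃₀ m₃₀) (ℕ.+-mono-≤ (U-meet ℓ₁ ℓ₃ n₃₁ m₃₁) (U-meet ℓ₂ ℓ₃ n₃₂ m₃₂)))))) ⟩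
              Z + (q + (q + (q + (q + (q + q))))) ≡⟨ cong (Z +_) (six q) ⟩
              Z + 6 * q ∎
              where
              open ℕ.≤-Reasoning
              M : ∀ {r r′} → Line r → Line r′ → V4 → ℕ
              M ℓ′ ℓ v = U ℓ′ v * U ℓ v
              four : ∀ x → 4 * x ≡ x + (x + (x + x))
              four = solveℕ 1 (λ x → κ 4 :*: x :=: x :+: (x :+: (x :+: x))) refl
              six : ∀ x → x + (x + (x + (x + (x + x)))) ≡ 6 * x
              six = solveℕ 1 (λ x → x :+: (x :+: (x :+: (x :+: (x :+: x)))) :=: κ 6 :*: x) refl
              -- Bonferroni's inequality for the indicators of four sets contained in a fifth.
              union : ∀ {a b c d z : ℕ} → a ≤ 1 → b ≤ 1 → c ≤ 1 → d ≤ 1 → a ≤ z → b ≤ z → c ≤ z → d ≤ z →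
                a + (b + (c + d)) ≤ z + (b * a + (c * a + (c * b + (d * a + (d * b + d * c)))))
              union {0} {0} {0} {d} _ _ _ _ _ _ _ h = ℕ.≤-trans h (ℕ.m≤m+n _ _)
              union {0} {0} {1} {0} _ _ _ _ _ _ h _ = ℕ.≤-trans h (ℕ.m≤m+n _ _)
              union {0} {0} {1} {1} _ _ _ _ _ _ h _ = ℕ.+-monoˡ-≤ 1 h
              union {0} {1} {0} {0} _ _ _ _ _ h _ _ = ℕ.≤-trans h (ℕ.m≤m+n _ _)
              union {0} {1} {0} {1} _ _ _ _ _ h _ _ = ℕ.+-monoˡ-≤ 1 h
              union {0} {1} {1} {0} _ _ _ _ _ h _ _ = ℕ.+-monoˡ-≤ 1 h
              union {0} {1} {1} {1} _ _ _ _ _ h _ _ = ℕ.+-mono-≤ h (s≤s (s≤s z≤n))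
              union {1} {0} {0} {0} _ _ _ _ h _ _ _ = ℕ.≤-trans h (ℕ.m≤m+n _ _)
              union {1} {0} {0} {1} _ _ _ _ h _ _ _ = ℕ.+-monoˡ-≤ 1 h
              union {1} {0} {1} {0} _ _ _ _ h _ _ _ = ℕ.+-monoˡ-≤ 1 h
              union {1} {0} {1} {1} _ _ _ _ h _ _ _ = ℕ.+-mono-≤ h (s≤s (s≤s z≤n))
              union {1} {1} {0} {0} _ _ _ _ h _ _ _ = ℕ.+-monoˡ-≤ 1 h
              union {1} {1} {0} {1} _ _ _ _ h _ _ _ = ℕ.+-mono-≤ h (s≤s (s≤s z≤n))
              union {1} {1} {1} {0} _ _ _ _ h _ _ _ = ℕ.+-mono-≤ h (s≤s (s≤s z≤n))
              union {1} {1} {1} {1} _ _ _ _ h _ _ _ = ℕ.+-mono-≤ h (s≤s (s≤s (s≤s z≤n)))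
              union {suc (suc _)} (s≤s ())
              union {0} {suc (suc _)} _ (s≤s ())
              union {1} {suc (suc _)} _ (s≤s ())
              union {0} {0} {suc (suc _)} _ _ (s≤s ())
              union {0} {1} {suc (suc _)} _ _ (s≤s ())
              union {1} {0} {suc (suc _)} _ _ (s≤s ())
              union {1} {1} {suc (suc _)} _ _ (s≤s ())
              union {0} {0} {1} {suc (suc _)} _ _ _ (s≤s ())
              union {0} {1} {0} {suc (suc _)} _ _ _ (s≤s ())
              union {0} {1} {1} {suc (suc _)} _ _ _ (s≤s ())
              union {1} {0} {0} {suc (suc _)} _ _ _ (s≤s ())
              union {1} {0} {1} {suc (suc _)} _ _ _ (s≤s ())
              union {1} {1} {0} {suc (suc _)} _ _ _ (s≤s ())
              union {1} {1} {1} {suc (suc _)} _ _ _ (s≤s ())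
              bonferroni : ∀ v (e₀ : Dec (Span (P r₀ ∷ P (j ℓ₀) ∷ []) v)) (e₁ : Dec (Span (P r₁ ∷ P (j ℓ₁) ∷ []) v)) (e₂ : Dec (Span (P r₂ ∷ P (j ℓ₂) ∷ []) v)) (e₃ : Dec (Span (P r₃ ∷ P (j ℓ₃) ∷ []) v)) →
                𝟙 e₀ + (𝟙 e₁ + (𝟙 e₂ + 𝟙 e₃)) ≤ 𝟙 (zero? v) + (𝟙 e₁ * 𝟙 e₀ + (𝟙 e₂ * 𝟙 e₀ + (𝟙 e₂ * 𝟙 e₁ + (𝟙 e₃ * 𝟙 e₀ + (𝟙 e₃ * 𝟙 e₁ + 𝟙 e₃ * 𝟙 e₂)))))
              bonferroni v e₀ e₁ e₂ e₃ = union (𝟙-≤1 e₀) (𝟙-≤1 e₁) (𝟙-≤1 e₂) (𝟙-≤1 e₃)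
                (𝟙-mono e₀ (zero? v) (U⇒zero ℓ₀)) (𝟙-mono e₁ (zero? v) (U⇒zero ℓ₁)) (𝟙-mono e₂ (zero? v) (U⇒zero ℓ₂)) (𝟙-mono e₃ (zero? v) (U⇒zero ℓ₃))

            Z-count : SV (λ v → on c v * x v) + Z * t ≡ q * (q * q) * t
            Z-count = trans (cong (SV (λ v → on c v * x v) +_) (sym (∑-*ʳ V.elems t _))) (trans (sym (∑-+ V.elems _ _)) (trans (∑-cong V.elems each) (trans (∑-*ʳ V.elems t _) (cong (_* t) (planeSize c≢𝟎)))))
              where
              go : ∀ v → x v ≡ 0 ⊎ x v ≡ t → x v + 𝟙 (x v ℕ.≟ 0) * t ≡ t
              go v (inj₁ e) = trans (cong₂ (λ y z → y + z * t) e (𝟙-yes (x v ℕ.≟ 0) e)) (ℕ.+-identityʳ t)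
              go v (inj₂ e) = trans (cong₂ (λ y z → y + z * t) e (𝟙-no (x v ℕ.≟ 0) (λ e′ → ℕ.1+n≰n (ℕ.≤-trans positive-t (ℕ.≤-reflexive (trans (sym e) e′)))))) (ℕ.+-identityʳ t)
              factor : ∀ o x y t → o * x + o * y * t ≡ o * (x + y * t)
              factor = solveℕ 4 (λ o x y t → o :*: x :+: o :*: y :*: t :=: o :*: (x :+: y :*: t)) refl
              each : ∀ v → on c v * x v + 𝟙 (zero? v) * t ≡ on c v * t
              each v = trans (cong (λ z → on c v * x v + z * t) (𝟙-× (dot c v ≟ 0#) (x v ℕ.≟ 0))) (trans (factor (on c v) (x v) (𝟙 (x v ℕ.≟ 0)) t) (cong (on c v *_) (go v (x-values v))))

            -- With s = 0 and k = q² - q + 2, `plane-sum` leaves exactly 3q² - 2q vectors of the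
            -- plane with x = 0. Four lines carry at least 4q² - 6q, so q ≤ 4; three lines would
            -- give no contradiction.
            impossible : ∀ {i} → dot c (P i) ≡ 0# → ⊥
            impossible {i} ci = start (line-from ci)
              where
              big : ∀ {z} → z < 8 → z < Sk (λ r → 𝟙 (on? c r))
              big lt = ℕ.≤-trans lt (ℕ.≤-trans 8≤q (ℕ.≤-trans (ℕ.m≤m+n q 2) (ℕ.≤-reflexive (sym nc))))
              zeros-exactly : ∀ {p q k t X Z n s} → t ≢ 0 → n ≡ q + 2 → s ≡ 0 → X + n * (p * t) ≡ n * (q * p * s) + k * (p * t) →
                X + Z * t ≡ q * (q * q) * t → Z + k * p ≡ q * (q * q) + (q + 2) * p
              zeros-exactly {p} {q} {k} {t} {X} {Z} t≢0 refl refl e e′ = p*-cancel t≢0 (lin≡ (cong₂ _+_ (sym e) e′) (ring p q k t X Z))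
                where
                ring : ∀ p q k t X Z → t * (Z + k * p) + (X + (q + 2) * (p * t) + q * (q * q) * t) ≡
                  t * (q * (q * q) + (q + 2) * p) + ((q + 2) * (q * p * 0) + k * (p * t) + (X + Z * t))
                ring = solveℕ 6 (λ p q k t X Z → t :*: (Z :+: k :*: p) :+: (X :+: (q :+: κ 2) :*: (p :*: t) :+: q :*: (q :*: q) :*: t) :=: t :*: (q :*: (q :*: q) :+: (q :+: κ 2) :*: p) :+: ((q :+: κ 2) :*: (q :*: p :*: κ 0) :+: k :*: (p :*: t) :+: (X :+: Z :*: t))) refl
              arith : ∀ {p q k t Z} → q ≡ suc p → t ≡ 2 * q → Z + k * p ≡ q * (q * q) + (q + 2) * p →
                k + t ≡ q * q + q + 2 → 4 * (q * q) ≤ Z + 6 * q → q * q ≤ 4 * q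
              arith {p} {k = k} {Z = Z} refl refl e e′ le = lin (ℕ.+-mono-≤ (ℕ.≤-reflexive (cong₂ _+_ e (cong (p *_) (sym e′)))) le) 0 (ring p k Z)
                where
                ring : ∀ p k Z → suc p * suc p + (suc p * (suc p * suc p) + (suc p + 2) * p + p * (k + 2 * suc p) + (Z + 6 * suc p)) + 0 ≡
                  4 * suc p + (Z + k * p + p * (suc p * suc p + suc p + 2) + 4 * (suc p * suc p))
                ring = solveℕ 3 (λ p k Z → (κ 1 :+: p) :*: (κ 1 :+: p) :+: ((κ 1 :+: p) :*: ((κ 1 :+: p) :*: (κ 1 :+: p)) :+: ((κ 1 :+: p) :+: κ 2) :*: p :+: p :*: (k :+: κ 2 :*: (κ 1 :+: p)) :+: (Z :+: κ 6 :*: (κ 1 :+: p))) :+: κ 0 :=: κ 4 :*: (κ 1 :+: p) :+: (Z :+: k :*: p :+: p :*: ((κ 1 :+: p) :*: (κ 1 :+: p) :+: (κ 1 :+: p) :+: κ 2) :+: κ 4 :*: ((κ 1 :+: p) :*: (κ 1 :+: p)))) refl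
              finish : 4 * (q * q) ≤ Z + 6 * q → ⊥
              finish le = ℕ.<⇒≱ (ℕ.*-monoˡ-< q ⦃ q≢0 ⦄ (ℕ.≤-trans (s≤s (s≤s (s≤s (s≤s (s≤s z≤n))))) 8≤q)) (arith {p} {q} {k} {t} {Z} q≡1+p t≡ (zeros-exactly {p} {q} {k} {t} {SV (λ v → on c v * x v)} {Z} {n c} {s c} (λ e → ℕ.1+n≰n (ℕ.≤-trans positive-t (ℕ.≤-reflexive e))) nc sc (plane-sum c≢𝟎) Z-count) (k+t i) le)
              last : ∀ {r₁ r₂} (ℓ₀ : Line i) (ℓ₁ : Line r₁) (ℓ₂ : Line r₂) → r₁ ∉ i ∷ j ℓ₀ ∷ [] → r₂ ∉ i ∷ j ℓ₀ ∷ r₁ ∷ j ℓ₁ ∷ [] →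
                (∃ λ r₃ → dot c (P r₃) ≡ 0# × r₃ ∉ i ∷ j ℓ₀ ∷ r₁ ∷ j ℓ₁ ∷ r₂ ∷ j ℓ₂ ∷ []) → ⊥
              last ℓ₀ ℓ₁ ℓ₂ ∉₁ ∉₂ (r₃ , c₃ , ∉₃) = finish (four-lines ℓ₀ ℓ₁ ℓ₂ (line-from c₃) (λ e → ∉₁ (here e)) (λ e → ∉₁ (there (here e)))
                (λ e → ∉₂ (here e)) (λ e → ∉₂ (there (here e))) (λ e → ∉₂ (there (there (here e)))) (λ e → ∉₂ (there (there (there (here e)))))
                (λ e → ∉₃ (here e)) (λ e → ∉₃ (there (here e))) (λ e → ∉₃ (there (there (here e)))) (λ e → ∉₃ (there (there (there (here e)))))
                (λ e → ∉₃ (there (there (there (there (here e)))))) (λ e → ∉₃ (there (there (there (there (there (here e))))))))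
              third : ∀ {r₁} (ℓ₀ : Line i) (ℓ₁ : Line r₁) → r₁ ∉ i ∷ j ℓ₀ ∷ [] → (∃ λ r₂ → dot c (P r₂) ≡ 0# × r₂ ∉ i ∷ j ℓ₀ ∷ r₁ ∷ j ℓ₁ ∷ []) → ⊥
              third {r₁} ℓ₀ ℓ₁ ∉₁ (r₂ , c₂ , ∉₂) = next (line-from c₂)
                where
                next : Line r₂ → ⊥
                next ℓ₂ = last ℓ₀ ℓ₁ ℓ₂ ∉₁ ∉₂ (pick (on? c) (i ∷ j ℓ₀ ∷ r₁ ∷ j ℓ₁ ∷ r₂ ∷ j ℓ₂ ∷ []) (big (s≤s (s≤s (s≤s (s≤s (s≤s (s≤s (s≤s z≤n)))))))))
              then : (ℓ₀ : Line i) → (∃ λ r₁ → dot c (P r₁) ≡ 0# × r₁ ∉ i ∷ j ℓ₀ ∷ []) → ⊥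
              then ℓ₀ (r₁ , c₁ , ∉₁) = next (line-from c₁)
                where
                next : Line r₁ → ⊥
                next ℓ₁ = third ℓ₀ ℓ₁ ∉₁ (pick (on? c) (i ∷ j ℓ₀ ∷ r₁ ∷ j ℓ₁ ∷ []) (big (s≤s (s≤s (s≤s (s≤s (s≤s z≤n)))))))
              start : Line i → ⊥
              start ℓ₀ = then ℓ₀ (pick (on? c) (i ∷ j ℓ₀ ∷ []) (big (s≤s (s≤s (s≤s z≤n)))))

          module _ {i : Fin k} (D : Pairs i) {l : Fin k} (l≢i : l ≢ i) (bl : dot (b D) (P l) ≡ 0#) (al : dot (a D) (P l) ≡ 0#)
            {r : Fin k} (r≢i : r ≢ i) (r≢l : r ≢ l) {c : V4} (c≢𝟎 : c ≢ 𝟎) (ci : dot c (P i) ≡ 0#) (cl : dot c (P l) ≡ 0#) (cr : dot c (P r) ≡ 0#) where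

            -- Every tangent at `P i` lies in `a` or `b`, and `c` meets each of these two planes in
            -- the secant of `P i` and `P l`.
            third-plane : s c ≡ 0
            third-plane = p*-cancel (qp≢0 q≡1+p p≢0) (trans (sym (tanCount-on i c≢𝟎 ci)) (trans (trans (∑-cong V.elems each) (∑-0 (V.elems {4}))) (sym (ℕ.*-zeroʳ (q * p)))))
              where
              apart : ∀ {e} → n e ≡ 2 → dot e (P i) ≡ 0# → dot e (P l) ≡ 0# → e ≢ 𝟎 → Ind (c ∷ e ∷ [])
              apart ne ei el e≢𝟎 = Ind-∷ (Ind-nonzero e≢𝟎) (λ sp → r≢l (n-two ne l≢i ei el (prop⇐ c≢𝟎 sp cr) r≢i))
              pair₂ : ∀ {e u} → dot c u ≡ 0# → dot e u ≡ 0# → dots (c ∷ e ∷ []) u ≡ 𝟎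
              pair₂ {e} {u} y z = cong₂ (λ y z → y ∷ z ∷ []) (trans (dot-comm u c) y) (trans (dot-comm u e) z)
              collinear : ∀ {e v} → Ind (c ∷ e ∷ []) → dot e (P i) ≡ 0# → dot e (P l) ≡ 0# → dot c v ≡ 0# → dot e v ≡ 0# → ¬ Tan i v
              collinear ce ei el cv ev tn = ℕ.1+n≰n (perp-dimension (Tan⇒Ind₃ tn l l≢i) ce (pair₂ cv ev ∷ pair₂ ci ei ∷ pair₂ cl el ∷ []))
              none : ∀ {v} → dot c v ≡ 0# → ¬ Tan i v
              none {v} cv tn = go (cover (pair D) v tn)
                where
                go : dot (a D) v ≡ 0# ⊎ dot (b D) v ≡ 0# → ⊥
                go (inj₁ av) = collinear (apart (na D) (⊥a D) al (a≢ D)) (⊥a D) al cv av tn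
                go (inj₂ bv) = collinear (apart (nb D) (ai (sb (pair D))) bl (a≢𝟎 (sb (pair D)))) (ai (sb (pair D))) bl cv bv tn
              each : ∀ v → on c v * 𝟙 (tan? i v) ≡ 0
              each v = trans (sym (𝟙-× (dot c v ≟ 0#) (tan? i v))) (𝟙-no ((dot c v ≟ 0#) ×-dec tan? i v) (λ (cv , tn) → none cv tn))

          impossible : Fin k → ⊥
          impossible i = from (pairs i)
            where
            many : 3 ≤ k
            many = ℕ.≤-trans (s≤s (s≤s (s≤s z≤n))) (ℕ.≤-trans 8≤q (arith q t k t≡ (k+t i) (ℕ.*-monoˡ-≤ q 8≤q)))
              where
              arith : ∀ q t k → t ≡ 2 * q → k + t ≡ q * q + q + 2 → 8 * q ≤ q * q → q ≤ k
              arith q _ k refl e le = lin (ℕ.+-mono-≤ le (ℕ.≤-reflexive (sym e))) (6 * q + 2) (ring q k)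
                where
                ring : ∀ q k → q + (q * q + (k + 2 * q)) + (6 * q + 2) ≡ k + (8 * q + (q * q + q + 2))
                ring = solveℕ 2 (λ q k → q :+: (q :*: q :+: (k :+: κ 2 :*: q)) :+: (κ 6 :*: q :+: κ 2) :=: k :+: (κ 8 :*: q :+: (q :*: q :+: q :+: κ 2))) refl
            finish : (D : Pairs i) {l r : Fin k} → l ≢ i → dot (b D) (P l) ≡ 0# → dot (a D) (P l) ≡ 0# → r ∉ i ∷ l ∷ [] →
              (∃ λ c → c ≢ 𝟎 × dots (P i ∷ P l ∷ P r ∷ []) c ≡ 𝟎) → ⊥
            finish D l≢i bl al r∉ (c , c≢𝟎 , e) = Hyperoval.impossible c≢𝟎
              (third-plane D l≢i bl al (λ e → r∉ (here e)) (λ e → r∉ (there (here e))) c≢𝟎 (Vec.∷-injectiveˡ e)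
                (Vec.∷-injectiveˡ (Vec.∷-injectiveʳ e)) (Vec.∷-injectiveˡ (Vec.∷-injectiveʳ (Vec.∷-injectiveʳ e)))) {i} (Vec.∷-injectiveˡ e)
            then : (D : Pairs i) → (∃ λ l → l ≢ i × dot (b D) (P l) ≡ 0# × dot (a D) (P l) ≡ 0#) → ⊥
            then D (l , l≢i , bl , al) = next (pick (λ _ → yes tt) (i ∷ l ∷ []) (ℕ.≤-trans many (ℕ.≤-reflexive (sym Sk-1))))
              where
              next : (∃ λ r → ⊤ × r ∉ i ∷ l ∷ []) → ⊥
              next (r , _ , r∉) = finish D l≢i bl al r∉ (nonzero-annihilator (P i) (P l) (P r))
            from : Pairs i → ⊥
            -- The line common to `a` and `b` carries no tangent at `P i`, so it is a secant.
            from D = then D (secant-in-line (Ind-swap (ind (pair D))) (ai (sb (pair D))) (⊥a D) (skew D))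

        no-such-cap : Fin k → ⊥
        no-such-cap i = go (proj₂ (proj₂ (two i)))
          where
          by-kind : ∀ {a b} → Kind i a b → ⊥
          by-kind (one-one _ _ e)   = Concurrent.impossible e i
          by-kind (one-two _ _ e)   = Paired.impossible e i
          by-kind (two-one _ _ e)   = Paired.impossible e i
          by-kind (two-two _ _ e _) = Paired.impossible e i
          go : ∀ {a b} → Two i a b → ⊥
          go T = by-kind (kind T)

      -- Complete caps with more than q² + 1 points.

      module LargeCaps (3≤q : 3 ≤ q) (t≤q : t ≤ q) where

        -- A plane through a tangent has n ≥ 1 and s ≥ 1, so n s ≥ q + 1, and `plane-inequality`
        -- would give q (q + 1) ≤ t² ≤ q².
        t≡0 : Fin k → t ≡ 0
        t≡0 i = go t refl
          where
          no-tangent : ∀ {v} → Tan i v → (∃ λ a → a ≢ 𝟎 × dots (v ∷ P i ∷ P i ∷ []) a ≡ 𝟎) → ⊥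
          no-tangent {v} tn (a , a≢𝟎 , e) = arith (n a) (s a) q t (ℕ.≤-trans (s≤s z≤n) 3≤q) n≥1 s≥1 (n+s a≢𝟎) t≤q (plane-inequality a≢𝟎 i)
            where
            ai : dot a (P i) ≡ 0#
            ai = Vec.∷-injectiveˡ (Vec.∷-injectiveʳ e)
            n≥1 : 1 ≤ n a
            n≥1 = ℕ.≤-trans (s≤s z≤n) (ℕ.≤-reflexive (sym (n≡1+m ai)))
            s≥1 : 1 ≤ s a
            s≥1 = ℕ.n≢0⇒n>0 (λ s≡0 → ℕ.1+n≰n (ℕ.≤-trans (ℕ.≤-reflexive (sym (cong₂ _*_ (𝟙-yes (dot a v ≟ 0#) (Vec.∷-injectiveˡ e)) (𝟙-yes (tan? i v) tn))))
              (ℕ.≤-trans (V.term (λ v → 𝟙 (dot a v ≟ 0#) * 𝟙 (tan? i v)) v) (ℕ.≤-reflexive (trans (tanCount-on i a≢𝟎 ai) (trans (cong (q * p *_) s≡0) (ℕ.*-zeroʳ (q * p))))))))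
            arith : ∀ n s q t → 1 ≤ q → 1 ≤ n → 1 ≤ s → n + s ≡ q + 2 → t ≤ q → n * (q * s) + t ≤ t * t → ⊥
            arith (suc n) (suc s) q t 0<q _ _ e t≤q le = ℕ.<⇒≱ {q * q} {q * suc q} (ℕ.*-monoʳ-< q ⦃ ℕ.>-nonZero 0<q ⦄ (ℕ.n<1+n q))
                (ℕ.≤-trans (ℕ.*-monoʳ-≤ q q<) (ℕ.≤-trans (ℕ.≤-reflexive (swap q (suc n) (suc s))) (ℕ.≤-trans (ℕ.m≤m+n _ t) (ℕ.≤-trans le (ℕ.*-mono-≤ t≤q t≤q)))))
              where
              swap : ∀ a b c → a * (b * c) ≡ b * (a * c)
              swap = solveℕ 3 (λ a b c → a :*: (b :*: c) :=: b :*: (a :*: c)) refl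
              q≡n+s : n + s ≡ q
              q≡n+s = ℕ.+-cancelʳ-≡ 2 _ _ (trans (ring n s) e)
                where
                ring : ∀ n s → n + s + 2 ≡ suc n + suc s
                ring = solveℕ 2 (λ n s → n :+: s :+: κ 2 :=: (κ 1 :+: n) :+: (κ 1 :+: s)) refl
              q< : suc q ≤ suc n * suc s
              q< = subst (λ z → suc z ≤ suc n * suc s) q≡n+s (ℕ.≤-trans (ℕ.m≤m+n (suc (n + s)) (n * s)) (ℕ.≤-reflexive (ring n s)))
                where
                ring : ∀ n s → suc (n + s) + n * s ≡ suc n * suc s
                ring = solveℕ 2 (λ n s → (κ 1 :+: (n :+: s)) :+: n :*: s :=: (κ 1 :+: n) :*: (κ 1 :+: s)) refl
          go : ∀ z → t ≡ z → z ≡ 0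
          go zero    _ = refl
          go (suc z) e = ⊥-elim (found (∑-pos V.elems {λ v → 𝟙 (tan? i v)} (ℕ.n≢0⇒n>0 (λ r → ℕ.1+n≢0 {z} (p*-cancel (qp≢0 q≡1+p p≢0) (trans (cong (q * p *_) (sym e)) (trans (sym (tangents≡ i)) (trans r (sym (ℕ.*-zeroʳ (q * p)))))))))))
            where
            found : (∃ λ v → 1 ≤ 𝟙 (tan? i v)) → ⊥
            -- Any plane through the tangent will do, so `P i` is simply repeated.
            found (v , le) = no-tangent (𝟙-pos (tan? i v) le) (nonzero-annihilator v (P i) (P i))

        -- The vectors `v` and `w` have q² annihilators, of which only q annihilate `u`; one of the
        -- others is rescaled.
        dual : ∀ {u v w : V4} → Ind (u ∷ v ∷ w ∷ []) → ∃ λ a → dot a u ≡ 1# × dot a v ≡ 0# × dot a w ≡ 0#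
        dual {u} {v} {w} ind = result (V.search (λ a → ann? (v ∷ w ∷ []) a ×-dec ¬? (dot a u ≟ 0#)))
          where
          result : Dec (∃ λ a → dots (v ∷ w ∷ []) a ≡ 𝟎 × dot a u ≢ 0#) → ∃ λ a → dot a u ≡ 1# × dot a v ≡ 0# × dot a w ≡ 0#
          result (yes (a , e , au)) = inv (dot a u) • a ,
            trans (scale u) (trans (*-comm _ _) (*-inv _ au)) ,
            trans (scale v) (trans (cong (inv (dot a u) ·_) (Vec.∷-injectiveˡ e)) (zeroʳ _)) ,
            trans (scale w) (trans (cong (inv (dot a u) ·_) (Vec.∷-injectiveˡ (Vec.∷-injectiveʳ e))) (zeroʳ _))
            where
            scale : ∀ z → dot (inv (dot a u) • a) z ≡ inv (dot a u) · dot a z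
            scale z = trans (dot-comm _ z) (trans (dot-• _ z a) (cong (inv (dot a u) ·_) (dot-comm z a)))
          result (no ¬∃) = ⊥-elim (ℕ.<⇒≱ (ℕ.m<m*n q q ⦃ q≢0 ⦄ 2≤q) (ℕ.≤-trans (ℕ.≤-reflexive (sym (annSize₂ (Ind-tail ind)))) (ℕ.≤-trans (∑-mono V.elems each) (ℕ.≤-reflexive (annSize₃ ind)))))
            where
            each : ∀ a → 𝟙 (ann? (v ∷ w ∷ []) a) ≤ 𝟙 (ann? (u ∷ v ∷ w ∷ []) a)
            each a = 𝟙-mono (ann? (v ∷ w ∷ []) a) (ann? (u ∷ v ∷ w ∷ []) a) (λ e → cong₂ _∷_ (decidable-stable (dot a u ≟ 0#) (λ au → ¬∃ (a , e , au))) e)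

        affine? : (u v w : V4) (a : V4) → Dec ((dot a u ≡ 1# × dot a v ≡ 1#) × dot a w ≡ 0#)
        affine? u v w a = ((dot a u ≟ 1#) ×-dec (dot a v ≟ 1#)) ×-dec (dot a w ≟ 0#)

        -- Translation by the sum of two dual covectors carries the annihilator of the three vectors
        -- onto this coset.
        affine-count : ∀ {u v w : V4} → Ind (u ∷ v ∷ w ∷ []) → SV (λ a → 𝟙 (affine? u v w a)) ≡ q
        affine-count {u} {v} {w} ind = go (dual ind) (dual (Ind-swap ind))
          where
          go : (∃ λ a → dot a u ≡ 1# × dot a v ≡ 0# × dot a w ≡ 0#) → (∃ λ b → dot b v ≡ 1# × dot b u ≡ 0# × dot b w ≡ 0#) → SV (λ a → 𝟙 (affine? u v w a)) ≡ q
          go (a , au , av , aw) (b , bv , bu , bw) = trans (sym (V.S-bij (o ⊕_) (o ⊕_) back back _)) (trans (∑-cong V.elems each) (annSize₃ ind))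
            where
            o = a ⊕ b
            back : ∀ c → o ⊕ (o ⊕ c) ≡ c
            back c = trans (sym (⊕-assoc o o c)) (trans (cong (_⊕ c) (⊕-self o)) (⊕-identityˡ c))
            shift : ∀ z c → dot (o ⊕ c) z ≡ dot a z ⊹ dot b z ⊹ dot c z
            shift z c = trans (dot-comm _ z) (trans (dot-⊕ z o c) (cong₂ _⊹_ (trans (dot-⊕ z a b) (cong₂ _⊹_ (dot-comm z a) (dot-comm z b))) (dot-comm z c)))
            at-u : ∀ c → dot (o ⊕ c) u ≡ 1# ⊹ dot c u
            at-u c = trans (shift u c) (cong (_⊹ dot c u) (trans (cong₂ _⊹_ au bu) (+-identityʳ 1#)))
            at-v : ∀ c → dot (o ⊕ c) v ≡ 1# ⊹ dot c v
            at-v c = trans (shift v c) (cong (_⊹ dot c v) (trans (cong₂ _⊹_ av bv) (+-identityˡ 1#)))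
            at-w : ∀ c → dot (o ⊕ c) w ≡ dot c w
            at-w c = trans (shift w c) (trans (cong (_⊹ dot c w) (trans (cong₂ _⊹_ aw bw) (+-identityˡ 0#))) (+-identityˡ _))
            drop : ∀ {y} → 1# ⊹ y ≡ 1# → y ≡ 0#
            drop {y} e = trans (solve 1 (λ y → y := (con true :+ y) :+ con true) refl y) (trans (cong (_⊹ 1#) e) (x+x≡0 1#))
              where open Solver
            each : ∀ c → 𝟙 (affine? u v w (o ⊕ c)) ≡ 𝟙 (ann? (u ∷ v ∷ w ∷ []) c)
            each c = 𝟙-iff (affine? u v w (o ⊕ c)) (ann? (u ∷ v ∷ w ∷ []) c)
              (λ ((eu , ev) , ew) → cong₂ _∷_ (drop (trans (sym (at-u c)) eu)) (cong₂ _∷_ (drop (trans (sym (at-v c)) ev)) (cong₂ _∷_ (trans (sym (at-w c)) ew) refl)))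
              (λ e → (trans (at-u c) (trans (cong (1# ⊹_) (Vec.∷-injectiveˡ e)) (+-identityʳ 1#)) , trans (at-v c) (trans (cong (1# ⊹_) (Vec.∷-injectiveˡ (Vec.∷-injectiveʳ e))) (+-identityʳ 1#))) ,
                     trans (at-w c) (Vec.∷-injectiveˡ (Vec.∷-injectiveʳ (Vec.∷-injectiveʳ e))))

        full-or-empty : Fin k → ∀ {a} → a ≢ 𝟎 → n a ≡ (q + 2) * 𝟙 (¬? (n a ℕ.≟ 0))
        full-or-empty i {a} a≢𝟎 = go (n a ℕ.≟ 0)
          where
          go : (e : Dec (n a ≡ 0)) → n a ≡ (q + 2) * 𝟙 (¬? e)
          go (yes e) = trans e (sym (ℕ.*-zeroʳ (q + 2)))
          go (no ne) = trans (trans (sym (ℕ.+-identityʳ (n a))) (trans (cong (n a +_) (sym s≡0)) (n+s a≢𝟎))) (sym (ℕ.*-identityʳ _))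
            where
            product≡0 : n a * (q * s a) ≡ 0
            product≡0 = ℕ.n≤0⇒n≡0 (ℕ.≤-trans (ℕ.m≤m+n _ t) (ℕ.≤-trans (plane-inequality a≢𝟎 i) (ℕ.≤-reflexive (cong (_* t) (t≡0 i)))))
            s≡0 : s a ≡ 0
            s≡0 = p*-cancel (ℕ.≢-nonZero⁻¹ q ⦃ q≢0 ⦄) (trans (p*-cancel ne (trans product≡0 (sym (ℕ.*-zeroʳ (n a))))) (sym (ℕ.*-zeroʳ q)))

        -- The planes a with a · P i = a · P l = 1 meet the cap in 0 or q + 2 points, so q + 2 divides (k - 2) q.
        impossible : Fin k → ⊥
        impossible i = at (proj₁ (other i)) (proj₂ (other i))
         where
         at : ∀ l → l ≢ i → ⊥
         at l l≢i = absurd (∣m+n∣m⇒∣n (subst (q + 2 ∣_) identity (m∣m*n {q + 2} (q * q + 2))) (m∣m*n {q + 2} (M + q)))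
          where
          -- Exactly one covector for each plane that meets the secant only in the point P i + P l,
          -- so no factor p disturbs the divisibility.
          unit? : ∀ a → Dec (dot a (P i) ≡ 1# × dot a (P l) ≡ 1#)
          unit? a = (dot a (P i) ≟ 1#) ×-dec (dot a (P l) ≟ 1#)
          M : ℕ
          M = SV (λ a → 𝟙 (unit? a) * 𝟙 (¬? (n a ℕ.≟ 0)))
          swap : ∀ a b c → a * (b * c) ≡ b * (a * c)
          swap = solveℕ 3 (λ a b c → a :*: (b :*: c) :=: b :*: (a :*: c)) refl
          by-planes : SV (λ a → 𝟙 (unit? a) * n a) ≡ (q + 2) * M
          by-planes = trans (∑-cong V.elems (λ a → trans (𝟙*-cong (unit? a) (λ (e , _) → full-or-empty i (λ { refl → 1≢0 (trans (sym e) (dot-𝟎ˡ (P i))) })))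
            (swap (𝟙 (unit? a)) (q + 2) _))) (∑-*ˡ V.elems (q + 2) _)
          each : ∀ j → SV (λ a → 𝟙 (affine? (P i) (P l) (P j) a)) + (𝟙 (j Fin.≟ i) + 𝟙 (j Fin.≟ l)) * q ≡ q
          each j with j Fin.≟ i | j Fin.≟ l
          ... | yes refl | yes refl = ⊥-elim (l≢i refl)
          ... | yes refl | no _ = cong₂ _+_ (trans (∑-cong V.elems (λ a → 𝟙-no (affine? (P i) (P l) (P i) a) (λ ((e , _) , e′) → 1≢0 (trans (sym e) e′)))) (∑-0 (V.elems {4}))) (ℕ.*-identityˡ q)
          ... | no _ | yes refl = cong₂ _+_ (trans (∑-cong V.elems (λ a → 𝟙-no (affine? (P i) (P l) (P l) a) (λ ((_ , e) , e′) → 1≢0 (trans (sym e) e′)))) (∑-0 (V.elems {4}))) (ℕ.*-identityˡ q)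
          ... | no j≢i | no j≢l = trans (ℕ.+-identityʳ _) (affine-count (ind₃ i l j (λ e → l≢i (sym e)) (λ e → j≢i (sym e)) (λ e → j≢l (sym e))))
          by-points : SV (λ a → 𝟙 (unit? a) * n a) + 2 * q ≡ k * q
          by-points = begin
            SV (λ a → 𝟙 (unit? a) * n a) + 2 * q
              ≡⟨ cong₂ _+_ (trans (∑-cong V.elems (λ a → trans (sym (∑-*ˡ (allFin k) (𝟙 (unit? a)) _)) (∑-cong (allFin k) (λ j → sym (𝟙-× (unit? a) (on? a j)))))) (∑-swap V.elems (allFin k) _))
                   (cong (_* q) (sym (trans (∑-+ (allFin k) _ _) (cong₂ _+_ (Finite.once (finFinite k) i) (Finite.once (finFinite k) l))))) ⟩
            Sk (λ j → SV (λ a → 𝟙 (affine? (P i) (P l) (P j) a))) + Sk (λ j → 𝟙 (j Fin.≟ i) + 𝟙 (j Fin.≟ l)) * q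
              ≡⟨ cong (Sk (λ j → SV (λ a → 𝟙 (affine? (P i) (P l) (P j) a))) +_) (sym (∑-*ʳ (allFin k) q _)) ⟩
            Sk (λ j → SV (λ a → 𝟙 (affine? (P i) (P l) (P j) a))) + Sk (λ j → (𝟙 (j Fin.≟ i) + 𝟙 (j Fin.≟ l)) * q) ≡⟨ ∑-+ (allFin k) _ _ ⟨
            Sk (λ j → SV (λ a → 𝟙 (affine? (P i) (P l) (P j) a)) + (𝟙 (j Fin.≟ i) + 𝟙 (j Fin.≟ l)) * q) ≡⟨ ∑-cong (allFin k) each ⟩
            Sk (λ _ → q) ≡⟨ Sk-const q ⟩
            k * q ∎
            where open ≡-Reasoning
          -- This is (k - 2) q = (q + 2) M with k = q² + q + 2, rearranged so that modulo q + 2 the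
          -- remainder 4 is left.
          identity : (q + 2) * (q * q + 2) ≡ (q + 2) * (M + q) + 4
          identity = arith q k t (t≡0 i) (k+t i) (trans (cong (_+ 2 * q) (sym by-planes)) by-points)
            where
            arith : ∀ q k t {M} → t ≡ 0 → k + t ≡ q * q + q + 2 → (q + 2) * M + 2 * q ≡ k * q → (q + 2) * (q * q + 2) ≡ (q + 2) * (M + q) + 4
            arith q k t {M} refl e e′ = lin≡ (cong₂ _+_ (sym e′) (cong (q *_) (sym e))) (ring q k M)
              where
              ring : ∀ q k M → (q + 2) * (q * q + 2) + ((q + 2) * M + 2 * q + q * (k + 0)) ≡ (q + 2) * (M + q) + 4 + (k * q + q * (q * q + q + 2))
              ring = solveℕ 3 (λ q k M → (q :+: κ 2) :*: (q :*: q :+: κ 2) :+: ((q :+: κ 2) :*: M :+: κ 2 :*: q :+: q :*: (k :+: κ 0)) :=: (q :+: κ 2) :*: (M :+: q) :+: κ 4 :+: (k :*: q :+: q :*: (q :*: q :+: q :+: κ 2))) refl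
          absurd : q + 2 ∣ 4 → ⊥
          absurd dv = ℕ.1+n≰n (ℕ.≤-trans (ℕ.+-monoˡ-≤ 2 3≤q) (∣⇒≤ dv))

open CapGeometry

open import Defs
open import Level using (0ℓ)
open import Algebra.Bundles using (CommutativeRing)
open import Algebra.Structures using (IsCommutativeSemiring)
import Algebra.Properties.Ring as RingProperties
open import Data.Empty using (⊥; ⊥-elim)
open import Data.Fin as Fin using (Fin; zero; suc)
import Data.Fin.Properties as Fin
open import Data.List using (List; _∷_; length; lookup; allFin)
open import Data.List.Properties using (length-tabulate)
open import Data.Nat as ℕ using (ℕ; zero; suc; s≤s; z≤n; _≤_)
open import Data.Nat.DivMod using ([m+kn]%n≡m%n; m*n%n≡0)
open import Data.Nat.Divisibility using (_∣_; divides)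
import Data.Nat.Properties as ℕ
open import Data.Nat.Solver using (module +-*-Solver)
open +-*-Solver using () renaming (solve to solveℕ; _:+_ to _:+:_; _:*_ to _:*:_; _:=_ to _:=:_; con to κ)
open import Data.Product using (∃; _×_; _,_; proj₁; proj₂)
open import Data.Vec as Vec using (Vec; []; _∷_; tabulate)
import Data.Vec.Properties as Vec
open import Function using (_∘_)
open import Relation.Binary using (tri<; tri≈; tri>)
open import Relation.Binary.PropositionalEquality as ≡ using (_≡_; _≢_; cong; cong₂; subst; module ≡-Reasoning)
open import Relation.Nullary using (¬_; Dec; yes; no)
open import Relation.Nullary.Decidable using (¬?; _×-dec_)

-- Transport of the given field to indices, where equality is propositional and decidable.

module FieldOnIndices (R : CommutativeRing 0ℓ 0ℓ) (q : ℕ) (isField : IsFiniteFieldOfOrder R q) where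
  open CommutativeRing R hiding (zero)
  open IsFiniteFieldOfOrder isField
  open RingProperties ring using (-‿involutive; -0#≈0#)

  idx : Carrier → Fin q
  idx x = proj₁ (enum-sur x)

  enum-idx : ∀ x → enum (idx x) ≈ x
  enum-idx x = proj₂ (enum-sur x)

  idx-cong : ∀ {x y} → x ≈ y → idx x ≡ idx y
  idx-cong {x} {y} e = enum-inj _ _ (trans (enum-idx x) (trans e (sym (enum-idx y))))

  idx-enum : ∀ i → idx (enum i) ≡ i
  idx-enum i = enum-inj _ _ (enum-idx (enum i))

  idx-inj : ∀ {x y} → idx x ≡ idx y → x ≈ y
  idx-inj {x} {y} e = trans (sym (enum-idx x)) (trans (reflexive (cong enum e)) (enum-idx y))

  infixl 6 _⊞_
  infixl 7 _⊠_
  _⊞_ _⊠_ : Fin q → Fin q → Fin q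
  a ⊞ b = idx (enum a + enum b)
  a ⊠ b = idx (enum a * enum b)

  𝟘 𝟏 : Fin q
  𝟘 = idx 0#
  𝟏 = idx 1#

  enum-⊞ : ∀ a b → enum (a ⊞ b) ≈ enum a + enum b
  enum-⊞ a b = enum-idx _

  enum-⊠ : ∀ a b → enum (a ⊠ b) ≈ enum a * enum b
  enum-⊠ a b = enum-idx _

  ⊞-identityˡ : ∀ a → 𝟘 ⊞ a ≡ a
  ⊞-identityˡ a = ≡.trans (idx-cong (trans (+-congʳ (enum-idx 0#)) (+-identityˡ (enum a)))) (idx-enum a)

  ⊞-comm : ∀ a b → a ⊞ b ≡ b ⊞ a
  ⊞-comm a b = idx-cong (+-comm _ _)

  ⊠-comm : ∀ a b → a ⊠ b ≡ b ⊠ a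
  ⊠-comm a b = idx-cong (*-comm _ _)

  ⊠-identityˡ : ∀ a → 𝟏 ⊠ a ≡ a
  ⊠-identityˡ a = ≡.trans (idx-cong (trans (*-congʳ (enum-idx 1#)) (*-identityˡ (enum a)))) (idx-enum a)

  ⊠-zeroˡ : ∀ a → 𝟘 ⊠ a ≡ 𝟘
  ⊠-zeroˡ a = idx-cong (trans (*-congʳ (enum-idx 0#)) (zeroˡ (enum a)))

  ⊠-distribˡ : ∀ a b c → a ⊠ (b ⊞ c) ≡ a ⊠ b ⊞ a ⊠ c
  ⊠-distribˡ a b c = idx-cong (trans (*-congˡ (enum-⊞ b c)) (trans (distribˡ _ _ _) (sym (+-cong (enum-⊠ a b) (enum-⊠ a c)))))

  ⊞-⊠-isCommutativeSemiring : IsCommutativeSemiring _≡_ _⊞_ _⊠_ 𝟘 𝟏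
  ⊞-⊠-isCommutativeSemiring = record
    { isSemiring = record
      { isSemiringWithoutAnnihilatingZero = record
        { +-isCommutativeMonoid = record
          { isMonoid = record
            { isSemigroup = record
              { isMagma = record { isEquivalence = ≡.isEquivalence ; ∙-cong = cong₂ _⊞_ }
              ; assoc = λ a b c → idx-cong (trans (+-congʳ (enum-⊞ a b)) (trans (+-assoc _ _ _) (sym (+-congˡ (enum-⊞ b c)))))
              }
            ; identity = ⊞-identityˡ , λ a → ≡.trans (⊞-comm a 𝟘) (⊞-identityˡ a)
            }
          ; comm = ⊞-comm
          }
        ; *-cong = cong₂ _⊠_
        ; *-assoc = λ a b c → idx-cong (trans (*-congʳ (enum-⊠ a b)) (trans (*-assoc _ _ _) (sym (*-congˡ (enum-⊠ b c)))))
        ; *-identity = ⊠-identityˡ , λ a → ≡.trans (⊠-comm a 𝟏) (⊠-identityˡ a)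
        ; distrib = ⊠-distribˡ , λ a b c → ≡.trans (⊠-comm (b ⊞ c) a) (≡.trans (⊠-distribˡ a b c) (cong₂ _⊞_ (⊠-comm a b) (⊠-comm a c)))
        }
      ; zero = ⊠-zeroˡ , λ a → ≡.trans (⊠-comm a 𝟘) (⊠-zeroˡ a)
      }
    ; *-comm = ⊠-comm
    }

  enum≈0 : ∀ {a} → enum a ≈ 0# → a ≡ 𝟘
  enum≈0 {a} e = ≡.trans (≡.sym (idx-enum a)) (idx-cong e)

  reciprocal : (a : Fin q) → Dec (a ≡ 𝟘) → Fin q
  reciprocal a (yes _) = 𝟘
  reciprocal a (no h)  = idx (proj₁ (inverse (enum a) (h ∘ enum≈0)))

  inv : Fin q → Fin q
  inv a = reciprocal a (a Fin.≟ 𝟘)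

  inv-𝟘 : inv 𝟘 ≡ 𝟘
  inv-𝟘 with 𝟘 Fin.≟ 𝟘
  ... | yes _ = ≡.refl
  ... | no h  = ⊥-elim (h ≡.refl)

  ⊠-inv : ∀ a → a ≢ 𝟘 → a ⊠ inv a ≡ 𝟏
  ⊠-inv a a≢𝟘 with a Fin.≟ 𝟘
  ... | yes e = ⊥-elim (a≢𝟘 e)
  ... | no h  = idx-cong (trans (*-congˡ (enum-idx _)) (proj₂ (inverse (enum a) (h ∘ enum≈0))))

  -- x ↦ - x pairs off the elements that it moves, so in even order it fixes some x ≠ 0.
  module _ (2∣q : 2 ∣ q) where
    private
      module I = Finite (finFinite q)

    neg : Fin q → Fin q
    neg a = idx (- enum a)

    neg-neg : ∀ a → neg (neg a) ≡ a
    neg-neg a = ≡.trans (idx-cong (trans (-‿cong (enum-idx _)) (-‿involutive (enum a)))) (idx-enum a)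

    fixed? : ∀ a → Dec (neg a ≡ a)
    fixed? a = neg a Fin.≟ a

    half : ℕ
    half = I.S (λ a → 𝟙 (a Fin.<? neg a))

    parity : q ≡ I.S (λ a → 𝟙 (fixed? a)) ℕ.+ 2 ℕ.* half
    parity = begin
      q ≡⟨ length-tabulate {n = q} (λ i → i) ⟨
      length (allFin q) ≡⟨ ∑-1 (allFin q) ⟨
      I.S (λ _ → 1) ≡⟨ ∑-cong (allFin q) each ⟩
      I.S (λ a → 𝟙 (fixed? a) ℕ.+ (𝟙 (a Fin.<? neg a) ℕ.+ 𝟙 (neg a Fin.<? a))) ≡⟨ ≡.trans (∑-+ (allFin q) _ _) (cong (I.S (λ a → 𝟙 (fixed? a)) ℕ.+_) (∑-+ (allFin q) _ _)) ⟩
      I.S (λ a → 𝟙 (fixed? a)) ℕ.+ (half ℕ.+ I.S (λ a → 𝟙 (neg a Fin.<? a))) ≡⟨ cong (λ z → I.S (λ a → 𝟙 (fixed? a)) ℕ.+ (half ℕ.+ z)) swapped ⟩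
      I.S (λ a → 𝟙 (fixed? a)) ℕ.+ (half ℕ.+ half) ≡⟨ cong (I.S (λ a → 𝟙 (fixed? a)) ℕ.+_) (double half) ⟩
      I.S (λ a → 𝟙 (fixed? a)) ℕ.+ 2 ℕ.* half ∎
      where
      open ≡-Reasoning
      double : ∀ x → x ℕ.+ x ≡ 2 ℕ.* x
      double = solveℕ 1 (λ x → x :+: x :=: κ 2 :*: x) ≡.refl
      swapped : I.S (λ a → 𝟙 (neg a Fin.<? a)) ≡ half
      swapped = ≡.trans (∑-cong (allFin q) (λ a → cong (λ z → 𝟙 (neg a Fin.<? z)) (≡.sym (neg-neg a)))) (I.S-bij neg neg neg-neg neg-neg (λ a → 𝟙 (a Fin.<? neg a)))
      each : ∀ a → 1 ≡ 𝟙 (fixed? a) ℕ.+ (𝟙 (a Fin.<? neg a) ℕ.+ 𝟙 (neg a Fin.<? a))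
      each a with Fin.<-cmp a (neg a)
      ... | tri< lt ≢ ≯ = ≡.sym (cong₂ ℕ._+_ (𝟙-no (fixed? a) (≢ ∘ ≡.sym)) (cong₂ ℕ._+_ (𝟙-yes (a Fin.<? neg a) lt) (𝟙-no (neg a Fin.<? a) ≯)))
      ... | tri≈ ≮ e ≯ = ≡.sym (cong₂ ℕ._+_ (𝟙-yes (fixed? a) (≡.sym e)) (cong₂ ℕ._+_ (𝟙-no (a Fin.<? neg a) ≮) (𝟙-no (neg a Fin.<? a) ≯)))
      ... | tri> ≮ ≢ gt = ≡.sym (cong₂ ℕ._+_ (𝟙-no (fixed? a) (≢ ∘ ≡.sym)) (cong₂ ℕ._+_ (𝟙-no (a Fin.<? neg a) ≮) (𝟙-yes (neg a Fin.<? a) gt)))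

    moved-fixed : ∃ λ a → neg a ≡ a × a ≢ 𝟘
    moved-fixed with I.search (λ a → fixed? a ×-dec ¬? (a Fin.≟ 𝟘))
    ... | yes r = r
    ... | no ¬∃ = ⊥-elim (odd 2∣q (≡.trans parity (cong (ℕ._+ 2 ℕ.* half) (I.S-unique fixed? (𝟘 , idx-cong (trans (-‿cong (enum-idx 0#)) -0#≈0#)) (λ a b e e′ → ≡.trans (only a e) (≡.sym (only b e′)))))))
      where
      only : ∀ a → neg a ≡ a → a ≡ 𝟘
      only a e with a Fin.≟ 𝟘
      ... | yes r = r
      ... | no r  = ⊥-elim (¬∃ (a , e , r))
      odd : ∀ {z} → 2 ∣ z → z ≡ 1 ℕ.+ 2 ℕ.* half → ⊥
      odd (divides r ≡.refl) e = ℕ.1+n≢0 {0} (begin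
        1 ≡⟨ [m+kn]%n≡m%n 1 half 2 ⟨
        (1 ℕ.+ half ℕ.* 2) ℕ.% 2 ≡⟨ cong (λ z → (1 ℕ.+ z) ℕ.% 2) (ℕ.*-comm half 2) ⟩
        (1 ℕ.+ 2 ℕ.* half) ℕ.% 2 ≡⟨ cong (ℕ._% 2) e ⟨
        (r ℕ.* 2) ℕ.% 2 ≡⟨ m*n%n≡0 r 2 ⟩
        0 ∎)
        where open ≡-Reasoning

    -- A nonzero z with - z = z satisfies z + z = 0, and x is the multiple z z⁻¹ x of it.
    x+x≈0 : ∀ x → x + x ≈ 0#
    x+x≈0 x = via moved-fixed
      where
      via : (∃ λ a → neg a ≡ a × a ≢ 𝟘) → x + x ≈ 0#
      via (a , e , a≢𝟘) = begin
        x + x ≈⟨ +-cong x≈ x≈ ⟩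
        z * y * x + z * y * x ≈⟨ distribʳ x (z * y) (z * y) ⟨
        (z * y + z * y) * x ≈⟨ *-congʳ (distribʳ y z z) ⟨
        (z + z) * y * x ≈⟨ *-congʳ (*-congʳ z+z≈0) ⟩
        0# * y * x ≈⟨ trans (*-congʳ (zeroˡ y)) (zeroˡ x) ⟩
        0# ∎
        where
        open import Relation.Binary.Reasoning.Setoid setoid
        z = enum a
        y = proj₁ (inverse z (a≢𝟘 ∘ enum≈0))
        x≈ : x ≈ z * y * x
        x≈ = sym (trans (*-congʳ (proj₂ (inverse z (a≢𝟘 ∘ enum≈0)))) (*-identityˡ x))
        z+z≈0 : z + z ≈ 0#
        z+z≈0 = trans (+-congʳ (trans (reflexive (cong enum (≡.sym e))) (enum-idx (- z)))) (-‿inverseˡ z)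

    field₂ : BinaryField
    field₂ = record
      { F = Fin q ; finite = finFinite q ; _+_ = _⊞_ ; _*_ = _⊠_ ; 0# = 𝟘 ; 1# = 𝟏 ; inv = inv
      ; isCommutativeSemiring = ⊞-⊠-isCommutativeSemiring
      ; x+x≡0 = λ a → idx-cong (x+x≈0 (enum a))
      ; 1≢0 = λ e → 0≉1 (idx-inj (≡.sym e))
      ; inv-0 = inv-𝟘
      ; *-inv = ⊠-inv
      }

    q≡ : BinaryField.q field₂ ≡ q
    q≡ = length-tabulate {n = q} (λ i → i)

-- Transport of caps and of completeness.

module CapsOnIndices (R : CommutativeRing 0ℓ 0ℓ) (q : ℕ) (isField : IsFiniteFieldOfOrder R q) (2∣q : 2 ∣ q) where
  open CommutativeRing R hiding (zero; ring)
  open IsFiniteFieldOfOrder isField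
  open FieldOnIndices R q isField
  open PG3 R

  B : BinaryField
  B = field₂ 2∣q

  open LinearAlgebra B

  lookup-⊕ : ∀ {d} (u v : Vec (Fin q) d) r → Vec.lookup (u ⊕ v) r ≡ Vec.lookup u r ⊞ Vec.lookup v r
  lookup-⊕ (x ∷ u) (y ∷ v) zero    = ≡.refl
  lookup-⊕ (x ∷ u) (y ∷ v) (suc r) = lookup-⊕ u v r

  lookup-• : ∀ {d} a (u : Vec (Fin q) d) r → Vec.lookup (a • u) r ≡ a ⊠ Vec.lookup u r
  lookup-• a (x ∷ u) zero    = ≡.refl
  lookup-• a (x ∷ u) (suc r) = lookup-• a u r

  val : Vec (Fin q) 4 → V4
  val v r = enum (Vec.lookup v r)

  code : V4 → Vec (Fin q) 4
  code u = tabulate (λ r → idx (u r))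

  val-code : ∀ u r → val (code u) r ≈ u r
  val-code u r = trans (reflexive (cong enum (Vec.lookup∘tabulate (λ r → idx (u r)) r))) (enum-idx (u r))

  val-⊕ : ∀ u v r → val (u ⊕ v) r ≈ val u r + val v r
  val-⊕ u v r = trans (reflexive (cong enum (lookup-⊕ u v r))) (enum-⊞ _ _)

  val-• : ∀ a u r → val (a • u) r ≈ enum a * val u r
  val-• a u r = trans (reflexive (cong enum (lookup-• a u r))) (enum-⊠ _ _)

  val-𝟎 : ∀ r → val 𝟎 r ≈ 0#
  val-𝟎 r = trans (reflexive (cong enum (Vec.lookup-replicate r 𝟘))) (enum-idx 0#)

  val-injective : ∀ {u v} → (∀ r → val u r ≈ val v r) → u ≡ v
  val-injective {u} {v} e = ≡.trans (≡.sym (Vec.tabulate∘lookup u)) (≡.trans (Vec.tabulate-cong (λ r → enum-inj _ _ (e r))) (Vec.tabulate∘lookup v))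

  val-comb₃ : ∀ a b c u v w r → val (comb (a ∷ b ∷ c ∷ []) (u ∷ v ∷ w ∷ [])) r ≈ enum a * val u r + enum b * val v r + enum c * val w r
  val-comb₃ a b c u v w r = trans (val-⊕ (a • u) _ r) (trans (+-cong (val-• a u r) (trans (val-⊕ (b • v) _ r) (+-cong (val-• b v r)
    (trans (val-⊕ (c • w) 𝟎 r) (trans (+-cong (val-• c w r) (val-𝟎 r)) (+-identityʳ _)))))) (sym (+-assoc _ _ _)))

  Collinear⇒ : ∀ {u v w} → Collinear u v w → ∃ λ a → ∃ λ b → ∃ λ c →
    ¬ (a ≡ 𝟘 × b ≡ 𝟘 × c ≡ 𝟘) × comb (a ∷ b ∷ c ∷ []) (code u ∷ code v ∷ code w ∷ []) ≡ 𝟎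
  Collinear⇒ {u} {v} {w} (a , b , c , nz , e) = idx a , idx b , idx c , (λ (p , p′ , p″) → nz (idx-inj p , idx-inj p′ , idx-inj p″)) ,
    val-injective (λ r → trans (val-comb₃ (idx a) (idx b) (idx c) (code u) (code v) (code w) r)
      (trans (+-cong (+-cong (*-cong (enum-idx a) (val-code u r)) (*-cong (enum-idx b) (val-code v r))) (*-cong (enum-idx c) (val-code w r))) (trans (e r) (sym (val-𝟎 r)))))

  ⇒Collinear : ∀ {u v w a b c} → ¬ (a ≡ 𝟘 × b ≡ 𝟘 × c ≡ 𝟘) → comb (a ∷ b ∷ c ∷ []) (code u ∷ code v ∷ code w ∷ []) ≡ 𝟎 → Collinear u v w
  ⇒Collinear {u} {v} {w} {a} {b} {c} nz e = enum a , enum b , enum c , (λ (p , p′ , p″) → nz (enum≈0 p , enum≈0 p′ , enum≈0 p″)) ,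
    λ r → trans (sym (+-cong (+-cong (*-congˡ (val-code u r)) (*-congˡ (val-code v r))) (*-congˡ (val-code w r))))
      (trans (sym (val-comb₃ a b c (code u) (code v) (code w) r)) (trans (reflexive (cong (λ z → val z r) e)) (val-𝟎 r)))

  Collinear-swap : ∀ {u v w} → Collinear u v w → Collinear v u w
  Collinear-swap (a , b , c , nz , e) = b , a , c , (λ (p , p′ , p″) → nz (p′ , p , p″)) , λ r → trans (+-congʳ (+-comm _ _)) (e r)

  Collinear-rotate : ∀ {u v w} → Collinear u v w → Collinear w u v
  Collinear-rotate (a , b , c , nz , e) = c , a , b , (λ (p , p′ , p″) → nz (p′ , p″ , p)) , λ r → trans (+-assoc _ _ _) (trans (+-comm _ _) (e r))

  SamePoint⇒ : ∀ {u v} → SamePoint u v → ∃ λ a → code u ≡ a • code v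
  SamePoint⇒ {u} {v} (a , e) = idx a , val-injective (λ r → trans (val-code u r) (trans (e r) (sym (trans (val-• (idx a) (code v) r) (*-cong (enum-idx a) (val-code v r))))))

  ⇒SamePoint : ∀ {u v a} → code u ≡ a • code v → SamePoint u v
  ⇒SamePoint {u} {v} {a} e = enum a , λ r → trans (sym (val-code u r)) (trans (reflexive (cong (λ z → val z r) e)) (trans (val-• a (code v) r) (*-congˡ (val-code v r))))

  nonzero⇒ : ∀ {u} → NonZeroV u → code u ≢ 𝟎
  nonzero⇒ {u} nz e = nz (λ r → trans (sym (val-code u r)) (trans (reflexive (cong (λ z → val z r) e)) (val-𝟎 r)))

  code-val : ∀ v → code (val v) ≡ v
  code-val v = val-injective (val-code (val v))

  module _ {K : List V4} (cap : IsCap K) (2≤k : 2 ≤ length K) where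
    open IsCap cap

    point : Fin (length K) → Vec (Fin q) 4
    point i = code (lookup K i)

    independent₂ : ∀ i j → i ≢ j → Ind (point i ∷ point j ∷ [])
    independent₂ i j i≢j = Ind-∷ (Ind-nonzero (nonzero⇒ (nonzero j))) (λ (c , e) → distinct i j i≢j (same c e))
      where
      same : ∀ c → point i ≡ comb c (point j ∷ []) → SamePoint (lookup K i) (lookup K j)
      same (a ∷ []) e = ⇒SamePoint (≡.trans e (⊕-identityʳ _))

    independent₃ : ∀ i j l → i ≢ j → i ≢ l → j ≢ l → Ind (point i ∷ point j ∷ point l ∷ [])
    independent₃ i j l i≢j i≢l j≢l (a ∷ b ∷ c ∷ []) e with (a Fin.≟ 𝟘) ×-dec ((b Fin.≟ 𝟘) ×-dec (c Fin.≟ 𝟘))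
    ... | yes (≡.refl , ≡.refl , ≡.refl) = ≡.refl
    ... | no nz = ⊥-elim (noThree i j l i≢j i≢l j≢l (⇒Collinear nz e))

    another-index : ∀ {k} → 2 ≤ k → (i : Fin k) → ∃ λ j → j ≢ i
    another-index (s≤s (s≤s _)) zero    = suc zero , λ ()
    another-index (s≤s (s≤s _)) (suc i) = zero , λ ()

    capOver : CapOver B
    capOver = record { k = length K ; P = point ; ind₂ = independent₂ ; ind₃ = independent₃ ; other = another-index 2≤k }

    some-index : Fin (length K)
    some-index = Fin.fromℕ< (ℕ.≤-trans (s≤s z≤n) 2≤k)

    -- A vector on no point and on no secant of the cap is collinear with no two of its points.
    -- Completeness forbids such an enlargement, and `complete⇒` draws the conclusion.
    extend : ∀ v → (∀ i → ¬ Span (point i ∷ []) v) → ¬ (∃ λ i → ∃ λ j → i ≢ j × Span (point i ∷ point j ∷ []) v) → NonZeroV (val v) × IsCap (val v ∷ K)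
    extend v off none = nz , record { nonzero = λ { zero → nz ; (suc i) → nonzero i } ; distinct = dist ; noThree = three }
      where
      v≢𝟎 : v ≢ 𝟎
      v≢𝟎 e = off some-index (𝟘 ∷ [] , ≡.trans e (≡.sym (≡.trans (⊕-identityʳ _) (0• _))))
      nz : NonZeroV (val v)
      nz h = v≢𝟎 (val-injective (λ r → trans (h r) (sym (val-𝟎 r))))
      dist : ∀ i j → i ≢ j → ¬ SamePoint (lookup (val v ∷ K) i) (lookup (val v ∷ K) j)
      dist zero    zero    i≢j _  = i≢j ≡.refl
      dist zero    (suc j) _   sp = let a , e = SamePoint⇒ sp in off j (a ∷ [] , ≡.trans (≡.sym (code-val v)) (≡.trans e (≡.sym (⊕-identityʳ _))))
      dist (suc i) zero    _   sp = via (SamePoint⇒ sp)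
        where
        via : (∃ λ a → point i ≡ a • code (val v)) → ⊥
        via (a , e) = off i (inv a ∷ [] , ≡.trans (•≡⇒ a≢𝟘 (≡.sym (≡.trans e (cong (a •_) (code-val v))))) (≡.sym (⊕-identityʳ _)))
          where
          a≢𝟘 : a ≢ 𝟘
          a≢𝟘 ≡.refl = nonzero⇒ (nonzero i) (≡.trans e (0• _))
      dist (suc i) (suc j) i≢j sp = distinct i j (i≢j ∘ cong suc) sp
      on-line : ∀ i j → i ≢ j → ¬ Collinear (val v) (lookup K i) (lookup K j)
      on-line i j i≢j col = via (Collinear⇒ col)
        where
        via : (∃ λ a → ∃ λ b → ∃ λ c → ¬ (a ≡ 𝟘 × b ≡ 𝟘 × c ≡ 𝟘) × comb (a ∷ b ∷ c ∷ []) (code (val v) ∷ point i ∷ point j ∷ []) ≡ 𝟎) → ⊥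
        via (a , b , c , nz , e) = nz (Vec.∷-injectiveˡ r , Vec.∷-injectiveˡ (Vec.∷-injectiveʳ r) , Vec.∷-injectiveˡ (Vec.∷-injectiveʳ (Vec.∷-injectiveʳ r)))
          where
          r : a ∷ b ∷ c ∷ [] ≡ 𝟎
          r = Ind-∷ (independent₂ i j i≢j) (λ s → none (i , j , i≢j , s)) (a ∷ b ∷ c ∷ []) (≡.trans (cong (λ z → comb (a ∷ b ∷ c ∷ []) (z ∷ point i ∷ point j ∷ [])) (≡.sym (code-val v))) e)
      three : ∀ i j l → i ≢ j → i ≢ l → j ≢ l → ¬ Collinear (lookup (val v ∷ K) i) (lookup (val v ∷ K) j) (lookup (val v ∷ K) l)
      three zero    zero    l       i≢j _   _   _   = i≢j ≡.refl
      three zero    (suc j) zero    _   i≢l _   _   = i≢l ≡.refl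
      three (suc i) zero    zero    _   _   j≢l _   = j≢l ≡.refl
      three zero    (suc j) (suc l) _   _   j≢l col = on-line j l (j≢l ∘ cong suc) col
      three (suc i) zero    (suc l) _   i≢l _   col = on-line i l (i≢l ∘ cong suc) (Collinear-swap col)
      three (suc i) (suc j) zero    i≢j _   _   col = on-line i j (i≢j ∘ cong suc) (Collinear-rotate col)
      three (suc i) (suc j) (suc l) i≢j i≢l j≢l col = noThree i j l (i≢j ∘ cong suc) (i≢l ∘ cong suc) (j≢l ∘ cong suc) col

    complete⇒ : (∀ v → NonZeroV v → ¬ IsCap (v ∷ K)) → Complete B capOver
    complete⇒ complete v off = result (Finite.search (finFinite (length K)) (λ i → Finite.search (finFinite (length K)) (λ j → ¬? (i Fin.≟ j) ×-dec span? (point i ∷ point j ∷ []) v)))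
      where
      result : Dec (∃ λ i → ∃ λ j → i ≢ j × Span (point i ∷ point j ∷ []) v) → ∃ λ i → ∃ λ j → i ≢ j × Span (point i ∷ point j ∷ []) v
      result (yes r)   = r
      result (no none) = let nz , cap′ = extend v off none in ⊥-elim (complete (val v) nz cap′)

  qB≡q : BinaryField.q B ≡ q
  qB≡q = q≡ 2∣q

  -- The maximum size of a cap and the lower bound for t.

  module _ (8≤q : 8 ≤ q) where
    8≤qB : 8 ≤ BinaryField.q B
    8≤qB = subst (8 ≤_) (≡.sym qB≡q) 8≤q

    size+t : ∀ {K} (cap : IsCap K) (2≤k : 2 ≤ length K) → length K ℕ.+ Caps.t B (capOver cap 2≤k) ≡ q ℕ.* q ℕ.+ q ℕ.+ 2
    size+t {K} cap 2≤k = subst (λ z → length K ℕ.+ Caps.t B (capOver cap 2≤k) ≡ z ℕ.* z ℕ.+ z ℕ.+ 2) qB≡q (Caps.k+t B (capOver cap 2≤k) (some-index cap 2≤k))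

    -- Adding points as long as possible reduces the bound for all caps to that for complete caps.
    max-size : ∀ fuel {K} → IsCap K → q ℕ.* q ℕ.+ q ℕ.+ 3 ≤ length K ℕ.+ fuel → length K ≤ q ℕ.* q ℕ.+ 1
    max-size fuel {K} cap enough with length K ℕ.≤? q ℕ.* q ℕ.+ 1
    ... | yes le = le
    ... | no ≰   = ⊥-elim (go fuel enough)
      where
      big : q ℕ.* q ℕ.+ 2 ≤ length K
      big = ℕ.≤-trans (ℕ.≤-reflexive (ℕ.+-suc (q ℕ.* q) 1)) (ℕ.≰⇒> ≰)
      2≤k : 2 ≤ length K
      2≤k = ℕ.≤-trans (ℕ.m≤n+m 2 (q ℕ.* q)) big
      t≤q : Caps.t B (capOver cap 2≤k) ≤ q
      t≤q = lin (ℕ.+-mono-≤ big (ℕ.≤-reflexive (size+t cap 2≤k))) 0 (ring q (length K) (Caps.t B (capOver cap 2≤k)))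
        where
        ring : ∀ q k t → t ℕ.+ (k ℕ.+ (q ℕ.* q ℕ.+ q ℕ.+ 2)) ℕ.+ 0 ≡ q ℕ.+ (q ℕ.* q ℕ.+ 2 ℕ.+ (k ℕ.+ t))
        ring = solveℕ 3 (λ q k t → t :+: (k :+: (q :*: q :+: q :+: κ 2)) :+: κ 0 :=: q :+: (q :*: q :+: κ 2 :+: (k :+: t))) ≡.refl
      go : ∀ fuel → q ℕ.* q ℕ.+ q ℕ.+ 3 ≤ length K ℕ.+ fuel → ⊥
      -- No cap has more than q² + q + 2 points, so the fuel cannot be exhausted.
      go zero enough = ℕ.1+n≰n (ℕ.≤-trans (ℕ.≤-reflexive (≡.sym (ℕ.+-suc (q ℕ.* q ℕ.+ q) 2))) (ℕ.≤-trans enough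
        (ℕ.≤-trans (ℕ.≤-reflexive (ℕ.+-identityʳ _)) (ℕ.≤-trans (ℕ.m≤m+n _ _) (ℕ.≤-reflexive (size+t cap 2≤k))))))
      -- An extension would be an even larger cap, excluded by recursion; hence the present cap is
      -- complete and `LargeCaps` applies.
      go (suc fuel) enough = Caps.CompleteCaps.LargeCaps.impossible B (capOver cap 2≤k) (complete⇒ cap 2≤k λ v _ cap′ →
          ≰ (ℕ.≤-trans (ℕ.n≤1+n _) (max-size fuel cap′ (ℕ.≤-trans enough (ℕ.≤-reflexive (ℕ.+-suc (length K) fuel))))))
        (ℕ.≤-trans (s≤s (s≤s (s≤s z≤n))) 8≤qB) (subst (Caps.t B (capOver cap 2≤k) ≤_) (≡.sym qB≡q) t≤q) (some-index cap 2≤k)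

    -- The larger cap has at most q² + 1 points, so k ≤ q².
    t-large : ∀ {K} (cap : IsCap K) (2≤k : 2 ≤ length K) → NotMaximum K → q ℕ.+ 2 ≤ Caps.t B (capOver cap 2≤k)
    t-large {K} cap 2≤k (K′ , cap′ , lt) = lin (ℕ.+-mono-≤ lt (ℕ.+-mono-≤ (max-size (q ℕ.* q ℕ.+ q ℕ.+ 3) cap′ (ℕ.m≤n+m _ (length K′))) (ℕ.≤-reflexive (≡.sym (size+t cap 2≤k))))) 0 (ring q (length K) (Caps.t B (capOver cap 2≤k)) (length K′))
      where
      ring : ∀ q k t k′ → q ℕ.+ 2 ℕ.+ (k′ ℕ.+ (q ℕ.* q ℕ.+ 1 ℕ.+ (k ℕ.+ t))) ℕ.+ 0 ≡ t ℕ.+ (suc k ℕ.+ (k′ ℕ.+ (q ℕ.* q ℕ.+ q ℕ.+ 2)))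
      ring = solveℕ 4 (λ q k t k′ → q :+: κ 2 :+: (k′ :+: (q :*: q :+: κ 1 :+: (k :+: t))) :+: κ 0 :=: t :+: ((κ 1 :+: k) :+: (k′ :+: (q :*: q :+: q :+: κ 2)))) ≡.refl

    t-lower-bound : ∀ {K} (complete : IsCompleteCap K) (2≤k : 2 ≤ length K) → NotMaximum K →
      let t = Caps.t B (capOver (proj₁ complete) 2≤k) in 5 ℕ.* (q ℕ.* q) ℕ.< (t ℕ.+ 3) ℕ.* (t ℕ.+ 3)
    t-lower-bound (cap , complete) 2≤k notMax = ℕ.≰⇒> λ le → via 2∣q le
      where
      t = Caps.t B (capOver cap 2≤k)
      via : 2 ∣ q → (t ℕ.+ 3) ℕ.* (t ℕ.+ 3) ≤ 5 ℕ.* (q ℕ.* q) → ⊥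
      via (divides h e) le = Caps.CompleteCaps.SmallDeficit.no-such-cap B (capOver cap 2≤k) (complete⇒ cap 2≤k complete) h
        (≡.trans qB≡q (≡.trans e (ℕ.*-comm h 2))) 8≤qB
        (subst (λ z → (t ℕ.+ 3) ℕ.* (t ℕ.+ 3) ≤ 5 ℕ.* (z ℕ.* z)) (≡.sym qB≡q) le)
        (subst (λ z → z ℕ.+ 2 ≤ t) (≡.sym qB≡q) (t-large cap 2≤k notMax)) (some-index cap 2≤k)

-- The quantity squared in `BelowBound` is q² + q + 5 - k = t + 3.
below-bound : ∀ q k t → k ℕ.+ t ≡ q ℕ.* q ℕ.+ q ℕ.+ 2 → 5 ℕ.* (q ℕ.* q) ℕ.< (t ℕ.+ 3) ℕ.* (t ℕ.+ 3) → BelowBound q k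
below-bound q k t e lt = k< , subst (λ z → 5 ℕ.* (q ℕ.* q) ℕ.< z ℕ.* z) (≡.sym rest) lt
  where
  total : q ℕ.* q ℕ.+ q ℕ.+ 5 ≡ k ℕ.+ (t ℕ.+ 3)
  total = ≡.trans (≡.sym (ℕ.+-assoc (q ℕ.* q ℕ.+ q) 2 3)) (≡.trans (cong (ℕ._+ 3) (≡.sym e)) (ℕ.+-assoc k t 3))
  rest : q ℕ.* q ℕ.+ q ℕ.+ 5 ℕ.∸ k ≡ t ℕ.+ 3
  rest = ≡.trans (cong (ℕ._∸ k) total) (ℕ.m+n∸m≡n k (t ℕ.+ 3))
  k< : k ℕ.< q ℕ.* q ℕ.+ q ℕ.+ 5
  k< = ℕ.≤-trans (ℕ.m<m+n k (ℕ.≤-trans (s≤s z≤n) (ℕ.m≤n+m 3 t))) (ℕ.≤-reflexive (≡.sym total))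

-- The counting presupposes two cap points. With fewer, t ≥ q² ≥ 8q settles the bound directly.
tiny-cap : ∀ q k → 8 ≤ q → k ≤ 1 → 5 ℕ.* (q ℕ.* q) ℕ.< (q ℕ.* q ℕ.+ q ℕ.+ 2 ℕ.∸ k ℕ.+ 3) ℕ.* (q ℕ.* q ℕ.+ q ℕ.+ 2 ℕ.∸ k ℕ.+ 3)
tiny-cap q k 8≤q k≤1 = ℕ.≤-trans (ℕ.≤-trans (s≤s (ℕ.*-monoˡ-≤ (q ℕ.* q) (ℕ.m≤m+n 5 3))) bound) (ℕ.*-mono-≤ big big)
  where
  bound : suc (8 ℕ.* (q ℕ.* q)) ≤ (8 ℕ.* q ℕ.+ 3) ℕ.* (8 ℕ.* q ℕ.+ 3)
  bound = lin {0} z≤n (56 ℕ.* (q ℕ.* q) ℕ.+ 48 ℕ.* q ℕ.+ 8) (ring q)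
    where
    ring : ∀ q → suc (8 ℕ.* (q ℕ.* q)) ℕ.+ 0 ℕ.+ (56 ℕ.* (q ℕ.* q) ℕ.+ 48 ℕ.* q ℕ.+ 8) ≡ (8 ℕ.* q ℕ.+ 3) ℕ.* (8 ℕ.* q ℕ.+ 3) ℕ.+ 0
    ring = solveℕ 1 (λ q → (κ 1 :+: (κ 8 :*: (q :*: q))) :+: κ 0 :+: (κ 56 :*: (q :*: q) :+: κ 48 :*: q :+: κ 8) :=: (κ 8 :*: q :+: κ 3) :*: (κ 8 :*: q :+: κ 3) :+: κ 0) ≡.refl
  big : 8 ℕ.* q ℕ.+ 3 ≤ q ℕ.* q ℕ.+ q ℕ.+ 2 ℕ.∸ k ℕ.+ 3
  big = ℕ.+-monoˡ-≤ 3 (ℕ.≤-trans (ℕ.*-monoˡ-≤ q 8≤q) (ℕ.≤-trans (ℕ.m≤m+n (q ℕ.* q) q) (ℕ.≤-trans (ℕ.≤-reflexive (≡.sym (ℕ.m+n∸n≡m (q ℕ.* q ℕ.+ q) 2))) (ℕ.∸-monoʳ-≤ (q ℕ.* q ℕ.+ q ℕ.+ 2) (ℕ.≤-trans k≤1 (s≤s z≤n))))))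

theorem1p6 : (q : ℕ) → 2 ∣ q → 8 ≤ q →
    (F : CommutativeRing 0ℓ 0ℓ) → IsFiniteFieldOfOrder F q →
    (K : List (PG3.V4 F)) → PG3.IsCompleteCap F K → PG3.NotMaximum F K →
    BelowBound q (length K)
theorem1p6 q 2∣q 8≤q F isField K complete notMax with 2 ℕ.≤? length K
... | yes 2≤k = below-bound q (length K) _ (size+t 8≤q (proj₁ complete) 2≤k) (t-lower-bound 8≤q complete 2≤k notMax)
  where open CapsOnIndices F q isField 2∣q
... | no 2≰k = below-bound q (length K) _ (ℕ.m+[n∸m]≡n (ℕ.≤-trans k≤1 (ℕ.≤-trans (s≤s z≤n) (ℕ.m≤n+m 2 (q ℕ.* q ℕ.+ q))))) (tiny-cap q (length K) 8≤q k≤1)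
  where
  k≤1 : length K ≤ 1
  k≤1 = ℕ.s≤s⁻¹ (ℕ.≰⇒> 2≰k)
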